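{- The logic $\mathrm{T}[\mathrm{Pol}]$ captures \textsc{PSpace}: for every finite relational vocabulary $\tau$, (i) for every sentence $\varphi$ of $\mathrm{T}[\mathrm{Pol}]$ over $\tau$, the class of finite $\tau$-structures $\mathfrak{M}$ with $\mathfrak{M}\models\varphi$ is decidable in \textsc{PSpace}, and (ii) for every isomorphism-closed class $\mathcal{K}$ of finite $\tau$-structures decidable in \textsc{PSpace}, there is a sentence $\varphi$ of $\mathrm{T}[\mathrm{Pol}]$ over $\tau$ such that for all finite $\tau$-structures $\mathfrak{M}$, $\mathfrak{M}\models\varphi$ iff $\mathfrak{M}\in\mathcal{K}$.
   Context: Structures are finite (nonempty) structures over a finite relational vocabulary $\tau$. A class of structures is decidable in a complexity class if some Turing machine within the resource bound accepts exactly the binary encodings $\mathit{enc}(\mathfrak{M})$ of the structures in the class, where $\mathit{enc}(\mathfrak{M})$ (for a linear order $<$ on $M$ and a fixed order of the vocabulary) is: $1^{|M|}0$ followed, for each relation symbol $R$ in vocabulary order, by the string of length $|M|^{\mathit{ar}(R)}$ whose $j$-th bit is $1$ iff the $j$-th tuple of $M^{\mathit{ar}(R)}$ in lexicographic order is in $R$. The logic $\mathrm{T}$: formulae are built from first-order logic (first-order atoms $R(x_1,\dots,x_k)$, $x=y$, $\top,\bot$; $\neg,\wedge,\vee$; $\exists x,\forall x$) together with: tape predicates (relation symbols not in $\tau$, interpreted as empty at the start); formulae $Ix\,\varphi$, $I(R(x_1,\dots,x_k))\,\varphi$, $D(R(x_1,\dots,x_k))\,\varphi$ for $R$ of arity $k$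 in $\tau$ or a tape predicate; labelled formulae $C\varphi$ for label symbols $C$, and looping atoms $C$. Semantics is a game between Eloise and Abelard starting from the input structure $\mathfrak{M}$, empty assignment and the formula, Eloise as verifier. $\neg$ swaps roles; the verifier (falsifier) chooses at $\vee$, $\exists$ ($\wedge$, $\forall$), quantifiers ranging over the current domain. At $Ix\psi$ the structure gets one new domain element (relations unchanged), $x$ is assigned to it, play continues at $\psi$. At $I(R(x_1,\dots,x_k))\psi$ the verifier picks a tuple $(m_1,\dots,m_k)$ of the current domain, $R$ becomes $R\cup\{(m_1,\dots,m_k)\}$, $x_i\mapsto m_i$, play continues at $\psi$; $D(\cdot)$ is analogous with $R\setminus\{(m_1,\dots,m_k)\}$. At $C\psi$ play moves to $\psi$; at a looping atom $C$ play jumps back to the position of the subformula $C\psi$ (current structure and assignment kept). At a first-order atom the verifier wins iff the atom holds in the current structure and assignment. A play ends with no winner if an atom has an unassigned variable, a looping atom has no corresponding label, or the play is infinite. $\mathfrak{M}\models\varphi$ iff Eloise has a winning strategy. $\mathrm{Pol}$ is the set of terms $c_mn^m+\dots+c_1n+c_0$ with a variable symbol $n$ and natural-number coefficients and exponents written in binary, denoting a polynomial in $n$; $n$ is interpreted as the domain size of the input structure. $\mathrm{T}[\mathrm{Pol}]$ is the fragment of $\mathrm{T}$ in which the domain-extension operator $Ix$ is not used (for any variable $x$) and every label symbol must be written $C(t)$ (labelled formulae have the form $C(t)\psi$) with $t\in\mathrm{Pol}$; looping atoms $C$ carry no term. Semantically, each node $C(t)\psi$ has a clock, initially the number denoted by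 $t$, decreased by one each time the node is visited (both when first reached and when jumped to from a looping atom $C$); if the node is visited when its clock is already $0$, the play ends and neither player wins. -}

module Defs where

open import Data.Nat using (ℕ; zero; suc; _+_; _*_; _≤_; _<_; _<ᵇ_; _≡ᵇ_)
open import Data.Bool using (Bool; true; false; not; _∧_; _∨_; if_then_else_)
open import Data.Fin using (Fin; toℕ)
open import Data.List using (List; []; _∷_; _++_; map; concatMap; replicate; length; filter; lookup; allFin)
open import Data.Vec using (Vec; []; _∷_; toList)
import Data.Vec as Vec
open import Data.Maybe using (Maybe; just; nothing; maybe)
open import Data.Product using (Σ; _×_; _,_)
open import Data.Sum using (_⊎_; inj₁; inj₂)
open import Data.List.Membership.Propositional using (_∈_)
open import Relation.Binary.PropositionalEquality using (_≡_)
open import Function.Bundles using (_↔_; Inverse; _⇔_)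

finEq : {n : ℕ} → Fin n → Fin n → Bool
finEq a b = toℕ a ≡ᵇ toℕ b

listEq : {A : Set} → (A → A → Bool) → List A → List A → Bool
listEq e [] [] = true
listEq e (x ∷ xs) (y ∷ ys) = e x y ∧ listEq e xs ys
listEq e _ _ = false

boolEq : Bool → Bool → Bool
boolEq true b = b
boolEq false b = not b

nth : {A : Set} → List A → ℕ → Maybe A
nth [] _ = nothing
nth (x ∷ xs) zero = just x
nth (x ∷ xs) (suc i) = nth xs i

fromListN : {A : Set} → (k : ℕ) → List A → Maybe (Vec A k)
fromListN zero [] = just []
fromListN (suc k) (x ∷ xs) = maybe (λ v → just (x ∷ v)) nothing (fromListN k xs)
fromListN _ _ = nothing

mapMaybe′ : {A B : Set} → (A → Maybe B) → List A → Maybe (List B)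
mapMaybe′ f [] = just []
mapMaybe′ f (x ∷ xs) with f x | mapMaybe′ f xs
... | just y | just ys = just (y ∷ ys)
... | _ | _ = nothing

allVecs : (n k : ℕ) → List (Vec (Fin n) k)
allVecs n zero = [] ∷ []
allVecs n (suc k) = concatMap (λ a → map (a ∷_) (allVecs n k)) (allFin n)

-- Polynomials c₀ + c₁ n + ... + cₘ nᵐ with natural coefficients,
-- represented by their coefficient list (c₀ ∷ c₁ ∷ ... ∷ cₘ ∷ []).
Pol : Set
Pol = List ℕ

evalPol : Pol → ℕ → ℕ
evalPol [] n = 0
evalPol (c ∷ cs) n = c + n * evalPol cs n

-- A finite relational vocabulary: the list of arities of its relation
-- symbols, in vocabulary order.
Voc : Set
Voc = List ℕ

record Struct (τ : Voc) : Set where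
  field
    size     : ℕ
    nonempty : 0 < size
    rel      : (i : Fin (length τ)) → Vec (Fin size) (lookup τ i) → Bool
open Struct public

record Iso {τ : Voc} (M N : Struct τ) : Set where
  field
    bij       : Fin (size M) ↔ Fin (size N)
    preserves : ∀ i (v : Vec (Fin (size M)) (lookup τ i)) →
                rel M i v ≡ rel N i (Vec.map (Inverse.to bij) v)

IsoClosed : {τ : Voc} → (Struct τ → Set) → Set
IsoClosed {τ} K = ∀ (M N : Struct τ) → Iso M N → K M → K N

enc : {τ : Voc} → Struct τ → List Bool
enc {τ} M =
  replicate (size M) true ++ (false ∷
  concatMap (λ i → map (rel M i) (allVecs (size M) (lookup τ i))) (allFin (length τ)))

-- Deterministic single-tape Turing machines over input alphabet {0,1}
-- Tape symbols: Fin (3 + extra); 0 = blank, 1 = bit 0, 2 = bit 1.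

data Dir : Set where
  left right stay : Dir

data Action (q g : ℕ) : Set where
  halt : Bool → Action q g                      -- true = accept
  go   : Fin q → Fin (3 + g) → Dir → Action q g

record TM : Set where
  field
    states : ℕ
    extra  : ℕ
    start  : Fin states
    δ      : Fin states → Fin (3 + extra) → Action states extra

record Config (M : TM) : Set where
  field
    state : Fin (TM.states M)
    head  : ℕ
    tape  : ℕ → Fin (3 + TM.extra M)
open Config public

bitSym : {g : ℕ} → Bool → Fin (3 + g)
bitSym false = Fin.suc Fin.zero
  where import Data.Fin as Fin
bitSym true = Fin.suc (Fin.suc Fin.zero)
  where import Data.Fin as Fin

initConfig : (M : TM) → List Bool → Config M
initConfig M w = record
  { state = TM.start M
  ; head  = 0
  ; tape  = λ i → maybe bitSym Data.Fin.zero (nth w i) }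
  where import Data.Fin

moveHead : Dir → ℕ → ℕ
moveHead left zero = zero
moveHead left (suc h) = h
moveHead right h = suc h
moveHead stay h = h

data Outcome (M : TM) : Set where
  done    : Bool → Outcome M
  running : Config M → Outcome M

step : (M : TM) → Config M → Outcome M
step M c with TM.δ M (state c) (tape c (head c))
... | halt b = done b
... | go q s d = running (record
        { state = q
        ; head  = moveHead d (head c)
        ; tape  = λ i → if i ≡ᵇ head c then s else tape c i })

exec : (M : TM) → ℕ → Config M → Outcome M
exec M zero c = running c
exec M (suc t) c with step M c
... | done b = done b
... | running c' = exec M t c'

InPSPACE : (List Bool → Set) → Set
InPSPACE L =
  Σ TM λ M → Σ Pol λ p → ∀ (w : List Bool) →
    (∀ t c → exec M t (initConfig M w) ≡ running c → head c ≤ evalPol p (length w))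
    × Σ ℕ λ t → Σ Bool λ b → (exec M t (initConfig M w) ≡ done b) × (b ≡ true ⇔ L w)

PSpaceDecidable : (τ : Voc) → (Struct τ → Set) → Set
PSpaceDecidable τ K = InPSPACE (λ w → Σ (Struct τ) λ M → K M × enc M ≡ w)

-- Relation symbols: those of τ, plus tape predicates (name, arity).
RelSym : Voc → Set
RelSym τ = Fin (length τ) ⊎ (ℕ × ℕ)

arity : (τ : Voc) → RelSym τ → ℕ
arity τ (inj₁ i) = lookup τ i
arity τ (inj₂ (_ , k)) = k

symEq : (τ : Voc) → RelSym τ → RelSym τ → Bool
symEq τ (inj₁ i) (inj₁ j) = finEq i j
symEq τ (inj₂ (a , k)) (inj₂ (b , l)) = (a ≡ᵇ b) ∧ (k ≡ᵇ l)
symEq τ _ _ = false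

Var Label : Set
Var = ℕ
Label = ℕ

data Formula (τ : Voc) : Set where
  atom  : (R : RelSym τ) → Vec Var (arity τ R) → Formula τ
  eq    : Var → Var → Formula τ
  tt ff : Formula τ
  neg   : Formula τ → Formula τ
  and or : Formula τ → Formula τ → Formula τ
  ex all : Var → Formula τ → Formula τ
  ins del : (R : RelSym τ) → Vec Var (arity τ R) → Formula τ → Formula τ
  lab   : Label → Pol → Formula τ → Formula τ
  loop  : Label → Formula τ

filterB : {A : Set} → (A → Bool) → List A → List A
filterB p [] = []
filterB p (x ∷ xs) = if p x then x ∷ filterB p xs else filterB p xs

memℕ : ℕ → List ℕ → Bool
memℕ x [] = false
memℕ x (y ∷ ys) = (x ≡ᵇ y) ∨ memℕ x ys

freeVars : {τ : Voc} → Formula τ → List Var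
freeVars (atom R xs) = toList xs
freeVars (eq x y) = x ∷ y ∷ []
freeVars tt = []
freeVars ff = []
freeVars (neg φ) = freeVars φ
freeVars (and φ ψ) = freeVars φ ++ freeVars ψ
freeVars (or φ ψ) = freeVars φ ++ freeVars ψ
freeVars (ex x φ) = filterB (λ y → not (y ≡ᵇ x)) (freeVars φ)
freeVars (all x φ) = filterB (λ y → not (y ≡ᵇ x)) (freeVars φ)
freeVars (ins R xs φ) = filterB (λ y → not (memℕ y (toList xs))) (freeVars φ)
freeVars (del R xs φ) = filterB (λ y → not (memℕ y (toList xs))) (freeVars φ)
freeVars (lab C t φ) = freeVars φ
freeVars (loop C) = []

Sentence : {τ : Voc} → Formula τ → Set
Sentence φ = freeVars φ ≡ []

-- subformula positions are paths of child indices from the root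
childAt : {τ : Voc} → Formula τ → ℕ → Maybe (Formula τ)
childAt (neg φ) zero = just φ
childAt (and φ ψ) zero = just φ
childAt (and φ ψ) (suc zero) = just ψ
childAt (or φ ψ) zero = just φ
childAt (or φ ψ) (suc zero) = just ψ
childAt (ex x φ) zero = just φ
childAt (all x φ) zero = just φ
childAt (ins R xs φ) zero = just φ
childAt (del R xs φ) zero = just φ
childAt (lab C t φ) zero = just φ
childAt _ _ = nothing

subAt : {τ : Voc} → Formula τ → List ℕ → Maybe (Formula τ)
subAt φ [] = just φ
subAt φ (i ∷ p) = maybe (λ ψ → subAt ψ p) nothing (childAt φ i)

labelHere : {τ : Voc} → Formula τ → Label → List ℕ → Maybe (List ℕ) → Maybe (List ℕ)
labelHere (lab C′ t ψ) C prefix acc = if C′ ≡ᵇ C then just prefix else acc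
labelHere _ C prefix acc = acc

-- The position of the nearest proper ancestor of the node at the given
-- path that is labelled with C (the "corresponding label" of a looping atom C).
findLabel : {τ : Voc} → Formula τ → Label → (prefix rest : List ℕ) → Maybe (List ℕ) → Maybe (List ℕ)
findLabel φ C prefix [] acc = acc
findLabel φ C prefix (i ∷ rest) acc =
  maybe (λ ψ → findLabel ψ C (prefix ++ (i ∷ [])) rest (labelHere φ C prefix acc)) nothing (childAt φ i)

Rels : Voc → ℕ → Set
Rels τ n = RelSym τ → List (Fin n) → Bool

record GState (τ : Voc) (n : ℕ) : Set where
  field
    rels      : Rels τ n
    asg       : Var → Maybe (Fin n)
    pos       : List ℕ
    visits    : List ℕ → ℕ           -- visits so far of each labelled node (clock = t - visits)
    eloiseVer : Bool
open GState public

assign : {n : ℕ} → (Var → Maybe (Fin n)) → Var → Fin n → (Var → Maybe (Fin n))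
assign f x a y = if y ≡ᵇ x then just a else f y

assignAll : {n : ℕ} → (Var → Maybe (Fin n)) → List Var → List (Fin n) → (Var → Maybe (Fin n))
assignAll f (x ∷ xs) (a ∷ as) = assignAll (assign f x a) xs as
assignAll f _ _ = f

addTuple delTuple : {τ : Voc} {n : ℕ} → Rels τ n → RelSym τ → List (Fin n) → Rels τ n
addTuple {τ} r R t R′ v = (symEq τ R′ R ∧ listEq finEq v t) ∨ r R′ v
delTuple {τ} r R t R′ v = not (symEq τ R′ R ∧ listEq finEq v t) ∧ r R′ v

down : {τ : Voc} {n : ℕ} → GState τ n → ℕ → GState τ n
down s i = record s { pos = pos s ++ (i ∷ []) }

data Node (τ : Voc) (n : ℕ) : Set where
  terminal : Maybe Bool → Node τ n          -- just true: Eloise wins; just false: Abelard wins; nothing: no winner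
  det      : GState τ n → Node τ n
  choice   : Bool → List (GState τ n) → Node τ n  -- true: Eloise chooses, false: Abelard chooses

node : {τ : Voc} (φ₀ : Formula τ) (n : ℕ) → GState τ n → Node τ n
node {τ} φ₀ n s with subAt φ₀ (pos s)
... | nothing = terminal nothing
... | just (atom R xs) =
        maybe (λ vs → terminal (just (boolEq (rels s R vs) (eloiseVer s)))) (terminal nothing)
              (mapMaybe′ (asg s) (toList xs))
... | just (eq x y) with asg s x | asg s y
...   | just a | just b = terminal (just (boolEq (finEq a b) (eloiseVer s)))
...   | _ | _ = terminal nothing
node {τ} φ₀ n s | just tt = terminal (just (eloiseVer s))
node {τ} φ₀ n s | just ff = terminal (just (not (eloiseVer s)))
node {τ} φ₀ n s | just (neg φ) = det (record (down s 0) { eloiseVer = not (eloiseVer s) })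
node {τ} φ₀ n s | just (or φ ψ) = choice (eloiseVer s) (down s 0 ∷ down s 1 ∷ [])
node {τ} φ₀ n s | just (and φ ψ) = choice (not (eloiseVer s)) (down s 0 ∷ down s 1 ∷ [])
node {τ} φ₀ n s | just (ex x φ) =
  choice (eloiseVer s) (map (λ a → record (down s 0) { asg = assign (asg s) x a }) (allFin n))
node {τ} φ₀ n s | just (all x φ) =
  choice (not (eloiseVer s)) (map (λ a → record (down s 0) { asg = assign (asg s) x a }) (allFin n))
node {τ} φ₀ n s | just (ins R xs φ) =
  choice (eloiseVer s) (map (λ t → record (down s 0)
    { rels = addTuple {τ} (rels s) R (toList t) ; asg = assignAll (asg s) (toList xs) (toList t) })
    (allVecs n (arity τ R)))
node {τ} φ₀ n s | just (del R xs φ) =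
  choice (eloiseVer s) (map (λ t → record (down s 0)
    { rels = delTuple {τ} (rels s) R (toList t) ; asg = assignAll (asg s) (toList xs) (toList t) })
    (allVecs n (arity τ R)))
node {τ} φ₀ n s | just (lab C t φ) =
  if visits s (pos s) <ᵇ evalPol t n
  then det (record (down s 0)
         { visits = λ p → if listEq _≡ᵇ_ p (pos s) then suc (visits s p) else visits s p })
  else terminal nothing
node {τ} φ₀ n s | just (loop C) =
  maybe (λ q → det (record s { pos = q })) (terminal nothing) (findLabel φ₀ C [] (pos s) nothing)

data EloiseWins {τ : Voc} (φ₀ : Formula τ) (n : ℕ) : GState τ n → Set where
  win    : ∀ {s} → node φ₀ n s ≡ terminal (just true) → EloiseWins φ₀ n s
  forced : ∀ {s s′} → node φ₀ n s ≡ det s′ → EloiseWins φ₀ n s′ → EloiseWins φ₀ n s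
  eChoose : ∀ {s opts s′} → node φ₀ n s ≡ choice true opts → s′ ∈ opts →
            EloiseWins φ₀ n s′ → EloiseWins φ₀ n s
  aChoose : ∀ {s opts} → node φ₀ n s ≡ choice false opts →
            (∀ s′ → s′ ∈ opts → EloiseWins φ₀ n s′) → EloiseWins φ₀ n s

initRels : {τ : Voc} (M : Struct τ) → Rels τ (size M)
initRels {τ} M (inj₁ i) vs = maybe (rel M i) false (fromListN (lookup τ i) vs)
initRels M (inj₂ _) vs = false

initState : {τ : Voc} (M : Struct τ) → GState τ (size M)
initState M = record
  { rels = initRels M ; asg = λ _ → nothing ; pos = [] ; visits = λ _ → 0 ; eloiseVer = true }

_⊨_ : {τ : Voc} → Struct τ → Formula τ → Set
M ⊨ φ = EloiseWins φ (size M) (initState M)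

{-# OPTIONS --safe #-}
-- Into PSPACE: each clock is polynomial, so a play makes polynomially many moves, and an
-- alternating polynomial-time machine, whose choices are those of the two players, can play
-- the game on the encoding. It is evaluated depth first on one tape; only a log that undoes
-- the steps has to be kept, not a stack of configurations.
--
-- From PSPACE: a configuration of a machine with space n ^ k is a family of relations. Eloise
-- writes down a linear order, the initial configuration and an accepting one, and then claims
-- that the second is reachable from the first. Such a claim is played by halving: she writes
-- down a middle configuration, and Abelard chooses the half to go on with. Polynomially many
-- halvings exhaust the exponentially many steps, so a polynomial clock suffices; the clock of
-- the editing loop pays for writing configurations bit by bit. As the class is closed under
-- isomorphism, the order that Eloise picks does not matter.
module Submission where

open import Defs
open import Data.Nat using (ℕ; zero; suc; pred; _+_; _*_; _∸_; _^_; _⊔_; _⊓_; _≤_; _<_; z≤n; s≤s; _≡ᵇ_; _<ᵇ_; >-nonZero)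
open import Data.Nat.Properties
open import Data.Nat.Tactic.RingSolver using (solve-∀)
open import Data.Bool using (Bool; true; false; not; _∧_; _∨_; if_then_else_; T)
open import Data.Fin using (Fin; toℕ; fromℕ<; combine; remQuot; join; splitAt; funToFin; finToFun) renaming (zero to fz; suc to fs)
import Data.Fin.Properties as FP
open import Data.List using (List; []; _∷_; _++_; map; concatMap; concat; replicate; drop; length; allFin; tabulate) renaming (lookup to lookupL)
import Data.List.Properties as LP
open import Data.List.Membership.Propositional using (_∈_)
open import Data.List.Membership.Propositional.Properties using (∈-map⁺; ∈-map⁻; ∈-concatMap⁺; ∈-concatMap⁻; ∈-allFin; ∈-++⁺ˡ; ∈-++⁺ʳ; ∈-++⁻; ∈-lookup)
open import Data.List.Relation.Unary.Any using (Any; here; there)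
import Data.List.Relation.Unary.Any as Any
open import Data.List.Relation.Unary.All using (All; []; _∷_)
import Data.List.Relation.Unary.All as All
open import Data.Vec using (Vec; []; _∷_; toList; _[_]≔_)
import Data.Vec as Vec
import Data.Vec.Properties as VP
open import Data.Maybe using (Maybe; just; nothing; maybe)
open import Data.Maybe.Properties using (just-injective)
open import Data.Product using (Σ; ∃; _×_; _,_; proj₁; proj₂)
open import Data.Product.Properties using (,-injectiveˡ)
open import Data.Sum using (_⊎_; inj₁; inj₂; [_,_])
open import Data.Unit using (⊤)
open import Data.Empty using (⊥; ⊥-elim)
open import Relation.Nullary using (¬_; Dec; yes; no; does; contradiction)
open import Relation.Binary using (DecidableEquality; tri<; tri≈; tri>)
open import Relation.Binary.PropositionalEquality using (_≡_; _≢_; refl; sym; trans; cong; cong₂; subst; subst₂)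
open import Function using (_∘_; id)
open import Function.Bundles using (_⇔_; _↔_; Inverse; Equivalence; mk⇔; mk↔ₛ′)

-- A play without winner counts as a loss of Eloise, so the value of a position is just whether she
-- wins; this turns the three-valued game into an alternating computation, and running into an
-- exhausted clock into rejection. For the converse the obstacle is that nothing forces the
-- relations written during a play to describe configurations. Reachability is therefore never read
-- off the relations: the claim is that every configuration matching slot 0 leads to one matching
-- slot 1, and it is carried forward from the initial configuration, whose description is checked.
-- Clocks are counted only when a strategy for Eloise is built, where one common polynomial
-- dominates all the visits. From a given winning strategy the conclusion is drawn by induction on
-- the height of its derivation, because looping atoms return to larger subformulae. Work space is a
-- number of extra blocks of tuples behind the blocks that spell the encoding, so that cells, head
-- moves and successor are all first-order over one linear order.

-- Finite types and Boolean equality.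

-- `decode` only has to undo `code`: junk codes are harmless.
record Finite (A : Set) : Set where
  field
    card        : ℕ
    code        : A → Fin card
    decode      : Fin card → A
    decode-code : ∀ a → decode (code a) ≡ a

  code-injective : ∀ {a b} → code a ≡ code b → a ≡ b
  code-injective {a} {b} p = trans (sym (decode-code a)) (trans (cong decode p) (decode-code b))

open Finite

retractFinite : {A B : Set} (f : A → B) (g : B → A) → (∀ a → g (f a) ≡ a) → Finite B → Finite A
retractFinite f g gf F = record
  { card = card F ; code = λ a → code F (f a) ; decode = λ i → g (decode F i)
  ; decode-code = λ a → trans (cong g (decode-code F (f a))) (gf a) }

finiteFin : ∀ n → Finite (Fin n)
finiteFin n = record { card = n ; code = id ; decode = id ; decode-code = λ _ → refl }

finite⊤ : Finite ⊤
finite⊤ = record { card = 1 ; code = λ _ → fz ; decode = λ _ → _ ; decode-code = λ _ → refl }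

finite⊎ : {A B : Set} → Finite A → Finite B → Finite (A ⊎ B)
finite⊎ {A} {B} F G = record
  { card = card F + card G
  ; code = λ x → join (card F) (card G) (to x)
  ; decode = λ i → from (splitAt (card F) i)
  ; decode-code = λ x → trans (cong from (FP.splitAt-join (card F) (card G) (to x))) (from-to x) }
  where
  to : A ⊎ B → Fin (card F) ⊎ Fin (card G)
  to (inj₁ a) = inj₁ (code F a)
  to (inj₂ b) = inj₂ (code G b)
  from : Fin (card F) ⊎ Fin (card G) → A ⊎ B
  from (inj₁ i) = inj₁ (decode F i)
  from (inj₂ j) = inj₂ (decode G j)
  from-to : ∀ x → from (to x) ≡ x
  from-to (inj₁ a) = cong inj₁ (decode-code F a)
  from-to (inj₂ b) = cong inj₂ (decode-code G b)

finite× : {A B : Set} → Finite A → Finite B → Finite (A × B)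
finite× {A} {B} F G = record
  { card = card F * card G
  ; code = λ x → combine (code F (proj₁ x)) (code G (proj₂ x))
  ; decode = λ i → from (remQuot (card G) i)
  ; decode-code = λ x → trans (cong from (FP.remQuot-combine (code F (proj₁ x)) (code G (proj₂ x))))
                              (cong₂ _,_ (decode-code F (proj₁ x)) (decode-code G (proj₂ x))) }
  where
  from : Fin (card F) × Fin (card G) → A × B
  from (i , j) = decode F i , decode G j

finiteBool : Finite Bool
finiteBool = retractFinite to from from-to (finiteFin 2)
  where
  to : Bool → Fin 2
  to false = fz
  to true = fs fz
  from : Fin 2 → Bool
  from fz = false
  from (fs _) = true
  from-to : ∀ b → from (to b) ≡ b
  from-to false = refl
  from-to true = refl

finiteMaybe : {A : Set} → Finite A → Finite (Maybe A)
finiteMaybe {A} F = retractFinite to from from-to (finite⊎ finite⊤ F)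
  where
  to : Maybe A → ⊤ ⊎ A
  to nothing = inj₁ _
  to (just a) = inj₂ a
  from : ⊤ ⊎ A → Maybe A
  from (inj₁ _) = nothing
  from (inj₂ a) = just a
  from-to : ∀ b → from (to b) ≡ b
  from-to nothing = refl
  from-to (just _) = refl

finiteVec : {A : Set} → Finite A → ∀ n → Finite (Vec A n)
finiteVec F zero = retractFinite (λ _ → _) (λ _ → []) (λ { [] → refl }) finite⊤
finiteVec F (suc n) = retractFinite (λ { (x ∷ xs) → x , xs }) (λ { (x , xs) → x ∷ xs })
  (λ { (x ∷ xs) → refl }) (finite× F (finiteVec F n))

finiteΣFin : ∀ n {B : Fin n → Set} → (∀ i → Finite (B i)) → Finite (Σ (Fin n) B)
finiteΣFin zero F = retractFinite {B = Fin 0} proj₁ (λ ()) (λ { (() , _) }) (finiteFin 0)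
finiteΣFin (suc n) {B} F = retractFinite to from from-to (finite⊎ (F fz) (finiteΣFin n (λ i → F (fs i))))
  where
  to : Σ (Fin (suc n)) B → B fz ⊎ Σ (Fin n) (B ∘ fs)
  to (fz , b) = inj₁ b
  to (fs i , b) = inj₂ (i , b)
  from : B fz ⊎ Σ (Fin n) (B ∘ fs) → Σ (Fin (suc n)) B
  from (inj₁ b) = fz , b
  from (inj₂ (i , b)) = fs i , b
  from-to : ∀ x → from (to x) ≡ x
  from-to (fz , b) = refl
  from-to (fs i , b) = refl

record BoolEq (A : Set) : Set where
  field
    _==_     : A → A → Bool
    ==-refl  : ∀ a → (a == a) ≡ true
    ==-sound : ∀ a b → (a == b) ≡ true → a ≡ b

  ==-sym-false : ∀ a b → (a == b) ≡ false → (b == a) ≡ false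
  ==-sym-false a b p with b == a in e
  ... | false = refl
  ... | true rewrite ==-sound b a e | ==-refl a = p

boolEqMaybe : {A : Set} → BoolEq A → BoolEq (Maybe A)
boolEqMaybe {A} E = record { _==_ = _=?_ ; ==-refl = rf ; ==-sound = sd }
  where
  open BoolEq E
  _=?_ : Maybe A → Maybe A → Bool
  nothing =? nothing = true
  just a =? just b = a == b
  _ =? _ = false
  rf : ∀ a → (a =? a) ≡ true
  rf nothing = refl
  rf (just a) = ==-refl a
  sd : ∀ a b → (a =? b) ≡ true → a ≡ b
  sd nothing nothing _ = refl
  sd (just a) (just b) p = cong just (==-sound a b p)

≡ᵇ-refl : ∀ n → (n ≡ᵇ n) ≡ true
≡ᵇ-refl zero = refl
≡ᵇ-refl (suc n) = ≡ᵇ-refl n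

≡ᵇ-sound : ∀ m n → (m ≡ᵇ n) ≡ true → m ≡ n
≡ᵇ-sound zero zero _ = refl
≡ᵇ-sound (suc m) (suc n) p = cong suc (≡ᵇ-sound m n p)

≢⇒≡ᵇ-false : ∀ {m n} → m ≢ n → (m ≡ᵇ n) ≡ false
≢⇒≡ᵇ-false {m} {n} ne with m ≡ᵇ n in e
... | false = refl
... | true = ⊥-elim (ne (≡ᵇ-sound m n e))

≡ᵇ-false⇒≢ : ∀ {m n} → (m ≡ᵇ n) ≡ false → m ≢ n
≡ᵇ-false⇒≢ {m} p refl with trans (sym (≡ᵇ-refl m)) p
... | ()

setAt : {A : Set} → (ℕ → A) → ℕ → A → ℕ → A
setAt f i a j = if j ≡ᵇ i then a else f j

≡ᵇ-sym-false : ∀ m n → (m ≡ᵇ n) ≡ false → (n ≡ᵇ m) ≡ false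
≡ᵇ-sym-false m n p = ≢⇒≡ᵇ-false (λ z → ≡ᵇ-false⇒≢ {m} {n} p (sym z))

-- The flag is that of `choice` and `fork`: `true` when Eloise chooses, `false` when the choice is
-- against her.
Quant : Bool → {A : Set} → (A → Set) → Set
Quant true Q = ∃ Q
Quant false Q = ∀ a → Q a

Both : Bool → Set → Set → Set
Both true Q R = Q ⊎ R
Both false Q R = Q × R

-- Multihead machines on a single tape

-- A deterministic machine whose heads H all work on one tape; each step
-- serves one head, which also sees whether it stands on cell 0.
data DInstr (H Γ S : Set) : Set where
  halt : Bool → DInstr H Γ S
  op   : H → (Bool → Γ → S × Γ × Dir) → DInstr H Γ S

module MultiHead {H : Set} (eqH : BoolEq H) where
  open BoolEq eqH

  setHd : (H → ℕ) → H → ℕ → H → ℕ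
  setHd hs h v h′ = if h′ == h then v else hs h′

  setHd-same : ∀ hs h v → setHd hs h v h ≡ v
  setHd-same hs h v rewrite ==-refl h = refl

  setHd-other : ∀ hs {h h′} v → (h′ == h) ≡ false → setHd hs h v h′ ≡ hs h′
  setHd-other hs v p rewrite p = refl

  -- One derivation packs halting, the verdict and the bound on the heads, so that a simulation is a
  -- map from traces to traces. Both ends of a move are bounded, because a mark is taken up at one
  -- and put down at the other.
  data DTrace {Γ S : Set} (δ : S → DInstr H Γ S) (B : ℕ) : S → (H → ℕ) → (ℕ → Γ) → Bool → Set where
    halts : ∀ {s hs tp b} → δ s ≡ halt b → DTrace δ B s hs tp b
    moves : ∀ {s hs tp b h f s′ a d} → δ s ≡ op h f → f (hs h ≡ᵇ 0) (tp (hs h)) ≡ (s′ , a , d) →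
            hs h ≤ B → moveHead d (hs h) ≤ B →
            DTrace δ B s′ (setHd hs h (moveHead d (hs h))) (setAt tp (hs h) a) b → DTrace δ B s hs tp b

data Trace (M : TM) (B : ℕ) : Config M → Bool → Set where
  end  : ∀ {c b} → head c ≤ B → step M c ≡ done b → Trace M B c b
  next : ∀ {c c′ b} → head c ≤ B → step M c ≡ running c′ → Trace M B c′ b → Trace M B c b

resume : (M : TM) → ℕ → Outcome M → Outcome M
resume M t (done b) = done b
resume M t (running c) = exec M t c

exec-suc : ∀ M t c → exec M (suc t) c ≡ resume M t (step M c)
exec-suc M t c with step M c
... | done b = refl
... | running c′ = refl

exec-done : ∀ {M c b} t → step M c ≡ done b → exec M (suc t) c ≡ done b
exec-done {M} {c} t e = trans (exec-suc M t c) (cong (resume M t) e)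

exec-running : ∀ {M c c′} t → step M c ≡ running c′ → exec M (suc t) c ≡ exec M t c′
exec-running {M} {c} t e = trans (exec-suc M t c) (cong (resume M t) e)

trace-bounded : ∀ {M B c b} → Trace M B c b → ∀ t c′ → exec M t c ≡ running c′ → head c′ ≤ B
trace-bounded (end p e) zero c′ refl = p
trace-bounded (next p e r) zero c′ refl = p
trace-bounded (end p e) (suc t) c′ q with trans (sym (exec-done t e)) q
... | ()
trace-bounded (next p e r) (suc t) c′ q = trace-bounded r t c′ (trans (sym (exec-running t e)) q)

trace-halts : ∀ {M B c b} → Trace M B c b → ∃ λ t → exec M t c ≡ done b
trace-halts (end p e) = 1 , exec-done 0 e
trace-halts (next p e r) with trace-halts r
... | t , q = suc t , trans (exec-running t e) q

-- The heads become marks on extra tracks of a single tape, found by scanning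
-- from cell 0, which carries an end mark.
module Serialise {H Γ S : Set} (eqH : BoolEq H) (finH : Finite H) (finΓ : Finite Γ) (finS : Finite S)
  (input : Maybe Bool → Γ) (δ : S → DInstr H Γ S) (s₀ : S) where
  open BoolEq eqH
  open MultiHead eqH

  Cell : Set
  Cell = Γ × Vec Bool (card finH) × Bool

  abstract
    finCell : Finite Cell
    finCell = finite× finΓ (finite× (finiteVec finiteBool (card finH)) finiteBool)

  unmarked : Γ → Cell
  unmarked a = a , Vec.replicate (card finH) false , false

  -- The three raw symbols are read as cells never visited, without marks. Hence the untouched input
  -- and the infinite blank part of the tape already consist of valid cells.
  cellOf : Fin (3 + card finCell) → Cell
  cellOf fz = unmarked (input nothing)
  cellOf (fs fz) = unmarked (input (just false))
  cellOf (fs (fs fz)) = unmarked (input (just true))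
  cellOf (fs (fs (fs i))) = decode finCell i

  symOf : Cell → Fin (3 + card finCell)
  symOf c = fs (fs (fs (code finCell c)))

  mark? : Vec Bool (card finH) → H → Bool
  mark? v h = Vec.lookup v (code finH h)

  setMark : Vec Bool (card finH) → H → Bool → Vec Bool (card finH)
  setMark v h b = v [ code finH h ]≔ b

  mark-setMark : ∀ v h b h′ → mark? (setMark v h b) h′ ≡ (if h′ == h then b else mark? v h′)
  mark-setMark v h b h′ with h′ == h in e
  ... | true rewrite ==-sound h′ h e = VP.lookup∘updateAt (code finH h) v
  ... | false = VP.lookup∘updateAt′ (code finH h′) (code finH h) ne v
    where ne : code finH h′ ≢ code finH h
          ne p with code-injective finH p
          ... | refl with trans (sym (==-refl h)) e
          ... | ()

  -- `seek` looks for the mark of the head to be served, `place` puts it on the new cell, `ret` runs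
  -- back to the end mark.
  TS : Set
  TS = ⊤ ⊎ (S ⊎ ((S × H) ⊎ S))

  pattern ini = inj₁ _
  pattern seek s = inj₂ (inj₁ s)
  pattern place s h = inj₂ (inj₂ (inj₁ (s , h)))
  pattern ret s = inj₂ (inj₂ (inj₂ s))

  abstract
    finTS : Finite TS
    finTS = finite⊎ finite⊤ (finite⊎ finS (finite⊎ (finite× finS finH) finS))

  serve : DInstr H Γ S → S → Cell → Bool ⊎ (TS × Cell × Dir)
  serve (halt b) s c = inj₁ b
  serve (op h f) s (a , v , e) with mark? v h
  ... | false = inj₂ (seek s , (a , v , e) , right)
  ... | true with f e a
  ...   | s′ , a′ , d = inj₂ (place s′ h , (a′ , setMark v h false , e) , d)

  act : TS → Cell → Bool ⊎ (TS × Cell × Dir)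
  -- All heads start on cell 0, which also receives the end mark.
  act ini (a , v , e) = inj₂ (seek s₀ , (a , Vec.replicate (card finH) true , true) , stay)
  act (seek s) c = serve (δ s) s c
  act (place s h) (a , v , e) = inj₂ (ret s , (a , setMark v h true , e) , stay)
  act (ret s) (a , v , true) = inj₂ (seek s , (a , v , true) , stay)
  act (ret s) (a , v , false) = inj₂ (ret s , (a , v , false) , left)

  toAction : Bool ⊎ (TS × Cell × Dir) → Action (card finTS) (card finCell)
  toAction (inj₁ b) = halt b
  toAction (inj₂ (q , c , d)) = go (code finTS q) (symOf c) d

  machine : TM
  machine = record
    { states = card finTS ; extra = card finCell ; start = code finTS (inj₁ _)
    ; δ = λ q a → toAction (act (decode finTS q) (cellOf a)) }

  config : TS → ℕ → (ℕ → Fin (3 + card finCell)) → Config machine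
  config q p f = record { state = code finTS q ; head = p ; tape = f }

  δ-code : ∀ q a → TM.δ machine (code finTS q) a ≡ toAction (act q (cellOf a))
  δ-code q a = cong (λ x → toAction (act x (cellOf a))) (decode-code finTS q)

  step-go : ∀ (M : TM) c {q a d} → TM.δ M (state c) (tape c (head c)) ≡ go q a d →
            step M c ≡ running (record { state = q ; head = moveHead d (head c) ; tape = setAt (tape c) (head c) a })
  step-go M c e rewrite e = refl

  step-halt : ∀ (M : TM) c {b} → TM.δ M (state c) (tape c (head c)) ≡ halt b → step M c ≡ done b
  step-halt M c e rewrite e = refl

  -- Marks are an arbitrary predicate `mk` rather than head positions, because between taking a mark
  -- up and putting it down the served head has none.
  CellOK : (H → ℕ → Bool) → (ℕ → Γ) → ℕ → Cell → Set
  CellOK mk tp i (a , v , e) = (a ≡ tp i) × (∀ h → mark? v h ≡ mk h i) × (e ≡ (i ≡ᵇ 0))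

  Rep : (H → ℕ → Bool) → (ℕ → Γ) → (ℕ → Fin (3 + card finCell)) → Set
  Rep mk tp f = ∀ i → CellOK mk tp i (cellOf (f i))

  rep-set : ∀ {mk mk′ tp tp′ f p c} → Rep mk tp f → CellOK mk′ tp′ p c →
            (∀ i → (i ≡ᵇ p) ≡ false → (∀ h → mk′ h i ≡ mk h i) × (tp′ i ≡ tp i)) →
            Rep mk′ tp′ (setAt f p (symOf c))
  rep-set {p = p} {c} R ok other i with i ≡ᵇ p in e
  ... | true rewrite ≡ᵇ-sound i p e | decode-code finCell c = ok
  ... | false with R i | other i e
  ...   | (x , y , z) | (my , tx) = trans x (sym tx) , (λ h → trans (y h) (sym (my h))) , z

  rep-keep : ∀ {mk tp f p} → Rep mk tp f → Rep mk tp (setAt f p (symOf (cellOf (f p))))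
  rep-keep {p = p} R = rep-set R (R p) (λ i _ → (λ h → refl) , refl)

  marks : (H → ℕ) → H → ℕ → Bool
  marks hs h i = hs h ≡ᵇ i

  module _ (B : ℕ) where

    Run : TS → ℕ → (ℕ → Fin (3 + card finCell)) → Bool → Set
    Run q p f b = Trace machine B (config q p f) b

    run-go : ∀ q p f {q′ c d b} → act q (cellOf (f p)) ≡ inj₂ (q′ , c , d) → p ≤ B →
             Run q′ (moveHead d p) (setAt f p (symOf c)) b → Run q p f b
    run-go q p f e p≤B r =
      next p≤B (step-go machine (config q p f) (trans (δ-code q (f p)) (cong toAction e))) r

    run-halt : ∀ q p f {b} → act q (cellOf (f p)) ≡ inj₁ b → p ≤ B → Run q p f b
    run-halt q p f e p≤B =
      end p≤B (step-halt machine (config q p f) (trans (δ-code q (f p)) (cong toAction e)))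

    run-ret : ∀ s hs tp {b} p f → p ≤ B → Rep (marks hs) tp f →
              (∀ f → Rep (marks hs) tp f → Run (seek s) 0 f b) → Run (ret s) p f b
    run-ret s hs tp zero f le R k = run-go (ret s) zero f eqn z≤n (k _ (rep-keep R))
      where eqn : act (ret s) (cellOf (f 0)) ≡ inj₂ (seek s , cellOf (f 0) , stay)
            eqn with cellOf (f 0) | R 0
            ... | a , v , .true | (_ , _ , refl) = refl
    run-ret s hs tp (suc p) f le R k =
      run-go (ret s) (suc p) f eqn le (run-ret s hs tp p _ (≤-trans (n≤1+n p) le) (rep-keep R) k)
      where eqn : act (ret s) (cellOf (f (suc p))) ≡ inj₂ (ret s , cellOf (f (suc p)) , left)
            eqn with cellOf (f (suc p)) | R (suc p)
            ... | a , v , .false | (_ , _ , refl) = refl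

    serve-found : ∀ {h f s a v e s′ a′ d} → mark? v h ≡ true → f e a ≡ (s′ , a′ , d) →
                  serve (op h f) s (a , v , e) ≡ inj₂ (place s′ h , (a′ , setMark v h false , e) , d)
    serve-found p q rewrite p | q = refl

    serve-skip : ∀ {h f s a v e} → mark? v h ≡ false →
                 serve (op h f) s (a , v , e) ≡ inj₂ (seek s , (a , v , e) , right)
    serve-skip p rewrite p = refl

    run-serve : ∀ s hs tp f {h g s′ a d b} → δ s ≡ op h g → g (hs h ≡ᵇ 0) (tp (hs h)) ≡ (s′ , a , d) →
                hs h ≤ B → moveHead d (hs h) ≤ B → Rep (marks hs) tp f →
                (∀ f → Rep (marks (setHd hs h (moveHead d (hs h)))) (setAt tp (hs h) a) f → Run (seek s′) 0 f b) →
                Run (seek s) (hs h) f b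
    run-serve s hs tp f {h} {g} {s′} {a} {d} eδ eg le le′ R k =
      run-go (seek s) p f found le
        (run-go (place s′ h) p′ f₁ refl le′ (run-ret s′ hs′ tp′ p′ _ le′ R₂ k))
      where
      p = hs h
      p′ = moveHead d p
      hs′ = setHd hs h p′
      tp′ = setAt tp p a
      c = cellOf (f p)
      v = proj₁ (proj₂ c)
      c₁ = (a , setMark v h false , proj₂ (proj₂ c))
      f₁ = setAt f p (symOf c₁)
      mk₁ : H → ℕ → Bool
      mk₁ h′ i = if h′ == h then false else (hs h′ ≡ᵇ i)
      found : act (seek s) c ≡ inj₂ (place s′ h , c₁ , d)
      found rewrite eδ = serve-found {h} {g} (trans (proj₁ (proj₂ (R p)) h) (≡ᵇ-refl p))
        (trans (cong₂ g (proj₂ (proj₂ (R p))) (proj₁ (R p))) eg)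
      mset : ∀ h′ → mark? (setMark v h false) h′ ≡ mk₁ h′ p
      mset h′ with mark-setMark v h false h′
      ... | q with h′ == h
      ...   | true = q
      ...   | false = trans q (proj₁ (proj₂ (R p)) h′)
      other : ∀ i → (i ≡ᵇ p) ≡ false → (∀ h′ → mk₁ h′ i ≡ marks hs h′ i) × (tp′ i ≡ tp i)
      other i e = aux , cong (if_then a else tp i) e
        where aux : ∀ h′ → mk₁ h′ i ≡ marks hs h′ i
              aux h′ with h′ == h in q
              ... | false = refl
              ... | true rewrite ==-sound h′ h q = sym (≡ᵇ-sym-false i p e)
      R₁ : Rep mk₁ tp′ f₁
      R₁ = rep-set R (sym (cong (if_then a else tp p) (≡ᵇ-refl p)) , mset , proj₂ (proj₂ (R p))) other
      other₂ : ∀ i → (i ≡ᵇ p′) ≡ false → (∀ h′ → marks hs′ h′ i ≡ mk₁ h′ i) × (tp′ i ≡ tp′ i)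
      other₂ i e = aux , refl
        where aux : ∀ h′ → marks hs′ h′ i ≡ mk₁ h′ i
              aux h′ with h′ == h
              ... | false = refl
              ... | true = ≡ᵇ-sym-false i p′ e
      mset₂ : ∀ h′ → mark? (setMark (proj₁ (proj₂ (cellOf (f₁ p′)))) h true) h′ ≡ marks hs′ h′ p′
      mset₂ h′ with mark-setMark (proj₁ (proj₂ (cellOf (f₁ p′)))) h true h′ | proj₁ (proj₂ (R₁ p′)) h′
      ... | q | r with h′ == h
      ...   | true = trans q (sym (≡ᵇ-refl p′))
      ...   | false = trans q r
      R₂ : Rep (marks hs′) tp′ (setAt f₁ p′ (symOf (_ , setMark (proj₁ (proj₂ (cellOf (f₁ p′)))) h true , _)))
      R₂ = rep-set R₁ (proj₁ (R₁ p′) , mset₂ , proj₂ (proj₂ (R₁ p′))) other₂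

    -- `gap` is the distance still to scan. The scan never passes the served head, so the bound on
    -- the heads is also the bound on the single-head machine.
    run-seek : ∀ s hs tp {h g s′ a d b} → δ s ≡ op h g → g (hs h ≡ᵇ 0) (tp (hs h)) ≡ (s′ , a , d) →
               hs h ≤ B → moveHead d (hs h) ≤ B →
               (∀ f → Rep (marks (setHd hs h (moveHead d (hs h)))) (setAt tp (hs h) a) f → Run (seek s′) 0 f b) →
               ∀ gap p f → p + gap ≡ hs h → Rep (marks hs) tp f → Run (seek s) p f b
    run-seek s hs tp eδ eg le le′ k zero p f q R
      rewrite trans (sym (+-identityʳ p)) q = run-serve s hs tp f eδ eg le le′ R k
    run-seek s hs tp {h} {g} eδ eg le le′ k (suc gap) p f q R =
      run-go (seek s) p f eqn (≤-trans (<⇒≤ p<) le)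
        (run-seek s hs tp eδ eg le le′ k gap (suc p) _ (trans (sym (+-suc p gap)) q) (rep-keep R))
      where
      p< : p < hs h
      p< = subst (p <_) q (m<m+n p (s≤s z≤n))
      eqn : act (seek s) (cellOf (f p)) ≡ inj₂ (seek s , cellOf (f p) , right)
      eqn rewrite eδ = serve-skip {h} {g} (trans (proj₁ (proj₂ (R p)) h) (≢⇒≡ᵇ-false (λ z → <⇒≢ p< (sym z))))

    serialise : ∀ {s hs tp b} → DTrace δ B s hs tp b → ∀ f → Rep (marks hs) tp f → Run (seek s) 0 f b
    serialise {s} (halts e) f R =
      run-halt (seek s) 0 f (cong (λ i → serve i s (cellOf (f 0))) e) z≤n
    serialise {s} {hs} {tp} (moves {h = h} eδ eg le le′ r) f R =
      run-seek s hs tp eδ eg le le′ (serialise r) (hs h) 0 f refl R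

    inputTape : List Bool → ℕ → Γ
    inputTape w i = input (nth w i)

    serialise-init : ∀ w {b} → DTrace δ B s₀ (λ _ → 0) (inputTape w) b → Trace machine B (initConfig machine w) b
    serialise-init w r = run-go (inj₁ _) 0 tape₀ refl z≤n (serialise r _ R)
      where
      tape₀ : ℕ → Fin (3 + card finCell)
      tape₀ i = maybe bitSym fz (nth w i)
      cell₀ : ∀ i → cellOf (tape₀ i) ≡ unmarked (inputTape w i)
      cell₀ i with nth w i
      ... | nothing = refl
      ... | just false = refl
      ... | just true = refl
      R : Rep (marks (λ _ → 0)) (inputTape w) (setAt tape₀ 0 (symOf (proj₁ (cellOf (tape₀ 0)) , Vec.replicate (card finH) true , true)))
      R zero rewrite decode-code finCell (proj₁ (cellOf (tape₀ 0)) , Vec.replicate (card finH) true , true) =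
        cong proj₁ (cell₀ 0) , (λ h → VP.lookup-replicate (code finH h) true) , refl
      R (suc i) rewrite cell₀ (suc i) = refl , (λ h → VP.lookup-replicate (code finH h) false) , refl

-- Alternating machines and their depth-first evaluation

-- `fork true` is existential, `fork false` universal.
data AInstr (H Γ A : Set) : Set where
  stop : Bool → AInstr H Γ A
  fork : Bool → A → A → AInstr H Γ A
  op   : H → (Bool → Γ → A × Γ × Dir) → AInstr H Γ A

combineB : Bool → Bool → Bool → Bool
combineB true = _∨_
combineB false = _∧_

module Alternating {H : Set} (eqH : BoolEq H) where
  open MultiHead eqH

  -- The computation tree from a configuration has depth at most t and value b.
  data Ev {Γ A : Set} (δ : A → AInstr H Γ A) : A → (H → ℕ) → (ℕ → Γ) → Bool → ℕ → Set where
    ev-stop : ∀ {a hs tp b t} → δ a ≡ stop b → Ev δ a hs tp b t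
    ev-op   : ∀ {a hs tp b t h f a′ g d} → δ a ≡ op h f → f (hs h ≡ᵇ 0) (tp (hs h)) ≡ (a′ , g , d) →
              Ev δ a′ (setHd hs h (moveHead d (hs h))) (setAt tp (hs h) g) b t → Ev δ a hs tp b (suc t)
    ev-fork : ∀ {a hs tp b c t k x y} → δ a ≡ fork k x y →
              Ev δ x hs tp b t → Ev δ y hs tp c t → Ev δ a hs tp (combineB k b c) (suc t)

-- The log, kept on its own track under the extra head `nothing`, holds what is
-- needed to undo each step, so that no configuration has to be copied.
module Backtrack {H Γ A : Set} (eqH : BoolEq H) (finH : Finite H) (finΓ : Finite Γ) (finA : Finite A)
  (δ : A → AInstr H Γ A) where
  open BoolEq eqH
  open MultiHead eqH using (setHd; setHd-same; setHd-other)
  open Alternating eqH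
  open MultiHead (boolEqMaybe eqH) using (halts; moves) renaming (setHd to setHd′; DTrace to DTrace′)

  -- For a step: the previous control state, the overwritten symbol, and whether the head stood on
  -- cell 0. For a fork: its control state, and whether the second branch is the one being
  -- evaluated.
  Entry : Set
  Entry = (A × Γ × Bool) ⊎ (A × Bool)

  Γ′ : Set
  Γ′ = Γ × Maybe Entry

  -- `bwd b` carries the value `b` of a finished subtree back along the log, and `pop` reads the
  -- topmost entry. A step is undone in two moves, first the head and then the symbol, because the
  -- symbol belongs to the cell where the head stood before.
  DS : Set
  DS = (A ⊎ (A × Entry)) ⊎ ((Bool ⊎ (Bool ⊎ Bool)) ⊎ ((Bool × A × Γ × Bool) ⊎ (Bool × A × Γ)))

  pattern fwd a = inj₁ (inj₁ a)
  pattern save a e = inj₁ (inj₂ (a , e))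
  pattern bwd b = inj₂ (inj₁ (inj₁ b))
  pattern pop b = inj₂ (inj₁ (inj₂ (inj₁ b)))
  pattern fin b = inj₂ (inj₁ (inj₂ (inj₂ b)))
  pattern undoMove b a g z = inj₂ (inj₂ (inj₁ (b , a , g , z)))
  pattern undoWrite b a g = inj₂ (inj₂ (inj₂ (b , a , g)))

  abstract
    finEntry : Finite Entry
    finEntry = finite⊎ (finite× finA (finite× finΓ finiteBool)) (finite× finA finiteBool)

    finΓ′ : Finite Γ′
    finΓ′ = finite× finΓ (finiteMaybe finEntry)

    finDS : Finite DS
    finDS = finite⊎ (finite⊎ finA (finite× finA finEntry))
      (finite⊎ (finite⊎ finiteBool (finite⊎ finiteBool finiteBool))
        (finite⊎ (finite× finiteBool (finite× finA (finite× finΓ finiteBool)))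
                 (finite× finiteBool (finite× finA finΓ))))

  -- A left move on cell 0 has not moved the head, so the direction alone does not determine where
  -- it came from; `z` records that case.
  undo : Dir → Bool → Dir
  undo right z = left
  undo stay z = stay
  undo left true = stay
  undo left false = right

  undo-moveHead : ∀ d p → moveHead (undo d (p ≡ᵇ 0)) (moveHead d p) ≡ p
  undo-moveHead left zero = refl
  undo-moveHead left (suc p) = refl
  undo-moveHead right p = refl
  undo-moveHead stay p = refl

  moveHead-≤ : ∀ d p → moveHead d p ≤ suc p
  moveHead-≤ left zero = z≤n
  moveHead-≤ left (suc p) = ≤-trans (n≤1+n p) (n≤1+n (suc p))
  moveHead-≤ right p = ≤-refl
  moveHead-≤ stay p = n≤1+n p

  DI : Set
  DI = DInstr (Maybe H) Γ′ DS

  forward : AInstr H Γ A → A → DI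
  forward (stop b) a = op nothing (λ z c → bwd b , c , stay)
  forward (fork k x y) a = op nothing (λ z c → fwd x , (proj₁ c , just (inj₂ (a , false))) , right)
  forward (op h f) a = op (just h) (λ z c → let r = f z (proj₁ c) in
    save (proj₁ r) (inj₁ (a , proj₁ c , z)) , (proj₁ (proj₂ r) , proj₂ c) , proj₂ (proj₂ r))

  -- The first branch has returned; the second is skipped if that value already decides the fork.
  second : AInstr H Γ A → Bool → A → Γ′ → DS × Γ′ × Dir
  second (fork true x y) true a c = bwd true , c , stay
  second (fork true x y) false a c = fwd y , (proj₁ c , just (inj₂ (a , true))) , right
  second (fork false x y) true a c = fwd y , (proj₁ c , just (inj₂ (a , true))) , right
  second (fork false x y) false a c = bwd false , c , stay
  second _ b a c = fin false , c , stay

  popped : Bool → Maybe Entry → Γ′ → DS × Γ′ × Dir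
  -- A filler: in the runs considered every cell below the log head holds an entry.
  popped b nothing c = fin false , c , stay
  popped b (just (inj₁ (a , g , z))) c = undoMove b a g z , c , stay
  popped b (just (inj₂ (a , false))) c = second (δ a) b a c
  popped b (just (inj₂ (a , true))) c = bwd b , c , stay

  unmove : AInstr H Γ A → Bool → A → Γ → Bool → DI
  unmove (op h f) b a g z = op (just h) (λ _ c → undoWrite b a g , c , undo (proj₂ (proj₂ (f z g))) z)
  unmove _ b a g z = halt false

  unwrite : AInstr H Γ A → Bool → Γ → DI
  unwrite (op h f) b g = op (just h) (λ _ c → bwd b , (g , proj₂ c) , stay)
  unwrite _ b g = halt false

  δ′ : DS → DI
  δ′ (fwd a) = forward (δ a) a
  δ′ (save a e) = op nothing (λ z c → fwd a , (proj₁ c , just e) , right)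
  -- The log head stands on the first free cell. If that is cell 0, the log is empty and `b` is the
  -- value of the whole tree.
  δ′ (bwd b) = op nothing (λ z c → (if z then fin b else pop b) , c , left)
  δ′ (pop b) = op nothing (λ z c → popped b (proj₂ c) c)
  δ′ (fin b) = halt b
  δ′ (undoMove b a g z) = unmove (δ a) b a g z
  δ′ (undoWrite b a g) = unwrite (δ a) b g

  record Match (hs : H → ℕ) (tp : ℕ → Γ) (hs′ : Maybe H → ℕ) (tp′ : ℕ → Γ′) : Set where
    constructor match
    field
      heads : ∀ h → hs′ (just h) ≡ hs h
      cells : ∀ i → proj₁ (tp′ i) ≡ tp i
  open Match

  SameLog : (ℕ → Γ′) → (ℕ → Γ′) → ℕ → Set
  SameLog tp′ tp″ L = ∀ i → i < L → proj₂ (tp″ i) ≡ proj₂ (tp′ i)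

  match-log : ∀ {hs tp hs′ tp′} → Match hs tp hs′ tp′ → ∀ v c → proj₁ c ≡ proj₁ (tp′ (hs′ nothing)) →
              Match hs tp (setHd′ hs′ nothing v) (setAt tp′ (hs′ nothing) c)
  match-log {hs} {tp} {hs′} {tp′} m v c e = match (heads m) cs
    where cs : ∀ i → proj₁ (setAt tp′ (hs′ nothing) c i) ≡ tp i
          cs i with i ≡ᵇ hs′ nothing in q
          ... | false = cells m i
          ... | true rewrite ≡ᵇ-sound i _ q = trans e (cells m _)

  match-op : ∀ {hs tp hs′ tp′} → Match hs tp hs′ tp′ → ∀ h {v v′} c g → v′ ≡ v → proj₁ c ≡ g →
             Match (setHd hs h v) (setAt tp (hs h) g) (setHd′ hs′ (just h) v′) (setAt tp′ (hs′ (just h)) c)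
  match-op {hs} {tp} {hs′} {tp′} m h {v} {v′} c g ev eg = match hd cs
    where hd : ∀ h′ → setHd′ hs′ (just h) v′ (just h′) ≡ setHd hs h v h′
          hd h′ with h′ == h
          ... | true = ev
          ... | false = heads m h′
          cs : ∀ i → proj₁ (setAt tp′ (hs′ (just h)) c i) ≡ setAt tp (hs h) g i
          cs i rewrite heads m h with i ≡ᵇ hs h
          ... | true = eg
          ... | false = cells m i

  setAt-same : ∀ {B : Set} (f : ℕ → B) i a → setAt f i a i ≡ a
  setAt-same f i a rewrite ≡ᵇ-refl i = refl

  setAt-other : ∀ {B : Set} (f : ℕ → B) {i j} a → j ≢ i → setAt f i a j ≡ f j
  setAt-other f {i} {j} a ne rewrite ≢⇒≡ᵇ-false ne = refl

  log-setAt : ∀ tp′ p c → proj₂ c ≡ proj₂ (tp′ p) → ∀ i → proj₂ (setAt {Γ′} tp′ p c i) ≡ proj₂ (tp′ i)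
  log-setAt tp′ p c e i with i ≡ᵇ p in q
  ... | false = refl
  ... | true rewrite ≡ᵇ-sound i p q = e

  module _ (B : ℕ) (r : Bool) where

    Tr : DS → (Maybe H → ℕ) → (ℕ → Γ′) → Set
    Tr s hs tp = DTrace′ δ′ B s hs tp r

    -- How a finished subtree hands its value over: heads and tape are restored, the log head is
    -- back at `L` and the entries below `L` are intact. Whatever lies at or above `L` is garbage,
    -- so nothing is asked of it.
    Back : (H → ℕ) → (ℕ → Γ) → Bool → ℕ → (ℕ → Γ′) → Set
    Back hs tp b L tp′ = ∀ hs″ tp″ → Match hs tp hs″ tp″ → hs″ nothing ≡ L → SameLog tp′ tp″ L → Tr (bwd b) hs″ tp″

    bwd-pop : ∀ {b hs tp L} → hs nothing ≡ suc L → suc L ≤ B →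
              Tr (pop b) (setHd′ hs nothing L) (setAt tp (suc L) (tp (suc L))) → Tr (bwd b) hs tp
    bwd-pop {b} {hs} {tp} {L} e le k with hs nothing in q
    bwd-pop {b} {hs} {tp} {L} refl le k | .(suc L) =
      moves refl (cong (λ n → (if n ≡ᵇ 0 then fin b else pop b) , tp (hs nothing) , left) q)
        (subst (_≤ B) (sym q) le) (subst (λ n → moveHead left n ≤ B) (sym q) (≤-trans (n≤1+n L) le))
        (subst (λ n → Tr (pop b) (setHd′ hs nothing (moveHead left n)) (setAt tp n (tp n))) (sym q) k)

    pop-step : ∀ {b hs tp s c d L} → hs nothing ≡ L → popped b (proj₂ (tp L)) (tp L) ≡ (s , c , d) → suc L ≤ B →
               Tr s (setHd′ hs nothing (moveHead d L)) (setAt tp L c) → Tr (pop b) hs tp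
    pop-step {d = d} {L} refl e le k =
      moves refl e (≤-trans (n≤1+n L) le) (≤-trans (moveHead-≤ d L) le) k

    -- The topmost entry is popped, the head moved back and the old symbol restored. The heads stay
    -- in bounds because the position before the step was at most `L`.
    back-op : ∀ {a hs tp b h f a′ g d hs₁ tp₁ tp′} → δ a ≡ op h f → f (hs h ≡ᵇ 0) (tp (hs h)) ≡ (a′ , g , d) →
              ∀ L → suc L ≤ B → hs h ≤ L →
              Back hs tp b L tp′ →
              (∀ i → i < L → proj₂ (tp₁ i) ≡ proj₂ (tp′ i)) →
              proj₂ (tp₁ L) ≡ just (inj₁ (a , tp (hs h) , (hs h ≡ᵇ 0))) →
              Match (setHd hs h (moveHead d (hs h))) (setAt tp (hs h) g) hs₁ tp₁ → hs₁ nothing ≡ suc L →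
              Tr (bwd b) hs₁ tp₁
    back-op {a} {hs} {tp} {b} {h} {f} {a′} {g} {d} {hs₁} {tp₁} {tp′} eδ ef L sL≤B hL k sl top m eL =
      bwd-pop eL sL≤B
        (pop-step refl (cong (λ e → popped b e (tp₂ L)) top₂) sL≤B
          (moves (cong (λ i → unmove i b a γ z) eδ) refl
            (≤-trans (≤-reflexive at-q) (≤-trans (moveHead-≤ d p) (≤-trans (s≤s hL) sL≤B)))
            (≤-trans (≤-reflexive back) (≤-trans hL (≤-trans (n≤1+n L) sL≤B)))
            (moves (cong (λ i → unwrite i b γ) eδ) refl le₄ le₄
              (k hs₅ tp₅ m₅ refl logs))))
      where
      p = hs h
      γ = tp p
      z = p ≡ᵇ 0
      q = moveHead d p
      tp₂ = setAt tp₁ (suc L) (tp₁ (suc L))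
      hs₂ = setHd′ hs₁ nothing L
      log₂ : ∀ i → proj₂ (tp₂ i) ≡ proj₂ (tp₁ i)
      log₂ = log-setAt tp₁ (suc L) (tp₁ (suc L)) refl
      top₂ : proj₂ (tp₂ L) ≡ just (inj₁ (a , γ , z))
      top₂ = trans (log₂ L) top
      hs₃ = setHd′ hs₂ nothing L
      tp₃ = setAt tp₂ L (tp₂ L)
      at-q : hs₃ (just h) ≡ q
      at-q = trans (heads m h) (setHd-same hs h q)
      dir : Dir
      dir = undo (proj₂ (proj₂ (f z γ))) z
      back : moveHead dir (hs₃ (just h)) ≡ p
      back rewrite at-q | ef = undo-moveHead d p
      hs₄ = setHd′ hs₃ (just h) (moveHead dir (hs₃ (just h)))
      tp₄ = setAt tp₃ (hs₃ (just h)) (tp₃ (hs₃ (just h)))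
      at-p : hs₄ (just h) ≡ p
      at-p = trans (cong (λ t → if t then moveHead dir (hs₃ (just h)) else hs₃ (just h)) (==-refl h)) back
      le₄ : hs₄ (just h) ≤ B
      le₄ = ≤-trans (≤-reflexive at-p) (≤-trans hL (≤-trans (n≤1+n L) sL≤B))
      hs₅ = setHd′ hs₄ (just h) (hs₄ (just h))
      tp₅ = setAt tp₄ (hs₄ (just h)) (γ , proj₂ (tp₄ (hs₄ (just h))))
      idem : ∀ (t : ℕ → Γ′) j i → setAt t j (t j) i ≡ t i
      idem t j i with i ≡ᵇ j in w
      ... | false = refl
      ... | true = cong t (sym (≡ᵇ-sound i j w))
      tp₄-tp₁ : ∀ i → tp₄ i ≡ tp₁ i
      tp₄-tp₁ i = trans (idem tp₃ _ i) (trans (idem tp₂ L i) (idem tp₁ (suc L) i))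
      m₅ : Match hs tp hs₅ tp₅
      m₅ = match hd cs
        where
        hd : ∀ h′ → hs₅ (just h′) ≡ hs h′
        hd h′ with h′ == h in w
        ... | true rewrite ==-sound h′ h w = at-p
        ... | false = trans (heads m h′) (setHd-other hs q w)
        cs : ∀ i → proj₁ (tp₅ i) ≡ tp i
        cs i with i ≡ᵇ hs₄ (just h) in w
        ... | true = cong tp (sym (trans (≡ᵇ-sound i _ w) at-p))
        ... | false = trans (cong proj₁ (tp₄-tp₁ i)) (trans (cells m i)
                        (setAt-other tp g (λ e → ≡ᵇ-false⇒≢ w (trans e (sym at-p)))))
      logs : SameLog tp′ tp₅ L
      logs i i<L = trans (log-setAt tp₄ (hs₄ (just h)) _ refl i) (trans (cong proj₂ (tp₄-tp₁ i)) (sl i i<L))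

    -- A step moves one head by at most one cell and pushes one entry, so no head is ever beyond the
    -- log head. Bounding the log by the depth of the tree thus bounds all heads. The rest of the
    -- evaluation is passed in as `Back`, which lets the two branches of a fork be run one after the
    -- other.
    simulate : ∀ {a hs tp b t} → Ev δ a hs tp b t → ∀ {hs′ tp′} → Match hs tp hs′ tp′ →
               (∀ h → hs h ≤ hs′ nothing) → hs′ nothing + t ≤ B →
               Back hs tp b (hs′ nothing) tp′ → Tr (fwd a) hs′ tp′
    simulate {a} {hs} {tp} {b} {t} (ev-stop e) {hs′} {tp′} m hL le k =
      moves (cong (λ i → forward i a) e) refl L≤B L≤B
        (k _ _ (match-log m _ _ refl) refl (λ i i<L → log-setAt tp′ (hs′ nothing) _ refl i))
      where L≤B : hs′ nothing ≤ B
            L≤B = ≤-trans (m≤m+n _ t) le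
    simulate {a} {hs} {tp} {b} {suc t} (ev-op {h = h} {f} {a′} {g} {d} e ef r) {hs′} {tp′} m hL le k =
      moves (cong (λ i → forward i a) e) (cong (λ w → save (proj₁ w) _ , (proj₁ (proj₂ w) , _) , proj₂ (proj₂ w)) ef′)
        (≤-trans (≤-reflexive (heads m h)) (≤-trans (hL h) (≤-trans (n≤1+n L) sL≤B)))
        (≤-trans (moveHead-≤ d _) (≤-trans (s≤s (≤-trans (≤-reflexive (heads m h)) (hL h))) sL≤B))
        (moves refl refl (≤-trans (n≤1+n L) sL≤B) sL≤B
          (simulate r m₂ hL₂ (≤-trans (≤-reflexive (sym (+-suc L t))) le)
            (λ hs″ tp″ m″ eL sl → back-op {tp′ = tp′} e ef L sL≤B (hL h) k
              (λ i i<L → trans (sl i (≤-trans i<L (n≤1+n L)))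
                 (trans (cong proj₂ (setAt-other tp₁ _ (<⇒≢ i<L))) (log-setAt tp′ _ _ refl i)))
              (trans (sl L ≤-refl) (trans (cong proj₂ (setAt-same tp₁ L _)) top))
              m″ eL)))
      where
      L = hs′ nothing
      sL≤B : suc L ≤ B
      sL≤B = ≤-trans (m≤m+n (suc L) t) (≤-trans (≤-reflexive (sym (+-suc L t))) le)
      ef′ : f (hs′ (just h) ≡ᵇ 0) (proj₁ (tp′ (hs′ (just h)))) ≡ (a′ , g , d)
      ef′ = trans (cong₂ f (cong (_≡ᵇ 0) (heads m h)) (trans (cells m _) (cong tp (heads m h)))) ef
      hs₁ = setHd′ hs′ (just h) (moveHead d (hs′ (just h)))
      tp₁ = setAt tp′ (hs′ (just h)) (g , proj₂ (tp′ (hs′ (just h))))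
      m₁ = match-op m h (g , proj₂ (tp′ (hs′ (just h)))) g (cong (moveHead d) (heads m h)) refl
      m₂ = match-log m₁ (suc L) (proj₁ (tp₁ L) , just (inj₁ (a , proj₁ (tp′ (hs′ (just h))) , (hs′ (just h) ≡ᵇ 0)))) refl
      top : just (inj₁ (a , proj₁ (tp′ (hs′ (just h))) , (hs′ (just h) ≡ᵇ 0))) ≡ just {A = Entry} (inj₁ (a , tp (hs h) , (hs h ≡ᵇ 0)))
      top = cong₂ (λ x y → just (inj₁ (a , x , y))) (trans (cells m _) (cong tp (heads m h))) (cong (_≡ᵇ 0) (heads m h))
      hL₂ : ∀ h′ → setHd hs h (moveHead d (hs h)) h′ ≤ suc L
      hL₂ h′ with h′ == h
      ... | true = ≤-trans (moveHead-≤ d _) (s≤s (hL h))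
      ... | false = ≤-trans (hL h′) (n≤1+n L)
    simulate {a} {hs} {tp} {_} {suc t} (ev-fork {b = b} {c} {k = kd} {x} {y} e r₁ r₂) {hs′} {tp′} m hL le k =
      moves (cong (λ i → forward i a) e) refl (≤-trans (n≤1+n L) sL≤B) sL≤B
        (simulate r₁ (match-log m (suc L) _ refl) hL₁ le₁ first)
      where
      L = hs′ nothing
      sL≤B : suc L ≤ B
      sL≤B = ≤-trans (m≤m+n (suc L) t) (≤-trans (≤-reflexive (sym (+-suc L t))) le)
      le₁ : suc L + t ≤ B
      le₁ = ≤-trans (≤-reflexive (sym (+-suc L t))) le
      hL₁ : ∀ h → hs h ≤ suc L
      hL₁ h = ≤-trans (hL h) (n≤1+n L)
      tp₁ : ℕ → Γ′
      tp₁ = setAt tp′ L (proj₁ (tp′ L) , just (inj₂ (a , false)))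
      idem : ∀ (t : ℕ → Γ′) j i → setAt t j (t j) i ≡ t i
      idem t j i with i ≡ᵇ j in w
      ... | false = refl
      ... | true = cong t (sym (≡ᵇ-sound i j w))
      below : ∀ tp″ → SameLog tp₁ tp″ (suc L) → SameLog tp′ tp″ L
      below tp″ sl i i<L = trans (sl i (≤-trans i<L (n≤1+n L))) (cong proj₂ (setAt-other tp′ _ (<⇒≢ i<L)))
      popStay : ∀ {b hs″ tp″ L′} → Match hs tp hs″ tp″ → hs″ nothing ≡ suc L → SameLog tp′ tp″ L →
                (∀ c″ → proj₂ c″ ≡ proj₂ (tp″ L) → popped b (proj₂ c″) c″ ≡ (bwd L′ , c″ , stay)) →
                Back hs tp L′ L tp′ → Tr (bwd b) hs″ tp″
      popStay {b} {hs″} {tp″} {L′} m″ eL sl st bk =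
        bwd-pop eL sL≤B (pop-step refl (st (tp₂ L) (cong proj₂ (idem tp″ (suc L) L))) sL≤B
          (bk _ _ (match (heads m″) (λ i → trans (cong proj₁ (both i)) (cells m″ i))) refl
             (λ i i<L → trans (cong proj₂ (both i)) (sl i i<L))))
        where
        tp₂ = setAt tp″ (suc L) (tp″ (suc L))
        both : ∀ i → setAt tp₂ L (tp₂ L) i ≡ tp″ i
        both i = trans (idem tp₂ L i) (idem tp″ (suc L) i)
      more : ∀ {b hs″ tp″} → Match hs tp hs″ tp″ → hs″ nothing ≡ suc L → SameLog tp₁ tp″ (suc L) →
             (∀ c″ → second (δ a) b a c″ ≡ (fwd y , (proj₁ c″ , just (inj₂ (a , true))) , right)) →
             Back hs tp c L tp′ → Tr (bwd b) hs″ tp″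
      more {b} {hs″} {tp″} m″ eL sl sec bk =
        bwd-pop eL sL≤B (pop-step refl
          (trans (cong (λ w → popped b w (tp₂ L)) (trans (cong proj₂ (idem tp″ (suc L) L)) (trans (sl L ≤-refl) (cong proj₂ (setAt-same tp′ L _)))))
                 (sec (tp₂ L))) sL≤B
          (simulate r₂ (match (heads m″) cs) hL₁ le₁
            (λ hs₃ tp₃′ m₃ eL₃ sl₃ → popStay m₃ eL₃
               (λ i i<L → trans (sl₃ i (≤-trans i<L (n≤1+n L)))
                  (trans (cong proj₂ (trans (setAt-other tp₂ _ (<⇒≢ i<L)) (idem tp″ (suc L) i))) (below tp″ sl i i<L)))
               (λ c″ ec → cong (λ w → popped c w c″) (trans ec (trans (sl₃ L ≤-refl) (cong proj₂ (setAt-same tp₂ L _)))))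
               bk)))
        where
        tp₂ = setAt tp″ (suc L) (tp″ (suc L))
        cs : ∀ i → proj₁ (setAt tp₂ L (proj₁ (tp₂ L) , just (inj₂ (a , true))) i) ≡ tp i
        cs i with i ≡ᵇ L in w
        ... | false = trans (cong proj₁ (idem tp″ (suc L) i)) (cells m″ i)
        ... | true rewrite ≡ᵇ-sound i L w = trans (cong proj₁ (idem tp″ (suc L) L)) (cells m″ L)
      topOf : ∀ {tp″ : ℕ → Γ′} {c″ : Γ′} → SameLog tp₁ tp″ (suc L) → proj₂ c″ ≡ proj₂ (tp″ L) → proj₂ c″ ≡ just (inj₂ (a , false))
      topOf sl ec = trans ec (trans (sl L ≤-refl) (cong proj₂ (setAt-same tp′ L _)))
      first : Back hs tp b (suc L) tp₁
      first hs″ tp″ m″ eL sl = decide kd b e k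
        where
        -- In the two cases that stop after the first branch `combineB kd b c` computes to `b`, so
        -- the value `c` of the branch never visited does not matter.
        decide : ∀ kd b → δ a ≡ fork kd x y → Back hs tp (combineB kd b c) L tp′ → Tr (bwd b) hs″ tp″
        decide true true e k = popStay m″ eL (below tp″ sl)
          (λ c″ ec → trans (cong (λ w → popped true w c″) (topOf {tp″} {c″} sl ec)) (cong (λ i → second i true a c″) e)) k
        decide true false e k = more m″ eL sl (λ c″ → cong (λ i → second i false a c″) e) k
        decide false true e k = more m″ eL sl (λ c″ → cong (λ i → second i true a c″) e) k
        decide false false e k = popStay m″ eL (below tp″ sl)
          (λ c″ ec → trans (cong (λ w → popped false w c″) (topOf {tp″} {c″} sl ec)) (cong (λ i → second i false a c″) e)) k

  -- The log starts empty, so the depth `t` of the tree becomes the space bound.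
  backtrack : ∀ {a tp b t tp′} → Ev δ a (λ _ → 0) tp b t → (∀ i → proj₁ (tp′ i) ≡ tp i) →
              DTrace′ δ′ t (fwd a) (λ _ → 0) tp′ b
  backtrack {b = b} {t} r ct = simulate t b r (match (λ _ → refl) ct) (λ _ → z≤n) ≤-refl
    (λ hs″ tp″ m″ eL sl → moves refl (cong (λ n → (if n ≡ᵇ 0 then fin b else pop b) , tp″ (hs″ nothing) , left) eL)
       (subst (_≤ t) (sym eL) z≤n) (subst (λ n → moveHead left n ≤ t) (sym eL) z≤n) (halts refl))

-- Programs for alternating machines

-- The two simulations composed. From here on it is enough to exhibit computation trees whose depth
-- is polynomial in the length of the word.
inPSPACE-alternating : {H Γ A : Set} (eqH : BoolEq H) → Finite H → Finite Γ → Finite A →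
  (δ : A → AInstr H Γ A) (input : Maybe Bool → Γ) (a₀ : A) (p : Pol) (L : List Bool → Set) →
  (∀ w → ∃ λ b → Alternating.Ev eqH δ a₀ (λ _ → 0) (λ i → input (nth w i)) b (evalPol p (length w)) × (b ≡ true ⇔ L w)) →
  InPSPACE L
inPSPACE-alternating {H} {Γ} {A} eqH finH finΓ finA δ input a₀ p L dec = M.machine , p , λ w → bounded w , result w
  where
  module Bt = Backtrack eqH finH finΓ finA δ
  module M = Serialise (boolEqMaybe eqH) (finiteMaybe finH) Bt.finΓ′ Bt.finDS (λ m → input m , nothing) Bt.δ′ (inj₁ (inj₁ a₀))
  trace : ∀ w → Trace M.machine (evalPol p (length w)) (initConfig M.machine w) (proj₁ (dec w))
  trace w = M.serialise-init _ w (Bt.backtrack (proj₁ (proj₂ (dec w))) (λ _ → refl))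
  bounded : ∀ w t c → exec M.machine t (initConfig M.machine w) ≡ running c → head c ≤ evalPol p (length w)
  bounded w = trace-bounded (trace w)
  result : ∀ w → Σ ℕ λ t → Σ Bool λ b → (exec M.machine t (initConfig M.machine w) ≡ done b) × (b ≡ true ⇔ L w)
  result w with trace-halts (trace w)
  ... | t , q = t , proj₁ (dec w) , q , proj₂ (proj₂ (dec w))

data Prog (H Γ Lb : Set) : Set where
  act     : H → (Bool → Γ → Γ × Dir) → Prog H Γ Lb
  _⨾_     : Prog H Γ Lb → Prog H Γ Lb → Prog H Γ Lb
  ifT     : H → (Bool → Γ → Bool) → Prog H Γ Lb → Prog H Γ Lb → Prog H Γ Lb
  whl     : H → (Bool → Γ → Bool) → Prog H Γ Lb → Prog H Γ Lb
  choose  : Bool → Prog H Γ Lb → Prog H Γ Lb → Prog H Γ Lb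
  verdict : Bool → Prog H Γ Lb
  jump    : Lb → Prog H Γ Lb

infixr 5 _⨾_

-- `nothing` is the test of a conditional or of a loop, and the fork of a choice.
Pt : ∀ {H Γ Lb} → Prog H Γ Lb → Set
Pt (act _ _) = ⊤
Pt (P ⨾ Q) = Pt P ⊎ Pt Q
Pt (ifT _ _ P Q) = Maybe (Pt P ⊎ Pt Q)
Pt (whl _ _ P) = Maybe (Pt P)
Pt (choose _ P Q) = Maybe (Pt P ⊎ Pt Q)
Pt (verdict _) = ⊤
Pt (jump _) = ⊤

finitePt : ∀ {H Γ Lb} (P : Prog H Γ Lb) → Finite (Pt P)
finitePt (act _ _) = finite⊤
finitePt (P ⨾ Q) = finite⊎ (finitePt P) (finitePt Q)
finitePt (ifT _ _ P Q) = finiteMaybe (finite⊎ (finitePt P) (finitePt Q))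
finitePt (whl _ _ P) = finiteMaybe (finitePt P)
finitePt (choose _ P Q) = finiteMaybe (finite⊎ (finitePt P) (finitePt Q))
finitePt (verdict _) = finite⊤
finitePt (jump _) = finite⊤

entry : ∀ {H Γ Lb} (P : Prog H Γ Lb) → Pt P
entry (act _ _) = _
entry (P ⨾ Q) = inj₁ (entry P)
entry (ifT _ _ P Q) = nothing
entry (whl _ _ P) = nothing
entry (choose _ P Q) = nothing
entry (verdict _) = _
entry (jump _) = _

module Programs {H Γ : Set} (eqH : BoolEq H) (h₀ : H) (N : ℕ) where
  open BoolEq eqH
  open MultiHead eqH using (setHd)
  open Alternating eqH

  Pr : Set
  Pr = Prog H Γ (Fin N)

  instr : ∀ {X : Set} (P : Pr) → Pt P → (Pt P → X) → X → (Fin N → X) → AInstr H Γ X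
  instr (act h f) pt emb exit gt = op h (λ z g → exit , f z g)
  instr (P ⨾ Q) (inj₁ x) emb exit gt = instr P x (λ y → emb (inj₁ y)) (emb (inj₂ (entry Q))) gt
  instr (P ⨾ Q) (inj₂ y) emb exit gt = instr Q y (λ y → emb (inj₂ y)) exit gt
  instr (ifT h τ P Q) nothing emb exit gt =
    op h (λ z g → (if τ z g then emb (just (inj₁ (entry P))) else emb (just (inj₂ (entry Q)))) , g , stay)
  instr (ifT h τ P Q) (just (inj₁ x)) emb exit gt = instr P x (λ y → emb (just (inj₁ y))) exit gt
  instr (ifT h τ P Q) (just (inj₂ x)) emb exit gt = instr Q x (λ y → emb (just (inj₂ y))) exit gt
  instr (whl h τ P) nothing emb exit gt =
    op h (λ z g → (if τ z g then emb (just (entry P)) else exit) , g , stay)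
  instr (whl h τ P) (just x) emb exit gt = instr P x (λ y → emb (just y)) (emb nothing) gt
  instr (choose k P Q) nothing emb exit gt = fork k (emb (just (inj₁ (entry P)))) (emb (just (inj₂ (entry Q))))
  instr (choose k P Q) (just (inj₁ x)) emb exit gt = instr P x (λ y → emb (just (inj₁ y))) exit gt
  instr (choose k P Q) (just (inj₂ x)) emb exit gt = instr Q x (λ y → emb (just (inj₂ y))) exit gt
  instr (verdict b) pt emb exit gt = stop b
  -- Control changes only by executing an instruction, so a jump is an idle step of `h₀`.
  instr (jump l) pt emb exit gt = op h₀ (λ z g → gt l , g , stay)

  record St : Set where
    constructor st
    field
      hd : H → ℕ
      tp : ℕ → Γ
  open St public

  record _≈_ (s s′ : St) : Set where
    constructor ≈-intro
    field
      hd≈ : ∀ h → hd s h ≡ hd s′ h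
      tp≈ : ∀ i → tp s i ≡ tp s′ i
  open _≈_ public

  ≈-refl : ∀ {s} → s ≈ s
  ≈-refl = ≈-intro (λ _ → refl) (λ _ → refl)

  ≈-sym : ∀ {s s′} → s ≈ s′ → s′ ≈ s
  ≈-sym p = ≈-intro (λ h → sym (hd≈ p h)) (λ i → sym (tp≈ p i))

  ≈-trans : ∀ {s s′ s″} → s ≈ s′ → s′ ≈ s″ → s ≈ s″
  ≈-trans p q = ≈-intro (λ h → trans (hd≈ p h) (hd≈ q h)) (λ i → trans (tp≈ p i) (tp≈ q i))

  module Machine (blocks : Fin N → Pr) where

    A : Set
    A = Σ (Fin N) λ l → Maybe (Pt (blocks l))

    abstract
      finA : Finite A
      finA = finiteΣFin N (λ l → finiteMaybe (finitePt (blocks l)))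

    block : Fin N → A
    block l = l , just (entry (blocks l))

    δ : A → AInstr H Γ A
    -- `nothing` is the point behind the end of a block; running into it rejects.
    δ (l , nothing) = stop false
    δ (l , just pt) = instr (blocks l) pt (λ x → l , just x) (l , nothing) block

    E : A → St → Bool → ℕ → Set
    E a s b t = Ev δ a (hd s) (tp s) b t

    ev-resp : ∀ {a hs tp hs′ tp′ b t} → (∀ h → hs h ≡ hs′ h) → (∀ i → tp i ≡ tp′ i) →
              Ev δ a hs tp b t → Ev δ a hs′ tp′ b t
    ev-resp eh et (ev-stop e) = ev-stop e
    ev-resp {hs = hs} {tp} {hs′} {tp′} eh et (ev-op {h = h} {f} {g = g} {d} e ef r) =
      ev-op e (trans (cong₂ f (cong (_≡ᵇ 0) (sym (eh h))) (trans (sym (et _)) (cong tp (sym (eh h))))) ef)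
        (ev-resp eh′ et′ r)
      where
      eh′ : ∀ h′ → setHd hs h (moveHead d (hs h)) h′ ≡ setHd hs′ h (moveHead d (hs′ h)) h′
      eh′ h′ with h′ == h
      ... | true = cong (moveHead d) (eh h)
      ... | false = eh h′
      et′ : ∀ i → setAt tp (hs h) g i ≡ setAt tp′ (hs′ h) g i
      et′ i rewrite eh h with i ≡ᵇ hs′ h
      ... | true = refl
      ... | false = et i
    ev-resp eh et (ev-fork e r₁ r₂) = ev-fork e (ev-resp eh et r₁) (ev-resp eh et r₂)

    E-resp : ∀ {a s s′ b t} → s ≈ s′ → E a s b t → E a s′ b t
    E-resp p = ev-resp (hd≈ p) (tp≈ p)

    E-≤ : ∀ {a s b t t′} → t ≤ t′ → E a s b t → E a s b t′
    E-≤ le (ev-stop e) = ev-stop e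
    E-≤ (s≤s le) (ev-op {a′ = a′} e ef r) = ev-op e ef (E-≤ {a′} {st _ _} le r)
    E-≤ {s = s} (s≤s le) (ev-fork {x = x} {y} e r₁ r₂) = ev-fork e (E-≤ {x} {s} le r₁) (E-≤ {y} {s} le r₂)

    -- A placement of `P` among the control states. Routines are proved correct for every placement,
    -- which makes the proofs compositional: a routine may occur anywhere and any number of times.
    record Cont (P : Pr) : Set where
      constructor cont
      field
        emb  : Pt P → A
        exit : A
        ok   : ∀ pt → δ (emb pt) ≡ instr P pt emb exit block
    open Cont

    -- P leads from s to s′ in c steps, whatever follows.
    Det : Pr → St → St → ℕ → Set
    Det P s s′ c = ∀ (C : Cont P) {b t} → E (exit C) s′ b t → E (emb C (entry P)) s b (c + t)

    -- P never falls through, and its computation tree has value b.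
    Goes : Pr → St → Bool → ℕ → Set
    Goes P s b t = ∀ (C : Cont P) → E (emb C (entry P)) s b t

    contˡ : ∀ {P Q} → Cont (P ⨾ Q) → Cont P
    contˡ {P} {Q} C = cont (λ y → emb C (inj₁ y)) (emb C (inj₂ (entry Q))) (λ x → ok C (inj₁ x))

    contʳ : ∀ {P Q} → Cont (P ⨾ Q) → Cont Q
    contʳ C = cont (λ y → emb C (inj₂ y)) (exit C) (λ y → ok C (inj₂ y))

    det-≈ : ∀ {P s s′ s″ c} → s′ ≈ s″ → Det P s s′ c → Det P s s″ c
    det-≈ p d C r = d C (E-resp {exit C} (≈-sym p) r)

    det-≤ : ∀ {P s s′ c c′} → c ≤ c′ → Det P s s′ c → Det P s s′ c′
    det-≤ {P} {s} le d C {t = t} r = E-≤ {emb C (entry P)} {s} (+-monoˡ-≤ t le) (d C r)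

    goes-≤ : ∀ {P s b t t′} → t ≤ t′ → Goes P s b t → Goes P s b t′
    goes-≤ {P} {s} le g C = E-≤ {emb C (entry P)} {s} le (g C)

    goes-≈ : ∀ {P s s′ b t} → s ≈ s′ → Goes P s b t → Goes P s′ b t
    goes-≈ {P} p g C = E-resp {emb C (entry P)} p (g C)

    det-seq : ∀ {P Q s s₁ s₂ c d} → Det P s s₁ c → Det Q s₁ s₂ d → Det (P ⨾ Q) s s₂ (c + d)
    det-seq {P} {Q} {s} {c = c} {d} p q C {b} {t} r =
      subst (E (emb C (inj₁ (entry P))) s b) (sym (+-assoc c d t)) (p (contˡ C) (q (contʳ C) r))

    goes-seq : ∀ {P Q s s₁ b c t} → Det P s s₁ c → Goes Q s₁ b t → Goes (P ⨾ Q) s b (c + t)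
    goes-seq p q C = p (contˡ C) (q (contʳ C))

    det-act : ∀ {h f s g d} → f (hd s h ≡ᵇ 0) (tp s (hd s h)) ≡ (g , d) →
              Det (act h f) s (st (setHd (hd s) h (moveHead d (hd s h))) (setAt (tp s) (hd s h) g)) 1
    det-act {h} {f} {s} e C r = ev-op (ok C _) (cong (exit C ,_) e) r

    same : St → H → St
    same s h = st (setHd (hd s) h (hd s h)) (setAt (tp s) (hd s h) (tp s (hd s h)))

    same-≈ : ∀ s h → s ≈ same s h
    same-≈ s h = ≈-intro eh et
      where
      eh : ∀ h′ → hd s h′ ≡ hd (same s h) h′
      eh h′ with h′ == h in q
      ... | false = refl
      ... | true = cong (hd s) (==-sound h′ h q)
      et : ∀ i → tp s i ≡ tp (same s h) i
      et i with i ≡ᵇ hd s h in q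
      ... | false = refl
      ... | true = cong (tp s) (≡ᵇ-sound i _ q)

    test-step : ∀ {a s b t h} {τ : Bool → Γ → Bool} {x y : A} →
                δ a ≡ op h (λ z g → (if τ z g then x else y) , g , stay) →
                E (if τ (hd s h ≡ᵇ 0) (tp s (hd s h)) then x else y) s b t → E a s b (suc t)
    test-step {s = s} {h = h} {τ} {x} {y} e r =
      ev-op e refl (E-resp {if τ (hd s h ≡ᵇ 0) (tp s (hd s h)) then x else y} (same-≈ s h) r)

    test-true : ∀ {a s b t h} {τ : Bool → Γ → Bool} {x y : A} →
                δ a ≡ op h (λ z g → (if τ z g then x else y) , g , stay) →
                τ (hd s h ≡ᵇ 0) (tp s (hd s h)) ≡ true → E x s b t → E a s b (suc t)
    test-true {s = s} {b} {t} {τ = τ} {x} {y} e q r =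
      test-step {τ = τ} e (subst (λ v → E (if v then x else y) s b t) (sym q) r)

    test-false : ∀ {a s b t h} {τ : Bool → Γ → Bool} {x y : A} →
                δ a ≡ op h (λ z g → (if τ z g then x else y) , g , stay) →
                τ (hd s h ≡ᵇ 0) (tp s (hd s h)) ≡ false → E y s b t → E a s b (suc t)
    test-false {s = s} {b} {t} {τ = τ} {x} {y} e q r =
      test-step {τ = τ} e (subst (λ v → E (if v then x else y) s b t) (sym q) r)

    module _ {h : H} {τ : Bool → Γ → Bool} where

      contThen : ∀ {P Q} → Cont (ifT h τ P Q) → Cont P
      contThen C = cont (λ y → emb C (just (inj₁ y))) (exit C) (λ y → ok C (just (inj₁ y)))

      contElse : ∀ {P Q} → Cont (ifT h τ P Q) → Cont Q
      contElse C = cont (λ y → emb C (just (inj₂ y))) (exit C) (λ y → ok C (just (inj₂ y)))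

      contBody : ∀ {P} → Cont (whl h τ P) → Cont P
      contBody C = cont (λ y → emb C (just y)) (emb C nothing) (λ y → ok C (just y))

      det-then : ∀ {P Q s s′ c} → τ (hd s h ≡ᵇ 0) (tp s (hd s h)) ≡ true → Det P s s′ c → Det (ifT h τ P Q) s s′ (suc c)
      det-then q d C r = test-true {τ = τ} (ok C nothing) q (d (contThen C) r)

      det-else : ∀ {P Q s s′ c} → τ (hd s h ≡ᵇ 0) (tp s (hd s h)) ≡ false → Det Q s s′ c → Det (ifT h τ P Q) s s′ (suc c)
      det-else q d C r = test-false {τ = τ} (ok C nothing) q (d (contElse C) r)

      goes-then : ∀ {P Q s b t} → τ (hd s h ≡ᵇ 0) (tp s (hd s h)) ≡ true → Goes P s b t → Goes (ifT h τ P Q) s b (suc t)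
      goes-then q g C = test-true {τ = τ} (ok C nothing) q (g (contThen C))

      goes-else : ∀ {P Q s b t} → τ (hd s h ≡ᵇ 0) (tp s (hd s h)) ≡ false → Goes Q s b t → Goes (ifT h τ P Q) s b (suc t)
      goes-else q g C = test-false {τ = τ} (ok C nothing) q (g (contElse C))

      det-exit : ∀ {P s} → τ (hd s h ≡ᵇ 0) (tp s (hd s h)) ≡ false → Det (whl h τ P) s s 1
      det-exit q C r = test-false {τ = τ} (ok C nothing) q r

      det-loop : ∀ {P s s₁ s₂ c d} → τ (hd s h ≡ᵇ 0) (tp s (hd s h)) ≡ true → Det P s s₁ c →
                 Det (whl h τ P) s₁ s₂ d → Det (whl h τ P) s s₂ (suc (c + d))
      det-loop {P} {s} {s₁} {s₂} {c} {d} q p w C {b} {t} r = test-true {τ = τ} (ok C nothing) q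
        (subst (E (emb C (just (entry P))) s b) (sym (+-assoc c d t)) (p (contBody C) (w C r)))

    goes-jump : ∀ {l s b t} → E (block l) s b t → Goes (jump l) s b (suc t)
    goes-jump {l} {s} r C = ev-op (ok C _) refl (E-resp {block l} (same-≈ s h₀) r)

    goes-verdict : ∀ {s b t} → Goes (verdict b) s b t
    goes-verdict C = ev-stop (ok C _)

    contLeft : ∀ {k P Q} → Cont (choose k P Q) → Cont P
    contLeft C = cont (λ y → emb C (just (inj₁ y))) (exit C) (λ y → ok C (just (inj₁ y)))

    contRight : ∀ {k P Q} → Cont (choose k P Q) → Cont Q
    contRight C = cont (λ y → emb C (just (inj₂ y))) (exit C) (λ y → ok C (just (inj₂ y)))

    goes-choose : ∀ {k P Q s b c t} → Goes P s b t → Goes Q s c t → Goes (choose k P Q) s (combineB k b c) (suc t)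
    goes-choose p q C = ev-fork (ok C nothing) (p (contLeft C)) (q (contRight C))

    block-goes : ∀ {l s b t} → Goes (blocks l) s b t → E (block l) s b t
    block-goes {l} g = g (cont (λ x → l , just x) (l , nothing) (λ pt → refl))

    det-≈ˡ : ∀ {P s s′ s″ c} → s ≈ s′ → Det P s s″ c → Det P s′ s″ c
    det-≈ˡ {P} p d C r = E-resp {emb C (entry P)} p (d C r)

-- Counter arithmetic with heads.

inc dec clear : ∀ {H Γ Lb} → H → Prog H Γ Lb
inc h = act h (λ _ g → g , right)
dec h = act h (λ _ g → g , left)

nz : ∀ {Γ : Set} → Bool → Γ → Bool
nz z _ = not z

clear h = whl h nz (dec h)

for : ∀ {H Γ Lb} → H → Prog H Γ Lb → Prog H Γ Lb
for h P = whl h nz (dec h ⨾ P)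

ifZero : ∀ {H Γ Lb} → H → Prog H Γ Lb → Prog H Γ Lb → Prog H Γ Lb
ifZero h P Q = ifT h (λ z _ → z) P Q

move : ∀ {H Γ Lb} → H → H → Prog H Γ Lb
move x y = for x (inc y)

-- The source survives: it is counted into `aux` on the way and moved back.
addTo : ∀ {H Γ Lb} → H → H → H → Prog H Γ Lb
addTo src dst aux = for src (inc aux ⨾ inc dst) ⨾ move aux src

mulBy : ∀ {H Γ Lb} → H → H → H → H → Prog H Γ Lb
mulBy n acc tmp aux = for acc (addTo n tmp aux) ⨾ move tmp acc

-- The time of `mulBy` on an accumulator `X`: `X` additions of `n`, each with two steps of loop
-- control, and then the move of the product back into the accumulator.
mulCost : ℕ → ℕ → ℕ
mulCost X n = X * (2 + (n * 7 + 2)) + 1 + (X * n * 3 + 1)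

incs : ∀ {H Γ Lb} → ℕ → H → Prog H Γ Lb → Prog H Γ Lb
incs zero h P = P
incs (suc c) h P = inc h ⨾ incs c h P

-- Sets x to a number from 1 up to n, at the choice of the player k.
pickLoop : ∀ {H Γ Lb} → Bool → H → H → Prog H Γ Lb
pickLoop k x t = whl t nz (choose k (clear t) (inc x ⨾ dec t))

pickValue : ∀ {H Γ Lb} → Bool → H → H → H → H → Prog H Γ Lb
pickValue k n x t a = clear x ⨾ inc x ⨾ addTo n t a ⨾ dec t ⨾ pickLoop k x t

module Routines {H Γ : Set} (eqH : BoolEq H) (h₀ : H) (N : ℕ) (blocks : Fin N → Prog H Γ (Fin N)) where
  open BoolEq eqH
  open MultiHead eqH using (setHd; setHd-same; setHd-other)
  open Programs {H} {Γ} eqH h₀ N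
  open Alternating eqH
  open Machine blocks
  open Cont

  infixl 20 _[_≔_]
  _[_≔_] : St → H → ℕ → St
  s [ h ≔ v ] = st (setHd (hd s) h v) (tp s)

  upd-cong : ∀ {s s′ v v′} h → s ≈ s′ → v ≡ v′ → (s [ h ≔ v ]) ≈ (s′ [ h ≔ v′ ])
  upd-cong {s} {s′} {v} {v′} h p q = ≈-intro eh (tp≈ p)
    where eh : ∀ h′ → setHd (hd s) h v h′ ≡ setHd (hd s′) h v′ h′
          eh h′ with h′ == h
          ... | true = q
          ... | false = hd≈ p h′

  upd-id : ∀ s h {v} → v ≡ hd s h → (s [ h ≔ v ]) ≈ s
  upd-id s h {v} e = ≈-intro eh (λ _ → refl)
    where eh : ∀ h′ → setHd (hd s) h v h′ ≡ hd s h′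
          eh h′ with h′ == h in q
          ... | true = trans e (cong (hd s) (sym (==-sound h′ h q)))
          ... | false = refl

  upd-upd : ∀ s h v v′ → (s [ h ≔ v ] [ h ≔ v′ ]) ≈ (s [ h ≔ v′ ])
  upd-upd s h v v′ = ≈-intro eh (λ _ → refl)
    where eh : ∀ h′ → setHd (setHd (hd s) h v) h v′ h′ ≡ setHd (hd s) h v′ h′
          eh h′ with h′ == h
          ... | true = refl
          ... | false = refl

  upd-comm : ∀ s {x y} v w → (x == y) ≡ false → (s [ x ≔ v ] [ y ≔ w ]) ≈ (s [ y ≔ w ] [ x ≔ v ])
  upd-comm s {x} {y} v w x≠y = ≈-intro eh (λ _ → refl)
    where eh : ∀ h′ → setHd (setHd (hd s) x v) y w h′ ≡ setHd (setHd (hd s) y w) x v h′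
          eh h′ with h′ == x in p | h′ == y in q
          ... | false | false = refl
          ... | true | false = refl
          ... | false | true = refl
          ... | true | true rewrite ==-sound h′ x p = contradiction (trans (sym q) x≠y) (λ ())

  upd-tail : ∀ {s x y v w u} → (x == y) ≡ false → (s [ x ≔ v ] [ y ≔ w ] [ x ≔ u ]) ≈ (s [ x ≔ u ] [ y ≔ w ])
  upd-tail {s} {x} {y} {v} {w} {u} x≠y =
    ≈-trans (upd-cong x (upd-comm s v w x≠y) refl)
      (≈-trans (upd-upd (s [ y ≔ w ]) x v u) (≈-sym (upd-comm s u w x≠y)))

  get-same : ∀ s h {v} → hd (s [ h ≔ v ]) h ≡ v
  get-same s h = setHd-same (hd s) h _

  get-other : ∀ s {h h′} v → (h′ == h) ≡ false → hd (s [ h ≔ v ]) h′ ≡ hd s h′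
  get-other s v p = setHd-other (hd s) v p

  moved : ∀ s h p → st (setHd (hd s) h p) (setAt (tp s) (hd s h) (tp s (hd s h))) ≈ (s [ h ≔ p ])
  moved s h p = ≈-intro (λ _ → refl) (λ i → sym (tp≈ (same-≈ s h) i))

  det-inc : ∀ {h s} → Det (inc h) s (s [ h ≔ suc (hd s h) ]) 1
  det-inc {h} {s} = det-≈ (moved s h _) (det-act refl)

  det-dec : ∀ {h s m} → hd s h ≡ suc m → Det (dec h) s (s [ h ≔ m ]) 1
  det-dec {h} {s} {m} e = det-≈ (≈-trans (moved s h _) (upd-cong h ≈-refl (cong (moveHead left) e))) (det-act refl)

  nz-suc : ∀ {s h m} → hd s h ≡ suc m → nz (hd s h ≡ᵇ 0) (tp s (hd s h)) ≡ true
  nz-suc e rewrite e = refl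

  nz-zero : ∀ {s h} → hd s h ≡ 0 → nz (hd s h ≡ᵇ 0) (tp s (hd s h)) ≡ false
  nz-zero e rewrite e = refl

  -- `S m` is the state in which the counter reads `m` and the loop test is due. The decrement
  -- precedes the body, so the body starts in `S (suc m) [ h ≔ m ]`.
  det-for : ∀ {h P} (S : ℕ → St) c n → (∀ m → hd (S m) h ≡ m) →
            (∀ m → m < n → Det P (S (suc m) [ h ≔ m ]) (S m) c) → Det (for h P) (S n) (S 0) (n * (2 + c) + 1)
  det-for {h} S c zero e body = det-exit (nz-zero {S 0} (e 0))
  det-for {h} S c (suc n) e body =
    det-≤ (≤-reflexive (arith c n)) (det-loop (nz-suc {S (suc n)} (e (suc n)))
      (det-seq (det-dec {s = S (suc n)} (e (suc n))) (body n ≤-refl))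
      (det-for S c n e (λ m lt → body m (≤-trans lt (n≤1+n n)))))
    where arith : ∀ c n → suc (1 + c + (n * (2 + c) + 1)) ≡ suc n * (2 + c) + 1
          arith = solve-∀

  ∸-step : ∀ {m n} → m < n → suc (n ∸ suc m) ≡ n ∸ m
  ∸-step {zero} {suc n} lt = refl
  ∸-step {suc m} {suc n} (s≤s lt) = ∸-step lt

  det-move : ∀ {x y s} → (x == y) ≡ false → Det (move x y) s (s [ y ≔ hd s y + hd s x ] [ x ≔ 0 ]) (hd s x * 3 + 1)
  det-move {x} {y} {s} x≠y = det-≈ˡ start (det-for S 1 X (λ m → get-same (s [ y ≔ Y + (X ∸ m) ]) x) body)
    where
    X = hd s x
    Y = hd s y
    y≠x = ==-sym-false x y x≠y
    S : ℕ → St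
    S m = s [ y ≔ Y + (X ∸ m) ] [ x ≔ m ]
    start : S X ≈ s
    start = ≈-trans (upd-id _ x (sym (get-other s _ x≠y)))
                    (upd-id s y (trans (cong (Y +_) (n∸n≡0 X)) (+-identityʳ Y)))
    body : ∀ m → m < X → Det (inc y) (S (suc m) [ x ≔ m ]) (S m) 1
    body m lt = det-≈ (≈-trans (upd-cong y (upd-upd _ x _ m) refl) (≈-trans (upd-tail y≠x)
        (upd-cong x (upd-cong y ≈-refl val) refl))) det-inc
      where
      val : suc (hd (S (suc m) [ x ≔ m ]) y) ≡ Y + (X ∸ m)
      val rewrite get-other (S (suc m)) {x} {y} m y≠x | get-other (s [ y ≔ Y + (X ∸ suc m) ]) {x} {y} (suc m) y≠x
                | get-same s y {Y + (X ∸ suc m)} = trans (sym (+-suc Y _)) (cong (Y +_) (∸-step lt))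

  det-addTo : ∀ {x y a s} → (x == y) ≡ false → (x == a) ≡ false → (y == a) ≡ false → hd s a ≡ 0 →
              Det (addTo x y a) s (s [ y ≔ hd s y + hd s x ]) (hd s x * 7 + 2)
  det-addTo {x} {y} {a} {s} x≠y x≠a y≠a a0 =
    det-≤ (≤-reflexive (trans (cong (λ v → X * 4 + 1 + (v * 3 + 1)) eA) (arith X)))
      (det-seq (det-≈ˡ start (det-for S 2 X (λ m → get-same (s [ y ≔ Y + (X ∸ m) ] [ a ≔ X ∸ m ]) x) body))
               (det-≈ finish (det-move a≠x)))
    where
    X = hd s x
    Y = hd s y
    a≠x = ==-sym-false x a x≠a
    a≠y = ==-sym-false y a y≠a
    y≠x = ==-sym-false x y x≠y
    arith : ∀ X → X * 4 + 1 + (X * 3 + 1) ≡ X * 7 + 2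
    arith = solve-∀
    S : ℕ → St
    S m = s [ y ≔ Y + (X ∸ m) ] [ a ≔ X ∸ m ] [ x ≔ m ]
    eA : hd (S 0) a ≡ X
    eA = trans (get-other (s [ y ≔ Y + X ] [ a ≔ X ]) 0 a≠x) (get-same (s [ y ≔ Y + X ]) a)
    start : S X ≈ s
    start = ≈-trans (upd-id _ x (sym (trans (get-other (s [ y ≔ Y + (X ∸ X) ]) _ x≠a) (get-other s _ x≠y))))
           (≈-trans (upd-id _ a (trans (n∸n≡0 X) (sym (trans (get-other s _ a≠y) a0))))
                    (upd-id s y (trans (cong (Y +_) (n∸n≡0 X)) (+-identityʳ Y))))
    body : ∀ m → m < X → Det (inc a ⨾ inc y) (S (suc m) [ x ≔ m ]) (S m) 2
    body m lt = det-≈ fix (det-seq det-inc det-inc)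
      where
      s₁ = S (suc m) [ x ≔ m ]
      s₂ = s₁ [ a ≔ suc (hd s₁ a) ]
      va : suc (hd s₁ a) ≡ X ∸ m
      va rewrite get-other (S (suc m)) {x} {a} m a≠x
               | get-other (s [ y ≔ Y + (X ∸ suc m) ] [ a ≔ X ∸ suc m ]) {x} {a} (suc m) a≠x
               | get-same (s [ y ≔ Y + (X ∸ suc m) ]) a {X ∸ suc m} = ∸-step lt
      vy : suc (hd s₂ y) ≡ Y + (X ∸ m)
      vy rewrite get-other s₁ {a} {y} (suc (hd s₁ a)) y≠a | get-other (S (suc m)) {x} {y} m y≠x
               | get-other (s [ y ≔ Y + (X ∸ suc m) ] [ a ≔ X ∸ suc m ]) {x} {y} (suc m) y≠x
               | get-other (s [ y ≔ Y + (X ∸ suc m) ]) {a} {y} (X ∸ suc m) y≠a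
               | get-same s y {Y + (X ∸ suc m)} = trans (sym (+-suc Y _)) (cong (Y +_) (∸-step lt))
      fix : (s₂ [ y ≔ suc (hd s₂ y) ]) ≈ S m
      fix = ≈-trans (upd-cong y (≈-trans (upd-cong a (upd-upd _ x _ m) refl) (upd-tail a≠x)) refl)
           (≈-trans (upd-comm _ _ _ x≠y) (upd-cong x (≈-trans (upd-tail y≠a)
              (≈-trans (upd-cong a (upd-cong y ≈-refl vy) va) ≈-refl)) refl))
    finish : (S 0 [ x ≔ hd (S 0) x + hd (S 0) a ] [ a ≔ 0 ]) ≈ (s [ y ≔ Y + X ])
    finish = ≈-trans (upd-cong a (upd-upd _ x 0 _) refl)
         (≈-trans (upd-tail a≠x)
         (≈-trans (upd-id _ x hx) (upd-id _ a (sym (trans (get-other s _ a≠y) a0)))))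
      where hx : hd (S 0) x + hd (S 0) a ≡ hd (s [ y ≔ Y + X ] [ a ≔ 0 ]) x
            hx = trans (cong₂ _+_ (get-same (s [ y ≔ Y + X ] [ a ≔ X ]) x) eA) (sym (trans (get-other (s [ y ≔ Y + X ]) 0 x≠a) (get-other s _ x≠y)))

  det-mulBy : ∀ {n i t a s} → (n == i) ≡ false → (n == t) ≡ false → (n == a) ≡ false → (i == t) ≡ false →
              (i == a) ≡ false → (t == a) ≡ false → hd s t ≡ 0 → hd s a ≡ 0 →
              Det (mulBy n i t a) s (s [ i ≔ hd s i * hd s n ]) (mulCost (hd s i) (hd s n))
  det-mulBy {n} {i} {t} {a} {s} n≠i n≠t n≠a i≠t i≠a t≠a t0 a0 =
    det-≤ (≤-reflexive (cong (λ v → I * (2 + (n₀ * 7 + 2)) + 1 + (v * 3 + 1)) eT))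
      (det-seq (det-≈ˡ start (det-for S (n₀ * 7 + 2) I (λ m → get-same (s [ t ≔ (I ∸ m) * n₀ ]) i) body))
               (det-≈ finish (det-move t≠i)))
    where
    I = hd s i
    n₀ = hd s n
    t≠i = ==-sym-false i t i≠t
    S : ℕ → St
    S m = s [ t ≔ (I ∸ m) * n₀ ] [ i ≔ m ]
    eT : hd (S 0) t ≡ I * n₀
    eT = trans (get-other (s [ t ≔ I * n₀ ]) 0 t≠i) (get-same s t)
    start : S I ≈ s
    start = ≈-trans (upd-id _ i (sym (get-other s _ i≠t)))
                    (upd-id s t (trans (cong (_* n₀) (n∸n≡0 I)) (sym t0)))
    body : ∀ m → m < I → Det (addTo n t a) (S (suc m) [ i ≔ m ]) (S m) (n₀ * 7 + 2)
    body m lt = det-≈ fix (det-≤ (≤-reflexive (cong (λ v → v * 7 + 2) vn)) (det-addTo n≠t n≠a t≠a va))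
      where
      s₀ = s [ t ≔ (I ∸ suc m) * n₀ ]
      s₁ = S (suc m) [ i ≔ m ]
      a≠i = ==-sym-false i a i≠a
      a≠t = ==-sym-false t a t≠a
      vn : hd s₁ n ≡ n₀
      vn = trans (get-other (S (suc m)) m n≠i) (trans (get-other s₀ _ n≠i) (get-other s _ n≠t))
      va : hd s₁ a ≡ 0
      va = trans (get-other (S (suc m)) m a≠i) (trans (get-other s₀ _ a≠i) (trans (get-other s _ a≠t) a0))
      vt : hd s₁ t + hd s₁ n ≡ (I ∸ m) * n₀
      vt = trans (cong₂ _+_ (trans (get-other (S (suc m)) m t≠i) (trans (get-other s₀ _ t≠i) (get-same s t))) vn)
          (trans (+-comm _ n₀) (cong (_* n₀) (∸-step lt)))
      fix : (s₁ [ t ≔ hd s₁ t + hd s₁ n ]) ≈ S m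
      fix = ≈-trans (upd-cong t (upd-upd _ i _ m) refl) (≈-trans (upd-tail t≠i)
              (upd-cong i (upd-cong t ≈-refl vt) refl))
    finish : (S 0 [ i ≔ hd (S 0) i + hd (S 0) t ] [ t ≔ 0 ]) ≈ (s [ i ≔ I * n₀ ])
    finish = ≈-trans (upd-cong t (upd-upd _ i 0 _) refl)
         (≈-trans (upd-tail t≠i)
         (≈-trans (upd-cong i (upd-id s t (sym t0)) (cong₂ _+_ (get-same (s [ t ≔ I * n₀ ]) i) eT)) ≈-refl))

  det-clear : ∀ {x s} → Det (clear x) s (s [ x ≔ 0 ]) (hd s x * 2 + 1)
  det-clear {x} {s} = lemma (hd s x) s refl
    where
    lemma : ∀ m s → hd s x ≡ m → Det (clear x) s (s [ x ≔ 0 ]) (m * 2 + 1)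
    lemma zero s e = det-≈ (≈-sym (upd-id s x (sym e))) (det-exit (nz-zero {s} e))
    lemma (suc m) s e = det-loop (nz-suc {s} e) (det-dec {s = s} e)
      (det-≈ (upd-upd s x m 0) (lemma m (s [ x ≔ m ]) (get-same s x)))

  -- The value of the linear tree of forks into which `pickLoop` unfolds: settle for the present
  -- value or go on to the next.
  vote : Bool → (ℕ → Bool) → ℕ → ℕ → Bool
  vote k bs v zero = bs v
  vote k bs v (suc m) = combineB k (bs v) (vote k bs (suc v) m)

  -- Six steps per pass cover both branches: the branch that settles still has to clear `t`, but
  -- clearing takes only two steps per unit.
  goes-pickLoop : ∀ {k x t P T} (bs : ℕ → Bool) → (x == t) ≡ false → ∀ m v s →
                  (∀ j → j ≤ m → Goes P (s [ x ≔ v + j ] [ t ≔ 0 ]) (bs (v + j)) T) →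
                  Goes (pickLoop k x t ⨾ P) (s [ x ≔ v ] [ t ≔ m ]) (vote k bs v m) (m * 6 + 1 + T)
  goes-pickLoop {k} {x} {t} {P} {T} bs x≠t zero v s g =
    goes-seq (det-exit (nz-zero {s [ x ≔ v ] [ t ≔ 0 ]} (get-same (s [ x ≔ v ]) t)))
      (subst (λ w → Goes P (s [ x ≔ w ] [ t ≔ 0 ]) (bs w) T) (+-identityʳ v) (g 0 z≤n))
  goes-pickLoop {k} {x} {t} {P} {T} bs x≠t (suc m) v s g C =
    test-true {s = s₀} {τ = nz} (ok (contˡ C) nothing) (nz-suc {s₀} (get-same (s [ x ≔ v ]) t))
      (E-≤ {emb body nothing} {s₀} (≤-reflexive (arith m T)) (ev-fork (ok body nothing)
        (E-≤ {emb body (just (inj₁ nothing))} {s₀} leftCost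
          (det-clear {t} {s₀} (contLeft body) (stopped C)))
        (E-≤ {emb body (just (inj₂ (inj₁ _)))} {s₀} rightCost
          (det-seq (det-inc {x} {s₀}) (det-≈ (≈-sym next≈) (det-dec {t} {s₀ [ x ≔ suc (hd s₀ x) ]} tval)) (contRight body)
            (goes-pickLoop bs x≠t m (suc v) s (λ j le → subst (λ w → Goes P (s [ x ≔ w ] [ t ≔ 0 ]) (bs w) T) (+-suc v j) (g (suc j) (s≤s le))) C)))))
    where
    s₀ = s [ x ≔ v ] [ t ≔ suc m ]
    t≠x = ==-sym-false x t x≠t
    body : Cont (choose k (clear t) (inc x ⨾ dec t))
    body = contBody {t} {nz} (contˡ C)
    arith : ∀ m T → suc (m * 6 + 5 + T) ≡ 5 + (m * 6 + 1 + T)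
    arith = solve-∀
    leftCost : hd s₀ t * 2 + 1 + (0 * 6 + 1 + T) ≤ m * 6 + 5 + T
    leftCost rewrite get-same (s [ x ≔ v ]) t {suc m} =
      ≤-trans (≤-reflexive (lemma m T)) (+-monoˡ-≤ T (+-mono-≤ {m * 2} {m * 6} (*-monoʳ-≤ m (s≤s (s≤s z≤n))) (n≤1+n 4)))
      where lemma : ∀ m T → suc m * 2 + 1 + (0 * 6 + 1 + T) ≡ m * 2 + 4 + T
            lemma = solve-∀
    rightCost : 1 + 1 + (m * 6 + 1 + T) ≤ m * 6 + 5 + T
    rightCost = ≤-trans (≤-reflexive (lemma m T)) (+-monoˡ-≤ T (+-monoʳ-≤ (m * 6) (≤-trans (n≤1+n 3) (n≤1+n 4))))
      where lemma : ∀ m T → 1 + 1 + (m * 6 + 1 + T) ≡ m * 6 + 3 + T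
            lemma = solve-∀
    tval : hd (s₀ [ x ≔ suc (hd s₀ x) ]) t ≡ suc m
    tval = trans (get-other s₀ _ t≠x) (get-same (s [ x ≔ v ]) t)
    xval : suc (hd s₀ x) ≡ suc v
    xval = cong suc (trans (get-other (s [ x ≔ v ]) _ x≠t) (get-same s x))
    next≈ : (s [ x ≔ suc v ] [ t ≔ m ]) ≈ (s₀ [ x ≔ suc (hd s₀ x) ] [ t ≔ m ])
    next≈ = ≈-sym (≈-trans (upd-cong t (upd-tail x≠t) refl) (≈-trans (upd-upd _ t _ m) (upd-cong t (upd-cong x ≈-refl xval) refl)))
    stopped : ∀ C → E (emb C (inj₁ nothing)) (s₀ [ t ≔ 0 ]) (bs v) (0 * 6 + 1 + T)
    stopped C = E-resp {emb C (inj₁ nothing)} (≈-sym (upd-upd (s [ x ≔ v ]) t (suc m) 0))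
      (goes-pickLoop {k} bs x≠t zero v s (λ { zero z≤n → g 0 z≤n }) C)

  Decides : Pr → St → ℕ → Set → Set
  Decides P s t Q = ∃ λ b → Goes P s b t × (b ≡ true ⇔ Q)

  Bounded : Bool → ℕ → (ℕ → Set) → Set
  Bounded true n Q = ∃ λ a → a < n × Q a
  Bounded false n Q = ∀ a → a < n → Q a

  open Equivalence using (to; from)

  both-combine : ∀ k {b c Q R} → b ≡ true ⇔ Q → c ≡ true ⇔ R → combineB k b c ≡ true ⇔ Both k Q R
  both-combine true {true} p q = mk⇔ (λ _ → inj₁ (to p refl)) (λ _ → refl)
  both-combine true {false} p q = mk⇔ (λ e → inj₂ (to q e)) (λ { (inj₁ x) → contradiction (from p x) (λ ()) ; (inj₂ y) → from q y })
  both-combine false {true} p q = mk⇔ (λ e → to p refl , to q e) (λ { (x , y) → from q y })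
  both-combine false {false} p q = mk⇔ (λ ()) (λ { (x , y) → from p x })

  vote-⇔ : ∀ k bs {Q : ℕ → Set} → (∀ j → bs j ≡ true ⇔ Q j) → ∀ m v → vote k bs v m ≡ true ⇔ Bounded k (suc m) (λ j → Q (v + j))
  vote-⇔ k bs {Q} h zero v = mk⇔ (fwd′ k) (bwd′ k)
    where
    fwd′ : ∀ k → bs v ≡ true → Bounded k 1 (λ j → Q (v + j))
    fwd′ true e = 0 , s≤s z≤n , subst Q (sym (+-identityʳ v)) (to (h v) e)
    fwd′ false e .zero (s≤s z≤n) = subst Q (sym (+-identityʳ v)) (to (h v) e)
    bwd′ : ∀ k → Bounded k 1 (λ j → Q (v + j)) → bs v ≡ true
    bwd′ true (.zero , s≤s z≤n , q) = from (h v) (subst Q (+-identityʳ v) q)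
    bwd′ false q = from (h v) (subst Q (+-identityʳ v) (q 0 (s≤s z≤n)))
  vote-⇔ k bs {Q} h (suc m) v = mk⇔ (λ e → fwd′ k (to both e)) (λ q → from both (bwd′ k q))
    where
    both = both-combine k (h v) (vote-⇔ k bs h m (suc v))
    fwd′ : ∀ k → Both k (Q v) (Bounded k (suc m) (λ j → Q (suc v + j))) → Bounded k (suc (suc m)) (λ j → Q (v + j))
    fwd′ true (inj₁ q) = 0 , s≤s z≤n , subst Q (sym (+-identityʳ v)) q
    fwd′ true (inj₂ (j , lt , q)) = suc j , s≤s lt , subst Q (sym (+-suc v j)) q
    fwd′ false (p , q) zero lt = subst Q (sym (+-identityʳ v)) p
    fwd′ false (p , q) (suc j) (s≤s lt) = subst Q (sym (+-suc v j)) (q j lt)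
    bwd′ : ∀ k → Bounded k (suc (suc m)) (λ j → Q (v + j)) → Both k (Q v) (Bounded k (suc m) (λ j → Q (suc v + j)))
    bwd′ true (zero , lt , q) = inj₁ (subst Q (+-identityʳ v) q)
    bwd′ true (suc j , s≤s lt , q) = inj₂ (j , lt , subst Q (+-suc v j) q)
    bwd′ false q = subst Q (+-identityʳ v) (q 0 (s≤s z≤n)) , λ j lt → subst Q (+-suc v j) (q (suc j) (s≤s lt))

  pickCost : ℕ → ℕ
  pickCost n = n * 2 + 1 + (1 + (n * 7 + 2 + (1 + (n * 6 + 1))))

  decides-⇔ : ∀ {P s t Q R} → Q ⇔ R → Decides P s t Q → Decides P s t R
  decides-⇔ e (b , g , h) = b , g , mk⇔ (λ x → to e (to h x)) (λ x → from h (from e x))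

  decides-≤ : ∀ {P s t t′ Q} → t ≤ t′ → Decides P s t Q → Decides P s t′ Q
  decides-≤ {P} {s} le (b , g , h) = b , goes-≤ {P} {s} le g , h

  decides-≈ : ∀ {P s s′ t Q} → s ≈ s′ → Decides P s t Q → Decides P s′ t Q
  decides-≈ {P} p (b , g , h) = b , goes-≈ {P} p g , h

  decides-seq : ∀ {P P′ s s₁ c t Q} → Det P s s₁ c → Decides P′ s₁ t Q → Decides (P ⨾ P′) s (c + t) Q
  decides-seq d (b , g , h) = b , goes-seq d g , h

  decides-verdict : ∀ {s b t Q} → b ≡ true ⇔ Q → Decides (verdict b) s t Q
  decides-verdict h = _ , goes-verdict , h

  decides-choose : ∀ {k P P′ s t Q R} → Decides P s t Q → Decides P′ s t R → Decides (choose k P P′) s (suc t) (Both k Q R)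
  decides-choose {k} (b , g , h) (c , g′ , h′) = combineB k b c , goes-choose g g′ , both-combine k h h′

  decides-zero : ∀ {x P P′ s t Q} → hd s x ≡ 0 → Decides P s t Q → Decides (ifZero x P P′) s (suc t) Q
  decides-zero {s = s} e (b , g , h) = b , goes-then (cong (_≡ᵇ 0) e) g , h

  decides-suc : ∀ {x P P′ s t Q m} → hd s x ≡ suc m → Decides P′ s t Q → Decides (ifZero x P P′) s (suc t) Q
  decides-suc {s = s} e (b , g , h) = b , goes-else (cong (_≡ᵇ 0) e) g , h

  decides-pick : ∀ {k n x t a P s T} {Q : ℕ → Set} → (x == t) ≡ false → (n == t) ≡ false → (n == a) ≡ false →
    (t == a) ≡ false → (x == a) ≡ false → (n == x) ≡ false →
    hd s t ≡ 0 → hd s a ≡ 0 → ∀ m → hd s n ≡ suc m → hd s x ≤ suc m →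
    (∀ j → j < suc m → Decides P (s [ x ≔ suc j ]) T (Q j)) →
    Decides (pickValue k n x t a ⨾ P) s (pickCost (suc m) + T) (Bounded k (suc m) Q)
  decides-pick {k} {n} {x} {t} {a} {P} {s} {T} {Q} x≠t n≠t n≠a t≠a x≠a n≠x t0 a0 m en xle D =
    vote k bs 1 m , (λ C → E-≤ {emb C (inj₁ (inj₁ nothing))} {s} cost (run (C))) ,
    mk⇔ (λ e → conv k (to vt e)) (λ q → from vt (conv⁻ k q))
    where
    -- Indexed by the content of `x`, which is one more than the chosen element; the values at 0 and
    -- beyond `suc m` are fillers.
    bs : ℕ → Bool
    bs zero = false
    bs (suc j) with suc j ≤? suc m
    ... | yes lt = proj₁ (D j lt)
    ... | no _ = false
    Q′ : ℕ → Set
    Q′ zero = ⊥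
    Q′ (suc j) = Σ (suc j ≤ suc m) λ _ → Q j
    bs-⇔ : ∀ j → bs j ≡ true ⇔ Q′ j
    bs-⇔ zero = mk⇔ (λ ()) (λ ())
    bs-⇔ (suc j) with suc j ≤? suc m
    ... | yes lt = mk⇔ (λ e → lt , to (proj₂ (proj₂ (D j lt))) e) (λ { (_ , q) → from (proj₂ (proj₂ (D j lt))) q })
    ... | no ge = mk⇔ (λ ()) (λ { (lt , _) → contradiction lt ge })
    vt = vote-⇔ k bs bs-⇔ m 1
    conv : ∀ k → Bounded k (suc m) (λ j → Q′ (1 + j)) → Bounded k (suc m) Q
    conv true (j , lt , (_ , q)) = j , lt , q
    conv false q j lt = proj₂ (q j lt)
    conv⁻ : ∀ k → Bounded k (suc m) Q → Bounded k (suc m) (λ j → Q′ (1 + j))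
    conv⁻ true (j , lt , q) = j , lt , (lt , q)
    conv⁻ false q j lt = lt , q j lt
    t≠x = ==-sym-false x t x≠t
    a≠x = ==-sym-false x a x≠a
    s₁ = s [ x ≔ 0 ] [ x ≔ suc (hd (s [ x ≔ 0 ]) x) ]
    s₂ = s₁ [ t ≔ hd s₁ t + hd s₁ n ]
    n₁ : hd s₁ n ≡ suc m
    n₁ = trans (get-other (s [ x ≔ 0 ]) _ n≠x) (trans (get-other s _ n≠x) en)
    t₂ : hd s₂ t ≡ suc m
    t₂ = trans (get-same s₁ t) (cong₂ _+_ (trans (get-other (s [ x ≔ 0 ]) _ t≠x) (trans (get-other s _ t≠x) t0)) n₁)
    a₁ : hd s₁ a ≡ 0
    a₁ = trans (get-other (s [ x ≔ 0 ]) _ a≠x) (trans (get-other s _ a≠x) a0)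
    fix : (s₂ [ t ≔ m ]) ≈ (s [ x ≔ 1 ] [ t ≔ m ])
    fix = ≈-trans (upd-upd s₁ t _ m) (upd-cong t (≈-trans (upd-upd s x 0 _) (upd-cong x ≈-refl (cong suc (get-same s x)))) refl)
    good : ∀ j → j ≤ m → Goes P (s [ x ≔ 1 + j ] [ t ≔ 0 ]) (bs (1 + j)) T
    good j le with suc j ≤? suc m
    ... | yes lt = goes-≈ {P} (≈-sym (upd-id (s [ x ≔ suc j ]) t (sym (trans (get-other s _ t≠x) t0)))) (proj₁ (proj₂ (D j lt)))
    ... | no ge = contradiction (s≤s le) ge
    -- The loop sits at the end of `pickValue`, nested inside the left operand of the sequence with
    -- `P`. To be treated together with `P` it needs a placement for the reassociated program, which
    -- is glued from the two separate ones.
    goes-assoc : ∀ {P₁ P₂ P₃ P₄ P₅ P₆ s s₁ s₂ s₃ s₄ b c₁ c₂ c₃ c₄ c} →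
      Det P₁ s s₁ c₁ → Det P₂ s₁ s₂ c₂ → Det P₃ s₂ s₃ c₃ → Det P₄ s₃ s₄ c₄ →
      Goes (P₅ ⨾ P₆) s₄ b c → Goes ((P₁ ⨾ P₂ ⨾ P₃ ⨾ P₄ ⨾ P₅) ⨾ P₆) s b (c₁ + (c₂ + (c₃ + (c₄ + c))))
    goes-assoc d₁ d₂ d₃ d₄ g C =
      d₁ (contˡ (contˡ C)) (d₂ (contˡ (contʳ (contˡ C))) (d₃ (contˡ (contʳ (contʳ (contˡ C))))
        (d₄ (contˡ (contʳ (contʳ (contʳ (contˡ C)))))
          (g (cont (λ { (inj₁ y) → emb C (inj₁ (inj₂ (inj₂ (inj₂ (inj₂ y))))) ; (inj₂ y) → emb C (inj₂ y) }) (exit C)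
             (λ { (inj₁ y) → ok C (inj₁ (inj₂ (inj₂ (inj₂ (inj₂ y))))) ; (inj₂ y) → ok C (inj₂ y) }))))))
    run : Goes (pickValue k n x t a ⨾ P) s (vote k bs 1 m) (hd s x * 2 + 1 + (1 + (hd s₁ n * 7 + 2 + (1 + (m * 6 + 1 + T)))))
    run = goes-assoc (det-clear {x} {s}) (det-inc {x}) (det-addTo {n} {t} {a} {s₁} n≠t n≠a t≠a a₁)
            (det-≈ fix (det-dec {t} {s₂} t₂)) (goes-pickLoop {k} {x} {t} {P} bs x≠t m 1 s good)
    cost : hd s x * 2 + 1 + (1 + (hd s₁ n * 7 + 2 + (1 + (m * 6 + 1 + T)))) ≤ pickCost (suc m) + T
    cost rewrite n₁ = ≤-trans (+-mono-≤ (+-monoˡ-≤ 1 (*-monoˡ-≤ 2 xle)) (s≤s (+-monoʳ-≤ (suc m * 7 + 2) (s≤s (+-monoˡ-≤ T (+-monoˡ-≤ 1 (*-monoˡ-≤ 6 (n≤1+n m))))))))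
      (≤-reflexive (lemma (suc m) T))
      where lemma : ∀ n T → n * 2 + 1 + (1 + (n * 7 + 2 + (1 + (n * 6 + 1 + T)))) ≡ n * 2 + 1 + (1 + (n * 7 + 2 + (1 + (n * 6 + 1)))) + T
            lemma = solve-∀

  decides-incs : ∀ {h s P t Q} c → Decides P (s [ h ≔ c + hd s h ]) t Q → Decides (incs c h P) s (c + t) Q
  decides-incs {h} {s} {P} zero r = decides-≈ {P} (upd-id s h refl) r
  decides-incs {h} {s} {P} (suc c) r = decides-seq (det-inc {h}) (decides-incs {h} {s [ h ≔ suc (hd s h) ]} c
    (decides-≈ {P} (≈-sym (≈-trans (upd-upd s h _ _)
      (upd-cong h ≈-refl (trans (cong (c +_) (get-same s h)) (+-suc c _))))) r))

  -- The loop is abandoned, inside its body, when the counter reaches r.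
  goes-for : ∀ {h P Q b t} (S : ℕ → St) c r k → (∀ m → hd (S m) h ≡ m) →
             (∀ m → suc r ≤ m → m < suc r + k → Det P (S (suc m) [ h ≔ m ]) (S m) c) →
             Goes P (S (suc r) [ h ≔ r ]) b t → Goes (for h P ⨾ Q) (S (suc r + k)) b (k * (2 + c) + (2 + t))
  goes-for {h} {P} {Q} {b} {t} S c r zero e body g C rewrite +-identityʳ r =
    test-true {s = S (suc r)} {τ = nz} (ok (contˡ C) nothing) (nz-suc {S (suc r)} (e (suc r)))
      (det-dec {h} {S (suc r)} (e (suc r)) (contˡ (contBody {h} {nz} (contˡ C))) (g (contʳ (contBody {h} {nz} (contˡ C)))))
  goes-for {h} {P} {Q} {b} {t} S c r (suc k) e body g C rewrite +-suc r k =
    test-true {s = S (suc (suc r + k))} {τ = nz} (ok (contˡ C) nothing) (nz-suc {S (suc (suc r + k))} (e _))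
      (E-≤ {emb C (inj₁ (just (inj₁ _)))} {S (suc (suc r + k))} (≤-reflexive (arith c (k * (2 + c)) (2 + t)))
        (det-seq (det-dec {h} {S (suc (suc r + k))} (e _)) (body (suc r + k) (m≤m+n (suc r) k) ≤-refl)
          (contBody {h} {nz} (contˡ C))
          (goes-for {h} {P} {Q} S c r k e (λ m p q → body m p (≤-trans q (n≤1+n _))) g C)))
    where arith : ∀ c a t → 1 + c + (a + t) ≡ suc (c + a + t)
          arith = solve-∀

  -- Transfers verdicts between structures with the same encoding, since both are values of one
  -- computation.
  ev-det : ∀ {a hs tp b c t u} → Ev δ a hs tp b t → Ev δ a hs tp c u → b ≡ c
  ev-det (ev-stop e) (ev-stop f) with trans (sym e) f
  ... | refl = refl
  ev-det (ev-stop e) (ev-op f _ _) with trans (sym e) f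
  ... | ()
  ev-det (ev-stop e) (ev-fork f _ _) with trans (sym e) f
  ... | ()
  ev-det (ev-op e _ _) (ev-stop f) with trans (sym e) f
  ... | ()
  ev-det (ev-op e p r) (ev-op f q r′) with trans (sym e) f
  ... | refl with trans (sym p) q
  ...   | refl = ev-det r r′
  ev-det (ev-op e _ _) (ev-fork f _ _) with trans (sym e) f
  ... | ()
  ev-det (ev-fork e _ _) (ev-stop f) with trans (sym e) f
  ... | ()
  ev-det (ev-fork e _ _) (ev-op f _ _) with trans (sym e) f
  ... | ()
  ev-det (ev-fork {k = k} e p q) (ev-fork f p′ q′) with trans (sym e) f
  ... | refl = cong₂ (combineB k) (ev-det p p′) (ev-det q q′)

-- Tuples, tables and polynomials

nth-++ˡ : ∀ {A : Set} (xs ys : List A) j → j < length xs → nth (xs ++ ys) j ≡ nth xs j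
nth-++ˡ (x ∷ xs) ys zero lt = refl
nth-++ˡ (x ∷ xs) ys (suc j) (s≤s lt) = nth-++ˡ xs ys j lt

nth-++ʳ : ∀ {A : Set} (xs ys : List A) j → nth (xs ++ ys) (length xs + j) ≡ nth ys j
nth-++ʳ [] ys j = refl
nth-++ʳ (x ∷ xs) ys j = nth-++ʳ xs ys j

nth-map : ∀ {A B : Set} (f : A → B) xs j {x} → nth xs j ≡ just x → nth (map f xs) j ≡ just (f x)
nth-map f (x ∷ xs) zero refl = refl
nth-map f (x ∷ xs) (suc j) e = nth-map f xs j e

nth-beyond : ∀ {A : Set} (xs : List A) j → length xs ≤ j → nth xs j ≡ nothing
nth-beyond [] j le = refl
nth-beyond (x ∷ xs) (suc j) (s≤s le) = nth-beyond xs j le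

nth-within : ∀ {A : Set} (xs : List A) j → j < length xs → ∃ λ x → nth xs j ≡ just x
nth-within (x ∷ xs) zero lt = x , refl
nth-within (x ∷ xs) (suc j) (s≤s lt) = nth-within xs j lt

nth-ext : ∀ {A : Set} (xs ys : List A) → (∀ j → nth xs j ≡ nth ys j) → xs ≡ ys
nth-ext [] [] e = refl
nth-ext [] (y ∷ ys) e with e 0
... | ()
nth-ext (x ∷ xs) [] e with e 0
... | ()
nth-ext (x ∷ xs) (y ∷ ys) e = cong₂ _∷_ (just-injective (e 0)) (nth-ext xs ys (λ j → e (suc j)))

offset : ∀ {n} → (Fin n → ℕ) → Fin n → ℕ
offset L fz = 0
offset L (fs i) = L fz + offset (λ j → L (fs j)) i

total : ∀ {n} → (Fin n → ℕ) → ℕ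
total {zero} L = 0
total {suc n} L = L fz + total (λ j → L (fs j))

offset-const : ∀ {n} L (i : Fin n) → offset (λ _ → L) i ≡ toℕ i * L
offset-const L fz = refl
offset-const L (fs i) = cong (L +_) (offset-const L i)

total-const : ∀ n L → total {n} (λ _ → L) ≡ n * L
total-const zero L = refl
total-const (suc n) L = cong (L +_) (total-const n L)

offset-cong : ∀ {n} {L L′ : Fin n → ℕ} → (∀ i → L i ≡ L′ i) → ∀ i → offset L i ≡ offset L′ i
offset-cong e fz = refl
offset-cong e (fs i) = cong₂ _+_ (e fz) (offset-cong (λ j → e (fs j)) i)

total-cong : ∀ {n} {L L′ : Fin n → ℕ} → (∀ i → L i ≡ L′ i) → total L ≡ total L′
total-cong {zero} e = refl
total-cong {suc n} e = cong₂ _+_ (e fz) (total-cong (λ j → e (fs j)))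

offset<total : ∀ {n} (L : Fin n → ℕ) i j → j < L i → offset L i + j < total L
offset<total L fz j lt = ≤-trans lt (m≤m+n _ _)
offset<total L (fs i) j lt = ≤-trans (≤-reflexive (trans (cong suc (+-assoc (L fz) _ j)) (sym (+-suc (L fz) _))))
  (+-monoʳ-≤ (L fz) (offset<total (λ j → L (fs j)) i j lt))

nth-concatMap : ∀ {A B : Set} {n} (g : A → List B) (h : Fin n → A) i j → j < length (g (h i)) →
                nth (concatMap g (tabulate h)) (offset (λ i → length (g (h i))) i + j) ≡ nth (g (h i)) j
nth-concatMap g h fz j lt = nth-++ˡ (g (h fz)) _ j lt
nth-concatMap g h (fs i) j lt =
  trans (cong (nth (concatMap g (tabulate h))) (+-assoc (length (g (h fz))) _ j))
    (trans (nth-++ʳ (g (h fz)) _ _) (nth-concatMap g (λ x → h (fs x)) i j lt))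

length-concatMap : ∀ {A B : Set} {n} (g : A → List B) (h : Fin n → A) →
                   length (concatMap g (tabulate h)) ≡ total (λ i → length (g (h i)))
length-concatMap {n = zero} g h = refl
length-concatMap {n = suc n} g h = trans (LP.length-++ (g (h fz))) (cong (length (g (h fz)) +_) (length-concatMap g (λ x → h (fs x))))

-- The tuple as a numeral in base `n` with the first component most significant. This is its
-- position in `allVecs`, hence that of its bit in a table of the encoding.
idxF : ∀ {n k} → Vec (Fin n) k → Fin (n ^ k)
idxF [] = fz
idxF (a ∷ v) = combine a (idxF v)

unidx : ∀ {n} k → Fin (n ^ k) → Vec (Fin n) k
unidx zero i = []
unidx {n} (suc k) i with remQuot {n} (n ^ k) i
... | a , j = a ∷ unidx k j

idx : ∀ {n k} → Vec (Fin n) k → ℕ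
idx v = toℕ (idxF v)

idx< : ∀ {n k} (v : Vec (Fin n) k) → idx v < n ^ k
idx< v = FP.toℕ<n (idxF v)

idxF-unidx : ∀ {n} k (i : Fin (n ^ k)) → idxF (unidx k i) ≡ i
idxF-unidx zero fz = refl
idxF-unidx {n} (suc k) i = trans (cong (combine (proj₁ (remQuot {n} (n ^ k) i))) (idxF-unidx k (proj₂ (remQuot {n} (n ^ k) i)))) (FP.combine-remQuot {n} (n ^ k) i)

idx-∷ : ∀ {n k} (a : Fin n) (v : Vec (Fin n) k) → idx (a ∷ v) ≡ toℕ a * n ^ k + idx v
idx-∷ {n} {k} a v = trans (FP.toℕ-combine a (idxF v)) (cong (_+ idx v) (*-comm (n ^ k) (toℕ a)))

idxF-injective : ∀ {n k} (v w : Vec (Fin n) k) → idxF v ≡ idxF w → v ≡ w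
idxF-injective [] [] e = refl
idxF-injective (a ∷ v) (b ∷ w) e with FP.combine-injective a (idxF v) b (idxF w) e
... | p , q = cong₂ _∷_ p (idxF-injective v w q)

idx-injective : ∀ {n k} (v w : Vec (Fin n) k) → idx v ≡ idx w → v ≡ w
idx-injective v w e = idxF-injective v w (FP.toℕ-injective e)

length-allVecs : ∀ n k → length (allVecs n k) ≡ n ^ k
length-allVecs n zero = refl
length-allVecs n (suc k) = trans (length-concatMap (λ a → map (a ∷_) (allVecs n k)) id)
  (trans (total-cong (λ a → trans (LP.length-map (a ∷_) (allVecs n k)) (length-allVecs n k))) (total-const n (n ^ k)))

nth-allVecs : ∀ n k (v : Vec (Fin n) k) → nth (allVecs n k) (idx v) ≡ just v
nth-allVecs n zero [] = refl
nth-allVecs n (suc k) (a ∷ v) = trans (cong (nth (allVecs n (suc k))) pos≡)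
    (trans (nth-concatMap (λ a → map (a ∷_) (allVecs n k)) id a (idx v) (subst (idx v <_) (sym (len a)) (idx< v)))
           (nth-map (a ∷_) (allVecs n k) (idx v) (nth-allVecs n k v)))
  where
  len : ∀ b → length (map (b ∷_) (allVecs n k)) ≡ n ^ k
  len b = trans (LP.length-map (b ∷_) (allVecs n k)) (length-allVecs n k)
  pos≡ : idx (a ∷ v) ≡ offset (λ b → length (map (b ∷_) (allVecs n k))) a + idx v
  pos≡ = trans (idx-∷ a v) (cong (_+ idx v) (sym (trans (offset-cong len a) (offset-const (n ^ k) a))))

∈-nth : ∀ {A : Set} (xs : List A) j {x} → nth xs j ≡ just x → x ∈ xs
∈-nth (x ∷ xs) zero refl = here refl
∈-nth (x ∷ xs) (suc j) e = there (∈-nth xs j e)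

∈-allVecs : ∀ {n k} (v : Vec (Fin n) k) → v ∈ allVecs n k
∈-allVecs {n} {k} v = ∈-nth (allVecs n k) (idx v) (nth-allVecs n k v)

-- A list of n ^ k entries is the table of a function on tuples.
tabulate-allVecs : ∀ {B : Set} n k (f : Vec (Fin n) k → B) (xs : List B) → length xs ≡ n ^ k →
                   (∀ v → nth xs (idx v) ≡ just (f v)) → map f (allVecs n k) ≡ xs
tabulate-allVecs n k f xs len e = nth-ext _ _ same-at
  where
  same-at : ∀ j → nth (map f (allVecs n k)) j ≡ nth xs j
  same-at j with j <? n ^ k
  ... | yes lt = subst (λ j → nth (map f (allVecs n k)) j ≡ nth xs j) at-j
        (trans (nth-map f (allVecs n k) (idx v) (nth-allVecs n k v)) (sym (e v)))
    where v = unidx k (fromℕ< lt)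
          at-j : idx v ≡ j
          at-j = trans (cong toℕ (idxF-unidx k (fromℕ< lt))) (FP.toℕ-fromℕ< lt)
  ... | no ge = trans (nth-beyond (map f (allVecs n k)) j (≤-trans (≤-reflexive (trans (LP.length-map f (allVecs n k)) (length-allVecs n k))) (≮⇒≥ ge)))
                      (sym (nth-beyond xs j (≤-trans (≤-reflexive len) (≮⇒≥ ge))))

-- Closed under sums and products by construction, so that a cost can be transcribed term by term;
-- `toPol` returns to coefficient lists.
data PE : Set where
  var     : PE
  con     : ℕ → PE
  _⊕_ _⊗_ : PE → PE → PE

infixl 6 _⊕_
infixl 7 _⊗_

⟪_⟫ : PE → ℕ → ℕ
⟪ var ⟫ n = n
⟪ con c ⟫ n = c
⟪ e ⊕ f ⟫ n = ⟪ e ⟫ n + ⟪ f ⟫ n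
⟪ e ⊗ f ⟫ n = ⟪ e ⟫ n * ⟪ f ⟫ n

_^ᴾ_ : PE → ℕ → PE
e ^ᴾ zero = con 1
e ^ᴾ suc k = e ⊗ e ^ᴾ k

⟪⟫-^ : ∀ e k n → ⟪ e ^ᴾ k ⟫ n ≡ ⟪ e ⟫ n ^ k
⟪⟫-^ e zero n = refl
⟪⟫-^ e (suc k) n = cong (⟪ e ⟫ n *_) (⟪⟫-^ e k n)

fromPol : Pol → PE
fromPol [] = con 0
fromPol (c ∷ cs) = con c ⊕ var ⊗ fromPol cs

⟪⟫-fromPol : ∀ p n → ⟪ fromPol p ⟫ n ≡ evalPol p n
⟪⟫-fromPol [] n = refl
⟪⟫-fromPol (c ∷ cs) n = cong (λ v → c + n * v) (⟪⟫-fromPol cs n)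

-- Costs are computed from the domain size, whereas space has to be bounded in the length of the
-- word, which is larger.
⟪⟫-mono : ∀ e {m n} → m ≤ n → ⟪ e ⟫ m ≤ ⟪ e ⟫ n
⟪⟫-mono var le = le
⟪⟫-mono (con c) le = ≤-refl
⟪⟫-mono (e ⊕ f) le = +-mono-≤ (⟪⟫-mono e le) (⟪⟫-mono f le)
⟪⟫-mono (e ⊗ f) le = *-mono-≤ (⟪⟫-mono e le) (⟪⟫-mono f le)

addPol : Pol → Pol → Pol
addPol [] q = q
addPol p [] = p
addPol (c ∷ p) (d ∷ q) = (c + d) ∷ addPol p q

evalPol-add : ∀ p q n → evalPol (addPol p q) n ≡ evalPol p n + evalPol q n
evalPol-add [] q n = refl
evalPol-add (c ∷ p) [] n = sym (+-identityʳ _)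
evalPol-add (c ∷ p) (d ∷ q) n = trans (cong (λ v → c + d + n * v) (evalPol-add p q n)) (arith c d n (evalPol p n) (evalPol q n))
  where arith : ∀ c d n P Q → c + d + n * (P + Q) ≡ c + n * P + (d + n * Q)
        arith = solve-∀

scalePol : ℕ → Pol → Pol
scalePol c = map (c *_)

evalPol-scale : ∀ c p n → evalPol (scalePol c p) n ≡ c * evalPol p n
evalPol-scale c [] n = sym (*-zeroʳ c)
evalPol-scale c (d ∷ p) n = trans (cong (λ v → c * d + n * v) (evalPol-scale c p n)) (arith c d n (evalPol p n))
  where arith : ∀ c d n P → c * d + n * (c * P) ≡ c * (d + n * P)
        arith = solve-∀

mulPol : Pol → Pol → Pol
mulPol [] q = []
mulPol (c ∷ p) q = addPol (scalePol c q) (0 ∷ mulPol p q)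

evalPol-mul : ∀ p q n → evalPol (mulPol p q) n ≡ evalPol p n * evalPol q n
evalPol-mul [] q n = refl
evalPol-mul (c ∷ p) q n = trans (evalPol-add (scalePol c q) (0 ∷ mulPol p q) n)
    (trans (cong₂ (λ u v → u + n * v) (evalPol-scale c q n) (evalPol-mul p q n)) (arith c n (evalPol p n) (evalPol q n)))
  where arith : ∀ c n P Q → c * Q + n * (P * Q) ≡ (c + n * P) * Q
        arith = solve-∀

toPol : PE → Pol
toPol var = 0 ∷ 1 ∷ []
toPol (con c) = c ∷ []
toPol (e ⊕ f) = addPol (toPol e) (toPol f)
toPol (e ⊗ f) = mulPol (toPol e) (toPol f)

evalPol-toPol : ∀ e n → evalPol (toPol e) n ≡ ⟪ e ⟫ n
evalPol-toPol var n = arith n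
  where arith : ∀ n → n * (1 + n * 0) ≡ n
        arith = solve-∀
evalPol-toPol (con c) n = trans (cong (c +_) (*-zeroʳ n)) (+-identityʳ c)
evalPol-toPol (e ⊕ f) n = trans (evalPol-add (toPol e) (toPol f) n) (cong₂ _+_ (evalPol-toPol e n) (evalPol-toPol f n))
evalPol-toPol (e ⊗ f) n = trans (evalPol-mul (toPol e) (toPol f) n) (cong₂ _*_ (evalPol-toPol e n) (evalPol-toPol f n))

toList-inj : ∀ {A : Set} {k} (u v : Vec A k) → toList u ≡ toList v → u ≡ v
toList-inj [] [] _ = refl
toList-inj (x ∷ u) (y ∷ v) e = cong₂ _∷_ (LP.∷-injectiveˡ e) (toList-inj u v (LP.∷-injectiveʳ e))

-- Clocks bound the length of a play

subAt-++ : ∀ {τ} (φ : Formula τ) p i {ψ} → subAt φ p ≡ just ψ → subAt φ (p ++ i ∷ []) ≡ childAt ψ i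
subAt-++ φ [] i refl with childAt φ i
... | nothing = refl
... | just ψ = refl
subAt-++ φ (j ∷ p) i e with childAt φ j
... | just χ = subAt-++ χ p i e

-- The accumulator only ever holds nodes labelled `C`, so a jump can land nowhere but on a label,
-- where a clock is charged.
findLabel-sound : ∀ {τ} (φ₀ φ : Formula τ) C pre p acc {q} → subAt φ₀ pre ≡ just φ →
  (∀ q → acc ≡ just q → ∃ λ t → ∃ λ ψ → subAt φ₀ q ≡ just (lab C t ψ)) →
  findLabel φ C pre p acc ≡ just q → ∃ λ t → ∃ λ ψ → subAt φ₀ q ≡ just (lab C t ψ)
findLabel-sound φ₀ φ C pre [] acc s h e = h _ e
findLabel-sound {τ} φ₀ φ C pre (i ∷ p) acc s h e with childAt φ i in ce
... | just ψ = findLabel-sound φ₀ ψ C (pre ++ i ∷ []) p (labelHere φ C pre acc) (trans (subAt-++ φ₀ pre i s) ce) (here-ok φ s) e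
  where
  here-ok : ∀ φ → subAt φ₀ pre ≡ just φ → ∀ q → labelHere φ C pre acc ≡ just q → ∃ λ t → ∃ λ ψ → subAt φ₀ q ≡ just (lab C t ψ)
  here-ok (lab C′ t ψ) s q e with C′ ≡ᵇ C in ec
  here-ok (lab C′ t ψ) s q refl | true = t , ψ , trans s (cong (λ D → just (lab D t ψ)) (≡ᵇ-sound C′ C ec))
  ... | false = h q e
  here-ok (atom R xs) s q e = h q e
  here-ok (eq x y) s q e = h q e
  here-ok tt s q e = h q e
  here-ok ff s q e = h q e
  here-ok (neg φ) s q e = h q e
  here-ok (and φ ψ) s q e = h q e
  here-ok (or φ ψ) s q e = h q e
  here-ok (ex x φ) s q e = h q e
  here-ok (all x φ) s q e = h q e
  here-ok (ins R xs φ) s q e = h q e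
  here-ok (del R xs φ) s q e = h q e
  here-ok (loop D) s q e = h q e

paths below : ∀ {τ} → Formula τ → List (List ℕ)
paths φ = [] ∷ below φ
below (neg φ) = map (0 ∷_) (paths φ)
below (and φ ψ) = map (0 ∷_) (paths φ) ++ map (1 ∷_) (paths ψ)
below (or φ ψ) = map (0 ∷_) (paths φ) ++ map (1 ∷_) (paths ψ)
below (ex x φ) = map (0 ∷_) (paths φ)
below (all x φ) = map (0 ∷_) (paths φ)
below (ins R xs φ) = map (0 ∷_) (paths φ)
below (del R xs φ) = map (0 ∷_) (paths φ)
below (lab C t φ) = map (0 ∷_) (paths φ)
below _ = []

subAt-∈-paths : ∀ {τ} (φ : Formula τ) p {ψ} → subAt φ p ≡ just ψ → p ∈ paths φ
subAt-∈-paths φ [] e = here refl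
subAt-∈-paths (neg φ) (zero ∷ p) e = there (∈-map⁺ (0 ∷_) (subAt-∈-paths φ p e))
subAt-∈-paths (and φ ψ) (zero ∷ p) e = there (∈-++⁺ˡ (∈-map⁺ (0 ∷_) (subAt-∈-paths φ p e)))
subAt-∈-paths (and φ ψ) (suc zero ∷ p) e = there (∈-++⁺ʳ (map (0 ∷_) (paths φ)) (∈-map⁺ (1 ∷_) (subAt-∈-paths ψ p e)))
subAt-∈-paths (or φ ψ) (zero ∷ p) e = there (∈-++⁺ˡ (∈-map⁺ (0 ∷_) (subAt-∈-paths φ p e)))
subAt-∈-paths (or φ ψ) (suc zero ∷ p) e = there (∈-++⁺ʳ (map (0 ∷_) (paths φ)) (∈-map⁺ (1 ∷_) (subAt-∈-paths ψ p e)))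
subAt-∈-paths (ex x φ) (zero ∷ p) e = there (∈-map⁺ (0 ∷_) (subAt-∈-paths φ p e))
subAt-∈-paths (all x φ) (zero ∷ p) e = there (∈-map⁺ (0 ∷_) (subAt-∈-paths φ p e))
subAt-∈-paths (ins R xs φ) (zero ∷ p) e = there (∈-map⁺ (0 ∷_) (subAt-∈-paths φ p e))
subAt-∈-paths (del R xs φ) (zero ∷ p) e = there (∈-map⁺ (0 ∷_) (subAt-∈-paths φ p e))
subAt-∈-paths (lab C t φ) (zero ∷ p) e = there (∈-map⁺ (0 ∷_) (subAt-∈-paths φ p e))

SymOK : ∀ τ → ℕ → RelSym τ → Set
SymOK τ V (inj₁ i) = lookupL τ i < V
SymOK τ V (inj₂ (a , k)) = a < V × k < V

-- One bound for variables, names of tape predicates and arities. It fixes how many heads and tracks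
-- are enough and, in the converse direction, which variables have to be assigned before a formula
-- can be evaluated.
Fits : ∀ {τ} → ℕ → Formula τ → Set
Fits {τ} V (atom R xs) = SymOK τ V R × All (_< V) (toList xs)
Fits V (eq x y) = x < V × y < V
Fits V tt = ⊤
Fits V ff = ⊤
Fits V (neg φ) = Fits V φ
Fits V (and φ ψ) = Fits V φ × Fits V ψ
Fits V (or φ ψ) = Fits V φ × Fits V ψ
Fits V (ex x φ) = x < V × Fits V φ
Fits V (all x φ) = x < V × Fits V φ
Fits {τ} V (ins R xs φ) = (SymOK τ V R × All (_< V) (toList xs)) × Fits V φ
Fits {τ} V (del R xs φ) = (SymOK τ V R × All (_< V) (toList xs)) × Fits V φ
Fits V (lab C t φ) = Fits V φ
Fits V (loop C) = ⊤

symOK-mono : ∀ {τ V W} R → V ≤ W → SymOK τ V R → SymOK τ W R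
symOK-mono (inj₁ i) le p = ≤-trans p le
symOK-mono (inj₂ _) le (p , q) = ≤-trans p le , ≤-trans q le

all<-mono : ∀ {V W xs} → V ≤ W → All (_< V) xs → All (_< W) xs
all<-mono le = All.map (λ p → ≤-trans p le)

fits-mono : ∀ {τ V W} (φ : Formula τ) → V ≤ W → Fits V φ → Fits W φ
fits-mono (atom R xs) le (p , q) = symOK-mono R le p , all<-mono le q
fits-mono (eq x y) le (p , q) = ≤-trans p le , ≤-trans q le
fits-mono tt le _ = _
fits-mono ff le _ = _
fits-mono (neg φ) le p = fits-mono φ le p
fits-mono (and φ ψ) le (p , q) = fits-mono φ le p , fits-mono ψ le q
fits-mono (or φ ψ) le (p , q) = fits-mono φ le p , fits-mono ψ le q
fits-mono (ex x φ) le (p , q) = ≤-trans p le , fits-mono φ le q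
fits-mono (all x φ) le (p , q) = ≤-trans p le , fits-mono φ le q
fits-mono (ins R xs φ) le ((p , q) , r) = (symOK-mono R le p , all<-mono le q) , fits-mono φ le r
fits-mono (del R xs φ) le ((p , q) , r) = (symOK-mono R le p , all<-mono le q) , fits-mono φ le r
fits-mono (lab C t φ) le p = fits-mono φ le p
fits-mono (loop C) le _ = _

bound-list : ∀ xs → ∃ λ V → All (_< V) xs
bound-list [] = 0 , []
bound-list (x ∷ xs) with bound-list xs
... | V , p = suc x ⊔ V , m≤m⊔n (suc x) V ∷ all<-mono (m≤n⊔m (suc x) V) p

bound-sym : ∀ τ R → ∃ λ V → SymOK τ V R
bound-sym τ (inj₁ i) = _ , ≤-refl
bound-sym τ (inj₂ (a , k)) = suc a ⊔ suc k , m≤m⊔n (suc a) (suc k) , m≤n⊔m (suc a) (suc k)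

bound-atom : ∀ τ R xs → ∃ λ V → SymOK τ V R × All (_< V) xs
bound-atom τ R xs with bound-sym τ R | bound-list xs
... | V , p | W , q = V ⊔ W , symOK-mono R (m≤m⊔n V W) p , all<-mono (m≤n⊔m V W) q

fits-exists : ∀ {τ} (φ : Formula τ) → ∃ λ V → Fits V φ
fits-exists {τ} (atom R xs) = bound-atom τ R (toList xs)
fits-exists (eq x y) = suc x ⊔ suc y , m≤m⊔n (suc x) (suc y) , m≤n⊔m (suc x) (suc y)
fits-exists tt = 0 , _
fits-exists ff = 0 , _
fits-exists (neg φ) = fits-exists φ
fits-exists (and φ ψ) with fits-exists φ | fits-exists ψ
... | V , p | W , q = V ⊔ W , fits-mono φ (m≤m⊔n V W) p , fits-mono ψ (m≤n⊔m V W) q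
fits-exists (or φ ψ) with fits-exists φ | fits-exists ψ
... | V , p | W , q = V ⊔ W , fits-mono φ (m≤m⊔n V W) p , fits-mono ψ (m≤n⊔m V W) q
fits-exists (ex x φ) with fits-exists φ
... | W , q = suc x ⊔ W , m≤m⊔n (suc x) W , fits-mono φ (m≤n⊔m (suc x) W) q
fits-exists (all x φ) with fits-exists φ
... | W , q = suc x ⊔ W , m≤m⊔n (suc x) W , fits-mono φ (m≤n⊔m (suc x) W) q
fits-exists {τ} (ins R xs φ) with bound-atom τ R (toList xs) | fits-exists φ
... | V , (p , p′) | W , q = V ⊔ W , (symOK-mono R (m≤m⊔n V W) p , all<-mono (m≤m⊔n V W) p′) , fits-mono φ (m≤n⊔m V W) q
fits-exists {τ} (del R xs φ) with bound-atom τ R (toList xs) | fits-exists φ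
... | V , (p , p′) | W , q = V ⊔ W , (symOK-mono R (m≤m⊔n V W) p , all<-mono (m≤m⊔n V W) p′) , fits-mono φ (m≤n⊔m V W) q
fits-exists (lab C t φ) = fits-exists φ
fits-exists (loop C) = 0 , _

fits-child : ∀ {τ V} (φ : Formula τ) i {ψ} → Fits V φ → childAt φ i ≡ just ψ → Fits V ψ
fits-child (neg φ) zero p refl = p
fits-child (and φ ψ) zero (p , q) refl = p
fits-child (and φ ψ) (suc zero) (p , q) refl = q
fits-child (or φ ψ) zero (p , q) refl = p
fits-child (or φ ψ) (suc zero) (p , q) refl = q
fits-child (ex x φ) zero (p , q) refl = q
fits-child (all x φ) zero (p , q) refl = q
fits-child (ins R xs φ) zero (p , q) refl = q
fits-child (del R xs φ) zero (p , q) refl = q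
fits-child (lab C t φ) zero p refl = p

fits-sub : ∀ {τ V} (φ : Formula τ) p {ψ} → Fits V φ → subAt φ p ≡ just ψ → Fits V ψ
fits-sub φ [] f refl = f
fits-sub φ (i ∷ p) f e with childAt φ i in ce
... | just χ = fits-sub χ p (fits-child φ i f ce) e

-- The number of moves before the next visit to a labelled node is below
-- `rank`: a looping atom is one move away from its label.
rank : ∀ {τ} → Formula τ → ℕ
rank (neg φ) = suc (rank φ)
rank (and φ ψ) = suc (rank φ + rank ψ)
rank (or φ ψ) = suc (rank φ + rank ψ)
rank (ex x φ) = suc (rank φ)
rank (all x φ) = suc (rank φ)
rank (ins R xs φ) = suc (rank φ)
rank (del R xs φ) = suc (rank φ)
rank (lab C t φ) = 1
rank (loop C) = 2
rank _ = 0

-- Unlike `rank` it does not restart at labels, so `weight φ₀` bounds the rank of every subformula.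
-- Leaves weigh 2 because that is the rank of a looping atom.
weight : ∀ {τ} → Formula τ → ℕ
weight (neg φ) = suc (weight φ)
weight (and φ ψ) = suc (weight φ + weight ψ)
weight (or φ ψ) = suc (weight φ + weight ψ)
weight (ex x φ) = suc (weight φ)
weight (all x φ) = suc (weight φ)
weight (ins R xs φ) = suc (weight φ)
weight (del R xs φ) = suc (weight φ)
weight (lab C t φ) = suc (weight φ)
weight _ = 2

rank≤weight : ∀ {τ} (φ : Formula τ) → rank φ ≤ weight φ
rank≤weight (atom R xs) = z≤n
rank≤weight (eq x y) = z≤n
rank≤weight tt = z≤n
rank≤weight ff = z≤n
rank≤weight (neg φ) = s≤s (rank≤weight φ)
rank≤weight (and φ ψ) = s≤s (+-mono-≤ (rank≤weight φ) (rank≤weight ψ))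
rank≤weight (or φ ψ) = s≤s (+-mono-≤ (rank≤weight φ) (rank≤weight ψ))
rank≤weight (ex x φ) = s≤s (rank≤weight φ)
rank≤weight (all x φ) = s≤s (rank≤weight φ)
rank≤weight (ins R xs φ) = s≤s (rank≤weight φ)
rank≤weight (del R xs φ) = s≤s (rank≤weight φ)
rank≤weight (lab C t φ) = s≤s z≤n
rank≤weight (loop C) = ≤-refl

weight-child : ∀ {τ} (φ : Formula τ) i {ψ} → childAt φ i ≡ just ψ → weight ψ ≤ weight φ
weight-child (neg φ) zero refl = n≤1+n _
weight-child (and φ ψ) zero refl = ≤-trans (m≤m+n _ _) (n≤1+n _)
weight-child (and φ ψ) (suc zero) refl = ≤-trans (m≤n+m _ (weight φ)) (n≤1+n _)
weight-child (or φ ψ) zero refl = ≤-trans (m≤m+n _ _) (n≤1+n _)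
weight-child (or φ ψ) (suc zero) refl = ≤-trans (m≤n+m _ (weight φ)) (n≤1+n _)
weight-child (ex x φ) zero refl = n≤1+n _
weight-child (all x φ) zero refl = n≤1+n _
weight-child (ins R xs φ) zero refl = n≤1+n _
weight-child (del R xs φ) zero refl = n≤1+n _
weight-child (lab C t φ) zero refl = n≤1+n _

weight-sub : ∀ {τ} (φ : Formula τ) p {ψ} → subAt φ p ≡ just ψ → weight ψ ≤ weight φ
weight-sub φ [] refl = ≤-refl
weight-sub φ (i ∷ p) e with childAt φ i in ce
... | just χ = ≤-trans (weight-sub χ p e) (weight-child φ i ce)

-- The moves of the game

module _ {τ : Voc} {φ₀ : Formula τ} {n : ℕ} where

  Wins : GState τ n → Set
  Wins = EloiseWins φ₀ n

  wins-terminal : ∀ {g m} → node φ₀ n g ≡ terminal m → Wins g → m ≡ just true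
  wins-terminal e (win e′) with trans (sym e) e′
  ... | refl = refl
  wins-terminal e (forced e′ _) with trans (sym e) e′
  ... | ()
  wins-terminal e (eChoose e′ _ _) with trans (sym e) e′
  ... | ()
  wins-terminal e (aChoose e′ _) with trans (sym e) e′
  ... | ()

  wins-det : ∀ {g g′} → node φ₀ n g ≡ det g′ → Wins g → Wins g′
  wins-det e (win e′) with trans (sym e) e′
  ... | ()
  wins-det e (forced e′ w) with trans (sym e) e′
  ... | refl = w
  wins-det e (eChoose e′ _ _) with trans (sym e) e′
  ... | ()
  wins-det e (aChoose e′ _) with trans (sym e) e′
  ... | ()

  wins-choose : ∀ {g gs} → node φ₀ n g ≡ choice true gs → Wins g → ∃ λ g′ → g′ ∈ gs × Wins g′
  wins-choose e (win e′) with trans (sym e) e′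
  ... | ()
  wins-choose e (forced e′ _) with trans (sym e) e′
  ... | ()
  wins-choose e (eChoose e′ m w) with trans (sym e) e′
  ... | refl = _ , m , w
  wins-choose e (aChoose e′ _) with trans (sym e) e′
  ... | ()

  wins-face : ∀ {g gs} → node φ₀ n g ≡ choice false gs → Wins g → ∀ g′ → g′ ∈ gs → Wins g′
  wins-face e (win e′) with trans (sym e) e′
  ... | ()
  wins-face e (forced e′ _) with trans (sym e) e′
  ... | ()
  wins-face e (eChoose e′ _ _) with trans (sym e) e′
  ... | ()
  wins-face e (aChoose e′ w) with trans (sym e) e′
  ... | refl = w

  module _ {g : GState τ n} where

    node-atom : ∀ {R xs} → subAt φ₀ (pos g) ≡ just (atom R xs) → node φ₀ n g ≡
      maybe (λ vs → terminal (just (boolEq (rels g R vs) (eloiseVer g)))) (terminal nothing) (mapMaybe′ (asg g) (toList xs))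
    node-atom e rewrite e = refl

    node-eq : ∀ {x y a b} → subAt φ₀ (pos g) ≡ just (eq x y) → asg g x ≡ just a → asg g y ≡ just b →
              node φ₀ n g ≡ terminal (just (boolEq (finEq a b) (eloiseVer g)))
    node-eq e p q rewrite e | p | q = refl

    node-eqˡ : ∀ {x y} → subAt φ₀ (pos g) ≡ just (eq x y) → asg g x ≡ nothing → node φ₀ n g ≡ terminal nothing
    node-eqˡ e p rewrite e | p = refl

    node-eqʳ : ∀ {x y} → subAt φ₀ (pos g) ≡ just (eq x y) → asg g y ≡ nothing → node φ₀ n g ≡ terminal nothing
    node-eqʳ {x} e p with asg g x in q
    ... | nothing rewrite e | q = refl
    ... | just a rewrite e | q | p = refl

    node-tt : subAt φ₀ (pos g) ≡ just tt → node φ₀ n g ≡ terminal (just (eloiseVer g))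
    node-tt e rewrite e = refl

    node-ff : subAt φ₀ (pos g) ≡ just ff → node φ₀ n g ≡ terminal (just (not (eloiseVer g)))
    node-ff e rewrite e = refl

    node-neg : ∀ {φ} → subAt φ₀ (pos g) ≡ just (neg φ) → node φ₀ n g ≡ det (record (down g 0) { eloiseVer = not (eloiseVer g) })
    node-neg e rewrite e = refl

    node-or : ∀ {φ ψ} → subAt φ₀ (pos g) ≡ just (or φ ψ) → node φ₀ n g ≡ choice (eloiseVer g) (down g 0 ∷ down g 1 ∷ [])
    node-or e rewrite e = refl

    node-and : ∀ {φ ψ} → subAt φ₀ (pos g) ≡ just (and φ ψ) → node φ₀ n g ≡ choice (not (eloiseVer g)) (down g 0 ∷ down g 1 ∷ [])
    node-and e rewrite e = refl

    afterVar : Var → Fin n → GState τ n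
    afterVar x a = record (down g 0) { asg = assign (asg g) x a }

    node-ex : ∀ {x φ} → subAt φ₀ (pos g) ≡ just (ex x φ) → node φ₀ n g ≡ choice (eloiseVer g) (map (afterVar x) (allFin n))
    node-ex e rewrite e = refl

    node-all : ∀ {x φ} → subAt φ₀ (pos g) ≡ just (all x φ) → node φ₀ n g ≡ choice (not (eloiseVer g)) (map (afterVar x) (allFin n))
    node-all e rewrite e = refl

    afterIns afterDel : (R : RelSym τ) → Vec Var (arity τ R) → Vec (Fin n) (arity τ R) → GState τ n
    afterIns R xs t = record (down g 0) { rels = addTuple {τ} (rels g) R (toList t) ; asg = assignAll (asg g) (toList xs) (toList t) }
    afterDel R xs t = record (down g 0) { rels = delTuple {τ} (rels g) R (toList t) ; asg = assignAll (asg g) (toList xs) (toList t) }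

    node-ins : ∀ {R xs φ} → subAt φ₀ (pos g) ≡ just (ins R xs φ) →
               node φ₀ n g ≡ choice (eloiseVer g) (map (afterIns R xs) (allVecs n (arity τ R)))
    node-ins e rewrite e = refl

    node-del : ∀ {R xs φ} → subAt φ₀ (pos g) ≡ just (del R xs φ) →
               node φ₀ n g ≡ choice (eloiseVer g) (map (afterDel R xs) (allVecs n (arity τ R)))
    node-del e rewrite e = refl

    afterLab : GState τ n
    afterLab = record (down g 0) { visits = λ p → if listEq _≡ᵇ_ p (pos g) then suc (visits g p) else visits g p }

    node-lab : ∀ {C t φ} → subAt φ₀ (pos g) ≡ just (lab C t φ) → (visits g (pos g) <ᵇ evalPol t n) ≡ true →
               node φ₀ n g ≡ det afterLab
    node-lab e p rewrite e | p = refl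

    node-stuck : ∀ {C t φ} → subAt φ₀ (pos g) ≡ just (lab C t φ) → (visits g (pos g) <ᵇ evalPol t n) ≡ false →
                 node φ₀ n g ≡ terminal nothing
    node-stuck e p rewrite e | p = refl

    node-loop : ∀ {C} → subAt φ₀ (pos g) ≡ just (loop C) → node φ₀ n g ≡
      maybe (λ q → det (record g { pos = q })) (terminal nothing) (findLabel φ₀ C [] (pos g) nothing)
    node-loop e rewrite e = refl

  open Equivalence using (to; from)

  terminal-⇔ : ∀ {g m} → node φ₀ n g ≡ terminal m → Wins g ⇔ (m ≡ just true)
  terminal-⇔ e = mk⇔ (wins-terminal e) (λ { refl → win e })

  det-⇔ : ∀ {g g′} → node φ₀ n g ≡ det g′ → Wins g′ ⇔ Wins g
  det-⇔ e = mk⇔ (forced e) (wins-det e)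

  choice-⇔ : ∀ {A : Set} {g} k (F : A → GState τ n) xs → (∀ x → x ∈ xs) → node φ₀ n g ≡ choice k (map F xs) →
             Quant k (λ x → Wins (F x)) ⇔ Wins g
  choice-⇔ true F xs m e = mk⇔ (λ { (x , w) → eChoose e (∈-map⁺ F (m x)) w }) ret′
    where ret′ : _ → _
          ret′ w with wins-choose e w
          ... | g′ , mem , w′ with ∈-map⁻ F mem
          ...   | x , _ , refl = x , w′
  choice-⇔ false F xs m e = mk⇔ (λ f → aChoose e (λ g′ mem → all′ f g′ mem)) (λ w x → wins-face e w (F x) (∈-map⁺ F (m x)))
    where all′ : (∀ x → Wins (F x)) → ∀ g′ → g′ ∈ map F xs → Wins g′
          all′ f g′ mem with ∈-map⁻ F mem
          ... | x , _ , refl = f x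

  pair-⇔ : ∀ {g g₀ g₁} k → node φ₀ n g ≡ choice k (g₀ ∷ g₁ ∷ []) → Both k (Wins g₀) (Wins g₁) ⇔ Wins g
  pair-⇔ true e = mk⇔ (λ { (inj₁ w) → eChoose e (here refl) w ; (inj₂ w) → eChoose e (there (here refl)) w }) ret′
    where ret′ : _ → _
          ret′ w with wins-choose e w
          ... | _ , here refl , w′ = inj₁ w′
          ... | _ , there (here refl) , w′ = inj₂ w′
  pair-⇔ false e = mk⇔ (λ { (v , w) → aChoose e (λ { _ (here refl) → v ; _ (there (here refl)) → w }) })
    (λ w → wins-face e w _ (here refl) , wins-face e w _ (there (here refl)))

-- Correctness of the Boolean equality tests.

finEq-refl : ∀ {n} (a : Fin n) → finEq a a ≡ true
finEq-refl a = ≡ᵇ-refl (toℕ a)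

finEq-sound : ∀ {n} (a b : Fin n) → finEq a b ≡ true → a ≡ b
finEq-sound a b e = FP.toℕ-injective (≡ᵇ-sound _ _ e)

listEq-refl : ∀ {A : Set} {e : A → A → Bool} → (∀ a → e a a ≡ true) → ∀ xs → listEq e xs xs ≡ true
listEq-refl r [] = refl
listEq-refl r (x ∷ xs) rewrite r x = listEq-refl r xs

listEq-sound : ∀ {A : Set} {e : A → A → Bool} → (∀ a b → e a b ≡ true → a ≡ b) → ∀ xs ys → listEq e xs ys ≡ true → xs ≡ ys
listEq-sound s [] [] _ = refl
listEq-sound {e = e} s (x ∷ xs) (y ∷ ys) q with e x y in p
... | true = cong₂ _∷_ (s x y p) (listEq-sound s xs ys q)

pathEq-refl : ∀ p → listEq _≡ᵇ_ p p ≡ true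
pathEq-refl = listEq-refl ≡ᵇ-refl

pathEq-sound : ∀ p q → listEq _≡ᵇ_ p q ≡ true → p ≡ q
pathEq-sound = listEq-sound ≡ᵇ-sound

symEq-refl : ∀ τ R → symEq τ R R ≡ true
symEq-refl τ (inj₁ i) = finEq-refl i
symEq-refl τ (inj₂ (a , k)) rewrite ≡ᵇ-refl a = ≡ᵇ-refl k

symEq-sound : ∀ τ R S → symEq τ R S ≡ true → R ≡ S
symEq-sound τ (inj₁ i) (inj₁ j) e = cong inj₁ (finEq-sound i j e)
symEq-sound τ (inj₂ (a , k)) (inj₂ (b , l)) e with a ≡ᵇ b in p
... | true = cong₂ (λ x y → inj₂ (x , y)) (≡ᵇ-sound a b p) (≡ᵇ-sound k l e)

<ᵇ-true : ∀ {m n} → m < n → (m <ᵇ n) ≡ true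
<ᵇ-true {m} {n} lt with m <ᵇ n | <⇒<ᵇ lt
... | true | _ = refl

<ᵇ-false : ∀ {m n} → n ≤ m → (m <ᵇ n) ≡ false
<ᵇ-false {m} {n} ge with m <ᵇ n in e
... | false = refl
... | true = contradiction (<ᵇ⇒< m n (subst T (sym e) _)) (≤⇒≯ ge)

differ : ∀ τ {n} (Q S : RelSym τ) (u v : List (Fin n)) → Q ≢ S ⊎ u ≢ v → (symEq τ Q S ∧ listEq finEq u v) ≡ false
differ τ Q S u v d with symEq τ Q S in se | listEq finEq u v in le
... | false | _ = refl
... | true | false = refl
differ τ Q S u v (inj₁ ne) | true | true = contradiction (symEq-sound τ Q S se) ne
differ τ Q S u v (inj₂ ne) | true | true = contradiction (listEq-sound finEq-sound u v le) ne

-- Playing the game by a program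

-- `hN` keeps the domain size, `hP` reads the word, `hI` points into the tables, and `hT`, `hA`,
-- `hC` are scratch; `hV` are the variables and `hK` the clocks.
data Hd (V P : ℕ) : Set where
  hN hP hI hT hA hC : Hd V P
  hV : Fin V → Hd V P
  hK : Fin P → Hd V P

eqHd : ∀ {V P} → BoolEq (Hd V P)
eqHd {V} {P} = record { _==_ = _=?_ ; ==-refl = rf ; ==-sound = sd }
  where
  _=?_ : Hd V P → Hd V P → Bool
  hN =? hN = true
  hP =? hP = true
  hI =? hI = true
  hT =? hT = true
  hA =? hA = true
  hC =? hC = true
  hV i =? hV j = finEq i j
  hK i =? hK j = finEq i j
  _ =? _ = false
  rf : ∀ a → (a =? a) ≡ true
  rf hN = refl
  rf hP = refl
  rf hI = refl
  rf hT = refl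
  rf hA = refl
  rf hC = refl
  rf (hV i) = finEq-refl i
  rf (hK i) = finEq-refl i
  sd : ∀ a b → (a =? b) ≡ true → a ≡ b
  sd hN hN _ = refl
  sd hP hP _ = refl
  sd hI hI _ = refl
  sd hT hT _ = refl
  sd hA hA _ = refl
  sd hC hC _ = refl
  sd (hV i) (hV j) e = cong hV (finEq-sound i j e)
  sd (hK i) (hK j) e = cong hK (finEq-sound i j e)

finHd : ∀ V P → Finite (Hd V P)
finHd V P = retractFinite to from from-to (finite⊎ (finiteFin 6) (finite⊎ (finiteFin V) (finiteFin P)))
  where
  to : Hd V P → Fin 6 ⊎ (Fin V ⊎ Fin P)
  to hN = inj₁ fz
  to hP = inj₁ (fs fz)
  to hI = inj₁ (fs (fs fz))
  to hT = inj₁ (fs (fs (fs fz)))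
  to hA = inj₁ (fs (fs (fs (fs fz))))
  to hC = inj₁ (fs (fs (fs (fs (fs fz)))))
  to (hV i) = inj₂ (inj₁ i)
  to (hK i) = inj₂ (inj₂ i)
  from : Fin 6 ⊎ (Fin V ⊎ Fin P) → Hd V P
  from (inj₁ fz) = hN
  from (inj₁ (fs fz)) = hP
  from (inj₁ (fs (fs fz))) = hI
  from (inj₁ (fs (fs (fs fz)))) = hT
  from (inj₁ (fs (fs (fs (fs fz))))) = hA
  from (inj₁ (fs (fs (fs (fs (fs _)))))) = hC
  from (inj₂ (inj₁ i)) = hV i
  from (inj₂ (inj₂ i)) = hK i
  from-to : ∀ h → from (to h) ≡ h
  from-to hN = refl
  from-to hP = refl
  from-to hI = refl
  from-to hT = refl
  from-to hA = refl
  from-to hC = refl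
  from-to (hV i) = refl
  from-to (hK i) = refl

-- The program that plays the game of φ₀: a head per variable (0 when it is
-- unassigned, 1 + a when it holds a), a head per clock, a track per relation.
module GameProgram {τ : Voc} (φ₀ : Formula τ) (V′ : ℕ) where

  V nodes tracks : ℕ
  V = suc V′
  nodes = length (paths φ₀)
  tracks = length τ + V * V

  open import Data.List.Membership.DecPropositional (LP.≡-dec Data.Nat.Properties._≟_) using (_∈?_)

  nodeAt : List ℕ → Fin nodes
  nodeAt p with p ∈? paths φ₀
  ... | yes m = Any.index m
  ... | no _ = fz

  pathOf : Fin nodes → List ℕ
  pathOf = lookupL (paths φ₀)

  pathOf-nodeAt : ∀ p {ψ} → subAt φ₀ p ≡ just ψ → pathOf (nodeAt p) ≡ p
  pathOf-nodeAt p e with p ∈? paths φ₀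
  ... | yes m = sym (AnyP.lookup-index m)
    where import Data.List.Relation.Unary.Any.Properties as AnyP
  ... | no n = contradiction (subAt-∈-paths φ₀ p e) n

  -- Total on purpose: numbers that are too large collapse onto `V′`, which is harmless because
  -- `Fits` excludes them.
  clamp : ℕ → Fin V
  clamp a = fromℕ< (s≤s (m⊓n≤n a V′))

  toℕ-clamp : ∀ {a} → a < V → toℕ (clamp a) ≡ a
  toℕ-clamp (s≤s lt) = trans (FP.toℕ-fromℕ< _) (m≤n⇒m⊓n≡m lt)

  clamp-injective : ∀ {a b} → a < V → b < V → clamp a ≡ clamp b → a ≡ b
  clamp-injective p q e = trans (sym (toℕ-clamp p)) (trans (cong toℕ e) (toℕ-clamp q))

  symCode : RelSym τ → Fin (length τ) ⊎ Fin (V * V)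
  symCode (inj₁ i) = inj₁ i
  symCode (inj₂ (a , k)) = inj₂ (combine (clamp a) (clamp k))

  symCode-injective : ∀ R S → SymOK τ V R → SymOK τ V S → symCode R ≡ symCode S → R ≡ S
  symCode-injective (inj₁ i) (inj₁ j) p q refl = refl
  symCode-injective (inj₂ (a , k)) (inj₂ (b , l)) (p , p′) (q , q′) e
    with FP.combine-injective (clamp a) (clamp k) (clamp b) (clamp l) (inj₂-injective e)
    where open import Data.Sum.Properties using (inj₂-injective)
  ... | x , y = cong₂ (λ u v → inj₂ (u , v)) (clamp-injective p q x) (clamp-injective p′ q′ y)

  track : RelSym τ → Fin tracks
  track R = join (length τ) (V * V) (symCode R)

  track-injective : ∀ R S → SymOK τ V R → SymOK τ V S → track R ≡ track S → R ≡ S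
  track-injective R S p q e = symCode-injective R S p q
    (trans (sym (FP.splitAt-join (length τ) (V * V) (symCode R)))
      (trans (cong (splitAt (length τ)) e) (FP.splitAt-join (length τ) (V * V) (symCode S))))

  -- The input bit stays readable on a component of its own. A relation occupies one track, where
  -- the bit of a tuple is kept in the cell `idx` of that tuple.
  Γ : Set
  Γ = Maybe Bool × Vec Bool tracks

  abstract
    finΓ : Finite Γ
    finΓ = finite× (finiteMaybe finiteBool) (finiteVec finiteBool tracks)

  blankTracks : Maybe Bool → Γ
  blankTracks m = m , Vec.replicate tracks false

  bit : RelSym τ → Γ → Bool
  bit R g = Vec.lookup (proj₂ g) (track R)

  setBit : RelSym τ → Bool → Γ → Γ
  setBit R b g = proj₁ g , (proj₂ g [ track R ]≔ b)

  bit-setBit-same : ∀ R b g → bit R (setBit R b g) ≡ b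
  bit-setBit-same R b g = VP.lookup∘updateAt (track R) (proj₂ g)

  bit-setBit-other : ∀ R S b g → SymOK τ V R → SymOK τ V S → R ≢ S → bit R (setBit S b g) ≡ bit R g
  bit-setBit-other R S b g p q ne =
    VP.lookup∘updateAt′ (track R) (track S) (λ e → ne (track-injective R S p q e)) (proj₂ g)

  H : Set
  H = Hd V nodes

  -- One label for the setup and two per node, as Eloise may arrive there as verifier or as
  -- falsifier.
  labels : ℕ
  labels = suc (nodes * 2)

  Pr : Set
  Pr = Prog H Γ (Fin labels)

  roleCode : Bool → Fin 2
  roleCode false = fz
  roleCode true = fs fz

  roleOf : Fin 2 → Bool
  roleOf fz = false
  roleOf (fs _) = true

  target : List ℕ → Bool → Fin labels
  target p r = fs (combine (nodeAt p) (roleCode r))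

  goto : List ℕ → Bool → Pr
  goto p r = jump (target p r)

  vh : Var → H
  vh x = hV (clamp x)

  ck : List ℕ → H
  ck p = hK (nodeAt p)

  -- A Horner step, `hI` becoming `hI * n + a`. The head of `x` holds `1 + a`, hence the decrement
  -- and the increment that takes it back.
  accumulate : Var → Pr
  accumulate x = mulBy hN hI hT hA ⨾ dec (vh x) ⨾ addTo (vh x) hI hA ⨾ inc (vh x)

  indexOf : List Var → Pr → Pr
  indexOf [] P = P
  indexOf (x ∷ xs) P = ifZero (vh x) (verdict false) (accumulate x ⨾ indexOf xs P)

  -- Each component enters the index as soon as it is picked. With a repeated variable the index is
  -- thus that of the picked tuple, while the variable keeps the last value, as with `assignAll`.
  pickTuple : Bool → List Var → Pr → Pr
  pickTuple k [] P = P
  pickTuple k (x ∷ xs) P = pickValue k hN (vh x) hT hA ⨾ accumulate x ⨾ pickTuple k xs P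

  -- A play that ends without winner gets `verdict false`, as a lost one does: only wins of Eloise
  -- are to be recognised.
  playNode : List ℕ → Bool → Maybe (Formula τ) → Pr
  playNode p r (just (atom R xs)) =
    indexOf (toList xs) (ifT hI (λ _ g → boolEq (bit R g) r) (verdict true) (verdict false))
  playNode p r (just (eq x y)) =
    ifZero (vh x) (verdict false) (ifZero (vh y) (verdict false)
      -- Copies `X` and `Y` of the two values are run down against each other, which leaves `Y ∸ X`
      -- in `hC` and `X ∸ Y` in `hA`; the values agree iff both are zero.
      (addTo (vh x) hT hA ⨾ addTo (vh y) hC hA ⨾ for hT (ifZero hC (inc hA) (dec hC)) ⨾
       ifZero hC (ifZero hA (verdict r) (verdict (not r))) (verdict (not r))))
  playNode p r (just tt) = verdict r
  playNode p r (just ff) = verdict (not r)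
  playNode p r (just (neg φ)) = goto (p ++ 0 ∷ []) (not r)
  playNode p r (just (and φ ψ)) = choose (not r) (goto (p ++ 0 ∷ []) r) (goto (p ++ 1 ∷ []) r)
  playNode p r (just (or φ ψ)) = choose r (goto (p ++ 0 ∷ []) r) (goto (p ++ 1 ∷ []) r)
  playNode p r (just (ex x φ)) = pickValue r hN (vh x) hT hA ⨾ goto (p ++ 0 ∷ []) r
  playNode p r (just (all x φ)) = pickValue (not r) hN (vh x) hT hA ⨾ goto (p ++ 0 ∷ []) r
  playNode p r (just (ins R xs φ)) =
    pickTuple r (toList xs) (act hI (λ _ g → setBit R true g , stay) ⨾ clear hI ⨾ goto (p ++ 0 ∷ []) r)
  playNode p r (just (del R xs φ)) =
    pickTuple r (toList xs) (act hI (λ _ g → setBit R false g , stay) ⨾ clear hI ⨾ goto (p ++ 0 ∷ []) r)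
  playNode p r (just (lab C t φ)) = ifZero (ck p) (verdict false) (dec (ck p) ⨾ goto (p ++ 0 ∷ []) r)
  playNode p r (just (loop C)) = maybe (λ q → goto q r) (verdict false) (findLabel φ₀ C [] p nothing)
  playNode p r nothing = verdict false

  holds : Maybe Bool → Γ → Bool
  holds nothing (nothing , _) = true
  holds (just b) (just c , _) = boolEq b c
  holds _ _ = false

  power : ℕ → Pr → Pr
  power zero P = P
  power (suc k) P = mulBy hN hI hT hA ⨾ power k P

  copyCell : Fin (length τ) → Pr
  -- A blank here means that the word ends inside a table.
  copyCell i = ifT hP (λ _ → holds nothing) (verdict false)
    (ifT hP (λ _ → holds (just true)) (act hI (λ _ g → setBit (inj₁ i) true g , stay) ⨾ inc hP ⨾ inc hI) (inc hP ⨾ inc hI))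

  copyRel : Fin (length τ) → Pr → Pr
  copyRel i P = inc hI ⨾ power (lookupL τ i) (move hI hC ⨾ for hC (copyCell i) ⨾ clear hI ⨾ P)

  copyAll : List (Fin (length τ)) → Pr → Pr
  copyAll [] P = P
  copyAll (i ∷ is) P = copyRel i (copyAll is P)

  horner : Pol → Pr → Pr
  horner [] P = P
  horner (c ∷ cs) P = horner cs (mulBy hN hI hT hA ⨾ incs c hI P)

  clockOf : Maybe (Formula τ) → Maybe Pol
  clockOf (just (lab C t φ)) = just t
  clockOf _ = nothing

  initClock : Fin nodes → Maybe Pol → Pr → Pr
  initClock i (just t) P = horner t (move hI (hK i) ⨾ P)
  initClock i nothing P = P

  initClocks : List (Fin nodes) → Pr
  initClocks [] = goto [] true
  initClocks (i ∷ is) = initClock i (clockOf (subAt φ₀ (pathOf i))) (initClocks is)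

  -- The checks made on the way are a nonempty run of ones, a zero, and tables that are neither cut
  -- off nor followed by further bits. By `fromBits` this is all that an encoding has to satisfy.
  setup : Pr
  setup = whl hP (λ _ → holds (just true)) (inc hP ⨾ inc hN) ⨾
    ifZero hN (verdict false)
      (ifT hP (λ _ → holds (just false))
        (inc hP ⨾ copyAll (allFin (length τ)) (ifT hP (λ _ → holds nothing) (initClocks (allFin nodes)) (verdict false)))
        (verdict false))

  playCode : Fin nodes × Fin 2 → Pr
  playCode (i , j) = playNode (pathOf i) (roleOf j) (subAt φ₀ (pathOf i))

  blocks : Fin labels → Pr
  blocks fz = setup
  blocks (fs j) = playCode (remQuot 2 j)

  blocks-target : ∀ p r {ψ} → subAt φ₀ p ≡ just ψ → blocks (target p r) ≡ playNode p r (just ψ)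
  blocks-target p r {ψ} e = trans (cong playCode (FP.remQuot-combine (nodeAt p) (roleCode r)))
    (trans (cong₂ (λ q b → playNode q b (subAt φ₀ q)) (pathOf-nodeAt p e) (role r)) (cong (playNode p r) e))
    where role : ∀ r → roleOf (roleCode r) ≡ r
          role false = refl
          role true = refl

-- Correctness of the simulated play.

finEq-clamp : ∀ {m n} (i : Fin m) (j : Fin n) {x} → toℕ j ≡ x → (toℕ i ≡ᵇ toℕ j) ≡ (toℕ i ≡ᵇ x)
finEq-clamp i j refl = refl

total-dec : ∀ {m} (f f′ : Fin m → ℕ) j v → f j ≡ suc v → (∀ i → f′ i ≡ (if finEq i j then v else f i)) → suc (total f′) ≡ total f
total-dec {suc m} f f′ fz v e h rewrite e | h fz = cong (λ w → suc (v + w)) (total-cong (λ i → h (fs i)))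
total-dec {suc m} f f′ (fs j) v e h rewrite h fz =
  trans (sym (+-suc (f fz) _)) (cong (f fz +_) (total-dec (λ i → f (fs i)) (λ i → f′ (fs i)) j v e (λ i → h (fs i))))

mapMaybe′-just : ∀ {A B : Set} {f : A → Maybe B} {x y xs ys} → f x ≡ just y → mapMaybe′ f xs ≡ just ys → mapMaybe′ f (x ∷ xs) ≡ just (y ∷ ys)
mapMaybe′-just {f = f} {x} {xs = xs} p q with f x | mapMaybe′ f xs
mapMaybe′-just refl refl | just _ | just _ = refl

mapMaybe′-head : ∀ {A B : Set} {f : A → Maybe B} {x xs} → f x ≡ nothing → mapMaybe′ f (x ∷ xs) ≡ nothing
mapMaybe′-head {f = f} {x} {xs} p with f x | mapMaybe′ f xs
mapMaybe′-head refl | nothing | just _ = refl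
mapMaybe′-head refl | nothing | nothing = refl

mapMaybe′-tail : ∀ {A B : Set} {f : A → Maybe B} {x xs} → mapMaybe′ f xs ≡ nothing → mapMaybe′ f (x ∷ xs) ≡ nothing
mapMaybe′-tail {f = f} {x} {xs} p with f x | mapMaybe′ f xs
mapMaybe′-tail refl | nothing | nothing = refl
mapMaybe′-tail refl | just _ | nothing = refl

module Play {τ : Voc} (φ₀ : Formula τ) (V′ : ℕ) (fits : Fits (suc V′) φ₀) (n₁ : ℕ) where
  open GameProgram φ₀ V′
  open BoolEq (eqHd {V} {nodes})
  open Programs {H} {Γ} eqHd hI labels hiding (Pr)
  open Machine blocks
  open Routines {H} {Γ} eqHd hI labels blocks
  open Equivalence using (to; from)

  -- `Z` bounds every index into a table, arities being below `V`. `W` is the number of moves that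
  -- one unit of clock has to pay for.
  n Z W : ℕ
  n = suc n₁
  Z = n ^ V
  W = weight φ₀

  value : Maybe (Fin n) → ℕ
  value nothing = 0
  value (just a) = suc (toℕ a)

  value≤n : ∀ m → value m ≤ n
  value≤n nothing = z≤n
  value≤n (just a) = FP.toℕ<n a

  record Scratch (s : St) : Set where
    constructor scratch
    field
      atN : hd s hN ≡ n
      atT : hd s hT ≡ 0
      atA : hd s hA ≡ 0
      atC : hd s hC ≡ 0
  open Scratch

  VarsRel : (Var → Maybe (Fin n)) → St → Set
  VarsRel f s = ∀ v → hd s (hV v) ≡ value (f (toℕ v))

  ClockRel : GState τ n → St → Set
  ClockRel g s = ∀ p {C t ψ} → subAt φ₀ p ≡ just (lab C t ψ) → hd s (ck p) ≡ evalPol t n ∸ visits g p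

  TapeRel : Rels τ n → St → Set
  TapeRel r s = ∀ R → SymOK τ V R → (t : Vec (Fin n) (arity τ R)) → bit R (tp s (idx t)) ≡ r R (toList t)

  record Rep (g : GState τ n) (s : St) : Set where
    constructor rep
    field
      work   : Scratch s
      atI    : hd s hI ≡ 0
      vars   : VarsRel (asg g) s
      clocks : ClockRel g s
      bits   : TapeRel (rels g) s
  open Rep

  record Frame (s s′ : St) : Set where
    constructor frame
    field
      fN : hd s′ hN ≡ hd s hN
      fT : hd s′ hT ≡ hd s hT
      fA : hd s′ hA ≡ hd s hA
      fC : hd s′ hC ≡ hd s hC
      fK : ∀ i → hd s′ (hK i) ≡ hd s (hK i)
      ft : ∀ i → tp s′ i ≡ tp s i
  open Frame

  frame-trans : ∀ {s s₁ s₂} → Frame s s₁ → Frame s₁ s₂ → Frame s s₂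
  frame-trans p q = frame (trans (fN q) (fN p)) (trans (fT q) (fT p)) (trans (fA q) (fA p)) (trans (fC q) (fC p))
    (λ i → trans (fK q i) (fK p i)) (λ i → trans (ft q i) (ft p i))

  frame-scratch : ∀ {s s′} → Frame s s′ → Scratch s → Scratch s′
  frame-scratch f w = scratch (trans (fN f) (atN w)) (trans (fT f) (atT w)) (trans (fA f) (atA w)) (trans (fC f) (atC w))

  vars-assign : ∀ {f s x} a → x < V → VarsRel f s → VarsRel (assign f x a) (s [ vh x ≔ suc (toℕ a) ])
  vars-assign {x = x} a lt r v rewrite finEq-clamp v (clamp x) (toℕ-clamp lt) with toℕ v ≡ᵇ x
  ... | true = refl
  ... | false = r v

  vars-at : ∀ {f s x} → x < V → VarsRel f s → hd s (vh x) ≡ value (f x)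
  vars-at {f} {x = x} lt r = trans (r (clamp x)) (cong (λ y → value (f y)) (toℕ-clamp lt))

  mulCost-mono : ∀ {I J} m → I ≤ J → mulCost I m ≤ mulCost J m
  mulCost-mono m le = +-mono-≤ (+-monoˡ-≤ 1 (*-monoˡ-≤ (2 + (m * 7 + 2)) le)) (+-monoˡ-≤ 1 (*-monoˡ-≤ 3 (*-monoˡ-≤ m le)))

  accCost : ℕ
  accCost = mulCost Z n + (n * 7 + 4)

  det-accumulate : ∀ {s x a} → Scratch s → hd s (vh x) ≡ suc a → a < n → hd s hI ≤ Z →
                   Det (accumulate x) s (s [ hI ≔ hd s hI * n + a ]) accCost
  det-accumulate {s} {x} {a} w hx lt le =
    det-≤ cost (det-seq mul (det-seq (det-dec {vh x} {s₁} hx) (det-seq add (det-≈ fix (det-inc {vh x})))))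
    where
    I = hd s hI
    s₁ = s [ hI ≔ I * hd s hN ]
    s₂ = s₁ [ vh x ≔ a ]
    s₃ = s₂ [ hI ≔ hd s₂ hI + hd s₂ (vh x) ]
    mul : Det (mulBy hN hI hT hA) s s₁ (mulCost I (hd s hN))
    mul = det-mulBy {hN} {hI} {hT} {hA} {s} refl refl refl refl refl refl (atT w) (atA w)
    add : Det (addTo (vh x) hI hA) s₂ s₃ (hd s₂ (vh x) * 7 + 2)
    add = det-addTo {vh x} {hI} {hA} {s₂} refl refl refl (atA w)
    x₂ : hd s₂ (vh x) ≡ a
    x₂ = get-same s₁ (vh x)
    x₃ : hd s₃ (vh x) ≡ a
    x₃ = x₂
    fix : (s₃ [ vh x ≔ suc (hd s₃ (vh x)) ]) ≈ (s [ hI ≔ I * n + a ])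
    fix = ≈-intro eh (λ _ → refl)
      where
      eh : ∀ h → hd (s₃ [ vh x ≔ suc (hd s₃ (vh x)) ]) h ≡ hd (s [ hI ≔ I * n + a ]) h
      eh hN = refl
      eh hP = refl
      eh hI = cong₂ (λ u v → I * u + v) (atN w) x₂
      eh hT = refl
      eh hA = refl
      eh hC = refl
      eh (hK i) = refl
      eh (hV v) with finEq v (clamp x) in q
      ... | false = refl
      ... | true rewrite finEq-sound v (clamp x) q = trans (cong suc x₃) (sym hx)
    cost : mulCost I (hd s hN) + (1 + (hd s₂ (vh x) * 7 + 2 + 1)) ≤ accCost
    cost rewrite x₂ | atN w = +-mono-≤ (mulCost-mono n le) (≤-trans (≤-reflexive (lemma a)) (+-monoˡ-≤ 4 (*-monoˡ-≤ 7 (<⇒≤ lt))))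
      where lemma : ∀ a → 1 + (a * 7 + 2 + 1) ≡ a * 7 + 4
            lemma = solve-∀

  shift< : ∀ {I a j} → I < n ^ j → a < n → I * n + a < n ^ suc j
  shift< {I} {a} {j} p q = ≤-trans (≤-trans (≤-reflexive (sym (+-suc (I * n) a))) (+-monoʳ-≤ (I * n) q))
    (≤-trans (≤-reflexive (trans (+-comm (I * n) n) (*-comm (suc I) n))) (*-monoʳ-≤ n p))

  pow≤Z : ∀ {j} → j ≤ V → n ^ j ≤ Z
  pow≤Z le = ^-monoʳ-≤ n le

  horner-∷ : ∀ {k} I (a : Fin n) (t : Vec (Fin n) k) → (I * n + toℕ a) * n ^ k + idx t ≡ I * n ^ suc k + idx (a ∷ t)
  horner-∷ {k} I a t = trans (lemma I n (toℕ a) (n ^ k) (idx t)) (cong (I * n ^ suc k +_) (sym (idx-∷ a t)))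
    where lemma : ∀ I n a p x → (I * n + a) * p + x ≡ I * (n * p) + (a * p + x)
          lemma = solve-∀

  -- After `j` variables the index is below `n ^ j`, which keeps each multiplication within the cost
  -- computed for `Z`.
  decides-index : ∀ {k} (xs : Vec Var k) j {s T Q P} f → All (_< V) (toList xs) → Scratch s → VarsRel f s →
    hd s hI < n ^ j → j + k ≤ V →
    (∀ (t : Vec (Fin n) k) → mapMaybe′ f (toList xs) ≡ just (toList t) → Decides P (s [ hI ≔ hd s hI * n ^ k + idx t ]) T Q) →
    (mapMaybe′ f (toList xs) ≡ nothing → ¬ Q) →
    Decides (indexOf (toList xs) P) s (k * suc accCost + T) Q
  decides-index [] j {s} {P = P} f _ w r lt le D undef =
    decides-≈ {P} (upd-id s hI (trans (+-identityʳ _) (*-identityʳ _))) (D [] refl)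
  decides-index {suc k} (x ∷ xs) j {s} {T} {Q} {P} f (x<V ∷ bd) w r lt le D undef = byCase (f x) refl
    where
    j≤V : j ≤ V
    j≤V = ≤-trans (m≤m+n j (suc k)) le
    byCase : ∀ m → f x ≡ m → Decides (indexOf (toList (x ∷ xs)) P) s (suc k * suc accCost + T) Q
    byCase nothing fx = decides-zero (trans (vars-at {f} {s} x<V r) (cong value fx))
        (decides-verdict (mk⇔ (λ ()) (λ q → contradiction q (undef (mapMaybe′-head {f = f} {xs = toList xs} fx)))))
    byCase (just a) fx = decides-≤ {indexOf (toList (x ∷ xs)) P} {s} (≤-reflexive (cong suc (sym (+-assoc accCost (k * suc accCost) T))))
        (decides-suc hx (decides-seq (det-accumulate {s} {x} w hx (FP.toℕ<n a) (≤-trans (<⇒≤ lt) (pow≤Z {j} j≤V)))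
          (decides-index xs (suc j) {s₁} f bd (scratch (atN w) (atT w) (atA w) (atC w)) r
            (shift< {hd s hI} {j = j} lt (FP.toℕ<n a)) (≤-trans (≤-reflexive (sym (+-suc j k))) le)
            (λ t e → decides-≈ {P} (≈-sym (≈-trans (upd-upd s hI _ _) (upd-cong hI ≈-refl (horner-∷ (hd s hI) a t))))
              (D (a ∷ t) (mapMaybe′-just {f = f} {xs = toList xs} fx e)))
            (λ e → undef (mapMaybe′-tail {f = f} {x = x} {xs = toList xs} e)))))
      where
      hx : hd s (vh x) ≡ suc (toℕ a)
      hx = trans (vars-at {f} {s} x<V r) (cong value fx)
      s₁ = s [ hI ≔ hd s hI * n + toℕ a ]

  bounded-⇔ : ∀ r {R : Fin n → Set} → Bounded r n (λ j → Σ (j < n) λ lt → R (fromℕ< lt)) ⇔ Quant r R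
  bounded-⇔ true {R} = mk⇔ (λ { (j , _ , lt , q) → fromℕ< lt , q })
    (λ { (a , q) → toℕ a , FP.toℕ<n a , FP.toℕ<n a , subst R (sym (FP.fromℕ<-toℕ a _)) q })
  bounded-⇔ false {R} = mk⇔ (λ q a → subst R (FP.fromℕ<-toℕ a _) (proj₂ (q (toℕ a) (FP.toℕ<n a))))
    (λ q j lt → lt , q (fromℕ< lt))

  decides-var : ∀ {r x s T P f} {R : Fin n → Set} → x < V → Scratch s → VarsRel f s →
    (∀ a → Decides P (s [ vh x ≔ suc (toℕ a) ]) T (R a)) →
    Decides (pickValue r hN (vh x) hT hA ⨾ P) s (pickCost n + T) (Quant r R)
  decides-var {r} {x} {s} {T} {P} {f} {R} x<V w vr D = decides-⇔ {pickValue r hN (vh x) hT hA ⨾ P} {s} (bounded-⇔ r)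
    (decides-pick {r} {hN} {vh x} {hT} {hA} {P} {s} refl refl refl refl refl refl (atT w) (atA w) n₁ (atN w)
      (≤-trans (≤-reflexive (vars-at {f} {s} x<V vr)) (value≤n _))
      (λ j lt → decides-⇔ {P} {s [ vh x ≔ suc j ]} (mk⇔ (λ q → lt , q) proj₂)
         (subst (λ i → Decides P (s [ vh x ≔ suc i ]) T (R (fromℕ< lt))) (FP.toℕ-fromℕ< lt) (D (fromℕ< lt)))))

  quant-∷ : ∀ r {k} {Q : Vec (Fin n) (suc k) → Set} → Quant r (λ a → Quant r (λ t → Q (a ∷ t))) ⇔ Quant r Q
  quant-∷ true = mk⇔ (λ { (a , t , q) → a ∷ t , q }) (λ { (a ∷ t , q) → a , t , q })
  quant-∷ false = mk⇔ (λ { q (a ∷ t) → q a t }) (λ q a t → q (a ∷ t))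

  quant-[] : ∀ r {Q : Vec (Fin n) 0 → Set} → Q [] ⇔ Quant r Q
  quant-[] true = mk⇔ (λ q → [] , q) (λ { ([] , q) → q })
  quant-[] false = mk⇔ (λ { q [] → q }) (λ q → q [])

  decides-tuple : ∀ {k} (xs : Vec Var k) j {r s T P} f (Q : Vec (Fin n) k → Set) → All (_< V) (toList xs) → Scratch s → VarsRel f s →
    hd s hI < n ^ j → j + k ≤ V →
    (∀ t s′ → Frame s s′ → VarsRel (assignAll f (toList xs) (toList t)) s′ → hd s′ hI ≡ hd s hI * n ^ k + idx t → Decides P s′ T (Q t)) →
    Decides (pickTuple r (toList xs) P) s (k * (pickCost n + accCost) + T) (Quant r Q)
  decides-tuple [] j {r} {s} {P = P} f Q _ w vr lt le D = decides-⇔ {P} {s} (quant-[] r)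
    (D [] s (frame refl refl refl refl (λ _ → refl) (λ _ → refl)) vr (sym (trans (+-identityʳ _) (*-identityʳ _))))
  decides-tuple {suc k} (x ∷ xs) j {r} {s} {T} {P} f Q (x<V ∷ bd) w vr lt le D =
    decides-≤ {pickTuple r (toList (x ∷ xs)) P} {s} (≤-reflexive (lemma (pickCost n) accCost (k * (pickCost n + accCost)) T))
    (decides-⇔ {pickTuple r (toList (x ∷ xs)) P} {s} (quant-∷ r)
      (decides-var {r} {x} {s} {f = f} x<V w vr (λ a →
        decides-seq {accumulate x} {pickTuple r (toList xs) P} {s [ vh x ≔ suc (toℕ a) ]}
          (det-accumulate {s [ vh x ≔ suc (toℕ a) ]} {x} (scratch (atN w) (atT w) (atA w) (atC w)) (get-same s (vh x)) (FP.toℕ<n a) (≤-trans (<⇒≤ lt) (pow≤Z {j} j≤V)))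
          (decides-tuple xs (suc j) {r} {s₂ a} (assign f x a) (λ t → Q (a ∷ t)) bd (scratch (atN w) (atT w) (atA w) (atC w))
            (vars-assign {f} {s} {x} a x<V vr) (shift< {hd s hI} {j = j} lt (FP.toℕ<n a)) (≤-trans (≤-reflexive (sym (+-suc j k))) le)
            (λ t s′ fr vr′ eI → D (a ∷ t) s′ (frame-trans {s} {s₂ a} {s′} (frame refl refl refl refl (λ _ → refl) (λ _ → refl)) fr) vr′
                                   (trans eI (horner-∷ (hd s hI) a t)))))))
    where
    s₂ : Fin n → St
    s₂ a = s [ vh x ≔ suc (toℕ a) ] [ hI ≔ hd s hI * n + toℕ a ]
    j≤V : j ≤ V
    j≤V = ≤-trans (m≤m+n j (suc k)) le
    lemma : ∀ p a k T → p + (a + (k + T)) ≡ p + a + k + T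
    lemma = solve-∀

  DecE : Fin labels → St → ℕ → Set → Set
  DecE l s t Q = ∃ λ b → E (block l) s b t × (b ≡ true ⇔ Q)

  decE : ∀ {p r ψ s t Q} → subAt φ₀ p ≡ just ψ → Decides (playNode p r (just ψ)) s t Q → DecE (target p r) s t Q
  decE {p} {r} {s = s} {t} e (b , g , h) = b , block-goes {target p r} {s} (subst (λ P → Goes P s b t) (sym (blocks-target p r e)) g) , h

  decides-goto : ∀ {p r s t Q} → DecE (target p r) s t Q → Decides (goto p r) s (suc t) Q
  decides-goto {p} {r} {s} (b , g , h) = b , goes-jump {target p r} {s} g , h

  compare : ∀ {s} X Y {P b t} → Scratch s → hd s hT ≡ 0 →
            (Goes P (s [ hT ≔ 0 ] [ hC ≔ Y ∸ X ] [ hA ≔ X ∸ Y ]) b t) →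
            Goes (for hT (ifZero hC (inc hA) (dec hC)) ⨾ P) (s [ hT ≔ X ] [ hC ≔ Y ]) b (X * 4 + 1 + t)
  compare {s} X Y {P} {b} {t} w t0 g = goes-seq
    (det-≈ˡ start (det-for {hT} {ifZero hC (inc hA) (dec hC)} S 2 X (λ m → refl) body))
    (goes-≈ {P} finish g)
    where
    S : ℕ → St
    S m = s [ hC ≔ Y ∸ (X ∸ m) ] [ hA ≔ (X ∸ m) ∸ Y ] [ hT ≔ m ]
    start : S X ≈ (s [ hT ≔ X ] [ hC ≔ Y ])
    start = ≈-intro (λ { hN → refl ; hP → refl ; hI → refl ; hT → refl ; hA → trans (cong (_∸ Y) (n∸n≡0 X)) (trans (0∸n≡0 Y) (sym (atA w)))
                       ; hC → cong (Y ∸_) (n∸n≡0 X) ; (hV _) → refl ; (hK _) → refl }) (λ _ → refl)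
    finish : (s [ hT ≔ 0 ] [ hC ≔ Y ∸ X ] [ hA ≔ X ∸ Y ]) ≈ S 0
    finish = ≈-intro (λ { hN → refl ; hP → refl ; hI → refl ; hT → refl ; hA → refl ; hC → refl ; (hV _) → refl ; (hK _) → refl }) (λ _ → refl)
    body : ∀ m → m < X → Det (ifZero hC (inc hA) (dec hC)) (S (suc m) [ hT ≔ m ]) (S m) 2
    body m lt = byCase (Y ∸ (X ∸ suc m)) refl
     where
     byCase : ∀ v → Y ∸ (X ∸ suc m) ≡ v → Det (ifZero hC (inc hA) (dec hC)) (S (suc m) [ hT ≔ m ]) (S m) 2
     byCase zero q = det-then (cong (_≡ᵇ 0) q) (det-≈ fix (det-inc {hA} {S (suc m) [ hT ≔ m ]}))
      where
      Y≤ : Y ≤ X ∸ suc m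
      Y≤ = m∸n≡0⇒m≤n q
      fix : (S (suc m) [ hT ≔ m ] [ hA ≔ suc (X ∸ suc m ∸ Y) ]) ≈ S m
      fix = ≈-intro (λ { hN → refl ; hP → refl ; hI → refl ; hT → refl
                       ; hA → trans (sym (+-∸-assoc 1 Y≤)) (cong (_∸ Y) (∸-step lt))
                       ; hC → trans q (sym (m≤n⇒m∸n≡0 (≤-trans Y≤ (∸-monoʳ-≤ X (n≤1+n m))))) ; (hV _) → refl ; (hK _) → refl }) (λ _ → refl)
     byCase (suc e) q = det-else (cong (_≡ᵇ 0) q) (det-≈ fix (det-dec {hC} {S (suc m) [ hT ≔ m ]} q))
      where
      d<Y : X ∸ suc m < Y
      d<Y = m∸n≢0⇒n<m (λ z → contradiction (trans (sym q) z) (λ ()))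
      fix : (S (suc m) [ hT ≔ m ] [ hC ≔ e ]) ≈ S m
      fix = ≈-intro (λ { hN → refl ; hP → refl ; hI → refl ; hT → refl
                       ; hA → trans (m≤n⇒m∸n≡0 (<⇒≤ d<Y)) (sym (m≤n⇒m∸n≡0 (subst (_≤ Y) (∸-step lt) d<Y)))
                       ; hC → trans (cong pred (sym q)) (trans (pred[m∸n]≡m∸[1+n] Y (X ∸ suc m)) (cong (Y ∸_) (∸-step lt)))
                       ; (hV _) → refl ; (hK _) → refl }) (λ _ → refl)

  -- A common bound on the work at any node: at most `V` variables read or picked, an index below
  -- `Z` to be cleared, and the comparison of two variables, which takes up to `n * 18 + 9` steps.
  nodeCost : ℕ
  nodeCost = V * (suc accCost + pickCost n) + Z * 2 + n * 18 + 20

  K : St → ℕ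
  K s = total (λ i → hd s (hK i))

  20≤nodeCost : 20 ≤ nodeCost
  20≤nodeCost = m≤n+m 20 (V * (suc accCost + pickCost n) + Z * 2 + n * 18)

  no-winner : ∀ {g} → node φ₀ n g ≡ terminal nothing → false ≡ true ⇔ Wins {φ₀ = φ₀} g
  no-winner e = mk⇔ (λ ()) (λ w → contradiction (wins-terminal e w) (λ ()))

  winner : ∀ {g b} → node φ₀ n g ≡ terminal (just b) → b ≡ true ⇔ Wins {φ₀ = φ₀} g
  winner e = mk⇔ (λ p → from (terminal-⇔ e) (cong just p)) (λ w → just-injective (to (terminal-⇔ e) w))

  sat : (R : RelSym τ) → SymOK τ V R → arity τ R < V
  sat (inj₁ i) p = p
  sat (inj₂ _) (p , q) = q

  module _ {g : GState τ n} {s : St} (R : Rep g s) where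

    play-atom : ∀ {S xs} → subAt φ₀ (pos g) ≡ just (atom S xs) →
                Decides (playNode (pos g) (eloiseVer g) (just (atom S xs))) s nodeCost (Wins {φ₀ = φ₀} g)
    play-atom {S} {xs} e = decides-≤ {playNode (pos g) (eloiseVer g) (just (atom S xs))} {s} cost
      (decides-index xs 0 {s} (asg g) (proj₂ (fits-sub φ₀ (pos g) fits e)) (work R) (vars R)
        (subst (_< 1) (sym (atI R)) (s≤s z≤n)) (<⇒≤ ar<V) found
        (λ q w → contradiction (wins-terminal (trans (node-atom {φ₀ = φ₀} {g = g} e) (cong (maybe _ (terminal nothing)) q)) w) (λ ())))
      where
      sok = proj₁ (fits-sub φ₀ (pos g) fits e)
      ar<V = sat S sok
      cost : arity τ S * suc accCost + 2 ≤ nodeCost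
      cost = +-mono-≤ (≤-trans (*-mono-≤ (<⇒≤ ar<V) (m≤m+n (suc accCost) (pickCost n))) (≤-trans (m≤m+n _ (Z * 2)) (m≤m+n _ (n * 18)))) (s≤s (s≤s z≤n))
      found : ∀ t → mapMaybe′ (asg g) (toList xs) ≡ just (toList t) →
              Decides (ifT hI (λ _ c → boolEq (bit S c) (eloiseVer g)) (verdict true) (verdict false))
                (s [ hI ≔ hd s hI * n ^ arity τ S + idx t ]) 2 (Wins {φ₀ = φ₀} g)
      found t q = byCase _ refl
        where
        cell = tp s (hd s hI * n ^ arity τ S + idx t)
        byCase : ∀ v → boolEq (bit S cell) (eloiseVer g) ≡ v → Decides (ifT hI (λ _ c → boolEq (bit S c) (eloiseVer g)) (verdict true) (verdict false))
                (s [ hI ≔ hd s hI * n ^ arity τ S + idx t ]) 2 (Wins {φ₀ = φ₀} g)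
        byCase v be = v , run v be , winner {g} (trans (node-atom {φ₀ = φ₀} {g = g} e) (trans (cong (maybe _ (terminal nothing)) q)
            (cong (λ b → terminal (just b)) (trans (cong (λ b → boolEq b (eloiseVer g)) (sym (bits R S sok t)))
              (trans (cong (λ i → boolEq (bit S (tp s (i * n ^ arity τ S + idx t))) (eloiseVer g)) (sym (atI R))) be)))))
          where
          run : ∀ v → boolEq (bit S cell) (eloiseVer g) ≡ v → Goes (ifT hI (λ _ c → boolEq (bit S c) (eloiseVer g)) (verdict true) (verdict false))
                  (s [ hI ≔ hd s hI * n ^ arity τ S + idx t ]) v 2
          run true be = goes-then be goes-verdict
          run false be = goes-else be goes-verdict

    play-eq : ∀ {x y} → subAt φ₀ (pos g) ≡ just (eq x y) →
              Decides (playNode (pos g) (eloiseVer g) (just (eq x y))) s nodeCost (Wins {φ₀ = φ₀} g)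
    play-eq {x} {y} e = byCase (asg g x) (asg g y) refl refl
      where
      r = eloiseVer g
      P₀ = playNode (pos g) r (just (eq x y))
      x<V = proj₁ (fits-sub φ₀ (pos g) fits e)
      y<V = proj₂ (fits-sub φ₀ (pos g) fits e)
      test = ifZero hC (ifZero hA (verdict r) (verdict (not r))) (verdict (not r))
      byCase : ∀ m m′ → asg g x ≡ m → asg g y ≡ m′ → Decides P₀ s nodeCost (Wins {φ₀ = φ₀} g)
      byCase nothing m′ p q = decides-≤ {P₀} {s} (≤-trans (s≤s z≤n) 20≤nodeCost)
        (decides-zero {t = 0} (trans (vars-at {asg g} {s} x<V (vars R)) (cong value p)) (decides-verdict (no-winner {g} (node-eqˡ {φ₀ = φ₀} {g = g} e p))))
      byCase (just a) nothing p q = decides-≤ {P₀} {s} (≤-trans (s≤s (s≤s z≤n)) 20≤nodeCost)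
        (decides-suc (trans (vars-at {asg g} {s} x<V (vars R)) (cong value p))
          (decides-zero {t = 0} (trans (vars-at {asg g} {s} y<V (vars R)) (cong value q)) (decides-verdict (no-winner {g} (node-eqʳ {φ₀ = φ₀} {g = g} e q)))))
      byCase (just a) (just b) p q = decides-≤ {P₀} {s} cost (decides-suc hx (decides-suc hy
          (boolEq (finEq a b) r , goes-seq (det-≈ {addTo (vh x) hT hA} fixT (det-addTo {vh x} {hT} {hA} {s} refl refl refl (atA (work R))))
             (goes-seq (det-≈ {addTo (vh y) hC hA} fixC (det-addTo {vh y} {hC} {hA} {s [ hT ≔ X ]} refl refl refl (atA (work R))))
               (compare {s} X Y {test} (work R) (atT (work R)) (verdicts _ refl))) , winner {g} (node-eq {φ₀ = φ₀} {g = g} e p q))))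
        where
        X = suc (toℕ a)
        Y = suc (toℕ b)
        hx : hd s (vh x) ≡ X
        hx = trans (vars-at {asg g} {s} x<V (vars R)) (cong value p)
        hy : hd s (vh y) ≡ Y
        hy = trans (vars-at {asg g} {s} y<V (vars R)) (cong value q)
        fixT : (s [ hT ≔ hd s hT + hd s (vh x) ]) ≈ (s [ hT ≔ X ])
        fixT = upd-cong {s} hT ≈-refl (cong₂ _+_ (atT (work R)) hx)
        fixC : (s [ hT ≔ X ] [ hC ≔ hd s hC + hd s (vh y) ]) ≈ (s [ hT ≔ X ] [ hC ≔ Y ])
        fixC = upd-cong {s [ hT ≔ X ]} hC ≈-refl (cong₂ _+_ (atC (work R)) hy)
        verdicts : ∀ c → finEq a b ≡ c → Goes test (s [ hT ≔ 0 ] [ hC ≔ Y ∸ X ] [ hA ≔ X ∸ Y ]) (boolEq c r) 2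
        verdicts true c = goes-then (cong (_≡ᵇ 0) YX) (goes-then (cong (_≡ᵇ 0) XY) goes-verdict)
          where
          ab = finEq-sound a b c
          YX : Y ∸ X ≡ 0
          YX rewrite ab = n∸n≡0 (toℕ b)
          XY : X ∸ Y ≡ 0
          XY rewrite ab = n∸n≡0 (toℕ b)
        verdicts false c with Y ∸ X in yx
        ... | suc _ = goes-else refl goes-verdict
        ... | zero = goes-then refl (goes-else (≢⇒≡ᵇ-false XY) goes-verdict)
          where
          XY : X ∸ Y ≢ 0
          XY z = ≡ᵇ-false⇒≢ {toℕ a} {toℕ b} c (≤-antisym (m∸n≡0⇒m≤n z) (m∸n≡0⇒m≤n yx))
        cost : suc (suc (hd s (vh x) * 7 + 2 + (hd s (vh y) * 7 + 2 + (X * 4 + 1 + 2)))) ≤ nodeCost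
        cost rewrite hx | hy = ≤-trans (s≤s (s≤s (+-mono-≤ (+-monoˡ-≤ 2 (*-monoˡ-≤ 7 (FP.toℕ<n a)))
            (+-mono-≤ (+-monoˡ-≤ 2 (*-monoˡ-≤ 7 (FP.toℕ<n b))) (+-monoˡ-≤ 2 (+-monoˡ-≤ 1 (*-monoˡ-≤ 4 (FP.toℕ<n a))))))))
            (≤-trans (≤-reflexive (lemma n)) (+-mono-≤ (m≤n+m (n * 18) (V * (suc accCost + pickCost n) + Z * 2)) (m≤m+n 9 11)))
          where lemma : ∀ n → suc (suc (n * 7 + 2 + (n * 7 + 2 + (n * 4 + 1 + 2)))) ≡ n * 18 + 9
                lemma = solve-∀

    rep-same : ∀ {g′ s′} → rels g′ ≡ rels g → asg g′ ≡ asg g → visits g′ ≡ visits g → s′ ≡ s → Rep g′ s′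
    rep-same refl refl refl refl = rep (work R) (atI R) (vars R) (clocks R) (bits R)

  -- The number of moves is bounded by `K s * W + rank ψ`. Every move lowers the rank, except the
  -- visit to a label; that takes a unit from `K s` and so frees `W`, which is at least the rank
  -- from which play continues.
  sim : ∀ m g s ψ → subAt φ₀ (pos g) ≡ just ψ → Rep g s → K s * W + rank ψ < m →
        DecE (target (pos g) (eloiseVer g)) s (m * nodeCost) (Wins {φ₀ = φ₀} g)
  sim (suc m) g s ψ e R (s≤s lt) = decE e (step-at ψ e lt)
    where
    r = eloiseVer g
    p = pos g
    G : Set
    G = Wins {φ₀ = φ₀} g

    Goal : Formula τ → Set
    Goal ψ = Decides (playNode p r (just ψ)) s (suc m * nodeCost) G

    bound : ∀ {ψ c} → c ≤ nodeCost → Decides (playNode p r (just ψ)) s (c + m * nodeCost) G → Goal ψ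
    bound {ψ} le = decides-≤ {playNode p r (just ψ)} {s} (+-monoˡ-≤ (m * nodeCost) le)

    leaf : ∀ {ψ} → Decides (playNode p r (just ψ)) s nodeCost G → Goal ψ
    leaf {ψ} = decides-≤ {playNode p r (just ψ)} {s} (m≤m+n nodeCost (m * nodeCost))

    small : ∀ {c} → c ≤ 20 → c ≤ nodeCost
    small le = ≤-trans le 20≤nodeCost

    childOf : ∀ {ψ} i {χ} → subAt φ₀ p ≡ just ψ → childAt ψ i ≡ just χ → subAt φ₀ (p ++ i ∷ []) ≡ just χ
    childOf i e c = trans (subAt-++ φ₀ p i e) c

    ih : ∀ {g′ s′ χ} → subAt φ₀ (pos g′) ≡ just χ → Rep g′ s′ → K s′ * W + rank χ < m →
         Decides (goto (pos g′) (eloiseVer g′)) s′ (suc (m * nodeCost)) (Wins {φ₀ = φ₀} g′)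
    ih {g′} {s′} e R lt = decides-goto {pos g′} {eloiseVer g′} {s′} (sim m g′ s′ _ e R lt)

    less : ∀ {a b} → K s * W + suc (a + b) ≤ m → K s * W + a < m
    less {a} {b} lt = ≤-trans (≤-trans (≤-reflexive (sym (+-suc (K s * W) a))) (+-monoʳ-≤ (K s * W) (s≤s (m≤m+n a b)))) lt

    less′ : ∀ {a} → K s * W + suc a ≤ m → K s * W + a < m
    less′ {a} lt = ≤-trans (≤-reflexive (sym (+-suc (K s * W) a))) lt

    lessʳ : ∀ {a b} → K s * W + suc (a + b) ≤ m → K s * W + b < m
    lessʳ {a} {b} lt = less {b} {a} (subst (λ v → K s * W + suc v ≤ m) (+-comm a b) lt)

    pair : ∀ k {φ χ} → subAt φ₀ (p ++ 0 ∷ []) ≡ just φ → subAt φ₀ (p ++ 1 ∷ []) ≡ just χ → node φ₀ n g ≡ choice k (down g 0 ∷ down g 1 ∷ []) →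
           K s * W + suc (rank φ + rank χ) ≤ m →
           Decides (choose k (goto (p ++ 0 ∷ []) r) (goto (p ++ 1 ∷ []) r)) s (2 + m * nodeCost) G
    pair k {φ} {χ} e₀ e₁ en lt = decides-⇔ {choose k (goto (p ++ 0 ∷ []) r) (goto (p ++ 1 ∷ []) r)} {s} (pair-⇔ k en)
      (decides-choose {k} (ih {down g 0} {s} e₀ (rep-same R refl refl refl refl) (less {rank φ} {rank χ} lt))
                          (ih {down g 1} {s} e₁ (rep-same R refl refl refl refl) (lessʳ {rank φ} {rank χ} lt)))

    quantifier : ∀ k {x φ} → x < V → subAt φ₀ (p ++ 0 ∷ []) ≡ just φ → node φ₀ n g ≡ choice k (map (afterVar {φ₀ = φ₀} {g = g} x) (allFin n)) →
                 K s * W + suc (rank φ) ≤ m →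
                 Decides (pickValue k hN (vh x) hT hA ⨾ goto (p ++ 0 ∷ []) r) s (pickCost n + suc (m * nodeCost)) G
    quantifier k {x} {φ} x<V e₀ en lt = decides-⇔ {pickValue k hN (vh x) hT hA ⨾ goto (p ++ 0 ∷ []) r} {s}
      (choice-⇔ k (afterVar {φ₀ = φ₀} {g = g} x) (allFin n) ∈-allFin en)
      (decides-var {k} {x} {s} {f = asg g} x<V (work R) (vars R) (λ a →
        ih {afterVar {φ₀ = φ₀} {g = g} x a} {s [ vh x ≔ suc (toℕ a) ]} e₀
          (rep (scratch (atN (work R)) (atT (work R)) (atA (work R)) (atC (work R))) (atI R)
               (vars-assign {asg g} {s} {x} a x<V (vars R)) (clocks R) (bits R))
          (less′ {rank φ} lt)))

    pickBound : pickCost n + 1 ≤ nodeCost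
    pickBound = +-mono-≤ (≤-trans (m≤n+m (pickCost n) (suc accCost)) (≤-trans (m≤m+n _ (V′ * (suc accCost + pickCost n)))
                  (≤-trans (m≤m+n _ (Z * 2)) (m≤m+n _ (n * 18))))) (s≤s z≤n)

    edit : ∀ b {S xs φ} (F : Vec (Fin n) (arity τ S) → GState τ n) → SymOK τ V S × All (_< V) (toList xs) →
           subAt φ₀ (p ++ 0 ∷ []) ≡ just φ → node φ₀ n g ≡ choice r (map F (allVecs n (arity τ S))) →
           (∀ t → pos (F t) ≡ p ++ 0 ∷ []) → (∀ t → eloiseVer (F t) ≡ r) → (∀ t → visits (F t) ≡ visits g) →
           (∀ t → asg (F t) ≡ assignAll (asg g) (toList xs) (toList t)) →
           (∀ t → rels (F t) S (toList t) ≡ b) →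
           (∀ t Q u → Q ≢ S ⊎ u ≢ toList t → rels (F t) Q u ≡ rels g Q u) →
           K s * W + suc (rank φ) ≤ m →
           Decides (pickTuple r (toList xs) (act hI (λ _ c → setBit S b c , stay) ⨾ clear hI ⨾ goto (p ++ 0 ∷ []) r)) s (suc m * nodeCost) G
    edit b {S} {xs} {φ} F (sok , bd) e₀ en hpos hver hvis hasg hset hkeep lt =
      decides-≤ {Pe} {s} cost (decides-⇔ {Pe} {s} (choice-⇔ r F (allVecs n (arity τ S)) ∈-allVecs en)
        (decides-tuple xs 0 {r} {s} (asg g) (λ t → Wins {φ₀ = φ₀} (F t)) bd (work R) (vars R)
          (subst (_< 1) (sym (atI R)) (s≤s z≤n)) (<⇒≤ (sat S sok)) after))
      where
      P₁ = act hI (λ _ c → setBit S b c , stay) ⨾ clear hI ⨾ goto (p ++ 0 ∷ []) r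
      Pe = pickTuple r (toList xs) P₁
      T₁ = 1 + (Z * 2 + 1 + suc (m * nodeCost))
      after : ∀ t s′ → Frame s s′ → VarsRel (assignAll (asg g) (toList xs) (toList t)) s′ → hd s′ hI ≡ hd s hI * n ^ arity τ S + idx t →
              Decides P₁ s′ T₁ (Wins {φ₀ = φ₀} (F t))
      after t s′ fr vr eI = decides-≤ {P₁} {s′} (s≤s (+-monoˡ-≤ (suc (m * nodeCost)) (+-monoˡ-≤ 1 (*-monoˡ-≤ 2 I≤Z))))
        (decides-seq {act hI (λ _ c → setBit S b c , stay)} (det-≈ {act hI (λ _ c → setBit S b c , stay)} fix (det-act refl))
          (decides-seq {clear hI} (det-clear {hI} {s₁})
            (subst₂ (λ q v → Decides (goto q v) (s₁ [ hI ≔ 0 ]) (suc (m * nodeCost)) (Wins {φ₀ = φ₀} (F t))) (hpos t) (hver t)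
              (ih {F t} {s₁ [ hI ≔ 0 ]} (trans (cong (subAt φ₀) (hpos t)) e₀) R′
                (subst (λ k → k * W + rank φ < m) (sym K≡) (less′ {rank φ} lt))))))
        where
        at : hd s′ hI ≡ idx t
        at = trans eI (cong (λ i → i * n ^ arity τ S + idx t) (atI R))
        I≤Z : hd s′ hI ≤ Z
        I≤Z = ≤-trans (≤-reflexive at) (≤-trans (<⇒≤ (idx< t)) (pow≤Z {arity τ S} (<⇒≤ (sat S sok))))
        s₁ = st (hd s′) (setAt (tp s′) (hd s′ hI) (setBit S b (tp s′ (hd s′ hI))))
        fix : st (MultiHead.setHd eqHd (hd s′) hI (hd s′ hI)) (setAt (tp s′) (hd s′ hI) (setBit S b (tp s′ (hd s′ hI)))) ≈ s₁
        fix = ≈-intro (hd≈ (upd-id s′ hI refl)) (λ _ → refl)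
        w′ = frame-scratch fr (work R)
        K≡ : K (s₁ [ hI ≔ 0 ]) ≡ K s
        K≡ = total-cong (fK fr)
        bits′ : TapeRel (rels (F t)) (s₁ [ hI ≔ 0 ])
        -- All relations share the cell, but only the track of `S` changes in it; so both the cell
        -- and the relation have to be compared.
        bits′ Q qok u with idx u ≡ᵇ hd s′ hI in ie
        ... | false = trans (cong (bit Q) (ft fr (idx u))) (trans (bits R Q qok u) (sym (hkeep t Q (toList u) diff)))
          where
          apart : ∀ Q (u : Vec (Fin n) (arity τ Q)) → idx u ≢ idx t → Q ≢ S ⊎ toList u ≢ toList t
          apart Q u ne with symEq τ Q S in se
          ... | false = inj₁ (λ { refl → contradiction (trans (sym (symEq-refl τ Q)) se) (λ ()) })
          ... | true with symEq-sound τ Q S se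
          ...   | refl = inj₂ (λ q → ne (cong idx (toList-inj u t q)) )
          diff = apart Q u (λ z → ≡ᵇ-false⇒≢ ie (trans z (sym at)))
        ... | true with symEq τ Q S in se
        ...   | false = trans (bit-setBit-other Q S b (tp s′ (hd s′ hI)) qok sok Q≢S)
                  (trans (cong (bit Q) (trans (ft fr (hd s′ hI)) (cong (tp s) (sym (≡ᵇ-sound _ _ ie)))))
                    (trans (bits R Q qok u) (sym (hkeep t Q (toList u) (inj₁ Q≢S)))))
          where Q≢S : Q ≢ S
                Q≢S refl = contradiction (trans (sym (symEq-refl τ Q)) se) (λ ())
        ...   | true with symEq-sound τ Q S se
        ...     | refl with idx-injective u t (trans (≡ᵇ-sound _ _ ie) at)
        ...       | refl = trans (bit-setBit-same S b (tp s′ (hd s′ hI))) (sym (hset t))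
        R′ : Rep (F t) (s₁ [ hI ≔ 0 ])
        R′ = rep (scratch (atN w′) (atT w′) (atA w′) (atC w′)) refl
               (λ v → trans (vr v) (cong (λ f → value (f (toℕ v))) (sym (hasg t))))
               (λ q {_} {t′} e → trans (fK fr (nodeAt q)) (trans (clocks R q e) (cong (λ f → evalPol t′ n ∸ f q) (sym (hvis t))))) bits′
      cost : arity τ S * (pickCost n + accCost) + T₁ ≤ suc m * nodeCost
      cost = ≤-trans (≤-reflexive (lemma (arity τ S * (pickCost n + accCost)) (Z * 2) (m * nodeCost)))
        (+-monoˡ-≤ (m * nodeCost) (≤-trans (+-monoˡ-≤ 3 (+-monoˡ-≤ (Z * 2) (*-mono-≤ (<⇒≤ (sat S sok))
          (≤-trans (≤-reflexive (+-comm (pickCost n) accCost)) (+-monoˡ-≤ (pickCost n) (n≤1+n accCost))))))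
          (+-mono-≤ (m≤m+n (V * (suc accCost + pickCost n) + Z * 2) (n * 18)) (m≤m+n 3 17))))
        where lemma : ∀ a z c → a + (1 + (z + 1 + suc c)) ≡ a + z + 3 + c
              lemma = solve-∀

    step-at : ∀ ψ → subAt φ₀ p ≡ just ψ → K s * W + rank ψ ≤ m → Goal ψ
    step-at (atom S xs) e lt = leaf {atom S xs} (play-atom R e)
    step-at (eq x y) e lt = leaf {eq x y} (play-eq R e)
    step-at tt e lt = decides-verdict (winner {g} (node-tt {φ₀ = φ₀} {g = g} e))
    step-at ff e lt = decides-verdict (winner {g} (node-ff {φ₀ = φ₀} {g = g} e))
    step-at (neg φ) e lt = bound {neg φ} (small (s≤s z≤n)) (decides-⇔ {goto (p ++ 0 ∷ []) (not r)} {s} (det-⇔ (node-neg {φ₀ = φ₀} {g = g} e))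
      (ih {record (down g 0) { eloiseVer = not r }} {s} (childOf 0 e refl) (rep-same R refl refl refl refl) (less′ {rank φ} lt)))
    step-at (and φ χ) e lt = bound {and φ χ} (small (s≤s (s≤s z≤n))) (pair (not r) (childOf 0 e refl) (childOf 1 e refl) (node-and {φ₀ = φ₀} {g = g} e) lt)
    step-at (or φ χ) e lt = bound {or φ χ} (small (s≤s (s≤s z≤n))) (pair r (childOf 0 e refl) (childOf 1 e refl) (node-or {φ₀ = φ₀} {g = g} e) lt)
    step-at (ex x φ) e lt = bound {ex x φ} pickBound (decides-≤ {playNode p r (just (ex x φ))} {s} (≤-reflexive (sym (+-assoc (pickCost n) 1 _)))
      (quantifier r (proj₁ (fits-sub φ₀ p fits e)) (childOf 0 e refl) (node-ex {φ₀ = φ₀} {g = g} e) lt))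
    step-at (all x φ) e lt = bound {all x φ} pickBound (decides-≤ {playNode p r (just (all x φ))} {s} (≤-reflexive (sym (+-assoc (pickCost n) 1 _)))
      (quantifier (not r) (proj₁ (fits-sub φ₀ p fits e)) (childOf 0 e refl) (node-all {φ₀ = φ₀} {g = g} e) lt))
    step-at (ins S xs φ) e lt = edit true {S} {xs} (afterIns {φ₀ = φ₀} {g = g} S xs) (proj₁ (fits-sub φ₀ p fits e)) (childOf 0 e refl) (node-ins {φ₀ = φ₀} {g = g} e)
      (λ _ → refl) (λ _ → refl) (λ _ → refl) (λ _ → refl) (λ t → cong (_∨ rels g S (toList t)) (cong₂ _∧_ (symEq-refl τ S) (listEq-refl finEq-refl (toList t))))
      (λ t Q u d → cong (_∨ rels g Q u) (differ τ Q S u (toList t) d)) lt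
    step-at (del S xs φ) e lt = edit false {S} {xs} (afterDel {φ₀ = φ₀} {g = g} S xs) (proj₁ (fits-sub φ₀ p fits e)) (childOf 0 e refl) (node-del {φ₀ = φ₀} {g = g} e)
      (λ _ → refl) (λ _ → refl) (λ _ → refl) (λ _ → refl) (λ t → cong (λ b → not b ∧ rels g S (toList t)) (cong₂ _∧_ (symEq-refl τ S) (listEq-refl finEq-refl (toList t))))
      (λ t Q u d → cong (λ b → not b ∧ rels g Q u) (differ τ Q S u (toList t) d)) lt
    step-at (lab C t φ) e lt = byCase (hd s (ck p)) refl
      where
      byCase : ∀ v → hd s (ck p) ≡ v → Goal (lab C t φ)
      byCase zero z = bound {lab C t φ} (small (s≤s z≤n)) (decides-zero {t = m * nodeCost} z (decides-verdict
        (no-winner {g} (node-stuck {φ₀ = φ₀} {g = g} e (<ᵇ-false {visits g p} {evalPol t n} (m∸n≡0⇒m≤n (trans (sym (clocks R p e)) z)))))))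
      byCase (suc v) z = bound {lab C t φ} (small (s≤s (s≤s (s≤s z≤n)))) (decides-suc z
        (decides-⇔ {dec (ck p) ⨾ goto (p ++ 0 ∷ []) r} {s} (det-⇔ (node-lab {φ₀ = φ₀} {g = g} e (<ᵇ-true vis<)))
          (decides-seq (det-dec {ck p} {s} z) (ih {afterLab {φ₀ = φ₀} {g = g}} {s [ ck p ≔ v ]} (childOf 0 e refl) R′ lt′))))
        where
        vis< : visits g p < evalPol t n
        vis< = m∸n≢0⇒n<m (λ q → contradiction (trans (sym z) (trans (clocks R p e) q)) (λ ()))
        clocks′ : ClockRel (afterLab {φ₀ = φ₀} {g = g}) (s [ ck p ≔ v ])
        clocks′ q {C′} {t′} {ψ′} e′ with listEq _≡ᵇ_ q p in qp
        ... | true with pathEq-sound q p qp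
        ...   | refl with trans (sym e′) e
        ...     | refl = trans (get-same s (ck p)) (trans (cong pred (sym z)) (trans (cong pred (clocks R p e)) (pred[m∸n]≡m∸[1+n] (evalPol t n) (visits g p))))
        clocks′ q {C′} {t′} {ψ′} e′ | false = trans (get-other s {ck p} {ck q} v (keys {nodeAt q} {nodeAt p} (λ i → distinct (cong pathOf i)))) (clocks R q e′)
          where
          distinct : pathOf (nodeAt q) ≢ pathOf (nodeAt p)
          distinct i = contradiction (trans (sym (trans (cong (λ q → listEq _≡ᵇ_ q p) (trans (sym (pathOf-nodeAt q e′)) (trans i (pathOf-nodeAt p e)))) (pathEq-refl p))) qp) (λ ())
          keys : ∀ {i j : Fin nodes} → i ≢ j → (toℕ i ≡ᵇ toℕ j) ≡ false
          keys ne = ≢⇒≡ᵇ-false (λ q → ne (FP.toℕ-injective q))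
        R′ : Rep (afterLab {φ₀ = φ₀} {g = g}) (s [ ck p ≔ v ])
        R′ = rep (scratch (atN (work R)) (atT (work R)) (atA (work R)) (atC (work R))) (atI R) (vars R) clocks′ (bits R)
        K≡ : suc (K (s [ ck p ≔ v ])) ≡ K s
        K≡ = total-dec (λ i → hd s (hK i)) (λ i → hd (s [ ck p ≔ v ]) (hK i)) (nodeAt p) v z (λ i → refl)
        lt′ : K (s [ ck p ≔ v ]) * W + rank φ < m
        lt′ = ≤-trans (s≤s (≤-trans (+-monoʳ-≤ (K (s [ ck p ≔ v ]) * W) (≤-trans (rank≤weight φ) (≤-trans (n≤1+n _) (weight-sub φ₀ p e))))
                (≤-reflexive (trans (+-comm (K (s [ ck p ≔ v ]) * W) W) (cong (_* W) K≡))))) (≤-trans (≤-reflexive (+-comm 1 _)) lt)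
    step-at (loop C) e lt = byCase (findLabel φ₀ C [] p nothing) refl
      where
      byCase : ∀ q → findLabel φ₀ C [] p nothing ≡ q → Decides (playNode p r (just (loop C))) s (suc m * nodeCost) G
      byCase nothing q = subst (λ z → Decides (maybe (λ q → goto q r) (verdict false) z) s (suc m * nodeCost) G) (sym q)
        (decides-verdict (no-winner {g} (trans (node-loop {φ₀ = φ₀} {g = g} e) (cong (maybe _ (terminal nothing)) q))))
      byCase (just q) eq′ with findLabel-sound φ₀ φ₀ C [] p nothing refl (λ _ ()) eq′
      ... | t , φ , e′ = subst (λ z → Decides (maybe (λ q → goto q r) (verdict false) z) s (suc m * nodeCost) G) (sym eq′)
        (decides-≤ {goto q r} {s} (+-monoˡ-≤ (m * nodeCost) (small (s≤s z≤n)))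
        (decides-⇔ {goto q r} {s} (det-⇔ (trans (node-loop {φ₀ = φ₀} {g = g} e) (cong (maybe _ (terminal nothing)) eq′)))
          (ih {record g { pos = q }} {s} e′ (rep-same R refl refl refl refl) (less′ {1} lt))))

-- Preparing the tape from the input word.

-- Reading the encoding of a structure

nth-drop : ∀ {A : Set} L (xs : List A) j → nth (drop L xs) j ≡ nth xs (L + j)
nth-drop zero xs j = refl
nth-drop (suc L) [] j = refl
nth-drop (suc L) (x ∷ xs) j = nth-drop L xs j

fromListN-toList : ∀ {A : Set} {k} (v : Vec A k) → fromListN k (toList v) ≡ just v
fromListN-toList [] = refl
fromListN-toList (x ∷ v) rewrite fromListN-toList v = refl

bool-ext : ∀ {a b} → (a ≡ true → b ≡ true) → (b ≡ true → a ≡ true) → a ≡ b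
bool-ext {true} f g = sym (f refl)
bool-ext {false} {true} f g = g refl
bool-ext {false} {false} f g = refl

<ᵇ-suc : ∀ j d → (j <ᵇ suc d) ≡ ((j ≡ᵇ d) ∨ (j <ᵇ d))
<ᵇ-suc zero zero = refl
<ᵇ-suc zero (suc d) = refl
<ᵇ-suc (suc j) zero = refl
<ᵇ-suc (suc j) (suc d) = <ᵇ-suc j d

is1 : Maybe Bool → Bool
is1 (just true) = true
is1 _ = false

evalCost : Pol → ℕ → ℕ
evalCost [] n = 0
evalCost (c ∷ cs) n = evalCost cs n + (mulCost (evalPol cs n) n + c)

clockCost : ℕ → Maybe Pol → ℕ
clockCost n nothing = 0
clockCost n (just t) = evalCost t n + (evalPol t n * 3 + 1)

module Setup {τ : Voc} (φ₀ : Formula τ) (V′ : ℕ) (fits : Fits (suc V′) φ₀) (fitsτ : ∀ i → lookupL τ i < suc V′) (n₁ : ℕ) where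
  open GameProgram φ₀ V′
  open BoolEq (eqHd {V} {nodes})
  open Programs {H} {Γ} eqHd hI labels hiding (Pr)
  open Machine blocks
  open Routines {H} {Γ} eqHd hI labels blocks
  open Play φ₀ V′ fits n₁
  open Equivalence using (to; from)
  open Scratch

  Reads : St → ℕ → List Bool → Set
  Reads s p bs = ∀ j → proj₁ (tp s (p + j)) ≡ nth bs j

  -- The loop invariant of the copying in closed form: what the tape is once `d` bits of the table
  -- have been transferred.
  copied : Fin (length τ) → List Bool → ℕ → (ℕ → Γ) → ℕ → Γ
  copied i bs d t j = if (j <ᵇ d) ∧ is1 (nth bs j) then setBit (inj₁ i) true (t j) else t j

  copied-input : ∀ i bs d t j → proj₁ (copied i bs d t j) ≡ proj₁ (t j)
  copied-input i bs d t j with (j <ᵇ d) ∧ is1 (nth bs j)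
  ... | true = refl
  ... | false = refl

  copied-step : ∀ i bs d t {b} → nth bs d ≡ just b → ∀ j →
    (if b then setAt (copied i bs d t) d (setBit (inj₁ i) true (copied i bs d t d)) j else copied i bs d t j) ≡ copied i bs (suc d) t j
  copied-step i bs d t {true} e j rewrite <ᵇ-suc j d with j ≡ᵇ d in jd
  ... | false = refl
  ... | true rewrite ≡ᵇ-sound j d jd | e | <ᵇ-false {d} {d} ≤-refl = refl
  copied-step i bs d t {false} e j rewrite <ᵇ-suc j d with j ≡ᵇ d in jd
  ... | false = refl
  ... | true rewrite ≡ᵇ-sound j d jd | e | <ᵇ-false {d} {d} ≤-refl = refl

  det-copyCell : ∀ i {s b} → proj₁ (tp s (hd s hP)) ≡ just b →
    Det (copyCell i) s (st (hd (s [ hP ≔ suc (hd s hP) ] [ hI ≔ suc (hd s hI) ]))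
      (λ j → if b then setAt (tp s) (hd s hI) (setBit (inj₁ i) true (tp s (hd s hI))) j else tp s j)) 5
  det-copyCell i {s} {true} e = det-else (nb e) (det-then (one e) (det-seq {act hI (λ _ g → setBit (inj₁ i) true g , stay)}
      (det-≈ {act hI (λ _ g → setBit (inj₁ i) true g , stay)} {s} {s″ = s₁} (≈-intro (hd≈ (upd-id s hI refl)) (λ _ → refl)) (det-act refl))
      (det-seq (det-inc {hP} {s₁}) (det-≈ {inc hI} (≈-intro (λ _ → refl) (λ _ → refl)) (det-inc {hI} {s₁ [ hP ≔ suc (hd s hP) ]})))))
    where
    s₁ : St
    s₁ = st (hd s) (setAt (tp s) (hd s hI) (setBit (inj₁ i) true (tp s (hd s hI))))
    nb : ∀ {g b} → proj₁ g ≡ just b → holds nothing g ≡ false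
    nb {just _ , _} e = refl
    one : ∀ {g} → proj₁ g ≡ just true → holds (just true) g ≡ true
    one {just true , _} e = refl
  det-copyCell i {s} {false} e = det-≤ (n≤1+n 4) (det-else (nb e) (det-else (zer e)
      (det-seq (det-inc {hP} {s}) (det-≈ {inc hI} (≈-intro (λ _ → refl) (λ _ → refl)) (det-inc {hI} {s [ hP ≔ suc (hd s hP) ]})))))
    where
    nb : ∀ {g b} → proj₁ g ≡ just b → holds nothing g ≡ false
    nb {just _ , _} e = refl
    zer : ∀ {g} → proj₁ g ≡ just false → holds (just true) g ≡ false
    zer {just false , _} e = refl

  module _ (i : Fin (length τ)) (s : St) (w : Scratch s) (I0 : hd s hI ≡ 0) (bs : List Bool) (rd : Reads s (hd s hP) bs) where
    L p : ℕ
    L = n ^ lookupL τ i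
    p = hd s hP

    L≤Z : L ≤ Z
    L≤Z = pow≤Z {lookupL τ i} (<⇒≤ (fitsτ i))

    copying : ℕ → St
    copying c = st (hd (s [ hI ≔ L ∸ c ] [ hP ≔ p + (L ∸ c) ] [ hC ≔ c ])) (copied i bs (L ∸ c) (tp s))

    copying-step : ∀ c → c < L → L ∸ suc c < length bs → Det (copyCell i) (copying (suc c) [ hC ≔ c ]) (copying c) 5
    copying-step c lt within with nth-within bs (L ∸ suc c) within
    ... | b , e = det-≈ {copyCell i} (≈-intro hds cells) (det-copyCell i {copying (suc c) [ hC ≔ c ]} {b}
          (trans (copied-input i bs (L ∸ suc c) (tp s) (p + (L ∸ suc c))) (trans (rd (L ∸ suc c)) e)))
      where
      hds : ∀ h → _ ≡ hd (copying c) h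
      hds hN = refl
      hds hP = trans (sym (+-suc p _)) (cong (p +_) (∸-step lt))
      hds hI = ∸-step lt
      hds hT = refl
      hds hA = refl
      hds hC = refl
      hds (hV v) = refl
      hds (hK v) = refl
      cells : ∀ j → _ ≡ tp (copying c) j
      cells j = trans (copied-step i bs (L ∸ suc c) (tp s) e j) (cong (λ d → copied i bs d (tp s) j) (∸-step lt))

    afterCopy : St
    afterCopy = st (hd (s [ hP ≔ p + L ])) (copied i bs L (tp s))

    counted : St
    counted = s [ hC ≔ L ]

    decides-power : ∀ a j {s P T Q} → Scratch s → hd s hI ≡ n ^ j → j + a ≤ V →
                    Decides P (s [ hI ≔ n ^ (j + a) ]) T Q → Decides (power a P) s (a * mulCost Z n + T) Q
    decides-power zero j {s} {P} w e le D = decides-≈ {P} (upd-id s hI (trans (cong (n ^_) (+-identityʳ j)) (sym e))) D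
    decides-power (suc a) j {s} {P} {T} w e le D =
      decides-≤ {power (suc a) P} {s} (≤-reflexive (sym (+-assoc (mulCost Z n) (a * mulCost Z n) T)))
      (decides-seq {mulBy hN hI hT hA} (det-≤ {mulBy hN hI hT hA} {s} cost (det-≈ {mulBy hN hI hT hA} (upd-cong {s} hI ≈-refl val)
          (det-mulBy {hN} {hI} {hT} {hA} {s} refl refl refl refl refl refl (atT w) (atA w))))
        (decides-power a (suc j) {s [ hI ≔ n ^ suc j ]} {P} (scratch (atN w) (atT w) (atA w) (atC w)) refl (≤-trans (≤-reflexive (sym (+-suc j a))) le)
          (decides-≈ {P} (≈-sym (≈-trans (upd-upd s hI _ _) (upd-cong {s} hI ≈-refl (cong (n ^_) (sym (+-suc j a)))))) D)))
      where
      val : hd s hI * hd s hN ≡ n ^ suc j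
      val = trans (cong₂ _*_ e (atN w)) (*-comm (n ^ j) n)
      cost : mulCost (hd s hI) (hd s hN) ≤ mulCost Z n
      cost rewrite atN w | e = mulCost-mono n (pow≤Z {j} (≤-trans (m≤m+n j (suc a)) le))

    relCost : ℕ
    -- The last 3 pays for the pass that is broken off when the word is too short.
    relCost = 1 + (V * mulCost Z n + (Z * 3 + 1 + (Z * 7 + 1 + (Z * 2 + 1)))) + 3

    private
      copyLoop : Pr → Pr
      copyLoop P = for hC (copyCell i) ⨾ clear hI ⨾ P

    decides-count : ∀ {P T Q} → Decides (copyLoop P) counted T Q →
                    Decides (copyRel i P) s (1 + (V * mulCost Z n + (Z * 3 + 1 + T))) Q
    decides-count {P} {T} D = decides-≤ {copyRel i P} {s} (s≤s (+-mono-≤ (*-monoˡ-≤ (mulCost Z n) (<⇒≤ (fitsτ i))) (+-monoˡ-≤ T (+-monoˡ-≤ 1 (*-monoˡ-≤ 3 L≤Z)))))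
      (decides-seq {inc hI} (det-≈ {inc hI} (upd-cong {s} hI ≈-refl (cong suc I0)) (det-inc {hI} {s}))
        (decides-power (lookupL τ i) 0 {s [ hI ≔ 1 ]} (scratch (atN w) (atT w) (atA w) (atC w)) refl (<⇒≤ (fitsτ i))
          (decides-seq {move hI hC} (det-≈ {move hI hC} fix (det-move {hI} {hC} {s [ hI ≔ 1 ] [ hI ≔ L ]} refl)) D)))
      where
      fix : (s [ hI ≔ 1 ] [ hI ≔ L ] [ hC ≔ hd s hC + L ] [ hI ≔ 0 ]) ≈ counted
      fix = ≈-intro (λ { hN → refl ; hP → refl ; hI → sym I0 ; hT → refl ; hA → refl ; hC → cong (_+ L) (atC w) ; (hV v) → refl ; (hK v) → refl }) (λ _ → refl)

    start≈ : copying L ≈ counted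
    start≈ = ≈-intro (λ { hN → refl ; hP → trans (cong (p +_) (n∸n≡0 L)) (+-identityʳ p) ; hI → trans (n∸n≡0 L) (sym I0) ; hT → refl ; hA → refl ; hC → refl
                        ; (hV v) → refl ; (hK v) → refl }) (λ j → cong (λ d → copied i bs d (tp s) j) (n∸n≡0 L))

    decides-copyRel : ∀ {P T Q} → L ≤ length bs → Decides P afterCopy T Q → Decides (copyRel i P) s (relCost + T) Q
    decides-copyRel {P} {T} le D = decides-≤ {copyRel i P} {s} cost (decides-count
      (decides-seq {for hC (copyCell i)} (det-≈ˡ {for hC (copyCell i)} start≈ (det-for {hC} {copyCell i} copying 5 L (λ m → refl)
          (λ c lt → copying-step c lt (≤-trans (≤-reflexive (∸-step lt)) (≤-trans (m∸n≤m L c) le)))))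
        (decides-seq {clear hI} (det-≈ {clear hI} fix (det-clear {hI} {copying 0})) D)))
      where
      fix : (copying 0 [ hI ≔ 0 ]) ≈ afterCopy
      fix = ≈-intro (λ { hN → refl ; hP → refl ; hI → sym I0 ; hT → refl ; hA → refl ; hC → sym (atC w) ; (hV v) → refl ; (hK v) → refl }) (λ _ → refl)
      cost : 1 + (V * mulCost Z n + (Z * 3 + 1 + (L * 7 + 1 + (L * 2 + 1 + T)))) ≤ relCost + T
      cost = ≤-trans (s≤s (+-monoʳ-≤ (V * mulCost Z n) (+-monoʳ-≤ (Z * 3 + 1) (+-mono-≤ (+-monoˡ-≤ 1 (*-monoˡ-≤ 7 L≤Z)) (+-monoˡ-≤ T (+-monoˡ-≤ 1 (*-monoˡ-≤ 2 L≤Z)))))))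
        (≤-trans (m≤n+m _ 3) (≤-reflexive (lemma (V * mulCost Z n) Z T)))
        where lemma : ∀ v z T → 3 + (1 + (v + (z * 3 + 1 + (z * 7 + 1 + (z * 2 + 1 + T))))) ≡ 1 + (v + (z * 3 + 1 + (z * 7 + 1 + (z * 2 + 1)))) + 3 + T
              lemma = solve-∀

    decides-short : ∀ {P Q} → length bs < L → ¬ Q → Decides (copyRel i P) s relCost Q
    decides-short {P} {Q} lt nq = decides-≤ {copyRel i P} {s} cost (decides-count (false , stops , mk⇔ (λ ()) (λ q → contradiction q nq)))
      where
      -- What the counter shows, after its decrement, in the pass that meets the blank; `k` complete
      -- passes precede it.
      r = L ∸ suc (length bs)
      k = length bs
      L≡ : suc r + k ≡ L
      L≡ = trans (sym (+-suc r k)) (m∸n+n≡m lt)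
      L∸r : L ∸ suc r ≡ k
      L∸r = trans (cong (_∸ suc r) (sym L≡)) (m+n∸m≡n (suc r) k)
      blank : holds nothing (tp (copying (suc r)) (p + (L ∸ suc r))) ≡ true
      blank = isBlank (trans (copied-input i bs (L ∸ suc r) (tp s) (p + (L ∸ suc r))) (trans (rd (L ∸ suc r)) (nth-beyond bs _ (≤-reflexive (sym L∸r)))))
        where isBlank : ∀ {g} → proj₁ g ≡ nothing → holds nothing g ≡ true
              isBlank {nothing , _} e = refl
      stops : Goes (copyLoop P) counted false (k * 7 + (2 + 1))
      stops = goes-≈ {copyLoop P} (≈-trans (subst (λ v → copying (suc r + k) ≈ copying v) L≡ ≈-refl) start≈)
        (goes-for {hC} {copyCell i} {clear hI ⨾ P} copying 5 r k (λ m → refl)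
          (λ m le lt′ → copying-step m (≤-trans lt′ (≤-reflexive L≡))
            (≤-trans (≤-reflexive (∸-step (≤-trans lt′ (≤-reflexive L≡)))) (≤-trans (∸-monoʳ-≤ L le) (≤-reflexive L∸r))))
          (goes-then blank goes-verdict))
      cost : 1 + (V * mulCost Z n + (Z * 3 + 1 + (k * 7 + (2 + 1)))) ≤ relCost
      cost = ≤-trans (s≤s (+-monoʳ-≤ (V * mulCost Z n) (+-monoʳ-≤ (Z * 3 + 1) (+-monoˡ-≤ 3 (≤-trans (*-monoˡ-≤ 7 (≤-trans (<⇒≤ lt) L≤Z))
               (≤-trans (m≤m+n (Z * 7) (1 + (Z * 2 + 1))) (≤-reflexive (sym (+-assoc (Z * 7) 1 _)))))))))
        (≤-reflexive (lemma (V * mulCost Z n) (Z * 3 + 1) (Z * 7 + 1 + (Z * 2 + 1))))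
        where lemma : ∀ v a z → 1 + (v + (a + (z + 3))) ≡ 1 + (v + (a + z)) + 3
              lemma = solve-∀

  segLength : List (Fin (length τ)) → ℕ
  segLength [] = 0
  segLength (i ∷ is) = n ^ lookupL τ i + segLength is

  copyCost : ℕ → ℕ
  copyCost c = c * (1 + (V * mulCost Z n + (Z * 3 + 1 + (Z * 7 + 1 + (Z * 2 + 1)))) + 3)

  -- Reading is unaffected by what the other tracks receive.
  reads-drop : ∀ i {s bs L} → Reads s (hd s hP) bs → Reads (st (hd (s [ hP ≔ hd s hP + L ])) (copied i bs L (tp s))) (hd s hP + L) (drop L bs)
  reads-drop i {s} {bs} {L} rd j = trans (copied-input i bs L (tp s) (hd s hP + L + j))
    (trans (cong (λ q → proj₁ (tp s q)) (+-assoc (hd s hP) L j)) (trans (rd (L + j)) (sym (nth-drop L bs j))))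

  afterAll : List (Fin (length τ)) → List Bool → St → St
  afterAll [] bs s = s
  afterAll (i ∷ is) bs s = afterAll is (drop (n ^ lookupL τ i) bs) (st (hd (s [ hP ≔ hd s hP + n ^ lookupL τ i ])) (copied i bs (n ^ lookupL τ i) (tp s)))

  decides-copyAll : ∀ is {s bs P T Q} → Scratch s → hd s hI ≡ 0 → Reads s (hd s hP) bs →
    (segLength is ≤ length bs → Decides P (afterAll is bs s) T Q) → (length bs < segLength is → ¬ Q) →
    Decides (copyAll is P) s (copyCost (length is) + T) Q
  decides-copyAll [] w I0 rd D nq = D z≤n
  decides-copyAll (i ∷ is) {s} {bs} {P} {T} {Q} w I0 rd D nq with n ^ lookupL τ i ≤? length bs
  ... | no gt = decides-≤ {copyAll (i ∷ is) P} {s} (≤-trans (m≤m+n _ (copyCost (length is))) (m≤m+n _ T))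
        (decides-short i s w I0 bs rd (≰⇒> gt) (nq (≤-trans (≰⇒> gt) (m≤m+n _ (segLength is)))))
  ... | yes le = decides-≤ {copyAll (i ∷ is) P} {s} (≤-reflexive (sym (+-assoc _ (copyCost (length is)) T)))
        (decides-copyRel i s w I0 bs rd le (decides-copyAll is (scratch (atN w) (atT w) (atA w) (atC w)) I0 (reads-drop i {s} {bs} {n ^ lookupL τ i} rd)
          (λ q → D (≤-trans (+-monoʳ-≤ (n ^ lookupL τ i) q) (≤-reflexive (trans (cong (n ^ lookupL τ i +_) (LP.length-drop (n ^ lookupL τ i) bs)) (m+[n∸m]≡n le)))))
          (λ q → nq (subst (_< len + segLength is) rest (+-monoʳ-< len q)))))
    where
    len = n ^ lookupL τ i
    rest : len + length (drop len bs) ≡ length bs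
    rest = trans (cong (len +_) (LP.length-drop len bs)) (m+[n∸m]≡n le)

  decides-horner : ∀ t {s P T Q} → Scratch s → hd s hI ≡ 0 → Decides P (s [ hI ≔ evalPol t n ]) T Q →
                   Decides (horner t P) s (evalCost t n + T) Q
  decides-horner [] {s} {P} w I0 D = decides-≈ {P} (upd-id s hI (sym I0)) D
  decides-horner (c ∷ cs) {s} {P} {T} w I0 D = decides-≤ {horner (c ∷ cs) P} {s} (≤-reflexive (lemma (evalCost cs n) (mulCost X n) c T))
    (decides-horner cs {s} {mulBy hN hI hT hA ⨾ incs c hI P} w I0
      (decides-seq {mulBy hN hI hT hA} (det-≤ {mulBy hN hI hT hA} {s [ hI ≔ X ]} (≤-reflexive (cong (mulCost X) (atN w)))
          (det-mulBy {hN} {hI} {hT} {hA} {s [ hI ≔ X ]} refl refl refl refl refl refl (atT w) (atA w)))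
        (decides-incs {hI} {s₁} {P} c (decides-≈ {P} (≈-sym fix) D))))
    where
    X = evalPol cs n
    s₁ = s [ hI ≔ X ] [ hI ≔ X * hd s hN ]
    val : c + X * hd s hN ≡ c + n * X
    val = cong (c +_) (trans (cong (X *_) (atN w)) (*-comm X n))
    fix : (s₁ [ hI ≔ c + X * hd s hN ]) ≈ (s [ hI ≔ c + n * X ])
    fix = ≈-trans (upd-upd (s [ hI ≔ X ]) hI (X * hd s hN) (c + X * hd s hN)) (≈-trans (upd-upd s hI X (c + X * hd s hN)) (upd-cong {s} hI ≈-refl val))
    lemma : ∀ e m c T → e + (m + (c + T)) ≡ e + (m + c) + T
    lemma = solve-∀

  clock : Fin nodes → Maybe Pol
  clock i = clockOf (subAt φ₀ (pathOf i))

  clockValue : Maybe Pol → ℕ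
  clockValue nothing = 0
  clockValue (just t) = evalPol t n

  clocksCost : List (Fin nodes) → ℕ
  clocksCost [] = 0
  clocksCost (i ∷ is) = clockCost n (clock i) + clocksCost is

  open import Data.List.Relation.Unary.Unique.Propositional using (Unique; []; _∷_)
  open import Data.List.Relation.Unary.Unique.Propositional.Properties using (allFin⁺)

  record Ready (s s′ : St) : Set where
    field
      work′  : Scratch s′
      I0′    : hd s′ hI ≡ 0
      vars′  : ∀ v → hd s′ (hV v) ≡ hd s (hV v)
      tape′  : ∀ i → tp s′ i ≡ tp s i
  open Ready

  -- `move` adds to the clock it fills, so each clock has to be zero when its turn comes. `Unique`
  -- guarantees that no node has two turns.
  decides-clocks : ∀ is {s T Q} → Unique is → Scratch s → hd s hI ≡ 0 → (∀ i → i ∈ is → hd s (hK i) ≡ 0) →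
    (∀ s′ → Ready s s′ → (∀ i → i ∈ is → hd s′ (hK i) ≡ clockValue (clock i)) →
            (∀ i → ¬ (i ∈ is) → hd s′ (hK i) ≡ hd s (hK i)) → Decides (goto [] true) s′ T Q) →
    Decides (initClocks is) s (clocksCost is + T) Q
  decides-clocks [] {s} u w I0 z D = D s (record { work′ = w ; I0′ = I0 ; vars′ = λ _ → refl ; tape′ = λ _ → refl }) (λ _ ()) (λ _ _ → refl)
  decides-clocks (i ∷ is) {s} {T} {Q} (i∉ ∷ u) w I0 z D with clock i in ce
  ... | nothing = decides-clocks is u w I0 (λ j m → z j (there m))
        (λ s′ rd h h′ → D s′ rd (λ { j (here refl) → trans (h′ j (fresh j refl)) (trans (z j (here refl)) (cong clockValue (sym ce))) ; j (there m) → h j m })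
                         (λ j ni → h′ j (λ m → ni (there m))))
    where
    fresh : ∀ j → j ≡ i → ¬ (j ∈ is)
    fresh j refl m = All.lookup i∉ m refl
  ... | just t = decides-≤ {initClock i (just t) (initClocks is)} {s} (≤-reflexive (lemma (evalCost t n) (evalPol t n * 3 + 1) (clocksCost is) T))
      (decides-horner t {s} {move hI (hK i) ⨾ initClocks is} w I0
        (decides-seq {move hI (hK i)} (det-≈ {move hI (hK i)} fix (det-move {hI} {hK i} {s [ hI ≔ X ]} refl))
          (decides-clocks is {s₁} {T} {Q} u (scratch (atN w) (atT w) (atA w) (atC w)) I0 zero-later
            (λ s′ rd h h′ → D s′ (record { work′ = work′ rd ; I0′ = I0′ rd ; vars′ = vars′ rd ; tape′ = tape′ rd })
               (λ { j (here refl) → trans (h′ j (fresh j refl)) (trans (get-same s (hK j)) (cong clockValue (sym ce))) ; j (there m) → h j m })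
               (λ j ni → trans (h′ j (λ m → ni (there m))) (get-other s {hK i} {hK j} X (keys (λ e → ni (here e)))))))))
    where
    X = evalPol t n
    s₁ = s [ hK i ≔ X ]
    fresh : ∀ j → j ≡ i → ¬ (j ∈ is)
    fresh j refl m = All.lookup i∉ m refl
    keys : ∀ {j} → j ≢ i → (toℕ j ≡ᵇ toℕ i) ≡ false
    keys ne = ≢⇒≡ᵇ-false (λ q → ne (FP.toℕ-injective q))
    zero-later : ∀ j → j ∈ is → hd s₁ (hK j) ≡ 0
    zero-later j m = trans (get-other s {hK i} {hK j} X (keys (λ e → fresh j e m))) (z j (there m))
    fix : (s [ hI ≔ X ] [ hK i ≔ hd s (hK i) + X ] [ hI ≔ 0 ]) ≈ s₁
    fix = ≈-intro eh (λ _ → refl)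
      where
      eh : ∀ h → hd (s [ hI ≔ X ] [ hK i ≔ hd s (hK i) + X ] [ hI ≔ 0 ]) h ≡ hd s₁ h
      eh hN = refl
      eh hP = refl
      eh hI = sym I0
      eh hT = refl
      eh hA = refl
      eh hC = refl
      eh (hV v) = refl
      eh (hK j) with toℕ j ≡ᵇ toℕ i
      ... | true = cong (_+ X) (z i (here refl))
      ... | false = refl
    lemma : ∀ a b c T → a + (b + (c + T)) ≡ a + b + c + T
    lemma = solve-∀

  -- What the copied tracks hold, relative to the relations still to be read.
  record Copied (rl : (i : Fin (length τ)) → Vec (Fin n) (lookupL τ i) → Bool) (todo : List (Fin (length τ))) (t : ℕ → Γ) : Set where
    field
      only   : ∀ i v → bit (inj₁ i) (t (idx v)) ≡ true → rl i v ≡ true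
      every  : ∀ i v → rl i v ≡ true → bit (inj₁ i) (t (idx v)) ≡ true ⊎ i ∈ todo
      others : ∀ a k → SymOK τ V (inj₂ (a , k)) → ∀ j → bit (inj₂ (a , k)) (t j) ≡ false
  open Copied

  afterAll-copied : ∀ {rl} is {bs s} → bs ≡ concatMap (λ i → map (rl i) (allVecs n (lookupL τ i))) is →
                    Copied rl is (tp s) → Copied rl [] (tp (afterAll is bs s))
  afterAll-copied [] e c = c
  afterAll-copied {rl} (i ∷ is) {bs} {s} e c = afterAll-copied {rl} is {drop len bs} {s′} (trans (cong (drop len) e) (drop-seg len seg _ lenseg)) step′
    where
    len = n ^ lookupL τ i
    seg = map (rl i) (allVecs n (lookupL τ i))
    s′ = st (hd (s [ hP ≔ hd s hP + len ])) (copied i bs len (tp s))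
    lenseg : length seg ≡ len
    lenseg = trans (LP.length-map (rl i) (allVecs n (lookupL τ i))) (length-allVecs n (lookupL τ i))
    drop-seg : ∀ len (xs ys : List Bool) → length xs ≡ len → drop len (xs ++ ys) ≡ ys
    drop-seg zero [] ys _ = refl
    drop-seg (suc len) (x ∷ xs) ys q = drop-seg len xs ys (suc-injective q)
    at : ∀ v → nth bs (idx v) ≡ just (rl i v)
    at v = trans (cong (λ b → nth b (idx v)) e) (trans (nth-++ˡ seg _ (idx v) (subst (idx v <_) (sym lenseg) (idx< v)))
             (nth-map (rl i) (allVecs n (lookupL τ i)) (idx v) (nth-allVecs n (lookupL τ i) v)))
    same′ : ∀ v → tp s′ (idx v) ≡ (if rl i v then setBit (inj₁ i) true (tp s (idx v)) else tp s (idx v))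
    same′ v = cong (if_then setBit (inj₁ i) true (tp s (idx v)) else tp s (idx v))
      (trans (cong₂ _∧_ (<ᵇ-true (idx< v)) (cong is1 (at v))) (unwrap (rl i v)))
      where unwrap : ∀ b → is1 (just b) ≡ b
            unwrap true = refl
            unwrap false = refl
    else′ : ∀ Q → SymOK τ V Q → Q ≢ inj₁ i → ∀ j → bit Q (tp s′ j) ≡ bit Q (tp s j)
    else′ Q qok ne j with (j <ᵇ len) ∧ is1 (nth bs j)
    ... | true = bit-setBit-other Q (inj₁ i) true (tp s j) qok (fitsτ i) ne
    ... | false = refl
    step′ : Copied rl is (tp s′)
    step′ = record { only = only′ ; every = every′ ; others = λ a k ok j → trans (else′ (inj₂ (a , k)) ok (λ ()) j) (others c a k ok j) }
      where
      only′ : ∀ i′ v → bit (inj₁ i′) (tp s′ (idx v)) ≡ true → rl i′ v ≡ true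
      only′ i′ v q with i′ FP.≟ i
      ... | no ne = only c i′ v (trans (sym (else′ (inj₁ i′) (fitsτ i′) (λ { refl → ne refl }) (idx v))) q)
      ... | yes refl with rl i v in rv
      ...   | true = refl
      ...   | false = trans (sym rv) (only c i v (trans (cong (bit (inj₁ i)) (sym (trans (same′ v) (cong (if_then setBit (inj₁ i) true (tp s (idx v)) else tp s (idx v)) rv)))) q))
      every′ : ∀ i′ v → rl i′ v ≡ true → bit (inj₁ i′) (tp s′ (idx v)) ≡ true ⊎ i′ ∈ is
      every′ i′ v q with i′ FP.≟ i
      ... | yes refl = inj₁ (trans (cong (bit (inj₁ i)) (trans (same′ v) (cong (if_then setBit (inj₁ i) true (tp s (idx v)) else tp s (idx v)) q)))
                         (bit-setBit-same (inj₁ i) true (tp s (idx v))))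
      ... | no ne with every c i′ v q
      ...   | inj₁ b = inj₁ (trans (else′ (inj₁ i′) (fitsτ i′) (λ { refl → ne refl }) (idx v)) b)
      ...   | inj₂ (here e′) = contradiction e′ ne
      ...   | inj₂ (there m) = inj₂ m

-- Polynomial costs and well-formed words.

-- The expression is kept as data, because it is handed out as the space bound and as the term of
-- the clocks.
IsPoly : (ℕ → ℕ) → Set
IsPoly f = Σ PE λ e → ∀ n → f n ≡ ⟪ e ⟫ n

pvar : IsPoly (λ n → n)
pvar = var , λ n → refl

pcon : ∀ c → IsPoly (λ _ → c)
pcon c = con c , λ n → refl

_p+_ : ∀ {f g} → IsPoly f → IsPoly g → IsPoly (λ n → f n + g n)
(e , p) p+ (d , q) = e ⊕ d , λ n → cong₂ _+_ (p n) (q n)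

_p*_ : ∀ {f g} → IsPoly f → IsPoly g → IsPoly (λ n → f n * g n)
(e , p) p* (d , q) = e ⊗ d , λ n → cong₂ _*_ (p n) (q n)

infixl 6 _p+_
infixl 7 _p*_

ppow : ∀ k → IsPoly (λ n → n ^ k)
ppow k = var ^ᴾ k , λ n → sym (⟪⟫-^ var k n)

peval : ∀ t → IsPoly (evalPol t)
peval t = fromPol t , λ n → sym (⟪⟫-fromPol t n)

pmulCost : ∀ {f} → IsPoly f → IsPoly (λ n → mulCost (f n) n)
pmulCost p = p p* (pcon 2 p+ (pvar p* pcon 7 p+ pcon 2)) p+ pcon 1 p+ (p p* pvar p* pcon 3 p+ pcon 1)

pevalCost : ∀ t → IsPoly (evalCost t)
pevalCost [] = pcon 0
pevalCost (c ∷ cs) = pevalCost cs p+ (pmulCost (peval cs) p+ pcon c)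

ptotal : ∀ {m} (f : Fin m → ℕ → ℕ) → (∀ i → IsPoly (f i)) → IsPoly (λ n → total (λ i → f i n))
ptotal {zero} f p = pcon 0
ptotal {suc m} f p = p fz p+ ptotal (λ i → f (fs i)) (λ i → p (fs i))

pickCostAt : ℕ → ℕ
pickCostAt n = n * 2 + 1 + (1 + (n * 7 + 2 + (1 + (n * 6 + 1))))

-- The side condition keeps `rest` from continuing the run of ones, which is what makes the unary
-- prefix readable.
replicate-split : ∀ m k {xs rest : List Bool} → (rest ≡ [] ⊎ ∃ λ r → rest ≡ false ∷ r) →
                  replicate m true ++ false ∷ xs ≡ replicate k true ++ rest → m ≡ k × rest ≡ false ∷ xs
replicate-split zero zero (inj₁ refl) ()
replicate-split zero zero (inj₂ (r , refl)) refl = refl , refl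
replicate-split zero (suc k) h ()
replicate-split (suc m) zero (inj₁ refl) ()
replicate-split (suc m) zero (inj₂ (r , refl)) ()
replicate-split (suc m) (suc k) h e with replicate-split m k h (LP.∷-injectiveʳ e)
... | p , q = cong suc p , q

leading-ones : ∀ w → ∃ λ m → ∃ λ rest → (w ≡ replicate m true ++ rest) × (rest ≡ [] ⊎ ∃ λ r → rest ≡ false ∷ r)
leading-ones [] = 0 , [] , refl , inj₁ refl
leading-ones (false ∷ w) = 0 , false ∷ w , refl , inj₂ (w , refl)
leading-ones (true ∷ w) with leading-ones w
... | m , rest , e , h = suc m , rest , cong (true ∷_) e , h

split-at : ∀ m (len : Fin m → ℕ) (bs : List Bool) → length bs ≡ total len →
           Σ (Fin m → List Bool) λ seg → (∀ i → length (seg i) ≡ len i) × concat (tabulate seg) ≡ bs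
split-at zero len [] e = (λ ()) , (λ ()) , refl
split-at (suc m) len bs e with split-at m (λ i → len (fs i)) (drop (len fz) bs) (trans (LP.length-drop (len fz) bs) (trans (cong (_∸ len fz) e) (m+n∸m≡n (len fz) _)))
... | seg , l , c = seg′ , l′ , trans (cong (Data.List.take (len fz) bs ++_) c) (LP.take++drop≡id (len fz) bs)
  where
  seg′ : Fin (suc m) → List Bool
  seg′ fz = Data.List.take (len fz) bs
  seg′ (fs i) = seg i
  l′ : ∀ i → length (seg′ i) ≡ len i
  l′ fz = trans (LP.length-take (len fz) bs) (m≤n⇒m⊓n≡m (≤-trans (m≤m+n _ _) (≤-reflexive (sym e))))
  l′ (fs i) = l i

-- Behind the prefix every bit string of the right length is an encoding: its segments simply are
-- the relations.
fromBits : ∀ (τ : Voc) n₁ bs → length bs ≡ total {length τ} (λ i → suc n₁ ^ lookupL τ i) →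
           ∃ λ (M : Struct τ) → enc M ≡ replicate (suc n₁) true ++ false ∷ bs
fromBits τ n₁ bs e with split-at (length τ) (λ i → suc n₁ ^ lookupL τ i) bs e
... | seg , l , c = M , cong (λ x → replicate (suc n₁) true ++ false ∷ x)
      (trans (cong concat (trans (LP.map-tabulate id (λ i → map (rel M i) (allVecs n (lookupL τ i)))) (LP.tabulate-cong table))) c)
  where
  n = suc n₁
  M : Struct τ
  M = record { size = n ; nonempty = s≤s z≤n ; rel = λ i v → is1 (nth (seg i) (idx v)) }
  table : ∀ i → map (rel M i) (allVecs n (lookupL τ i)) ≡ seg i
  table i = tabulate-allVecs n (lookupL τ i) (rel M i) (seg i) (l i) at
    where at : ∀ v → nth (seg i) (idx v) ≡ just (rel M i v)
          at v with nth-within (seg i) (idx v) (subst (idx v <_) (sym (l i)) (idx< v))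
          ... | true , q = trans q (sym (cong (λ m → just (is1 m)) q))
          ... | false , q = trans q (sym (cong (λ m → just (is1 m)) q))

-- Deciding satisfaction on words.

module Decision {τ : Voc} (φ₀ : Formula τ) (V′ : ℕ) (fits : Fits (suc V′) φ₀) (fitsτ : ∀ i → lookupL τ i < suc V′) where
  open GameProgram φ₀ V′
  open Programs {H} {Γ} eqHd hI labels hiding (Pr)
  open Machine blocks
  open Routines {H} {Γ} eqHd hI labels blocks
  open Equivalence using (to; from)
  module S = Setup φ₀ V′ fits fitsτ
  module L = Play φ₀ V′ fits

  scan : Pr
  scan = whl hP (λ _ → holds (just true)) (inc hP ⨾ inc hN)

  Reads : St → ℕ → List Bool → Set
  Reads s p bs = ∀ j → proj₁ (tp s (p + j)) ≡ nth bs j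

  holds-is : ∀ m {g} → proj₁ g ≡ m → holds m g ≡ true
  holds-is nothing {nothing , _} e = refl
  holds-is (just true) {just true , _} e = refl
  holds-is (just false) {just false , _} e = refl

  holds-not : ∀ m {g m′} → proj₁ g ≡ m′ → m ≢ m′ → holds m g ≡ false
  holds-not nothing {nothing , _} refl ne = contradiction refl ne
  holds-not nothing {just _ , _} e ne = refl
  holds-not (just b) {nothing , _} e ne = refl
  holds-not (just true) {just true , _} refl ne = contradiction refl ne
  holds-not (just true) {just false , _} e ne = refl
  holds-not (just false) {just true , _} e ne = refl
  holds-not (just false) {just false , _} refl ne = contradiction refl ne

  det-scan : ∀ m {rest s} → (rest ≡ [] ⊎ ∃ λ r → rest ≡ false ∷ r) → Reads s (hd s hP) (replicate m true ++ rest) →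
             Det scan s (s [ hN ≔ hd s hN + m ] [ hP ≔ hd s hP + m ]) (m * 3 + 1)
  det-scan zero {rest} {s} h rd = det-≈ {scan} fix (det-exit {hP} {λ _ → holds (just true)} {inc hP ⨾ inc hN} {s}
      (holds-not (just true) (trans (cong (λ q → proj₁ (tp s q)) (sym (+-identityʳ _))) (rd 0)) (stop-here h)))
    where
    stop-here : (rest ≡ [] ⊎ ∃ λ r → rest ≡ false ∷ r) → just true ≢ nth rest 0
    stop-here (inj₁ refl) ()
    stop-here (inj₂ (r , refl)) ()
    fix : s ≈ (s [ hN ≔ hd s hN + 0 ] [ hP ≔ hd s hP + 0 ])
    fix = ≈-sym (≈-trans (upd-id (s [ hN ≔ hd s hN + 0 ]) hP (+-identityʳ _)) (upd-id s hN (+-identityʳ _)))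
  det-scan (suc m) {rest} {s} h rd = det-≤ {scan} (≤-reflexive (lemma m)) (det-loop {hP} {λ _ → holds (just true)} {inc hP ⨾ inc hN} {s}
      (holds-is (just true) (trans (cong (λ q → proj₁ (tp s q)) (sym (+-identityʳ _))) (rd 0)))
      (det-seq (det-inc {hP} {s}) (det-inc {hN} {s [ hP ≔ suc (hd s hP) ]}))
      (det-≈ {scan} fix (det-scan m {rest} {s₁} h (λ j → trans (cong (λ q → proj₁ (tp s q)) (sym (+-suc (hd s hP) j))) (rd (suc j))))))
    where
    s₁ = s [ hP ≔ suc (hd s hP) ] [ hN ≔ suc (hd s hN) ]
    fix : (s₁ [ hN ≔ suc (hd s hN) + m ] [ hP ≔ suc (hd s hP) + m ]) ≈ (s [ hN ≔ hd s hN + suc m ] [ hP ≔ hd s hP + suc m ])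
    fix = ≈-intro (λ { hN → sym (+-suc (hd s hN) m) ; hP → sym (+-suc (hd s hP) m) ; hI → refl ; hT → refl ; hA → refl ; hC → refl ; (hV v) → refl ; (hK v) → refl }) (λ _ → refl)
    lemma : ∀ m → suc (1 + 1 + (m * 3 + 1)) ≡ suc m * 3 + 1
    lemma = solve-∀

  -- The costs met along `setup` and in the play, restated as functions of the domain size, since
  -- one polynomial has to be fixed before the word is known.
  accCostAt nodeCostAt copyCostAt runCost fullCost : ℕ → ℕ
  accCostAt n = mulCost (n ^ V) n + (n * 7 + 4)
  nodeCostAt n = V * (suc (accCostAt n) + pickCostAt n) + n ^ V * 2 + n * 18 + 20
  copyCostAt n = length (allFin (length τ)) * (1 + (V * mulCost (n ^ V) n + (n ^ V * 3 + 1 + (n ^ V * 7 + 1 + (n ^ V * 2 + 1)))) + 3)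

  clockAt : Fin nodes → Maybe Pol
  clockAt i = clockOf (subAt φ₀ (pathOf i))

  clockValueAt : Maybe Pol → ℕ → ℕ
  clockValueAt nothing n = 0
  clockValueAt (just t) n = evalPol t n

  clocksCostAt : List (Fin nodes) → ℕ → ℕ
  clocksCostAt [] n = 0
  clocksCostAt (i ∷ is) n = clockCost n (clockAt i) + clocksCostAt is n

  runCost n = suc (total (λ i → clockValueAt (clockAt i) n) * weight φ₀ + rank φ₀) * nodeCostAt n

  fullCost n = n * 3 + 1 + (1 + (1 + (1 + (copyCostAt n + (1 + (clocksCostAt (allFin nodes) n + (1 + runCost n)))))))

  pfullCost : IsPoly fullCost
  pfullCost = pvar p* pcon 3 p+ pcon 1 p+ (pcon 1 p+ (pcon 1 p+ (pcon 1 p+ (pcopy p+ (pcon 1 p+ (pclocks (allFin nodes) p+ (pcon 1 p+ prun)))))))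
    where
    pZ = ppow V
    pcopy : IsPoly copyCostAt
    pcopy = pcon (length (allFin (length τ))) p* (pcon 1 p+ (pcon V p* pmulCost pZ p+ (pZ p* pcon 3 p+ pcon 1 p+ (pZ p* pcon 7 p+ pcon 1 p+ (pZ p* pcon 2 p+ pcon 1)))) p+ pcon 3)
    pclockCost : ∀ m → IsPoly (λ n → clockCost n m)
    pclockCost nothing = pcon 0
    pclockCost (just t) = pevalCost t p+ (peval t p* pcon 3 p+ pcon 1)
    pclocks : ∀ is → IsPoly (clocksCostAt is)
    pclocks [] = pcon 0
    pclocks (i ∷ is) = pclockCost (clockAt i) p+ pclocks is
    pvalue : ∀ m → IsPoly (clockValueAt m)
    pvalue nothing = pcon 0
    pvalue (just t) = peval t
    pacc : IsPoly accCostAt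
    pacc = pmulCost pZ p+ (pvar p* pcon 7 p+ pcon 4)
    ppick : IsPoly pickCostAt
    ppick = pvar p* pcon 2 p+ pcon 1 p+ (pcon 1 p+ (pvar p* pcon 7 p+ pcon 2 p+ (pcon 1 p+ (pvar p* pcon 6 p+ pcon 1))))
    pnode : IsPoly nodeCostAt
    pnode = pcon V p* (pcon 1 p+ pacc p+ ppick) p+ pZ p* pcon 2 p+ pvar p* pcon 18 p+ pcon 20
    prun : IsPoly runCost
    prun = (pcon 1 p+ (ptotal (λ i → clockValueAt (clockAt i)) (λ i → pvalue (clockAt i)) p* pcon (weight φ₀) p+ pcon (rank φ₀))) p* pnode

  s₀ : List Bool → St
  s₀ w = st (λ _ → 0) (λ i → blankTracks (nth w i))

  module _ (n₁ : ℕ) (bs : List Bool) where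
    open S n₁ using (segLength; afterAll; Copied; afterAll-copied; decides-copyAll; decides-clocks; Ready)
    open L n₁ using (scratch; rep; decides-goto; sim)
    open Ready

    n : ℕ
    n = suc n₁

    w : List Bool
    w = replicate n true ++ false ∷ bs

    s₁ s₂ : St
    s₁ = s₀ w [ hN ≔ n ] [ hP ≔ n ]
    s₂ = s₁ [ hP ≔ suc n ]

    reads₁ : Reads s₁ n (false ∷ bs)
    reads₁ j = trans (cong (λ k → nth w (k + j)) (sym (LP.length-replicate n {true}))) (nth-++ʳ (replicate n true) (false ∷ bs) j)

    reads₂ : Reads s₂ (suc n) bs
    reads₂ j = trans (cong (λ k → nth w k) (sym (+-suc n j))) (reads₁ (suc j))

    lastPart : Pr
    lastPart = ifT hP (λ _ → holds nothing) (initClocks (allFin nodes)) (verdict false)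

    rels-all : List (Fin (length τ))
    rels-all = allFin (length τ)

    decides-prefix : ∀ {Q T} → Decides (copyAll rels-all lastPart) s₂ T Q → Decides setup (s₀ w) (n * 3 + 1 + (1 + (1 + (1 + T)))) Q
    decides-prefix {Q} {T} D = decides-seq {scan} (det-scan n {false ∷ bs} {s₀ w} (inj₂ (bs , refl)) (λ j → refl))
      (decides-suc {hN} {s = s₁} refl (b , goes-then (holds-is (just false) (trans (cong (λ q → proj₁ (tp s₁ q)) (sym (+-identityʳ n))) (reads₁ 0))) g , h))
      where
      E′ = decides-seq {inc hP} (det-inc {hP} {s₁}) D
      b = proj₁ E′
      g = proj₁ (proj₂ E′)
      h = proj₂ (proj₂ E′)

    segLength-tabulate : ∀ {m} (f : Fin m → Fin (length τ)) → segLength (tabulate f) ≡ total (λ i → n ^ lookupL τ (f i))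
    segLength-tabulate {zero} f = refl
    segLength-tabulate {suc m} f = cong (n ^ lookupL τ (f fz) +_) (segLength-tabulate (λ i → f (fs i)))

    afterAll-hd : ∀ is bs s h → (BoolEq._==_ eqHd h hP) ≡ false → hd (afterAll is bs s) h ≡ hd s h
    afterAll-hd [] bs s h ne = refl
    afterAll-hd (i ∷ is) bs s h ne = trans (afterAll-hd is _ _ h ne) (get-other s {hP} {h} _ ne)

    afterAll-reads : ∀ is bs s → Reads s (hd s hP) bs → Reads (afterAll is bs s) (hd (afterAll is bs s) hP) (drop (segLength is) bs)
    afterAll-reads [] bs s rd = rd
    afterAll-reads (i ∷ is) bs s rd j = trans (afterAll-reads is _ _ (S.reads-drop n₁ i {s} {bs} {n ^ lookupL τ i} rd) j)
      (cong (λ x → nth x j) (LP.drop-drop (n ^ lookupL τ i) (segLength is) bs))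

    s₃ : St
    s₃ = afterAll rels-all bs s₂

    decides-valid : ∀ (M : Struct τ) → enc M ≡ w → Decides setup (s₀ w) (fullCost n) (M ⊨ φ₀)
    decides-valid record { size = m ; nonempty = ne ; rel = rl } e with replicate-split m n (inj₂ (bs , refl)) e
    ... | refl , e′ = decides-prefix (decides-copyAll rels-all {s₂} {bs} (scratch refl refl refl refl) refl reads₂
          (λ _ → run) (λ lt → contradiction lt (<-irrefl lenbs)))
      where
      M : Struct τ
      M = record { size = n ; nonempty = ne ; rel = rl }
      bits≡ : bs ≡ concatMap (λ i → map (rl i) (allVecs n (lookupL τ i))) rels-all
      bits≡ = LP.∷-injectiveʳ e′
      lenbs : length bs ≡ segLength rels-all
      lenbs = trans (cong length bits≡) (trans (length-concatMap (λ i → map (rl i) (allVecs n (lookupL τ i))) id)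
        (trans (total-cong (λ i → trans (LP.length-map (rl i) (allVecs n (lookupL τ i))) (length-allVecs n (lookupL τ i)))) (sym (segLength-tabulate id))))
      cp : Copied rl [] (tp s₃)
      cp = afterAll-copied {rl} rels-all {bs} {s₂} bits≡ (record
        { only = λ i v q → contradiction (trans (sym (VP.lookup-replicate (track (inj₁ i)) false)) q) (λ ())
        ; every = λ i v q → inj₂ (∈-allFin i)
        ; others = λ a k ok j → VP.lookup-replicate (track (inj₂ (a , k))) false })
      blank : holds nothing (tp s₃ (hd s₃ hP)) ≡ true
      blank = holds-is nothing (trans (cong (λ q → proj₁ (tp s₃ q)) (sym (+-identityʳ _))) (trans (afterAll-reads rels-all bs s₂ reads₂ 0)
        (nth-beyond (drop (segLength rels-all) bs) 0 (≤-reflexive (trans (LP.length-drop (segLength rels-all) bs) (m≤n⇒m∸n≡0 (≤-reflexive lenbs)))))))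
      play : ∀ s′ → Ready s₃ s′ → (∀ i → i ∈ allFin nodes → hd s′ (hK i) ≡ S.clockValue n₁ (S.clock n₁ i)) → Decides (goto [] true) s′ (1 + runCost n) (M ⊨ φ₀)
      play s′ rd hk = decides-goto {[]} {true} {s′} (subst (λ k → L.DecE n₁ (target [] true) s′ (suc (k * weight φ₀ + rank φ₀) * nodeCostAt n) (M ⊨ φ₀)) K≡
        (sim (suc (L.K n₁ s′ * weight φ₀ + rank φ₀)) (initState M) s′ φ₀ refl R ≤-refl))
        where
        value≡ : ∀ m → S.clockValue n₁ m ≡ clockValueAt m n
        value≡ nothing = refl
        value≡ (just t) = refl
        K≡ : L.K n₁ s′ ≡ total (λ i → clockValueAt (clockAt i) n)
        K≡ = total-cong (λ i → trans (hk i (∈-allFin i)) (value≡ (clockAt i)))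
        bits : L.TapeRel n₁ (initRels M) s′
        bits (inj₁ i) ok t = trans (cong (bit (inj₁ i)) (tape′ rd (idx t))) (trans (bool-ext (Copied.only cp i t) (λ q → every-done (Copied.every cp i t q)))
            (sym (cong (maybe (rl i) false) (fromListN-toList t))))
          where every-done : ∀ {A : Set} → A ⊎ i ∈ [] → A
                every-done (inj₁ a) = a
        bits (inj₂ (a , k)) ok t = trans (cong (bit (inj₂ (a , k))) (tape′ rd (idx t))) (Copied.others cp a k ok (idx t))
        R : L.Rep n₁ (initState M) s′
        R = rep (work′ rd) (I0′ rd) (λ v → trans (vars′ rd v) (afterAll-hd rels-all bs s₂ (hV v) refl))
          (λ p {C} {t} e → trans (hk (nodeAt p) (∈-allFin (nodeAt p))) (cong (λ m → S.clockValue n₁ (clockOf m)) (trans (cong (subAt φ₀) (pathOf-nodeAt p e)) e))) bits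
      keep : ∀ h → (BoolEq._==_ eqHd h hP) ≡ false → hd s₃ h ≡ hd s₂ h
      keep h = afterAll-hd rels-all bs s₂ h
      cost≡ : ∀ is → S.clocksCost n₁ is ≡ clocksCostAt is n
      cost≡ [] = refl
      cost≡ (i ∷ is) = cong (clockCost n (clockAt i) +_) (cost≡ is)
      open import Data.List.Relation.Unary.Unique.Propositional.Properties using (allFin⁺)
      clocksPart : Decides (initClocks (allFin nodes)) s₃ (clocksCostAt (allFin nodes) n + (1 + runCost n)) (M ⊨ φ₀)
      clocksPart = subst (λ c → Decides (initClocks (allFin nodes)) s₃ (c + (1 + runCost n)) (M ⊨ φ₀)) (cost≡ (allFin nodes))
        (decides-clocks (allFin nodes) {s₃} (allFin⁺ nodes) (scratch (keep hN refl) (keep hT refl) (keep hA refl) (keep hC refl)) (keep hI refl)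
          (λ i _ → keep (hK i) refl) (λ s′ rd hk _ → play s′ rd hk))
      run : Decides lastPart s₃ (1 + (clocksCostAt (allFin nodes) n + (1 + runCost n))) (M ⊨ φ₀)
      run = proj₁ clocksPart , goes-then blank (proj₁ (proj₂ clocksPart)) , proj₂ (proj₂ clocksPart)

    decides-invalid : ∀ {Q} → length bs ≢ segLength rels-all → ¬ Q → Decides setup (s₀ w) (fullCost n) Q
    decides-invalid {Q} ne nq = decides-prefix (decides-copyAll rels-all {s₂} {bs} {lastPart} (scratch refl refl refl refl) refl reads₂ leftover (λ _ → nq))
      where
      leftover : segLength rels-all ≤ length bs → Decides lastPart s₃ (1 + (clocksCostAt (allFin nodes) n + (1 + runCost n))) Q
      leftover le with nth-within (drop (segLength rels-all) bs) 0 (≤-trans (m<n⇒0<n∸m (≤∧≢⇒< le (λ z → ne (sym z)))) (≤-reflexive (sym (LP.length-drop (segLength rels-all) bs))))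
      ... | b , q = false , goes-else (holds-not nothing (trans (cong (λ p → proj₁ (tp s₃ p)) (sym (+-identityʳ _))) (trans (afterAll-reads rels-all bs s₂ reads₂ 0) q)) (λ ())) goes-verdict
                  , mk⇔ (λ ()) (λ x → contradiction x nq)

    decides-word : Decides setup (s₀ w) (fullCost n) (Σ (Struct τ) λ M → M ⊨ φ₀ × enc M ≡ w)
    decides-word with length bs Data.Nat.Properties.≟ segLength rels-all
    ... | no ne = decides-invalid ne (λ { (M , _ , e) → noM M e })
      where
      noM : ∀ M → enc M ≡ w → ⊥
      noM record { size = m ; nonempty = ne′ ; rel = rl } e with replicate-split m n (inj₂ (bs , refl)) e
      ... | refl , e′ = ne (trans (cong length (LP.∷-injectiveʳ e′)) (trans (length-concatMap (λ i → map (rl i) (allVecs n (lookupL τ i))) id)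
        (trans (total-cong (λ i → trans (LP.length-map (rl i) (allVecs n (lookupL τ i))) (length-allVecs n (lookupL τ i)))) (sym (segLength-tabulate id)))))
    ... | yes le with fromBits τ n₁ bs (trans le (segLength-tabulate id))
    ...   | M , eM with decides-valid M eM
    ...     | b , g , h = b , g , mk⇔ (λ q → M , to h q , eM) (λ { (M′ , m , e) → other M′ m e })
      where
      -- The verdict was obtained for the structure that `fromBits` read from the word. Any `M′`
      -- with the same encoding gets its verdict from the same run, and determinism identifies the
      -- two.
      other : ∀ M′ → M′ ⊨ φ₀ → enc M′ ≡ w → b ≡ true
      other M′ m e with decides-valid M′ e
      ... | b′ , g′ , h′ = trans (ev-det (g C) (g′ C)) (from h′ m)
        where C : Cont setup
              C = cont (λ x → fz , just x) (fz , nothing) (λ pt → refl)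

  -- The 3 extra steps let the early rejections, of words without leading ones or without a zero
  -- behind them, be accounted for without unfolding the cost.
  decides-setup : ∀ w → Decides setup (s₀ w) (fullCost (length w) + 3) (Σ (Struct τ) λ M → M ⊨ φ₀ × enc M ≡ w)
  decides-setup w with leading-ones w
  ... | zero , rest , refl , h = decides-≤ {setup} {s₀ w} (≤-trans (m≤n+m 2 _) (+-monoʳ-≤ (fullCost (length w)) (n≤1+n 2)))
        (decides-seq {scan} (det-scan 0 {rest} {s₀ w} h (λ j → refl))
          (decides-zero {hN} {t = 0} refl (decides-verdict (mk⇔ (λ ()) (λ { (M , _ , e) → empty M e h })))))
    where
    empty : ∀ M → enc M ≡ rest → (rest ≡ [] ⊎ ∃ λ r → rest ≡ false ∷ r) → false ≡ true
    empty record { size = suc m } refl (inj₁ ())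
    empty record { size = suc m } refl (inj₂ (r , ()))
  ... | suc n₁ , [] , refl , h = decides-≤ {setup} {s₀ w} short
        (decides-seq {scan} (det-scan (suc n₁) {[]} {s₀ w} h (λ j → refl))
          (decides-suc {hN} {s = s₀ w [ hN ≔ suc n₁ ] [ hP ≔ suc n₁ ]} refl (false , goes-else blank goes-verdict , mk⇔ (λ ()) (λ { (M , _ , e) → contradiction (noM M e) (λ ()) }))))
    where
    blank : holds (just false) (blankTracks (nth w (suc n₁))) ≡ false
    blank = holds-not (just false) (nth-beyond w (suc n₁) (≤-reflexive (trans (cong length (LP.++-identityʳ (replicate (suc n₁) true))) (LP.length-replicate (suc n₁))))) (λ ())
    noM : ∀ M → enc M ≡ w → [] ≡ false ∷ _
    noM M e = proj₂ (replicate-split (size M) (suc n₁) (inj₁ refl) e)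
    short : suc n₁ * 3 + 1 + 2 ≤ fullCost (length w) + 3
    short rewrite LP.++-identityʳ (replicate n₁ true) | LP.length-replicate n₁ {true} =
      ≤-trans (m≤m+n (suc n₁ * 3 + 1 + 2) 1) (≤-trans (≤-reflexive (+-assoc (suc n₁ * 3 + 1) 2 1)) (+-monoˡ-≤ 3 (m≤m+n (suc n₁ * 3 + 1) _)))
  ... | suc n₁ , false ∷ bs , refl , h = decides-≤ {setup} {s₀ w} (≤-trans mono (m≤m+n _ 3)) (decides-word n₁ bs)
    where
    mono : fullCost (suc n₁) ≤ fullCost (length w)
    mono rewrite proj₂ pfullCost (suc n₁) | proj₂ pfullCost (length w) =
      ⟪⟫-mono (proj₁ pfullCost) (≤-trans (m≤m+n (suc n₁) _) (≤-reflexive (sym (trans (LP.length-++ (replicate (suc n₁) true)) (cong (_+ suc (length bs)) (LP.length-replicate (suc n₁)))))))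
  ... | suc n₁ , true ∷ rest , refl , inj₁ ()
  ... | suc n₁ , true ∷ rest , refl , inj₂ (_ , ())

  inPSPACE : InPSPACE (λ w → Σ (Struct τ) λ M → M ⊨ φ₀ × enc M ≡ w)
  inPSPACE = inPSPACE-alternating (eqHd {V} {nodes}) (finHd V nodes) finΓ finA δ blankTracks (block fz) (toPol e) _
    (λ w → proj₁ (decides-setup w)
         , subst (λ t → E (block fz) (s₀ w) (proj₁ (decides-setup w)) t) (time (length w)) (block-goes {fz} {s₀ w} (proj₁ (proj₂ (decides-setup w))))
         , proj₂ (proj₂ (decides-setup w)))
    where
    e = proj₁ pfullCost ⊕ con 3
    time : ∀ n → fullCost n + 3 ≡ evalPol (toPol e) n
    time n = trans (cong (_+ 3) (proj₂ pfullCost n)) (sym (evalPol-toPol e n))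

-- The bound has to cover all arities of the vocabulary besides the formula, as every relation is
-- copied, mentioned or not.
pspace-decidable : ∀ (τ : Voc) (φ : Formula τ) → PSpaceDecidable τ (λ M → M ⊨ φ)
pspace-decidable τ φ = Decision.inPSPACE φ (V₁ ⊔ V₂) (fits-mono φ (≤-trans (m≤m⊔n V₁ V₂) (n≤1+n _)) (proj₂ (fits-exists φ)))
    (λ i → ≤-trans (bounded i) (≤-trans (m≤n⊔m V₁ V₂) (n≤1+n _)))
  where
  V₁ = proj₁ (fits-exists φ)
  V₂ = proj₁ (bound-list τ)
  bounded : ∀ i → lookupL τ i < V₂
  bounded i = All.lookup (proj₂ (bound-list τ)) (∈-lookup {xs = τ} i)

-- First-order formulas in the game

-- The fragment without edits and loops. As the relations do not change during its evaluation, it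
-- has an ordinary truth definition, to which the game is then compared.
data FO (τ : Voc) : Set where
  atomF     : (R : RelSym τ) → Vec Var (arity τ R) → FO τ
  eqF       : Var → Var → FO τ
  ttF ffF   : FO τ
  notF      : FO τ → FO τ
  andF orF  : FO τ → FO τ → FO τ
  exF allF  : Var → FO τ → FO τ

formula : ∀ {τ} → FO τ → Formula τ
formula (atomF R xs) = atom R xs
formula (eqF x y) = eq x y
formula ttF = tt
formula ffF = ff
formula (notF χ) = neg (formula χ)
formula (andF χ ψ) = and (formula χ) (formula ψ)
formula (orF χ ψ) = or (formula χ) (formula ψ)
formula (exF x χ) = ex x (formula χ)
formula (allF x χ) = all x (formula χ)

module Semantics {τ : Voc} {n : ℕ} (r : Rels τ n) where

  infixl 20 _[_↦_]
  _[_↦_] : (Var → Fin n) → Var → Fin n → Var → Fin n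
  (ρ [ x ↦ a ]) y = if y ≡ᵇ x then a else ρ y

  ⟦_⟧ : FO τ → (Var → Fin n) → Set
  ⟦ atomF R xs ⟧ ρ = r R (toList (Vec.map ρ xs)) ≡ true
  ⟦ eqF x y ⟧ ρ = ρ x ≡ ρ y
  ⟦ ttF ⟧ ρ = ⊤
  ⟦ ffF ⟧ ρ = ⊥
  ⟦ notF χ ⟧ ρ = ¬ ⟦ χ ⟧ ρ
  ⟦ andF χ ψ ⟧ ρ = ⟦ χ ⟧ ρ × ⟦ ψ ⟧ ρ
  ⟦ orF χ ψ ⟧ ρ = ⟦ χ ⟧ ρ ⊎ ⟦ ψ ⟧ ρ
  ⟦ exF x χ ⟧ ρ = ∃ λ a → ⟦ χ ⟧ (ρ [ x ↦ a ])
  ⟦ allF x χ ⟧ ρ = ∀ a → ⟦ χ ⟧ (ρ [ x ↦ a ])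

  open import Relation.Nullary.Decidable using (_×-dec_; _⊎-dec_; ¬?)

  ⟦_⟧? : ∀ χ ρ → Dec (⟦ χ ⟧ ρ)
  ⟦ atomF R xs ⟧? ρ = r R (toList (Vec.map ρ xs)) Data.Bool.≟ true
    where import Data.Bool
  ⟦ eqF x y ⟧? ρ = ρ x FP.≟ ρ y
  ⟦ ttF ⟧? ρ = yes _
  ⟦ ffF ⟧? ρ = no λ ()
  ⟦ notF χ ⟧? ρ = ¬? (⟦ χ ⟧? ρ)
  ⟦ andF χ ψ ⟧? ρ = ⟦ χ ⟧? ρ ×-dec ⟦ ψ ⟧? ρ
  ⟦ orF χ ψ ⟧? ρ = ⟦ χ ⟧? ρ ⊎-dec ⟦ ψ ⟧? ρ
  ⟦ exF x χ ⟧? ρ = FP.any? (λ a → ⟦ χ ⟧? (ρ [ x ↦ a ]))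
  ⟦ allF x χ ⟧? ρ = FP.all? (λ a → ⟦ χ ⟧? (ρ [ x ↦ a ]))

-- Truth from the point of view of Eloise, who verifies or falsifies.
Side : Bool → Set → Set
Side true X = X
Side false X = ¬ X

⇔-trans : ∀ {A B C : Set} → A ⇔ B → B ⇔ C → A ⇔ C
⇔-trans p q = mk⇔ (λ a → Equivalence.to q (Equivalence.to p a)) (λ c → Equivalence.from p (Equivalence.from q c))

⇔-sym : ∀ {A B : Set} → A ⇔ B → B ⇔ A
⇔-sym p = mk⇔ (Equivalence.from p) (Equivalence.to p)

side-cong : ∀ s {A B} → A ⇔ B → Side s A ⇔ Side s B
side-cong true e = e
side-cong false e = mk⇔ (λ na b → na (Equivalence.from e b)) (λ nb a → nb (Equivalence.to e a))

-- When Eloise falsifies, this is elimination of a double negation, hence the decision procedure;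
-- the same holds for conjunctions and universal quantifiers below.
side-neg : ∀ s {A} → Dec A → Side (not s) A ⇔ Side s (¬ A)
side-neg true d = mk⇔ id id
side-neg false d = mk⇔ (λ a na → na a) (λ nna → decidable-stable d nna)
  where open import Relation.Nullary.Decidable using (decidable-stable)

side-or : ∀ s {A B} → Both s (Side s A) (Side s B) ⇔ Side s (A ⊎ B)
side-or true = mk⇔ id id
side-or false = mk⇔ (λ { (p , q) → [ p , q ] }) (λ k → (λ a → k (inj₁ a)) , (λ b → k (inj₂ b)))

side-and : ∀ s {A B} → Dec A → Both (not s) (Side s A) (Side s B) ⇔ Side s (A × B)
side-and true d = mk⇔ id id
side-and false {A} {B} d = mk⇔ (λ { (inj₁ na) (a , _) → na a ; (inj₂ nb) (_ , b) → nb b }) (λ k → pick d k)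
  where pick : Dec A → ¬ (A × B) → ¬ A ⊎ ¬ B
        pick (yes a) k = inj₂ (λ b → k (a , b))
        pick (no na) k = inj₁ na

side-ex : ∀ s {n} {A : Fin n → Set} → Quant s (λ a → Side s (A a)) ⇔ Side s (∃ A)
side-ex true = mk⇔ id id
side-ex false = mk⇔ (λ k → λ { (a , x) → k a x }) (λ k a x → k (a , x))

side-all : ∀ s {n} {A : Fin n → Set} → (∀ a → Dec (A a)) → Quant (not s) (λ a → Side s (A a)) ⇔ Side s (∀ a → A a)
side-all true d = mk⇔ id id
side-all false {n} {A} d = mk⇔ (λ { (a , na) k → na (k a) }) (λ k → FP.¬∀⟶∃¬ n A d k)

quant-⇔ : ∀ s {A : Set} {P Q : A → Set} → (∀ a → P a ⇔ Q a) → Quant s P ⇔ Quant s Q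
quant-⇔ true e = mk⇔ (λ { (a , p) → a , Equivalence.to (e a) p }) (λ { (a , q) → a , Equivalence.from (e a) q })
quant-⇔ false e = mk⇔ (λ p a → Equivalence.to (e a) (p a)) (λ q a → Equivalence.from (e a) (q a))

both-⇔ : ∀ s {A B C D} → A ⇔ C → B ⇔ D → Both s A B ⇔ Both s C D
both-⇔ true e f = mk⇔ (λ { (inj₁ a) → inj₁ (Equivalence.to e a) ; (inj₂ b) → inj₂ (Equivalence.to f b) })
                      (λ { (inj₁ a) → inj₁ (Equivalence.from e a) ; (inj₂ b) → inj₂ (Equivalence.from f b) })
both-⇔ false e f = mk⇔ (λ { (a , b) → Equivalence.to e a , Equivalence.to f b }) (λ { (a , b) → Equivalence.from e a , Equivalence.from f b })

module Evaluate {τ : Voc} {φ₀ : Formula τ} {n V : ℕ} (fits : Fits V φ₀) where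
  open Equivalence using (to; from)

  At : List ℕ → Formula τ → Set
  At p ψ = subAt φ₀ p ≡ just ψ

  at-child : ∀ p i {ψ χ} → At p ψ → childAt ψ i ≡ just χ → At (p ++ i ∷ []) χ
  at-child p i e c = trans (subAt-++ φ₀ p i e) c

  Assigns : GState τ n → (Var → Fin n) → Set
  Assigns g ρ = ∀ v → v < V → asg g v ≡ just (ρ v)

  assigns-tuple : ∀ {g ρ k} (xs : Vec Var k) → Assigns g ρ → All (_< V) (toList xs) →
                  mapMaybe′ (asg g) (toList xs) ≡ just (toList (Vec.map ρ xs))
  assigns-tuple [] h b = refl
  assigns-tuple {g} (x ∷ xs) h (p ∷ b) with asg g x | h x p | mapMaybe′ (asg g) (toList xs) | assigns-tuple {g} xs h b
  ... | _ | refl | _ | refl = refl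

  module _ {r : Rels τ n} where
    open Semantics {τ} {n} r

    bool-side : ∀ s b → boolEq b s ≡ true ⇔ Side s (b ≡ true)
    bool-side true true = mk⇔ id id
    bool-side true false = mk⇔ (λ ()) (λ ())
    bool-side false true = mk⇔ (λ ()) (λ k → contradiction refl k)
    bool-side false false = mk⇔ (λ _ ()) (λ _ → refl)

    terminal-bool : ∀ {g b} → node φ₀ n g ≡ terminal (just b) → Wins {φ₀ = φ₀} g ⇔ (b ≡ true)
    terminal-bool e = ⇔-trans (terminal-⇔ e) (mk⇔ just-injective (cong just))

    -- All variables below `V` are assigned, so no play through `formula χ` ends without winner, and
    -- the game is plain truth seen from the role of Eloise.
    evaluate : ∀ χ g ρ → At (pos g) (formula χ) → Assigns g ρ → rels g ≡ r →
               Wins {φ₀ = φ₀} g ⇔ Side (eloiseVer g) (⟦ χ ⟧ ρ)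
    evaluate (atomF R xs) g ρ e h refl =
      ⇔-trans (terminal-bool (trans (node-atom {φ₀ = φ₀} {g = g} e)
          (cong (maybe _ (terminal nothing)) (assigns-tuple {g} xs h (proj₂ (fits-sub φ₀ (pos g) fits e))))))
        (bool-side (eloiseVer g) _)
    evaluate (eqF x y) g ρ e h refl =
      ⇔-trans (terminal-bool (node-eq {φ₀ = φ₀} {g = g} e (h x (proj₁ f)) (h y (proj₂ f))))
        (⇔-trans (bool-side (eloiseVer g) _) (side-cong (eloiseVer g)
          (mk⇔ (finEq-sound _ _) (λ q → trans (cong (λ a → finEq a (ρ y)) q) (finEq-refl (ρ y))))))
      where f = fits-sub φ₀ (pos g) fits e
    evaluate ttF g ρ e h refl = ⇔-trans (terminal-bool (node-tt {φ₀ = φ₀} {g = g} e)) (side-⊤ (eloiseVer g))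
      where side-⊤ : ∀ s → s ≡ true ⇔ Side s ⊤
            side-⊤ true = mk⇔ (λ _ → _) (λ _ → refl)
            side-⊤ false = mk⇔ (λ ()) (λ k → contradiction _ k)
    evaluate ffF g ρ e h refl = ⇔-trans (terminal-bool (node-ff {φ₀ = φ₀} {g = g} e)) (side-⊥ (eloiseVer g))
      where side-⊥ : ∀ s → not s ≡ true ⇔ Side s ⊥
            side-⊥ true = mk⇔ (λ ()) (λ ())
            side-⊥ false = mk⇔ (λ _ ()) (λ _ → refl)
    evaluate (notF χ) g ρ e h refl = ⇔-trans (⇔-sym (det-⇔ (node-neg {φ₀ = φ₀} {g = g} e)))
      (⇔-trans (evaluate χ (record (down g 0) { eloiseVer = not (eloiseVer g) }) ρ (at-child (pos g) 0 e refl) h refl)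
        (side-neg (eloiseVer g) (⟦ χ ⟧? ρ)))
    evaluate (andF χ ψ) g ρ e h refl = ⇔-trans (⇔-sym (pair-⇔ (not (eloiseVer g)) (node-and {φ₀ = φ₀} {g = g} e)))
      (⇔-trans (both-⇔ (not (eloiseVer g)) (evaluate χ (down g 0) ρ (at-child (pos g) 0 e refl) h refl)
                                           (evaluate ψ (down g 1) ρ (at-child (pos g) 1 e refl) h refl))
        (side-and (eloiseVer g) (⟦ χ ⟧? ρ)))
    evaluate (orF χ ψ) g ρ e h refl = ⇔-trans (⇔-sym (pair-⇔ (eloiseVer g) (node-or {φ₀ = φ₀} {g = g} e)))
      (⇔-trans (both-⇔ (eloiseVer g) (evaluate χ (down g 0) ρ (at-child (pos g) 0 e refl) h refl)
                                     (evaluate ψ (down g 1) ρ (at-child (pos g) 1 e refl) h refl))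
        (side-or (eloiseVer g)))
    evaluate (exF x χ) g ρ e h refl = ⇔-trans (⇔-sym (choice-⇔ (eloiseVer g) (afterVar {φ₀ = φ₀} {g = g} x) (allFin n) ∈-allFin (node-ex {φ₀ = φ₀} {g = g} e)))
      (⇔-trans (quant-⇔ (eloiseVer g) (λ a → evaluate χ (afterVar {φ₀ = φ₀} {g = g} x a) (ρ [ x ↦ a ]) (at-child (pos g) 0 e refl) (assigns-var g x a h) refl))
        (side-ex (eloiseVer g)))
      where
      assigns-var : ∀ g x a → Assigns g ρ → Assigns (afterVar {φ₀ = φ₀} {g = g} x a) (ρ [ x ↦ a ])
      assigns-var g x a h v lt with v ≡ᵇ x
      ... | true = refl
      ... | false = h v lt
    evaluate (allF x χ) g ρ e h refl = ⇔-trans (⇔-sym (choice-⇔ (not (eloiseVer g)) (afterVar {φ₀ = φ₀} {g = g} x) (allFin n) ∈-allFin (node-all {φ₀ = φ₀} {g = g} e)))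
      (⇔-trans (quant-⇔ (not (eloiseVer g)) (λ a → evaluate χ (afterVar {φ₀ = φ₀} {g = g} x a) (ρ [ x ↦ a ]) (at-child (pos g) 0 e refl) (assigns-var g x a h) refl))
        (side-all (eloiseVer g) (λ a → ⟦ χ ⟧? (ρ [ x ↦ a ]))))
      where
      assigns-var : ∀ g x a → Assigns g ρ → Assigns (afterVar {φ₀ = φ₀} {g = g} x a) (ρ [ x ↦ a ])
      assigns-var g x a h v lt with v ≡ᵇ x
      ... | true = refl
      ... | false = h v lt

  findLabel-++ : ∀ (φ : Formula τ) C pre p i acc {ψ χ} → subAt φ p ≡ just ψ → childAt ψ i ≡ just χ →
                 findLabel φ C pre (p ++ i ∷ []) acc ≡ labelHere ψ C (pre ++ p) (findLabel φ C pre p acc)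
  findLabel-++ φ C pre [] i acc refl c rewrite c | LP.++-identityʳ pre = refl
  findLabel-++ φ C pre (j ∷ p) i acc {ψ} e c with childAt φ j
  ... | just φ′ = trans (findLabel-++ φ′ C (pre ++ j ∷ []) p i _ e c)
                        (cong (λ q → labelHere ψ C q (findLabel φ′ C (pre ++ j ∷ []) p (labelHere φ C pre acc))) (LP.++-assoc pre (j ∷ []) p))

  -- Where a looping atom `C` at this position would jump to.
  env : List ℕ → Label → Maybe (List ℕ)
  env p C = findLabel φ₀ C [] p nothing

  env-child : ∀ p i C {ψ χ} → At p ψ → childAt ψ i ≡ just χ → env (p ++ i ∷ []) C ≡ labelHere ψ C p (env p C)
  env-child p i C e c = findLabel-++ φ₀ C [] p i nothing e c

-- Rewriting relations inside the game

varsFrom : ∀ k → Var → Vec Var k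
varsFrom zero x = []
varsFrom (suc k) x = x ∷ varsFrom k (suc x)

-- One pass of the loop labelled 1 inserts or deletes one tuple of one of the
-- relations Rs; the verifier leaves it at ψ.
options : ∀ {τ} → List (RelSym τ) → Formula τ → Formula τ
options [] ψ = ψ
options {τ} (R ∷ Rs) ψ = or (ins R (varsFrom (arity τ R) 0) (loop 1)) (or (del R (varsFrom (arity τ R) 0) (loop 1)) (options Rs ψ))

edits : ∀ {τ} → Pol → List (RelSym τ) → Formula τ → Formula τ
edits {τ} t Rs ψ = lab 1 t (options {τ} Rs ψ)

-- Each relation contributes two nested disjunctions to `options`, so the exit is reached by going
-- right twice per relation.
exitPos : List ℕ → ℕ → List ℕ
exitPos q zero = q
exitPos q (suc k) = exitPos ((q ++ 1 ∷ []) ++ 1 ∷ []) k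

edited : ∀ {τ n} → Bool → Rels τ n → RelSym τ → List (Fin n) → Rels τ n
edited {τ} true r R u = addTuple {τ} r R u
edited {τ} false r R u = delTuple {τ} r R u

edited-same : ∀ {τ n} b (r : Rels τ n) R u → edited {τ} b r R u R u ≡ b
edited-same {τ} true r R u = cong (_∨ r R u) (cong₂ _∧_ (symEq-refl τ R) (listEq-refl finEq-refl u))
edited-same {τ} false r R u = cong (λ b → not b ∧ r R u) (cong₂ _∧_ (symEq-refl τ R) (listEq-refl finEq-refl u))

edited-other : ∀ {τ n} b (r : Rels τ n) R u Q v → Q ≢ R ⊎ v ≢ u → edited {τ} b r R u Q v ≡ r Q v
edited-other {τ} true r R u Q v d = cong (_∨ r Q v) (differ τ Q R v u d)
edited-other {τ} false r R u Q v d = cong (λ b → not b ∧ r Q v) (differ τ Q R v u d)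

≟-tuple : ∀ {τ n} (Q R : RelSym τ) (v u : List (Fin n)) → (Q ≡ R × v ≡ u) ⊎ (Q ≢ R ⊎ v ≢ u)
≟-tuple {τ} Q R v u with symEq τ Q R in se | listEq finEq v u in le
... | true | true = inj₁ (symEq-sound τ Q R se , listEq-sound finEq-sound v u le)
... | false | _ = inj₂ (inj₁ (λ { refl → contradiction (trans (sym (symEq-refl τ Q)) se) (λ ()) }))
... | true | false = inj₂ (inj₂ (λ { refl → contradiction (trans (sym (listEq-refl finEq-refl v)) le) (λ ()) }))

module Heights {τ : Voc} (φ₀ : Formula τ) (n : ℕ) where

  -- `EloiseWins` with a bound on the height of the derivation.
  data W : ℕ → GState τ n → Set where
    w-win    : ∀ {k g} → node φ₀ n g ≡ terminal (just true) → W k g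
    w-forced : ∀ {k g g′} → node φ₀ n g ≡ det g′ → W k g′ → W (suc k) g
    w-choose : ∀ {k g gs g′} → node φ₀ n g ≡ choice true gs → g′ ∈ gs → W k g′ → W (suc k) g
    w-face   : ∀ {k g gs} → node φ₀ n g ≡ choice false gs → (∀ g′ → g′ ∈ gs → W k g′) → W (suc k) g

  w-mono : ∀ {k l g} → k ≤ l → W k g → W l g
  w-mono le (w-win e) = w-win e
  w-mono (s≤s le) (w-forced e w) = w-forced e (w-mono le w)
  w-mono (s≤s le) (w-choose e m w) = w-choose e m (w-mono le w)
  w-mono (s≤s le) (w-face e w) = w-face e (λ g′ m → w-mono le (w g′ m))

  -- Branching is finite, so the heights below a move of Abelard have a maximum.
  common-height : ∀ gs → (∀ g → g ∈ gs → ∃ λ k → W k g) → ∃ λ k → ∀ g → g ∈ gs → W k g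
  common-height [] h = 0 , λ _ ()
  common-height (g ∷ gs) h with h g (here refl) | common-height gs (λ g′ m → h g′ (there m))
  ... | k , w | l , ws = k ⊔ l , λ { _ (here refl) → w-mono (m≤m⊔n k l) w ; g′ (there m) → w-mono (m≤n⊔m k l) (ws g′ m) }

  height : ∀ {g} → EloiseWins φ₀ n g → ∃ λ k → W k g
  height (win e) = 0 , w-win e
  height (forced e w) with height w
  ... | k , v = suc k , w-forced e v
  height (eChoose e m w) with height w
  ... | k , v = suc k , w-choose e m v
  height (aChoose {opts = gs} e w) with common-height gs (λ g m → height (w g m))
  ... | k , v = suc k , w-face e v

  w-wins : ∀ {k g} → W k g → EloiseWins φ₀ n g
  w-wins (w-win e) = win e
  w-wins (w-forced e w) = forced e (w-wins w)
  w-wins (w-choose e m w) = eChoose e m (w-wins w)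
  w-wins (w-face e w) = aChoose e (λ g m → w-wins (w g m))

  w-terminal : ∀ {k g m} → node φ₀ n g ≡ terminal m → W k g → m ≡ just true
  w-terminal e w = wins-terminal e (w-wins w)

  w-det : ∀ {k g g′} → node φ₀ n g ≡ det g′ → W k g → ∃ λ l → k ≡ suc l × W l g′
  w-det e (w-win e′) with trans (sym e) e′
  ... | ()
  w-det e (w-forced e′ w) with trans (sym e) e′
  ... | refl = _ , refl , w
  w-det e (w-choose e′ _ _) with trans (sym e) e′
  ... | ()
  w-det e (w-face e′ _) with trans (sym e) e′
  ... | ()

  w-chosen : ∀ {k g gs} → node φ₀ n g ≡ choice true gs → W k g → ∃ λ l → ∃ λ g′ → k ≡ suc l × g′ ∈ gs × W l g′
  w-chosen e (w-win e′) with trans (sym e) e′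
  ... | ()
  w-chosen e (w-forced e′ _) with trans (sym e) e′
  ... | ()
  w-chosen e (w-choose e′ m w) with trans (sym e) e′
  ... | refl = _ , _ , refl , m , w
  w-chosen e (w-face e′ _) with trans (sym e) e′
  ... | ()

  w-faced : ∀ {k g gs} → node φ₀ n g ≡ choice false gs → W k g → ∃ λ l → k ≡ suc l × (∀ g′ → g′ ∈ gs → W l g′)
  w-faced e (w-win e′) with trans (sym e) e′
  ... | ()
  w-faced e (w-forced e′ _) with trans (sym e) e′
  ... | ()
  w-faced e (w-choose e′ _ _) with trans (sym e) e′
  ... | ()
  w-faced e (w-face e′ w) with trans (sym e) e′
  ... | refl = _ , refl , w

module Editing {τ : Voc} {φ₀ : Formula τ} {n V : ℕ} (fits : Fits V φ₀) where
  open Evaluate {τ} {φ₀} {n} {V} fits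
  open Heights φ₀ n

  -- Edits overwrite variables with the components of the edited tuple. Formulae are later evaluated
  -- under whatever assignment results, so only definedness has to be tracked.
  Tot : (Var → Maybe (Fin n)) → Set
  Tot f = ∀ v → v < V → ∃ λ a → f v ≡ just a

  tot-assign : ∀ {f} x a → Tot f → Tot (assign f x a)
  tot-assign x a h v lt with v ≡ᵇ x
  ... | true = a , refl
  ... | false = h v lt

  tot-assignAll : ∀ {f} xs as → Tot f → Tot (assignAll f xs as)
  tot-assignAll [] as h = h
  tot-assignAll (x ∷ xs) [] h = h
  tot-assignAll {f} (x ∷ xs) (a ∷ as) h = tot-assignAll {assign f x a} xs as (tot-assign {f} x a h)

  at : GState τ n → List ℕ → GState τ n
  at g q = record g { pos = q }

  editedAt : Bool → GState τ n → (R : RelSym τ) → Vec (Fin n) (arity τ R) → List ℕ → GState τ n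
  editedAt b g R u q = record g
    { rels = edited {τ} b (rels g) R (toList u)
    ; asg = assignAll (asg g) (toList (varsFrom (arity τ R) 0)) (toList u) ; pos = q }

  loop-target : ∀ {q C p} → At q (loop C) → env q C ≡ just p → ∀ g → pos g ≡ q → node φ₀ n g ≡ det (at g p)
  loop-target e h g refl = trans (node-loop {φ₀ = φ₀} {g = g} e) (cong (maybe _ (terminal nothing)) h)

  env-start : ∀ {p t χ} → At p (lab 1 t χ) → env (p ++ 0 ∷ []) 1 ≡ just p
  env-start {p} e = env-child p 0 1 e refl

  env-exit : ∀ Rs q C {ψ} → At q (options Rs ψ) → env (exitPos q (length Rs)) C ≡ env q C
  env-exit [] q C e = refl
  env-exit (R ∷ Rs) q C e = trans (env-exit Rs _ C (at-child (q ++ 1 ∷ []) 1 (at-child q 1 e refl) refl))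
    (trans (env-child (q ++ 1 ∷ []) 1 C (at-child q 1 e refl) refl) (env-child q 1 C e refl))

  at-exit : ∀ Rs q {ψ} → At q (options Rs ψ) → At (exitPos q (length Rs)) ψ
  at-exit [] q e = e
  at-exit (R ∷ Rs) q e = at-exit Rs _ (at-child (q ++ 1 ∷ []) 1 (at-child q 1 e refl) refl)

  leave : ∀ Rs g {ψ} → At (pos g) (options Rs ψ) → eloiseVer g ≡ true → Wins {φ₀ = φ₀} (at g (exitPos (pos g) (length Rs))) → Wins {φ₀ = φ₀} g
  leave [] g e r w = w
  leave (R ∷ Rs) g e refl w =
    eChoose (node-or {φ₀ = φ₀} {g = g} e) (there (here refl))
      (eChoose (node-or {φ₀ = φ₀} {g = down g 1} (at-child (pos g) 1 e refl)) (there (here refl))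
        (leave Rs (down (down g 1) 1) (at-child (pos g ++ 1 ∷ []) 1 (at-child (pos g) 1 e refl) refl) refl w))

  change : ∀ Rs g {ψ p} → At (pos g) (options Rs ψ) → eloiseVer g ≡ true → env (pos g) 1 ≡ just p →
           ∀ {R} → R ∈ Rs → ∀ b u → Wins {φ₀ = φ₀} (editedAt b g R u p) → Wins {φ₀ = φ₀} g
  change (R ∷ Rs) g {ψ} {p} e refl h (here refl) true u w =
    eChoose (node-or {φ₀ = φ₀} {g = g} e) (here refl)
      (eChoose (node-ins {φ₀ = φ₀} {g = down g 0} (at-child (pos g) 0 e refl)) (∈-map⁺ _ (∈-allVecs u))
        (forced (loop-target {p = p} (at-child q₀ 0 (at-child (pos g) 0 e refl) refl)
          (trans (env-child q₀ 0 1 (at-child (pos g) 0 e refl) refl) (trans (env-child (pos g) 0 1 e refl) h))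
          (editedAt true g R u (q₀ ++ 0 ∷ [])) refl) w))
    where q₀ = pos g ++ 0 ∷ []
  change (R ∷ Rs) g {ψ} {p} e refl h (here refl) false u w =
    eChoose (node-or {φ₀ = φ₀} {g = g} e) (there (here refl))
      (eChoose (node-or {φ₀ = φ₀} {g = down g 1} e₁) (here refl)
        (eChoose (node-del {φ₀ = φ₀} {g = down (down g 1) 0} (at-child q₁ 0 e₁ refl)) (∈-map⁺ _ (∈-allVecs u))
          (forced (loop-target {p = p} (at-child (q₁ ++ 0 ∷ []) 0 (at-child q₁ 0 e₁ refl) refl)
            (trans (env-child (q₁ ++ 0 ∷ []) 0 1 (at-child q₁ 0 e₁ refl) refl) (trans (env-child q₁ 0 1 e₁ refl) (trans (env-child (pos g) 1 1 e refl) h)))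
            (editedAt false g R u ((q₁ ++ 0 ∷ []) ++ 0 ∷ [])) refl) w)))
    where q₁ = pos g ++ 1 ∷ []
          e₁ = at-child (pos g) 1 e refl
  change (R ∷ Rs) g {ψ} {p} e refl h (there m) b u w =
    eChoose (node-or {φ₀ = φ₀} {g = g} e) (there (here refl))
      (eChoose (node-or {φ₀ = φ₀} {g = down g 1} e₁) (there (here refl))
        (change Rs (down (down g 1) 1) (at-child q₁ 1 e₁ refl) refl
          (trans (env-child q₁ 1 1 e₁ refl) (trans (env-child (pos g) 1 1 e refl) h)) m b u w))
    where q₁ = pos g ++ 1 ∷ []
          e₁ = at-child (pos g) 1 e refl

  Edits : Set
  Edits = List (Σ (RelSym τ) λ R → Vec (Fin n) (arity τ R))

  record Rewritten (r′ : Rels τ n) (E : ℕ) (p q : List ℕ) (g g′ : GState τ n) : Set where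
    field
      pos≡    : pos g′ ≡ q
      ver≡    : eloiseVer g′ ≡ true
      total′  : Tot (asg g′)
      rels≡   : ∀ R (u : Vec (Fin n) (arity τ R)) → rels g′ R (toList u) ≡ r′ R (toList u)
      here≡   : visits g′ p ≡ visits g p + suc E
      there≡  : ∀ q → q ≢ p → visits g′ q ≡ visits g q
  open Rewritten public

  -- One visit of the loop per edit, and one more to leave it.
  rewrite-rels : ∀ (r′ : Rels τ n) {t Rs ψ} (E : Edits) g → At (pos g) (edits t Rs ψ) → eloiseVer g ≡ true → Tot (asg g) →
    (∀ R u → (R , u) ∈ E → R ∈ Rs) → visits g (pos g) + length E < evalPol t n →
    (∀ R u → rels g R (toList u) ≡ r′ R (toList u) ⊎ (R , u) ∈ E) →
    (∀ g′ → Rewritten r′ (length E) (pos g) (exitPos (pos g ++ 0 ∷ []) (length Rs)) g g′ → Wins {φ₀ = φ₀} g′) → Wins {φ₀ = φ₀} g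
  rewrite-rels r′ {t} {Rs} {ψ} E g e v tot inRs lt agree k =
    forced (node-lab {φ₀ = φ₀} {g = g} e (<ᵇ-true (≤-trans (s≤s (m≤m+n _ (length E))) lt))) (body E inRs lt agree k)
    where
    p = pos g
    g₁ = afterLab {φ₀ = φ₀} {g = g}
    e₁ : At (p ++ 0 ∷ []) (options Rs ψ)
    e₁ = at-child p 0 e refl
    vis-here : visits g₁ p ≡ suc (visits g p)
    vis-here rewrite pathEq-refl p = refl
    vis-there : ∀ q → q ≢ p → visits g₁ q ≡ visits g q
    vis-there q ne with listEq _≡ᵇ_ q p in qp
    ... | true = contradiction (pathEq-sound q p qp) ne
    ... | false = refl
    body : ∀ E → (∀ R u → (R , u) ∈ E → R ∈ Rs) → visits g p + length E < evalPol t n →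
      (∀ R u → rels g R (toList u) ≡ r′ R (toList u) ⊎ (R , u) ∈ E) →
      (∀ g′ → Rewritten r′ (length E) p (exitPos (p ++ 0 ∷ []) (length Rs)) g g′ → Wins {φ₀ = φ₀} g′) → Wins {φ₀ = φ₀} g₁
    body [] inRs lt agree k = leave Rs g₁ e₁ v (k _ (record
      { pos≡ = refl ; ver≡ = v ; total′ = tot
      ; rels≡ = λ R u → done-all (agree R u)
      ; here≡ = trans vis-here (+-comm 1 _) ; there≡ = vis-there }))
      where done-all : ∀ {A : Set} {x : Σ (RelSym τ) λ R → Vec (Fin n) (arity τ R)} → A ⊎ x ∈ [] → A
            done-all (inj₁ a) = a
    body ((R , u) ∷ E) inRs lt agree k =
      change Rs g₁ e₁ v (env-start e) (inRs R u (here refl)) b u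
        (rewrite-rels r′ {t} {Rs} {ψ} E g₂ e v (tot-assignAll (toList (varsFrom (arity τ R) 0)) (toList u) tot)
          (λ Q w m → inRs Q w (there m))
          (≤-trans (s≤s (≤-reflexive (trans (cong (_+ length E) vis-here) (sym (+-suc (visits g p) (length E)))))) lt)
          agree′
          (λ g′ w → k g′ (record { pos≡ = pos≡ w ; ver≡ = ver≡ w ; total′ = total′ w ; rels≡ = rels≡ w
             ; here≡ = trans (here≡ w) (trans (cong (_+ suc (length E)) vis-here) (sym (+-suc (visits g p) (suc (length E)))))
             ; there≡ = λ q ne → trans (there≡ w q ne) (vis-there q ne) })))
      where
      -- Insertion or deletion according to the wanted value. The tuple may already be right, so `E`
      -- has to contain the wrong tuples but need not consist of them.
      b = r′ R (toList u)
      g₂ = editedAt b g₁ R u p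
      agree′ : ∀ Q w → rels g₂ Q (toList w) ≡ r′ Q (toList w) ⊎ (Q , w) ∈ E
      agree′ Q w with ≟-tuple {τ} Q R (toList w) (toList u)
      ... | inj₁ (refl , q) rewrite q = inj₁ (edited-same {τ} b (rels g) Q (toList u))
      ... | inj₂ d with agree Q w
      ...   | inj₁ a = inj₁ (trans (edited-other {τ} b (rels g) R (toList u) Q (toList w) d) a)
      ...   | inj₂ (there m) = inj₂ m
      ...   | inj₂ (here refl) = contradiction refl-both (λ ())
        where refl-both : ⊥
              refl-both = [ (λ ne → ne refl) , (λ ne → ne refl) ] d

  -- All that a winning strategy reveals about the loop: it is left somewhere, with the other
  -- relations untouched. Nothing is said about the edited relations or the clocks. The height `l`
  -- is kept for the inductions that continue from here.
  record Left (Rs : List (RelSym τ)) (k : ℕ) (q : List ℕ) (r : Rels τ n) : Set where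
    constructor left-at
    field
      {l}     : ℕ
      g′      : GState τ n
      l≤k     : l ≤ k
      wins′   : W l g′
      pos≡    : pos g′ ≡ q
      ver≡    : eloiseVer g′ ≡ true
      total′  : Tot (asg g′)
      kept    : ∀ R → (∀ S → S ∈ Rs → R ≢ S) → ∀ u → rels g′ R u ≡ r R u

  -- A pass returns to the label, a larger formula, so the induction is on the bound `m` for the
  -- height. Insertions and deletions are moves of Eloise, so her strategy singles out one sequence
  -- of edits.
  edit-sound : ∀ m {k t Rs ψ} g → k ≤ m → At (pos g) (edits t Rs ψ) → eloiseVer g ≡ true → Tot (asg g) → W k g →
               Left Rs m (exitPos (pos g ++ 0 ∷ []) (length Rs)) (rels g)
  options-sound : ∀ m {k t Rs ψ} p g → k ≤ m → At p (edits t Rs ψ) → ∀ Rs′ → (∀ R → R ∈ Rs′ → R ∈ Rs) →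
                  exitPos (pos g) (length Rs′) ≡ exitPos (p ++ 0 ∷ []) (length Rs) → env (pos g) 1 ≡ just p →
                  At (pos g) (options Rs′ ψ) → eloiseVer g ≡ true → Tot (asg g) → W k g → Left Rs m (exitPos (p ++ 0 ∷ []) (length Rs)) (rels g)

  back-sound : ∀ m {k t Rs ψ} p g b R (u : Vec (Fin n) (arity τ R)) q → k ≤ m → At p (edits t Rs ψ) → R ∈ Rs →
               At q (loop 1) → env q 1 ≡ just p → eloiseVer g ≡ true → Tot (asg g) → W k (editedAt b g R u q) →
               Left Rs m (exitPos (p ++ 0 ∷ []) (length Rs)) (rels g)
  back-sound m {k} {Rs = Rs} p g b R u q le ep mem eq′ h v tot w with w-det (loop-target eq′ h (editedAt b g R u q) refl) w
  ... | l , refl , w′ with edit-sound m {Rs = Rs} (editedAt b g R u p) (≤-trans (n≤1+n l) le) ep v (tot-assignAll (toList (varsFrom (arity τ R) 0)) (toList u) tot) w′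
  ...   | left-at g′ le′ w″ ps vr tt′ kp = left-at g′ le′ w″ ps vr tt′
            (λ Q ne x → trans (kp Q ne x) (edited-other {τ} b (rels g) R (toList u) Q x (inj₁ (ne R mem))))

  edit-sound m {k} {t} g le e v tot w with visits g (pos g) <ᵇ evalPol t n in lt
  ... | false with w-terminal (node-stuck {φ₀ = φ₀} {g = g} e lt) w
  ...   | ()
  edit-sound m {k} {t} {Rs} g le e v tot w | true with w-det (node-lab {φ₀ = φ₀} {g = g} e lt) w
  edit-sound (suc m) {.(suc l)} {t} {Rs} g (s≤s le) e v tot w | true | l , refl , w′
    with options-sound m {Rs = Rs} (pos g) (afterLab {φ₀ = φ₀} {g = g}) le e Rs (λ R m → m) refl (env-start e) (at-child (pos g) 0 e refl) v tot w′
  ... | left-at g′ le′ w″ ps vr tt′ kp = left-at g′ (≤-trans le′ (n≤1+n m)) w″ ps vr tt′ kp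

  options-sound m {Rs = Rs} p g le ep [] sub eqp h e v tot w = left-at g le w eqp v tot (λ _ _ _ → refl)
  options-sound m {Rs = Rs} p g le ep (R ∷ Rs′) sub eqp h e refl tot w with w-chosen (node-or {φ₀ = φ₀} {g = g} e) w
  ... | l , _ , refl , here refl , w₀ with w-chosen (node-ins {φ₀ = φ₀} {g = down g 0} (at-child (pos g) 0 e refl)) w₀
  ...   | l₂ , g₂ , refl , mem , w₂ with ∈-map⁻ _ mem
  ...     | u , _ , refl = back-sound m {Rs = Rs} p g true R u ((pos g ++ 0 ∷ []) ++ 0 ∷ []) (≤-trans (n≤1+n _) (≤-trans (n≤1+n _) le)) ep (sub R (here refl))
              (at-child q₀ 0 (at-child (pos g) 0 e refl) refl)
              (trans (env-child q₀ 0 1 (at-child (pos g) 0 e refl) refl) (trans (env-child (pos g) 0 1 e refl) h)) refl tot w₂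
    where q₀ = pos g ++ 0 ∷ []
  options-sound m {Rs = Rs} p g le ep (R ∷ Rs′) sub eqp h e refl tot w | l , _ , refl , there (here refl) , w₀
    with w-chosen (node-or {φ₀ = φ₀} {g = down g 1} (at-child (pos g) 1 e refl)) w₀
  ... | l₁ , _ , refl , there (here refl) , w₁ =
        options-sound m {Rs = Rs} p (down (down g 1) 1) (≤-trans (n≤1+n _) (≤-trans (n≤1+n _) le)) ep Rs′ (λ S m → sub S (there m)) eqp
          (trans (env-child (pos g ++ 1 ∷ []) 1 1 (at-child (pos g) 1 e refl) refl) (trans (env-child (pos g) 1 1 e refl) h))
          (at-child (pos g ++ 1 ∷ []) 1 (at-child (pos g) 1 e refl) refl) refl tot w₁
  ... | l₁ , _ , refl , here refl , w₁ with w-chosen (node-del {φ₀ = φ₀} {g = down (down g 1) 0} (at-child (pos g ++ 1 ∷ []) 0 (at-child (pos g) 1 e refl) refl)) w₁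
  ...   | l₂ , g₂ , refl , mem , w₂ with ∈-map⁻ _ mem
  ...     | u , _ , refl = back-sound m {Rs = Rs} p g false R u ((q₁ ++ 0 ∷ []) ++ 0 ∷ []) (≤-trans (n≤1+n _) (≤-trans (n≤1+n _) (≤-trans (n≤1+n _) le))) ep (sub R (here refl))
              (at-child (q₁ ++ 0 ∷ []) 0 (at-child q₁ 0 e₁ refl) refl)
              (trans (env-child (q₁ ++ 0 ∷ []) 0 1 (at-child q₁ 0 e₁ refl) refl) (trans (env-child q₁ 0 1 e₁ refl) (trans (env-child (pos g) 1 1 e refl) h))) refl tot w₂
    where q₁ = pos g ++ 1 ∷ []
          e₁ = at-child (pos g) 1 e refl

-- Linear orders and lexicographic successor

total-mono-< : ∀ {n} (f g : Fin n → ℕ) j → (∀ i → f i ≤ g i) → f j < g j → total f < total g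
total-mono-≤ : ∀ {n} (f g : Fin n → ℕ) → (∀ i → f i ≤ g i) → total f ≤ total g
total-mono-≤ {zero} f g h = z≤n
total-mono-≤ {suc n} f g h = +-mono-≤ (h fz) (total-mono-≤ (λ i → f (fs i)) (λ i → g (fs i)) (λ i → h (fs i)))
total-mono-< f g fz h lt = +-mono-≤ lt (total-mono-≤ (λ i → f (fs i)) (λ i → g (fs i)) (λ i → h (fs i)))
total-mono-< f g (fs j) h lt = ≤-trans (≤-reflexive (sym (+-suc (f fz) _)))
  (+-mono-≤ (h fz) (total-mono-< (λ i → f (fs i)) (λ i → g (fs i)) j (λ i → h (fs i)) lt))

-- A value that is missed could be punched out, which would leave an injection into a smaller set.
injective⇒surjective : ∀ {n} (f : Fin n → Fin n) → (∀ {a b} → f a ≡ f b → a ≡ b) → ∀ i → ∃ λ a → f a ≡ i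
injective⇒surjective {suc n} f inj i with FP.any? (λ a → f a FP.≟ i)
... | yes p = p
... | no np = contradiction (FP.injective⇒≤ {f = λ a → Data.Fin.punchOut (avoid a)} (λ {a} {b} e → inj (FP.punchOut-injective (avoid a) (avoid b) e))) (<⇒≱ ≤-refl)
  where avoid : ∀ a → i ≢ f a
        avoid a e = np (a , sym e)

indicator : Bool → ℕ
indicator true = 1
indicator false = 0

module Ranking {n : ℕ} (lt : Fin n → Fin n → Bool) (irr : ∀ a → lt a a ≡ false)
  (trn : ∀ a b c → lt a b ≡ true → lt b c ≡ true → lt a c ≡ true)
  (cmp : ∀ a b → a ≡ b ⊎ lt a b ≡ true ⊎ lt b a ≡ true) where

  below-count : Fin n → ℕ
  below-count a = total (λ b → indicator (lt b a))

  below-mono : ∀ a c → lt a c ≡ true → below-count a < below-count c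
  below-mono a c ac = total-mono-< _ _ a le strict
    where
    le : ∀ b → indicator (lt b a) ≤ indicator (lt b c)
    le b with lt b a in ba
    ... | false = z≤n
    ... | true rewrite trn b a c ba ac = ≤-refl
    strict : indicator (lt a a) < indicator (lt a c)
    strict rewrite irr a | ac = ≤-refl

  below<n : ∀ a → below-count a < n
  below<n a = ≤-trans (total-mono-< _ (λ _ → 1) a le strict) (≤-reflexive (trans (total-const n 1) (*-identityʳ n)))
    where
    le : ∀ b → indicator (lt b a) ≤ 1
    le b with lt b a
    ... | true = ≤-refl
    ... | false = z≤n
    strict : indicator (lt a a) < 1
    strict rewrite irr a = ≤-refl

  -- The order that Eloise writes is only a relation. Counting predecessors turns it into a
  -- permutation of the domain, along which the structure can be relabelled.
  rk : Fin n → Fin n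
  rk a = fromℕ< (below<n a)

  toℕ-rk : ∀ a → toℕ (rk a) ≡ below-count a
  toℕ-rk a = FP.toℕ-fromℕ< (below<n a)

  rk-< : ∀ a b → lt a b ≡ true ⇔ (toℕ (rk a) < toℕ (rk b))
  rk-< a b = mk⇔ (λ p → subst₂ _<_ (sym (toℕ-rk a)) (sym (toℕ-rk b)) (below-mono a b p)) conv
    where
    conv : toℕ (rk a) < toℕ (rk b) → lt a b ≡ true
    conv p with cmp a b
    ... | inj₁ refl = contradiction p (<-irrefl refl)
    ... | inj₂ (inj₁ q) = q
    ... | inj₂ (inj₂ q) = contradiction p (<⇒≯ (subst₂ _<_ (sym (toℕ-rk b)) (sym (toℕ-rk a)) (below-mono b a q)))

  rk-injective : ∀ {a b} → rk a ≡ rk b → a ≡ b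
  rk-injective {a} {b} e with cmp a b
  ... | inj₁ q = q
  ... | inj₂ (inj₁ q) = contradiction (Equivalence.to (rk-< a b) q) (λ l → <-irrefl (cong toℕ e) l)
  ... | inj₂ (inj₂ q) = contradiction (Equivalence.to (rk-< b a) q) (λ l → <-irrefl (cong toℕ (sym e)) l)

offset-injective : ∀ {m} (L : Fin m → ℕ) i j i′ j′ → j < L i → j′ < L i′ → offset L i + j ≡ offset L i′ + j′ → i ≡ i′ × j ≡ j′
offset-injective L fz j fz j′ p q e = refl , e
offset-injective L fz j (fs i′) j′ p q e = contradiction p (≤⇒≯ (≤-trans (m≤m+n (L fz) _) (≤-reflexive (trans (sym (+-assoc (L fz) _ j′)) (sym e)))))
offset-injective L (fs i) j fz j′ p q e = contradiction q (≤⇒≯ (≤-trans (m≤m+n (L fz) _) (≤-reflexive (trans (sym (+-assoc (L fz) _ j)) e))))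
offset-injective L (fs i) j (fs i′) j′ p q e
  with offset-injective (λ x → L (fs x)) i j i′ j′ p q (+-cancelˡ-≡ (L fz) _ _ (trans (sym (+-assoc (L fz) _ j)) (trans e (+-assoc (L fz) _ j′))))
... | a , b = cong fs a , b

offset-next : ∀ {m} (L : Fin m → ℕ) i i′ → toℕ i′ ≡ suc (toℕ i) → offset L i′ ≡ offset L i + L i
offset-next L fz (fs fz) e = +-comm (L fz) 0
offset-next L (fs i) (fs i′) e = trans (cong (L fz +_) (offset-next (λ x → L (fs x)) i i′ (suc-injective e))) (sym (+-assoc (L fz) _ _))

offset-last : ∀ {m} (L : Fin m → ℕ) i → suc (toℕ i) ≡ m → offset L i + L i ≡ total L
offset-last {suc zero} L fz e = sym (+-identityʳ _)
offset-last {suc m} L (fs i) e = trans (+-assoc (L fz) _ _) (cong (L fz +_) (offset-last (λ x → L (fs x)) i (suc-injective e)))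

-- Uniqueness of quotient and remainder.
digit-unique : ∀ P a i b j → i < P → j < P → a * P + i ≡ b * P + j → a ≡ b × i ≡ j
digit-unique P zero i zero j p q e = refl , e
digit-unique P zero i (suc b) j p q e = contradiction p (≤⇒≯ (≤-trans (m≤m+n P _) (≤-reflexive (trans (sym (+-assoc P _ j)) (sym e)))))
digit-unique P (suc a) i zero j p q e = contradiction q (≤⇒≯ (≤-trans (m≤m+n P _) (≤-reflexive (trans (sym (+-assoc P _ i)) e))))
digit-unique P (suc a) i (suc b) j p q e
  with digit-unique P a i b j p q (+-cancelˡ-≡ P _ _ (trans (sym (+-assoc P _ i)) (trans e (+-assoc P _ j))))
... | x , y = cong suc x , y

minF maxF : ∀ {τ} → (Var → Var → FO τ) → Var → FO τ
minF lt x = notF (exF (suc x) (lt (suc x) x))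
maxF lt x = notF (exF (suc x) (lt x (suc x)))

-- The bound variable `suc (x + y)` differs from both `x` and `y`.
sucF : ∀ {τ} → (Var → Var → FO τ) → Var → Var → FO τ
sucF lt x y = andF (lt x y) (notF (exF (suc (x + y)) (andF (lt x (suc (x + y))) (lt (suc (x + y)) y))))

lexMin lexMax : ∀ {τ k} → (Var → Var → FO τ) → Vec Var k → FO τ
lexMin lt [] = ttF
lexMin lt (x ∷ xs) = andF (minF lt x) (lexMin lt xs)
lexMax lt [] = ttF
lexMax lt (x ∷ xs) = andF (maxF lt x) (lexMax lt xs)

sameF : ∀ {τ k l} → Vec Var k → Vec Var l → FO τ
sameF [] [] = ttF
sameF (x ∷ xs) (y ∷ ys) = andF (eqF x y) (sameF xs ys)
sameF _ _ = ffF

-- An odometer: either this digit stays and the later ones advance, or it advances and all later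
-- digits roll over from maximal to minimal.
lexSuc : ∀ {τ k l} → (Var → Var → FO τ) → Vec Var k → Vec Var l → FO τ
lexSuc lt (x ∷ xs) (y ∷ ys) = orF (andF (eqF x y) (lexSuc lt xs ys)) (andF (sucF lt x y) (andF (lexMax lt xs) (lexMin lt ys)))
lexSuc lt _ _ = ffF

module Lexicographic {τ : Voc} {n₁ : ℕ} (r : Rels τ (suc n₁)) (lt : Var → Var → FO τ)
  (rk : Fin (suc n₁) → Fin (suc n₁)) (inv : ∀ i → ∃ λ a → rk a ≡ i)
  (lt-sem : ∀ x y ρ → Semantics.⟦_⟧ {τ} r (lt x y) ρ ⇔ (toℕ (rk (ρ x)) < toℕ (rk (ρ y)))) where
  open Semantics {τ} {suc n₁} r
  open Equivalence using (to; from)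

  n : ℕ
  n = suc n₁

  ridx : ∀ {k} → Vec (Fin n) k → ℕ
  ridx t = idx (Vec.map rk t)

  get-new : ∀ ρ x a → (ρ [ x ↦ a ]) x ≡ a
  get-new ρ x a rewrite ≡ᵇ-refl x = refl

  get-old : ∀ ρ {x y} a → y ≢ x → (ρ [ x ↦ a ]) y ≡ ρ y
  get-old ρ a ne rewrite ≢⇒≡ᵇ-false ne = refl

  below-inv : ∀ i → i < n → ∃ λ a → toℕ (rk a) ≡ i
  below-inv i lt with inv (fromℕ< lt)
  ... | a , e = a , trans (cong toℕ e) (FP.toℕ-fromℕ< lt)

  rank<n : ∀ a → toℕ (rk a) < n
  rank<n a = FP.toℕ<n (rk a)

  sem-min : ∀ x ρ → ⟦ minF lt x ⟧ ρ ⇔ (toℕ (rk (ρ x)) ≡ 0)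
  sem-min x ρ = mk⇔ fwd bwd
    where
    fwd : _ → toℕ (rk (ρ x)) ≡ 0
    fwd none with toℕ (rk (ρ x)) in e
    ... | zero = refl
    ... | suc m with below-inv 0 (s≤s z≤n)
    ...   | a , q = contradiction (a , from (lt-sem (suc x) x (ρ [ suc x ↦ a ]))
              (subst₂ (λ u v → toℕ (rk u) < toℕ (rk v)) (sym (get-new ρ (suc x) a)) (sym (get-old ρ {suc x} {x} a (λ z → 1+n≢n (sym z))))
                 (subst₂ _<_ (sym q) (sym e) (s≤s z≤n)))) none
    bwd : toℕ (rk (ρ x)) ≡ 0 → _
    bwd e (a , l) = contradiction (subst (toℕ (rk ((ρ [ suc x ↦ a ]) (suc x))) <_) (trans (cong (λ u → toℕ (rk u)) (get-old ρ {suc x} {x} a (λ z → 1+n≢n (sym z)))) e)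
      (to (lt-sem (suc x) x (ρ [ suc x ↦ a ])) l)) (λ ())

  sem-max : ∀ x ρ → ⟦ maxF lt x ⟧ ρ ⇔ (suc (toℕ (rk (ρ x))) ≡ n)
  sem-max x ρ = mk⇔ fwd bwd
    where
    old : ∀ a → (ρ [ suc x ↦ a ]) x ≡ ρ x
    old a = get-old ρ {suc x} {x} a (λ z → 1+n≢n (sym z))
    fwd : _ → suc (toℕ (rk (ρ x))) ≡ n
    fwd none with suc (toℕ (rk (ρ x))) ≟ n
    ... | yes e = e
    ... | no ne with below-inv (suc (toℕ (rk (ρ x)))) (≤∧≢⇒< (rank<n (ρ x)) ne)
    ...   | a , q = contradiction (a , from (lt-sem x (suc x) (ρ [ suc x ↦ a ]))
              (subst₂ (λ u v → toℕ (rk u) < toℕ (rk v)) (sym (old a)) (sym (get-new ρ (suc x) a)) (≤-reflexive (sym q)))) none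
    bwd : suc (toℕ (rk (ρ x))) ≡ n → _
    bwd e (a , l) = contradiction (subst₂ (λ u v → toℕ (rk u) < toℕ (rk v)) (old a) (get-new ρ (suc x) a) (to (lt-sem x (suc x) (ρ [ suc x ↦ a ])) l))
      (≤⇒≯ (≤-pred (≤-trans (rank<n a) (≤-reflexive (sym e)))))

  sem-suc : ∀ x y ρ → ⟦ sucF lt x y ⟧ ρ ⇔ (toℕ (rk (ρ y)) ≡ suc (toℕ (rk (ρ x))))
  sem-suc x y ρ = mk⇔ fwd bwd
    where
    z = suc (x + y)
    oldx : ∀ a → (ρ [ z ↦ a ]) x ≡ ρ x
    oldx a = get-old ρ {z} {x} a (<⇒≢ (s≤s (m≤m+n x y)))
    oldy : ∀ a → (ρ [ z ↦ a ]) y ≡ ρ y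
    oldy a = get-old ρ {z} {y} a (<⇒≢ (s≤s (m≤n+m y x)))
    fwd : _ → toℕ (rk (ρ y)) ≡ suc (toℕ (rk (ρ x)))
    fwd (xy , none) with toℕ (rk (ρ y)) ≟ suc (toℕ (rk (ρ x)))
    ... | yes e = e
    ... | no ne with to (lt-sem x y ρ) xy
    ...   | l with below-inv (suc (toℕ (rk (ρ x)))) (≤-trans (s≤s l) (rank<n (ρ y)))
    ...     | a , q = contradiction (a ,
                from (lt-sem x z (ρ [ z ↦ a ])) (subst₂ (λ u v → toℕ (rk u) < toℕ (rk v)) (sym (oldx a)) (sym (get-new ρ z a)) (≤-reflexive (sym q))) ,
                from (lt-sem z y (ρ [ z ↦ a ])) (subst₂ (λ u v → toℕ (rk u) < toℕ (rk v)) (sym (get-new ρ z a)) (sym (oldy a))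
                  (subst (_< toℕ (rk (ρ y))) (sym q) (≤∧≢⇒< l (λ w → ne (sym w)))))) none
    bwd : toℕ (rk (ρ y)) ≡ suc (toℕ (rk (ρ x))) → _
    bwd e = from (lt-sem x y ρ) (≤-reflexive (sym e)) , λ { (a , p , q) →
      let p′ = subst₂ (λ u v → toℕ (rk u) < toℕ (rk v)) (oldx a) (get-new ρ z a) (to (lt-sem x z (ρ [ z ↦ a ])) p)
          q′ = subst₂ (λ u v → toℕ (rk u) < toℕ (rk v)) (get-new ρ z a) (oldy a) (to (lt-sem z y (ρ [ z ↦ a ])) q)
      in <-irrefl refl (≤-trans (s≤s p′) (≤-trans q′ (≤-reflexive e))) }

  ridx-∷ : ∀ {k} a (t : Vec (Fin n) k) → ridx (a ∷ t) ≡ toℕ (rk a) * n ^ k + ridx t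
  ridx-∷ a t = idx-∷ (rk a) (Vec.map rk t)

  ridx< : ∀ {k} (t : Vec (Fin n) k) → ridx t < n ^ k
  ridx< t = idx< (Vec.map rk t)

  pow-pos : ∀ k → 0 < n ^ k
  pow-pos k = m^n>0 n k

  sem-lexMin : ∀ {k} (xs : Vec Var k) ρ → ⟦ lexMin lt xs ⟧ ρ ⇔ (ridx (Vec.map ρ xs) ≡ 0)
  sem-lexMin [] ρ = mk⇔ (λ _ → refl) (λ _ → _)
  sem-lexMin {suc k} (x ∷ xs) ρ = mk⇔
    (λ { (p , q) → trans (ridx-∷ (ρ x) (Vec.map ρ xs)) (cong₂ (λ a b → a * n ^ k + b) (to (sem-min x ρ) p) (to (sem-lexMin xs ρ) q)) })
    (λ e → let d = digit-unique (n ^ k) (toℕ (rk (ρ x))) _ 0 0 (ridx< (Vec.map ρ xs)) (pow-pos k) (trans (sym (ridx-∷ (ρ x) (Vec.map ρ xs))) e)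
           in from (sem-min x ρ) (proj₁ d) , from (sem-lexMin xs ρ) (proj₂ d))

  sem-lexMax : ∀ {k} (xs : Vec Var k) ρ → ⟦ lexMax lt xs ⟧ ρ ⇔ (suc (ridx (Vec.map ρ xs)) ≡ n ^ k)
  sem-lexMax [] ρ = mk⇔ (λ _ → refl) (λ _ → _)
  sem-lexMax {suc k} (x ∷ xs) ρ = mk⇔
    (λ { (p , q) → trans (cong suc (ridx-∷ (ρ x) (Vec.map ρ xs))) (trans (sym (+-suc _ _)) (trans (cong (toℕ (rk (ρ x)) * n ^ k +_) (to (sem-lexMax xs ρ) q))
           (trans (+-comm _ (n ^ k)) (cong (_* n ^ k) (to (sem-max x ρ) p))))) })
    (λ e → both (trans (cong suc (sym (ridx-∷ (ρ x) (Vec.map ρ xs)))) e))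
    where
    a = toℕ (rk (ρ x))
    i = ridx (Vec.map ρ xs)
    both : suc (a * n ^ k + i) ≡ n * n ^ k → _
    both e with suc i ≟ n ^ k
    ... | yes q = from (sem-max x ρ) (*-cancelʳ-≡ _ _ (n ^ k) {{>-nonZero (pow-pos k)}} (trans (+-comm (n ^ k) (a * n ^ k)) (trans (cong (a * n ^ k +_) (sym q)) (trans (+-suc _ i) e))))
                , from (sem-lexMax xs ρ) q
    ... | no ne with digit-unique (n ^ k) a (suc i) n 0 (≤∧≢⇒< (ridx< (Vec.map ρ xs)) ne) (pow-pos k) (trans (+-suc _ i) (trans e (sym (+-identityʳ _))))
    ...   | _ , ()

  vec-same : ∀ {k} (xs ys : Vec Var k) ρ → ⟦ sameF xs ys ⟧ ρ ⇔ (Vec.map ρ xs ≡ Vec.map ρ ys)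
  vec-same [] [] ρ = mk⇔ (λ _ → refl) (λ _ → _)
  vec-same (x ∷ xs) (y ∷ ys) ρ = mk⇔ (λ { (p , q) → cong₂ _∷_ p (to (vec-same xs ys ρ) q) })
    (λ e → VP.∷-injectiveˡ e , from (vec-same xs ys ρ) (VP.∷-injectiveʳ e))

  ridx-injective : (∀ {a b} → rk a ≡ rk b → a ≡ b) → ∀ {k} (t u : Vec (Fin n) k) → ridx t ≡ ridx u → t ≡ u
  ridx-injective inj t u e = map-inj t u (idx-injective (Vec.map rk t) (Vec.map rk u) e)

    where
    map-inj : ∀ {k} (t u : Vec (Fin n) k) → Vec.map rk t ≡ Vec.map rk u → t ≡ u
    map-inj [] [] _ = refl
    map-inj (a ∷ t) (b ∷ u) e = cong₂ _∷_ (inj (VP.∷-injectiveˡ e)) (map-inj t u (VP.∷-injectiveʳ e))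

  sem-lexSuc : (∀ {a b} → rk a ≡ rk b → a ≡ b) → ∀ {k} (xs ys : Vec Var k) ρ →
               ⟦ lexSuc lt xs ys ⟧ ρ ⇔ (ridx (Vec.map ρ ys) ≡ suc (ridx (Vec.map ρ xs)))
  sem-lexSuc inj [] [] ρ = mk⇔ (λ ()) (λ ())
  sem-lexSuc inj {suc k} (x ∷ xs) (y ∷ ys) ρ = mk⇔ fwd bwd
    where
    a = toℕ (rk (ρ x))
    b = toℕ (rk (ρ y))
    i = ridx (Vec.map ρ xs)
    j = ridx (Vec.map ρ ys)
    P = n ^ k
    fwd : _ → ridx (Vec.map ρ (y ∷ ys)) ≡ suc (ridx (Vec.map ρ (x ∷ xs)))
    fwd (inj₁ (p , q)) = trans (ridx-∷ (ρ y) (Vec.map ρ ys)) (trans (cong₂ (λ u v → toℕ (rk u) * P + v) (sym p) (to (sem-lexSuc inj xs ys ρ) q))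
      (trans (+-suc (a * P) i) (cong suc (sym (ridx-∷ (ρ x) (Vec.map ρ xs))))))
    fwd (inj₂ (p , q , o)) = trans (ridx-∷ (ρ y) (Vec.map ρ ys)) (trans (cong₂ (λ u v → u * P + v) (to (sem-suc x y ρ) p) (to (sem-lexMin ys ρ) o))
      (trans (+-identityʳ _) (trans (+-comm P (a * P)) (trans (cong (a * P +_) (sym (to (sem-lexMax xs ρ) q)))
        (trans (+-suc (a * P) i) (cong suc (sym (ridx-∷ (ρ x) (Vec.map ρ xs)))))))))
    bwd : ridx (Vec.map ρ (y ∷ ys)) ≡ suc (ridx (Vec.map ρ (x ∷ xs))) → _
    bwd e with trans (sym (ridx-∷ (ρ y) (Vec.map ρ ys))) (trans e (trans (cong suc (ridx-∷ (ρ x) (Vec.map ρ xs))) (sym (+-suc (a * P) i))))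
    ... | e′ with suc i ≟ P
    ...   | no ne with digit-unique P b j a (suc i) (ridx< (Vec.map ρ ys)) (≤∧≢⇒< (ridx< (Vec.map ρ xs)) ne) e′
    ...     | u , v = inj₁ (inj (FP.toℕ-injective (sym u)) , from (sem-lexSuc inj xs ys ρ) v)
    bwd e | e′ | yes q with digit-unique P b j (suc a) 0 (ridx< (Vec.map ρ ys)) (pow-pos k)
              (trans e′ (trans (cong (a * P +_) q) (trans (+-comm (a * P) P) (sym (+-identityʳ _)))))
    ...     | u , v = inj₂ (from (sem-suc x y ρ) u , from (sem-lexMax xs ρ) q , from (sem-lexMin ys ρ) v)

-- Runs of a space-bounded machine

n<2^n : ∀ n → n < 2 ^ n
n<2^n zero = s≤s z≤n
n<2^n (suc n) = ≤-trans (s≤s (n<2^n n)) (≤-trans (+-monoˡ-≤ (2 ^ n) (m^n>0 2 n)) (≤-reflexive (cong (2 ^ n +_) (sym (+-identityʳ (2 ^ n))))))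

module Runs (M : TM) where
  open TM M using (states; extra)

  Q G : ℕ
  Q = states
  G = 3 + extra

  exec-+ : ∀ a {b c c′} → exec M a c ≡ running c′ → exec M (a + b) c ≡ exec M b c′
  exec-+ zero refl = refl
  exec-+ (suc a) {b} {c} e = trans (exec-suc M (a + b) c) (trans (resumed (step M c) (trans (sym (exec-suc M a c)) e)) refl)
    where
    resumed : ∀ o {c′} → resume M a o ≡ running c′ → resume M (a + b) o ≡ exec M b c′
    resumed (running d) e = exec-+ a e

  last-running : ∀ t {c b} → exec M t c ≡ done b → ∃ λ T → ∃ λ c′ → exec M T c ≡ running c′ × step M c′ ≡ done b
  last-running (suc t) {c} {b} e = byCase (step M c) refl (trans (sym (exec-suc M t c)) e)
    where
    byCase : ∀ o → step M c ≡ o → resume M t o ≡ done b → ∃ λ T → ∃ λ c′ → exec M T c ≡ running c′ × step M c′ ≡ done b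
    byCase (done b′) q refl = 0 , c , refl , q
    byCase (running d) q r with last-running t r
    ... | T , c′ , x , y = suc T , c′ , trans (exec-running T q) x , y

  halts-after : ∀ T {c c′ b} k → exec M T c ≡ running c′ → step M c′ ≡ done b → exec M (T + suc k) c ≡ done b
  halts-after T k e s = trans (exec-+ T e) (exec-done k s)

  done-+ : ∀ t {c b} k → exec M t c ≡ done b → exec M (t + k) c ≡ done b
  done-+ (suc t) {c} {b} k e = trans (exec-suc M (t + k) c) (resumed (step M c) (trans (sym (exec-suc M t c)) e))
    where
    resumed : ∀ o → resume M t o ≡ done b → resume M (t + k) o ≡ done b
    resumed (done _) e = e
    resumed (running d) e = done-+ t k e

  done-unique : ∀ t u {c b b′} → exec M t c ≡ done b → exec M u c ≡ done b′ → b ≡ b′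
  done-unique t u {c} e f with trans (sym (done-+ t u e)) (trans (cong (λ v → exec M v c) (+-comm t u)) (done-+ u t f))
  ... | refl = refl

  record _≃_ (c d : Config M) : Set where
    field
      state≃ : state c ≡ state d
      head≃  : head c ≡ head d
      tape≃  : ∀ i → tape c i ≡ tape d i
  open _≃_

  δ≃ : ∀ {c d} → c ≃ d → TM.δ M (state c) (tape c (head c)) ≡ TM.δ M (state d) (tape d (head d))
  δ≃ {c} {d} e = cong₂ (TM.δ M) (state≃ e) (trans (cong (tape c) (head≃ e)) (tape≃ e (head d)))

  after : Config M → Action states extra → Outcome M
  after c (halt b) = done b
  after c (go q s d) = running (record { state = q ; head = moveHead d (head c) ; tape = setAt (tape c) (head c) s })

  step-after : ∀ c → step M c ≡ after c (TM.δ M (state c) (tape c (head c)))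
  step-after c with TM.δ M (state c) (tape c (head c))
  ... | halt b = refl
  ... | go q s d = refl

  ≃-done : ∀ {c d b} → c ≃ d → step M c ≡ done b → step M d ≡ done b
  ≃-done {c} {d} {b} e s = trans (step-after d) (trans (cong (after d) (sym (δ≃ e))) (same-halt _ (trans (sym (step-after c)) s)))
    where same-halt : ∀ a → after c a ≡ done b → after d a ≡ done b
          same-halt (halt _) refl = refl

  ≃-running : ∀ {c d c′} → c ≃ d → step M c ≡ running c′ → ∃ λ d′ → step M d ≡ running d′ × c′ ≃ d′
  ≃-running {c} {d} {c′} e s with same-go _ (trans (sym (step-after c)) s)
    where
    tapes : ∀ s i → setAt (tape c) (head c) s i ≡ setAt (tape d) (head d) s i
    tapes s i rewrite head≃ e with i ≡ᵇ head d
    ... | true = refl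
    ... | false = tape≃ e i
    same-go : ∀ a → after c a ≡ running c′ → ∃ λ d′ → after d a ≡ running d′ × c′ ≃ d′
    same-go (go q s m) refl = _ , refl , record { state≃ = refl ; head≃ = cong (moveHead m) (head≃ e) ; tape≃ = tapes s }
  ... | d′ , p , q = d′ , trans (step-after d) (trans (cong (after d) (sym (δ≃ e))) p) , q

  ≃-exec : ∀ t {c d c′} → c ≃ d → exec M t c ≡ running c′ → ∃ λ d′ → exec M t d ≡ running d′ × c′ ≃ d′
  ≃-exec zero e refl = _ , refl , e
  ≃-exec (suc t) {c} {d} {c′} e x = byCase (step M c) refl (trans (sym (exec-suc M t c)) x)
    where
    byCase : ∀ o → step M c ≡ o → resume M t o ≡ running c′ → ∃ λ d′ → exec M (suc t) d ≡ running d′ × c′ ≃ d′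
    byCase (running c₁) q r with ≃-running e q
    ... | d₁ , p , e₁ with ≃-exec t e₁ r
    ...   | d′ , y , e′ = d′ , trans (exec-running t p) y , e′

  module _ (c₀ : Config M) (B : ℕ) (bounded : ∀ t c → exec M t c₀ ≡ running c → head c < B) where

    -- Makes a configuration of the run determined by finitely many data: its state, its head and
    -- the cells below `B`.
    tape-beyond : ∀ t {c} → exec M t c₀ ≡ running c → ∀ i → B ≤ i → tape c i ≡ tape c₀ i
    tape-beyond t {c} e i le = walk t 0 c₀ refl e
      where
      setAt-beyond : ∀ {c a} → head c < B → setAt (tape c) (head c) a i ≡ tape c i
      setAt-beyond {c} lt rewrite ≢⇒≡ᵇ-false {i} {head c} (λ z → <-irrefl (sym z) (≤-trans lt le)) = refl
      walk : ∀ t u d {c} → exec M u c₀ ≡ running d → exec M t d ≡ running c → tape c i ≡ tape d i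
      walk zero u d x refl = refl
      walk (suc t) u d {c} x e = byCase (TM.δ M (state d) (tape d (head d))) refl
        where
        byCase : ∀ a → TM.δ M (state d) (tape d (head d)) ≡ a → tape c i ≡ tape d i
        byCase (halt b) q with trans (sym e) (exec-done t (trans (step-after d) (cong (after d) q)))
        ... | ()
        byCase (go s a m) q = trans (walk t (u + 1) _ (trans (exec-+ u x) (exec-running 0 st₁)) (trans (sym (exec-running t st₁)) e)) (setAt-beyond {d} (bounded u d x))
          where st₁ = trans (step-after d) (cong (after d) q)

    configs : ℕ
    configs = Q * (B * G ^ B)

    codeConfig : ∀ (c : Config M) → head c < B → Fin configs
    codeConfig c lt = combine (state c) (combine (fromℕ< lt) (funToFin (λ (i : Fin B) → tape c (toℕ i))))

    codeConfig-≃ : ∀ t u {c d} (x : exec M t c₀ ≡ running c) (y : exec M u c₀ ≡ running d) →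
                   codeConfig c (bounded t c x) ≡ codeConfig d (bounded u d y) → c ≃ d
    codeConfig-≃ t u {c} {d} x y e with FP.combine-injective (state c) _ (state d) _ e
    ... | s , e₂ with FP.combine-injective (fromℕ< (bounded t c x)) _ (fromℕ< (bounded u d y)) _ e₂
    ...   | h , f = record { state≃ = s
             ; head≃ = trans (sym (FP.toℕ-fromℕ< (bounded t c x))) (trans (cong toℕ h) (FP.toℕ-fromℕ< (bounded u d y))) ; tape≃ = tapes }
      where
      tapes : ∀ i → tape c i ≡ tape d i
      tapes i with i <? B
      ... | no ge = trans (tape-beyond t x i (≮⇒≥ ge)) (sym (tape-beyond u y i (≮⇒≥ ge)))
      ... | yes lt = subst (λ j → tape c j ≡ tape d j) (FP.toℕ-fromℕ< lt)
            (trans (sym (FP.finToFun-funToFin (λ (i : Fin B) → tape c (toℕ i)) (fromℕ< lt)))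
              (trans (cong (λ z → finToFun {G} {B} z (fromℕ< lt)) f) (FP.finToFun-funToFin (λ (i : Fin B) → tape d (toℕ i)) (fromℕ< lt))))

    -- A repeated configuration would put the run into a cycle.
    halting-time : ∀ T {c b} → exec M T c₀ ≡ running c → step M c ≡ done b → T < configs
    halting-time T {c} {b} e s with T <? configs
    ... | yes lt = lt
    ... | no ge = ⊥-elim (collide (FP.pigeonhole (s≤s (≮⇒≥ ge)) codeAt))
      where
      running-at : ∀ i → i ≤ T → ∃ λ d → exec M i c₀ ≡ running d
      running-at i le = byCase (exec M i c₀) refl
        where
        byCase : ∀ o → exec M i c₀ ≡ o → ∃ λ d → o ≡ running d
        byCase (running d) q = d , refl
        byCase (done b) q with trans (sym e) (trans (cong (λ k → exec M k c₀) (sym (m+[n∸m]≡n le))) (done-+ i (T ∸ i) q))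
        ... | ()
      conf : ∀ i → i ≤ T → Config M
      conf i le = proj₁ (running-at i le)
      conf-run : ∀ i (le : i ≤ T) → exec M i c₀ ≡ running (conf i le)
      conf-run i le = proj₂ (running-at i le)
      codeAt : Fin (suc T) → Fin configs
      codeAt i = codeConfig (conf (toℕ i) (≤-pred (FP.toℕ<n i))) (bounded (toℕ i) (conf (toℕ i) (≤-pred (FP.toℕ<n i))) (conf-run (toℕ i) (≤-pred (FP.toℕ<n i))))
      collide : (∃ λ i → ∃ λ j → toℕ {suc T} i < toℕ {suc T} j × codeAt i ≡ codeAt j) → ⊥
      -- What happens in the last `T ∸ toℕ j` steps from moment `j` also happens from the equal
      -- configuration at `i`. The run would then have halted by time `T`, at which it is still
      -- running.
      collide (i , j , i<j , q) with ≃-exec (T ∸ toℕ j)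
          (≃-sym (codeConfig-≃ (toℕ i) (toℕ j) (conf-run (toℕ i) (≤-pred (FP.toℕ<n i))) (conf-run (toℕ j) (≤-pred (FP.toℕ<n j))) q))
          (trans (sym (exec-+ (toℕ j) (conf-run (toℕ j) (≤-pred (FP.toℕ<n j))))) (trans (cong (λ k → exec M k c₀) (m+[n∸m]≡n (≤-pred (FP.toℕ<n j)))) e))
        where
        ≃-sym : ∀ {c d : Config M} → c ≃ d → d ≃ c
        ≃-sym p = record { state≃ = sym (state≃ p) ; head≃ = sym (head≃ p) ; tape≃ = λ k → sym (tape≃ p k) }
      ... | d , x , p with trans (sym e) (trans (cong (λ k → exec M k c₀) time)
              (halts-after (toℕ i + (T ∸ toℕ j)) (T ∸ suc (toℕ i + (T ∸ toℕ j))) (trans (exec-+ (toℕ i) (conf-run (toℕ i) (≤-pred (FP.toℕ<n i)))) x) (≃-done p s)))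
        where
        early : toℕ i + (T ∸ toℕ j) < T
        early = ≤-trans (+-monoˡ-≤ (T ∸ toℕ j) i<j) (≤-reflexive (m+[n∸m]≡n (≤-pred (FP.toℕ<n j))))
        time : T ≡ toℕ i + (T ∸ toℕ j) + suc (T ∸ suc (toℕ i + (T ∸ toℕ j)))
        time = trans (sym (m+[n∸m]≡n early)) (sym (+-suc (toℕ i + (T ∸ toℕ j)) _))
      ...   | ()

    -- The bound `x ≤ 2 ^ x` applied to each of the three factors. The exponent is the number of
    -- halvings for which the clocks provide, `depthAt`.
    configs≤ : configs ≤ 2 ^ (Q + (B + G * B))
    configs≤ = ≤-trans (*-mono-≤ (<⇒≤ (n<2^n Q)) (*-mono-≤ (<⇒≤ (n<2^n B)) (≤-trans (^-monoˡ-≤ B (<⇒≤ (n<2^n G))) (≤-reflexive (^-*-assoc 2 G B)))))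
      (≤-reflexive (trans (cong (2 ^ Q *_) (sym (^-distribˡ-+-* 2 B (G * B)))) (sym (^-distribˡ-+-* 2 Q (B + G * B)))))

-- Configurations as relations

opaque
  bigOr bigAnd : ∀ {τ m} → (Fin m → FO τ) → FO τ
  bigOr {m = zero} f = ffF
  bigOr {m = suc m} f = orF (f fz) (bigOr (λ i → f (fs i)))
  bigAnd {m = zero} f = ttF
  bigAnd {m = suc m} f = andF (f fz) (bigAnd (λ i → f (fs i)))

existsF forallF : ∀ {τ} → ℕ → Var → FO τ → FO τ
existsF zero x χ = χ
existsF (suc k) x χ = exF x (existsF k (suc x) χ)
forallF zero x χ = χ
forallF (suc k) x χ = allF x (forallF k (suc x) χ)

iffF : ∀ {τ} → FO τ → FO τ → FO τ
iffF χ ψ = andF (orF (notF χ) ψ) (orF (notF ψ) χ)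

-- Conditions on block numbers, symbols and states are settled while the formula is built; the
-- formula itself cannot express them.
guardF : ∀ {τ} {P : Set} → Dec P → FO τ → FO τ
guardF (yes _) χ = χ
guardF (no _) χ = ffF

testF : ∀ {τ m} → Fin m → Fin m → FO τ
testF i j = guardF (i FP.≟ j) ttF

≤-total-at : ∀ {m} (f : Fin m → ℕ) i → f i ≤ total f
≤-total-at f fz = m≤m+n _ _
≤-total-at f (fs i) = ≤-trans (≤-total-at (λ j → f (fs j)) i) (m≤n+m _ (f fz))

offset-zero : ∀ {m} (L : Fin m → ℕ) b → toℕ b ≡ 0 → offset L b ≡ 0
offset-zero L fz e = refl

offset-pos : ∀ {m} (L : Fin m → ℕ) b → toℕ b ≢ 0 → (∀ b → 0 < L b) → 0 < offset L b
offset-pos L fz ne pos = contradiction refl ne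
offset-pos L (fs b) ne pos = ≤-trans (pos fz) (m≤m+n (L fz) _)

unoffset : ∀ {m} (L : Fin m → ℕ) i → i < total L → ∃ λ b → ∃ λ j → j < L b × offset L b + j ≡ i
unoffset {suc m} L i lt with i <? L fz
... | yes p = fz , i , p , refl
... | no np with unoffset (λ b → L (fs b)) (i ∸ L fz) (+-cancelˡ-< (L fz) _ _ (subst (_< L fz + total (λ b → L (fs b))) (sym (m+[n∸m]≡n (≮⇒≥ np))) lt))
...   | b , j , p , e = fs b , j , p , trans (+-assoc (L fz) _ j) (trans (cong (L fz +_) e) (m+[n∸m]≡n (≮⇒≥ np)))

module Connectives {τ : Voc} {n : ℕ} (r : Rels τ n) where
  open Semantics {τ} {n} r
  open Equivalence using (to; from)

  opaque
    unfolding bigOr bigAnd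

    sem-bigOr : ∀ {m} (f : Fin m → FO τ) ρ → ⟦ bigOr f ⟧ ρ ⇔ ∃ λ i → ⟦ f i ⟧ ρ
    sem-bigOr {zero} f ρ = mk⇔ (λ ()) (λ { (() , _) })
    sem-bigOr {suc m} f ρ = mk⇔
      (λ { (inj₁ x) → fz , x ; (inj₂ y) → fs (proj₁ (to (sem-bigOr (λ i → f (fs i)) ρ) y)) , proj₂ (to (sem-bigOr (λ i → f (fs i)) ρ) y) })
      (λ { (fz , x) → inj₁ x ; (fs i , y) → inj₂ (from (sem-bigOr (λ i → f (fs i)) ρ) (i , y)) })

    sem-bigAnd : ∀ {m} (f : Fin m → FO τ) ρ → ⟦ bigAnd f ⟧ ρ ⇔ (∀ i → ⟦ f i ⟧ ρ)
    sem-bigAnd {zero} f ρ = mk⇔ (λ _ ()) (λ _ → _)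
    sem-bigAnd {suc m} f ρ = mk⇔ (λ { (x , y) → λ { fz → x ; (fs i) → to (sem-bigAnd (λ i → f (fs i)) ρ) y i } })
      (λ h → h fz , from (sem-bigAnd (λ i → f (fs i)) ρ) (λ i → h (fs i)))

  upds : ∀ {k} → (Var → Fin n) → Var → Vec (Fin n) k → Var → Fin n
  upds ρ x [] = ρ
  upds ρ x (a ∷ t) = upds (ρ [ x ↦ a ]) (suc x) t

  sem-existsF : ∀ k x χ ρ → ⟦ existsF k x χ ⟧ ρ ⇔ ∃ λ (t : Vec (Fin n) k) → ⟦ χ ⟧ (upds ρ x t)
  sem-existsF zero x χ ρ = mk⇔ (λ p → [] , p) (λ { ([] , p) → p })
  sem-existsF (suc k) x χ ρ = mk⇔ (λ { (a , p) → let q = to (sem-existsF k (suc x) χ (ρ [ x ↦ a ])) p in a ∷ proj₁ q , proj₂ q })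
    (λ { (a ∷ t , p) → a , from (sem-existsF k (suc x) χ (ρ [ x ↦ a ])) (t , p) })

  sem-forallF : ∀ k x χ ρ → ⟦ forallF k x χ ⟧ ρ ⇔ (∀ (t : Vec (Fin n) k) → ⟦ χ ⟧ (upds ρ x t))
  sem-forallF zero x χ ρ = mk⇔ (λ { p [] → p }) (λ p → p [])
  sem-forallF (suc k) x χ ρ = mk⇔ (λ { p (a ∷ t) → to (sem-forallF k (suc x) χ (ρ [ x ↦ a ])) (p a) t })
    (λ p a → from (sem-forallF k (suc x) χ (ρ [ x ↦ a ])) (λ t → p (a ∷ t)))

  upds-below : ∀ {k} ρ x (t : Vec (Fin n) k) y → y < x → upds ρ x t y ≡ ρ y
  upds-below ρ x [] y lt = refl
  upds-below ρ x (a ∷ t) y lt = trans (upds-below (ρ [ x ↦ a ]) (suc x) t y (≤-trans lt (n≤1+n x))) (cong (if_then a else ρ y) (≢⇒≡ᵇ-false (<⇒≢ lt)))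

  upds-new : ∀ {k} ρ x (t : Vec (Fin n) k) → Vec.map (upds ρ x t) (varsFrom k x) ≡ t
  upds-new ρ x [] = refl
  upds-new ρ x (a ∷ t) = cong₂ _∷_ (trans (upds-below (ρ [ x ↦ a ]) (suc x) t x ≤-refl) (cong (if_then a else ρ x) (≡ᵇ-refl x))) (upds-new (ρ [ x ↦ a ]) (suc x) t)

  map-below : ∀ {k} ρ x (t : Vec (Fin n) k) m y → y + m ≤ x → Vec.map (upds ρ x t) (varsFrom m y) ≡ Vec.map ρ (varsFrom m y)
  map-below ρ x t zero y le = refl
  map-below ρ x t (suc m) y le = cong₂ _∷_ (upds-below ρ x t y (≤-trans (≤-trans (s≤s (m≤m+n y m)) (≤-reflexive (sym (+-suc y m)))) le))
    (map-below ρ x t m (suc y) (≤-trans (≤-reflexive (sym (+-suc y m))) le))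

  sem-iffF : ∀ χ ψ ρ → ⟦ iffF χ ψ ⟧ ρ ⇔ (⟦ χ ⟧ ρ ⇔ ⟦ ψ ⟧ ρ)
  sem-iffF χ ψ ρ = mk⇔ (λ { (p , q) → mk⇔ (λ a → [ (λ na → contradiction a na) , (λ b → b) ] p) (λ b → [ (λ nb → contradiction b nb) , (λ a → a) ] q) })
    (λ e → side χ ψ (to e) (⟦ χ ⟧? ρ) , side ψ χ (from e) (⟦ ψ ⟧? ρ))
    where
    side : ∀ χ ψ → (⟦ χ ⟧ ρ → ⟦ ψ ⟧ ρ) → Dec (⟦ χ ⟧ ρ) → ¬ ⟦ χ ⟧ ρ ⊎ ⟦ ψ ⟧ ρ
    side χ ψ f (yes a) = inj₂ (f a)
    side χ ψ f (no na) = inj₁ na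

  sem-guardF : ∀ {P : Set} (d : Dec P) χ ρ → ⟦ guardF d χ ⟧ ρ ⇔ (P × ⟦ χ ⟧ ρ)
  sem-guardF (yes p) χ ρ = mk⇔ (λ x → p , x) proj₂
  sem-guardF (no np) χ ρ = mk⇔ (λ ()) (λ x → np (proj₁ x))

  sem-testF : ∀ {m} (i j : Fin m) ρ → ⟦ testF i j ⟧ ρ ⇔ (i ≡ j)
  sem-testF i j ρ = ⇔-trans (sem-guardF (i FP.≟ j) ttF ρ) (mk⇔ proj₁ (λ e → e , _))

-- Every part of the tape is a table over tuples: the leading ones over single elements, the
-- separating zero over the empty tuple, a relation over tuples of its arity, and work space over
-- tuples of a chosen length.
data Kind (τ : Voc) : Set where
  un sep wk : Kind τ
  rl        : Fin (length τ) → Kind τ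

-- Formulas about a run of M on the encoding of the structure. The cells of the
-- tape are the tuples of the blocks, in the order in which `enc` lists them,
-- followed by work space; slots 0, 1 and 2 hold configurations.
module Simulation (τ : Voc) (M : TM) (k : ℕ) (kinds : List (Kind τ)) where
  open Runs M using (Q; G)
  open TM M using (start; δ)

  karity : Kind τ → ℕ
  karity un = 1
  karity sep = 0
  karity (rl i) = lookupL τ i
  karity wk = k

  -- `F` counts the possible facts about a cell: it carries a given symbol, or the head is on it in
  -- a given state.
  nb F : ℕ
  nb = length kinds
  F = G + Q

  kind : Fin nb → Kind τ
  kind = lookupL kinds

  ar : Fin nb → ℕ
  ar b = karity (kind b)

  symF : Fin G → Fin F
  symF s = join G Q (inj₁ s)

  stF : Fin Q → Fin F
  stF q = join G Q (inj₂ q)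

  opaque
    nameOf : Fin 3 → Fin F → Fin nb → ℕ
    -- The name 0 is reserved for the order `LT`.
    nameOf j f b = suc (toℕ (combine (combine j f) b))

    nameOf-injective : ∀ {j f b j′ f′ b′} → nameOf j f b ≡ nameOf j′ f′ b′ → j ≡ j′ × f ≡ f′ × b ≡ b′
    nameOf-injective {j} {f} {b} {j′} {f′} {b′} e with FP.combine-injective (combine j f) b (combine j′ f′) b′ (FP.toℕ-injective (suc-injective e))
    ... | p , q with FP.combine-injective j f j′ f′ p
    ...   | u , v = u , v , q

    nameOf-positive : ∀ j f b → nameOf j f b ≢ 0
    nameOf-positive j f b ()

  sy : Fin 3 → Fin F → Fin nb → RelSym τ
  sy j f b = inj₂ (nameOf j f b , ar b)

  LT : RelSym τ
  LT = inj₂ (0 , 2)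

  sy-injective : ∀ {j f b j′ f′ b′} → sy j f b ≡ sy j′ f′ b′ → j ≡ j′ × f ≡ f′ × b ≡ b′
  sy-injective e = nameOf-injective (,-injectiveˡ (inj₂-injective e))
    where open import Data.Sum.Properties using (inj₂-injective)

  -- At least every arity, so the variables `X` of one cell and `Y` of another are disjoint.
  width : ℕ
  width = total ar

  lt : Var → Var → FO τ
  lt x y = atomF LT (x ∷ y ∷ [])

  X Y : ∀ b → Vec Var (ar b)
  X b = varsFrom (ar b) 0
  Y b = varsFrom (ar b) width

  fact : Fin 3 → Fin F → ∀ b → Vec Var (ar b) → FO τ
  fact j f b xs = atomF (sy j f b) xs

  -- Within a block the successor is lexicographic; otherwise it leads from the last tuple of one
  -- block to the first of the next. Blocks are never empty, so no block is skipped.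
  cellSuc sameCell : ∀ b → Vec Var (ar b) → ∀ b′ → Vec Var (ar b′) → FO τ
  cellSuc b xs b′ ys = orF (guardF (toℕ b′ ≟ toℕ b) (lexSuc lt xs ys)) (guardF (toℕ b′ ≟ suc (toℕ b)) (andF (lexMax lt xs) (lexMin lt ys)))
  sameCell b xs b′ ys = guardF (toℕ b ≟ toℕ b′) (sameF xs ys)

  firstCell : ∀ b → Vec Var (ar b) → FO τ
  firstCell b xs = guardF (toℕ b ≟ 0) (lexMin lt xs)

  moveF : Dir → ∀ b₀ → Vec Var (ar b₀) → ∀ b → Vec Var (ar b) → FO τ
  moveF right b₀ ys b xs = cellSuc b₀ ys b xs
  moveF stay b₀ ys b xs = sameCell b₀ ys b xs
  -- The second disjunct is a left move on the first cell, which stays put as in `moveHead`.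
  moveF left b₀ ys b xs = orF (cellSuc b xs b₀ ys) (andF (firstCell b₀ ys) (sameCell b₀ ys b xs))

  onGo : (Fin Q → Fin G → Dir → FO τ) → Action Q (TM.extra M) → FO τ
  onGo φ (halt _) = ffF
  onGo φ (go q s d) = φ q s d

  onAccept : FO τ → Action Q (TM.extra M) → FO τ
  onAccept φ (halt true) = φ
  onAccept φ _ = ffF

  scanned : Fin 3 → Fin Q → Fin G → ∀ b → Vec Var (ar b) → FO τ
  scanned j q s b xs = andF (fact j (stF q) b xs) (fact j (symF s) b xs)

  -- Guesses the state, the scanned symbol and the cell of the head. In a slot that describes a
  -- configuration with its head on the cells, exactly one guess succeeds.
  someScanned : Fin 3 → (Fin Q → Fin G → ∀ b → Vec Var (ar b) → FO τ) → FO τ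
  someScanned j φ = bigOr (λ q → bigOr (λ s → bigOr (λ b → existsF (ar b) width (andF (scanned j q s b (Y b)) (φ q s b (Y b))))))

  nextSym : Fin G → ∀ b → Vec Var (ar b) → FO τ
  nextSym s′ b xs = orF (bigOr (λ q → bigOr (λ s → andF (scanned fz q s b xs) (onGo (λ _ s″ _ → testF s″ s′) (δ q s)))))
                        (andF (notF (bigOr (λ q → fact fz (stF q) b xs))) (fact fz (symF s′) b xs))

  nextSt : Fin Q → ∀ b → Vec Var (ar b) → FO τ
  nextSt q′ b xs = someScanned fz (λ q s b₀ ys → onGo (λ q″ _ d → andF (testF q″ q′) (moveF d b₀ ys b xs)) (δ q s))

  nextF : Fin F → Fin nb → FO τ
  nextF f b with splitAt G f
  ... | inj₁ s = nextSym s b (X b)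
  ... | inj₂ q = nextSt q b (X b)

  definesF : Fin 3 → (Fin F → Fin nb → FO τ) → FO τ
  definesF j φ = bigAnd (λ b → forallF (ar b) 0 (bigAnd (λ f → iffF (fact j f b (X b)) (φ f b))))

  -- In `stepF` the first conjunct excludes that the machine halts; the second determines slot 1
  -- completely from slot 0, fact by fact.
  stepF acceptF initF linearF : FO τ
  stepF = andF (someScanned fz (λ q s _ _ → onGo (λ _ _ _ → ttF) (δ q s))) (definesF (fs fz) nextF)
  acceptF = someScanned (fs fz) (λ q s _ _ → onAccept ttF (δ q s))

  equalF : Fin 3 → Fin 3 → FO τ
  equalF i j = definesF i (λ f b → fact j f b (X b))

  bitF : Bool → Fin G → FO τ
  bitF c s = testF (bitSym c) s

  contentF : ∀ kd → Vec Var (karity kd) → Fin G → FO τ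
  contentF un xs s = bitF true s
  contentF sep xs s = bitF false s
  contentF (rl i) xs s = orF (andF (atomF (inj₁ i) xs) (bitF true s)) (andF (notF (atomF (inj₁ i) xs)) (bitF false s))
  contentF wk xs s = testF fz s

  startF : Fin F → Fin nb → FO τ
  startF f b with splitAt G f
  ... | inj₁ s = contentF (kind b) (X b) s
  ... | inj₂ q = andF (testF start q) (firstCell b (X b))

  initF = definesF fz startF

  linearF = andF (allF 0 (notF (lt 0 0)))
    (andF (allF 0 (allF 1 (allF 2 (orF (notF (andF (lt 0 1) (lt 1 2))) (lt 0 2)))))
          (allF 0 (allF 1 (orF (eqF 0 1) (orF (lt 0 1) (lt 1 0))))))

  module Meaning {n₁ : ℕ} (r : Rels τ (suc n₁)) (rk : Fin (suc n₁) → Fin (suc n₁))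
    (rk-inj : ∀ {a b} → rk a ≡ rk b → a ≡ b)
    (order : ∀ a b → r LT (a ∷ b ∷ []) ≡ true ⇔ (toℕ (rk a) < toℕ (rk b))) where
    open Semantics {τ} {suc n₁} r
    open Connectives {τ} {suc n₁} r
    open Lexicographic {τ} {n₁} r lt rk (injective⇒surjective rk rk-inj) (λ x y ρ → order (ρ x) (ρ y)) using (n; ridx; ridx<; pow-pos; sem-lexMin; sem-lexMax; sem-lexSuc; vec-same; ridx-injective)
    open Equivalence using (to; from)

    L : Fin nb → ℕ
    L b = n ^ ar b

    Nc : ℕ
    Nc = total L

    cell : ∀ b → Vec (Fin n) (ar b) → ℕ
    cell b t = offset L b + ridx t

    cell< : ∀ b t → cell b t < Nc
    cell< b t = offset<total L b (ridx t) (ridx< t)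

    cell-injective : ∀ b t b′ t′ → cell b t ≡ cell b′ t′ → (b , t) ≡ (b′ , t′)
    cell-injective b t b′ t′ e with offset-injective L b (ridx t) b′ (ridx t′) (ridx< t) (ridx< t′) e
    ... | refl , q = cong (b ,_) (ridx-injective rk-inj t t′ q)

    uncell : ∀ i → i < Nc → ∃ λ b → ∃ λ t → cell b t ≡ i
    uncell i lt with unoffset L i lt
    ... | b , j , p , e = b , Vec.map rk⁻¹ u , trans (cong (offset L b +_) (trans (cong idx (map-rk u)) idx-u)) e
      where
      rk⁻¹ : Fin n → Fin n
      rk⁻¹ a = proj₁ (injective⇒surjective rk rk-inj a)
      u = unidx (ar b) (fromℕ< p)
      idx-u : idx u ≡ j
      idx-u = trans (cong toℕ (idxF-unidx (ar b) (fromℕ< p))) (FP.toℕ-fromℕ< p)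
      map-rk : ∀ {k} (v : Vec (Fin n) k) → Vec.map rk (Vec.map rk⁻¹ v) ≡ v
      map-rk [] = refl
      map-rk (a ∷ v) = cong₂ _∷_ (proj₂ (injective⇒surjective rk rk-inj a)) (map-rk v)

    val : ∀ {k} → (Var → Fin n) → Vec Var k → Vec (Fin n) k
    val ρ xs = Vec.map ρ xs

    sem-first : ∀ b xs ρ → ⟦ firstCell b xs ⟧ ρ ⇔ (cell b (val ρ xs) ≡ 0)
    sem-first b xs ρ = ⇔-trans (sem-guardF (toℕ b ≟ 0) (lexMin lt xs) ρ) (mk⇔
      (λ { (z , m) → cong₂ _+_ (offset-zero L b z) (to (sem-lexMin xs ρ) m) })
      (λ e → block-zero (m+n≡0⇒m≡0 (offset L b) e) (toℕ b ≟ 0) , from (sem-lexMin xs ρ) (m+n≡0⇒n≡0 (offset L b) e)))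
      where
      block-zero : offset L b ≡ 0 → Dec (toℕ b ≡ 0) → toℕ b ≡ 0
      block-zero e (yes z) = z
      block-zero e (no nz) = contradiction (offset-pos L b nz (λ b → pow-pos (ar b))) (≤⇒≯ (≤-reflexive e))

    sem-same : ∀ b xs b′ ys ρ → ⟦ sameCell b xs b′ ys ⟧ ρ ⇔ (cell b′ (val ρ ys) ≡ cell b (val ρ xs))
    sem-same b xs b′ ys ρ = ⇔-trans (sem-guardF (toℕ b ≟ toℕ b′) (sameF xs ys) ρ) (mk⇔
        (λ { (e , p) → there′ b′ ys (FP.toℕ-injective e) p })
        (λ e → cong (λ c → toℕ (proj₁ c)) (sym (cell-injective b′ (val ρ ys) b (val ρ xs) e)) ,
               back′ b′ ys (cong proj₁ (sym (cell-injective b′ (val ρ ys) b (val ρ xs) e))) e))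
      where
      there′ : ∀ b′ (ys : Vec Var (ar b′)) → b ≡ b′ → ⟦ sameF xs ys ⟧ ρ → cell b′ (val ρ ys) ≡ cell b (val ρ xs)
      there′ b′ ys refl p = cong (cell b) (sym (to (vec-same xs ys ρ) p))
      same-block : ∀ {t u : Vec (Fin n) (ar b)} → _≡_ {A = Σ (Fin nb) λ b → Vec (Fin n) (ar b)} (b , t) (b , u) → u ≡ t
      same-block refl = refl
      back′ : ∀ b′ (ys : Vec Var (ar b′)) → b ≡ b′ → cell b′ (val ρ ys) ≡ cell b (val ρ xs) → ⟦ sameF xs ys ⟧ ρ
      back′ b′ ys refl e = from (vec-same xs ys ρ) (same-block (cell-injective b (val ρ ys) b (val ρ xs) e))

    sem-suc : ∀ b xs b′ ys ρ → ⟦ cellSuc b xs b′ ys ⟧ ρ ⇔ (cell b′ (val ρ ys) ≡ suc (cell b (val ρ xs)))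
    sem-suc b xs b′ ys ρ = mk⇔
        (λ { (inj₁ p) → inside (to (sem-guardF (toℕ b′ ≟ toℕ b) (lexSuc lt xs ys) ρ) p)
           ; (inj₂ p) → across (to (sem-guardF (toℕ b′ ≟ suc (toℕ b)) (andF (lexMax lt xs) (lexMin lt ys)) ρ) p) })
        (λ q → split q (suc i ≟ L b))
      where
      i = ridx (val ρ xs)
      j = ridx (val ρ ys)
      inside : toℕ b′ ≡ toℕ b × ⟦ lexSuc lt xs ys ⟧ ρ → cell b′ (val ρ ys) ≡ suc (cell b (val ρ xs))
      inside (e , p) = go′ b′ ys (FP.toℕ-injective (sym e)) p
        where go′ : ∀ b′ (ys : Vec Var (ar b′)) → b ≡ b′ → ⟦ lexSuc lt xs ys ⟧ ρ → cell b′ (val ρ ys) ≡ suc (cell b (val ρ xs))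
              go′ b′ ys refl p = trans (cong (offset L b +_) (to (sem-lexSuc rk-inj xs ys ρ) p)) (+-suc (offset L b) i)
      across : toℕ b′ ≡ suc (toℕ b) × ⟦ lexMax lt xs ⟧ ρ × ⟦ lexMin lt ys ⟧ ρ → cell b′ (val ρ ys) ≡ suc (cell b (val ρ xs))
      across (e , p , q) = trans (cong (offset L b′ +_) (to (sem-lexMin ys ρ) q)) (trans (+-identityʳ _) (trans (offset-next L b b′ e)
               (trans (cong (offset L b +_) (sym (to (sem-lexMax xs ρ) p))) (+-suc (offset L b) i))))
      stay-in : ∀ b′ (ys : Vec Var (ar b′)) → b′ ≡ b → ridx (val ρ ys) ≡ suc i → ⟦ lexSuc lt xs ys ⟧ ρ
      stay-in b′ ys refl e = from (sem-lexSuc rk-inj xs ys ρ) e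
      split : cell b′ (val ρ ys) ≡ suc (cell b (val ρ xs)) → Dec (suc i ≡ L b) → ⟦ cellSuc b xs b′ ys ⟧ ρ
      split q (no nm) = inj₁ (from (sem-guardF (toℕ b′ ≟ toℕ b) (lexSuc lt xs ys) ρ) (cong toℕ (proj₁ u) , stay-in b′ ys (proj₁ u) (proj₂ u)))
        where u = offset-injective L b′ j b (suc i) (ridx< (val ρ ys)) (≤∧≢⇒< (ridx< (val ρ xs)) nm) (trans q (sym (+-suc (offset L b) i)))
      split q (yes m) = last? (suc (toℕ b) ≟ nb)
        where
        at-end : cell b′ (val ρ ys) ≡ offset L b + L b
        at-end = trans q (trans (sym (+-suc (offset L b) i)) (cong (offset L b +_) m))
        last? : Dec (suc (toℕ b) ≡ nb) → ⟦ cellSuc b xs b′ ys ⟧ ρ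
        last? (yes last) = contradiction (cell< b′ (val ρ ys)) (<-irrefl (trans at-end (offset-last L b last)))
        last? (no nl) = inj₂ (from (sem-guardF (toℕ b′ ≟ suc (toℕ b)) (andF (lexMax lt xs) (lexMin lt ys)) ρ)
            (trans (cong toℕ (proj₁ u)) (FP.toℕ-fromℕ< lt′) , from (sem-lexMax xs ρ) m , from (sem-lexMin ys ρ) (proj₂ u)))
          where
          lt′ = ≤∧≢⇒< (FP.toℕ<n b) nl
          b⁺ = fromℕ< lt′
          u = offset-injective L b′ j b⁺ 0 (ridx< (val ρ ys)) (pow-pos (ar b⁺))
                (trans at-end (trans (sym (offset-next L b b⁺ (FP.toℕ-fromℕ< lt′))) (sym (+-identityʳ _))))

    sem-move : ∀ d b₀ ys b xs ρ → ⟦ moveF d b₀ ys b xs ⟧ ρ ⇔ (cell b (val ρ xs) ≡ moveHead d (cell b₀ (val ρ ys)))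
    sem-move right b₀ ys b xs ρ = sem-suc b₀ ys b xs ρ
    sem-move stay b₀ ys b xs ρ = sem-same b₀ ys b xs ρ
    sem-move left b₀ ys b xs ρ = mk⇔
      (λ { (inj₁ p) → cong (moveHead left) (sym (to (sem-suc b xs b₀ ys ρ) p))
         ; (inj₂ (p , q)) → trans (trans (to (sem-same b₀ ys b xs ρ) q) (to (sem-first b₀ ys ρ) p)) (cong (moveHead left) (sym (to (sem-first b₀ ys ρ) p))) })
      (λ e → back (cell b₀ (val ρ ys)) refl e)
      where
      back : ∀ v → cell b₀ (val ρ ys) ≡ v → cell b (val ρ xs) ≡ moveHead left v → ⟦ moveF left b₀ ys b xs ⟧ ρ
      back zero z e = inj₂ (from (sem-first b₀ ys ρ) z , from (sem-same b₀ ys b xs ρ) (trans e (sym z)))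
      back (suc v) z e = inj₁ (from (sem-suc b xs b₀ ys ρ) (trans z (cong suc (sym e))))

    Truth : Config M → Fin F → ℕ → Set
    Truth c f i with splitAt G f
    ... | inj₁ s = tape c i ≡ s
    ... | inj₂ q = head c ≡ i × state c ≡ q

    -- Only the `Nc` cells are described; the tape of `c` behind them is left open.
    Holds : Fin 3 → Config M → Set
    Holds j c = ∀ b (t : Vec (Fin n) (ar b)) f → r (sy j f b) (toList t) ≡ true ⇔ Truth c f (cell b t)

    holds-sym : ∀ {j c} → Holds j c → ∀ b t s → r (sy j (symF s) b) (toList t) ≡ true ⇔ (tape c (cell b t) ≡ s)
    holds-sym {j} {c} h b t s = ⇔-trans (h b t (symF s)) conv
      where conv : Truth c (symF s) (cell b t) ⇔ (tape c (cell b t) ≡ s)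
            conv rewrite FP.splitAt-join G Q (inj₁ s) = mk⇔ id id

    holds-st : ∀ {j c} → Holds j c → ∀ b t q → r (sy j (stF q) b) (toList t) ≡ true ⇔ (head c ≡ cell b t × state c ≡ q)
    holds-st {j} {c} h b t q = ⇔-trans (h b t (stF q)) conv
      where conv : Truth c (stF q) (cell b t) ⇔ (head c ≡ cell b t × state c ≡ q)
            conv rewrite FP.splitAt-join G Q (inj₂ q) = mk⇔ id id

    sem-defines : ∀ j φ ρ → ⟦ definesF j φ ⟧ ρ ⇔ (∀ b t f → r (sy j f b) (toList t) ≡ true ⇔ ⟦ φ f b ⟧ (upds ρ 0 t))
    sem-defines j φ ρ = mk⇔
      (λ h b t f → subst (λ u → r (sy j f b) (toList u) ≡ true ⇔ ⟦ φ f b ⟧ (upds ρ 0 t)) (upds-new ρ 0 t)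
        (to (sem-iffF (fact j f b (X b)) (φ f b) (upds ρ 0 t)) (to (sem-bigAnd (λ f → iffF (fact j f b (X b)) (φ f b)) (upds ρ 0 t))
          (to (sem-forallF (ar b) 0 (body b) ρ) (to (sem-bigAnd (λ b → forallF (ar b) 0 (body b)) ρ) h b) t) f)))
      (λ h → from (sem-bigAnd (λ b → forallF (ar b) 0 (body b)) ρ) (λ b → from (sem-forallF (ar b) 0 (body b) ρ) (λ t →
        from (sem-bigAnd (λ f → iffF (fact j f b (X b)) (φ f b)) (upds ρ 0 t)) (λ f → from (sem-iffF (fact j f b (X b)) (φ f b) (upds ρ 0 t))
          (subst (λ u → r (sy j f b) (toList u) ≡ true ⇔ ⟦ φ f b ⟧ (upds ρ 0 t)) (sym (upds-new ρ 0 t)) (h b t f))))))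
      where body : ∀ b → FO τ
            body b = bigAnd (λ f → iffF (fact j f b (X b)) (φ f b))

    defines-holds : ∀ j φ ρ c → (∀ b t f → ⟦ φ f b ⟧ (upds ρ 0 t) ⇔ Truth c f (cell b t)) → ⟦ definesF j φ ⟧ ρ ⇔ Holds j c
    defines-holds j φ ρ c e = ⇔-trans (sem-defines j φ ρ)
      (mk⇔ (λ h b t f → ⇔-trans (h b t f) (e b t f)) (λ h b t f → ⇔-trans (h b t f) (⇔-sym (e b t f))))

    sem-equal : ∀ i j ρ c → Holds j c → ⟦ equalF i j ⟧ ρ ⇔ Holds i c
    sem-equal i j ρ c h = defines-holds i (λ f b → fact j f b (X b)) ρ c (λ b t f → subst (λ u → r (sy j f b) (toList u) ≡ true ⇔ Truth c f (cell b t)) (sym (upds-new ρ 0 t)) (h b t f))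

    sem-scanned : ∀ {j c} → Holds j c → ∀ q s b xs ρ → ⟦ scanned j q s b xs ⟧ ρ ⇔ (head c ≡ cell b (val ρ xs) × state c ≡ q × tape c (head c) ≡ s)
    sem-scanned {j} {c} h q s b xs ρ = mk⇔
      (λ { (p , o) → let x = to (holds-st h b (val ρ xs) q) p in proj₁ x , proj₂ x , trans (cong (tape c) (proj₁ x)) (to (holds-sym h b (val ρ xs) s) o) })
      (λ { (p , o , m) → from (holds-st h b (val ρ xs) q) (p , o) , from (holds-sym h b (val ρ xs) s) (trans (cong (tape c) (sym p)) m) })

    sem-someScanned : ∀ {j c} → Holds j c → head c < Nc → ∀ φ ρ (P : Set) →
      (∀ b ys → head c ≡ cell b ys → ⟦ φ (state c) (tape c (head c)) b (Y b) ⟧ (upds ρ width ys) ⇔ P) → ⟦ someScanned j φ ⟧ ρ ⇔ P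
    sem-someScanned {j} {c} h lt φ ρ P e = mk⇔ fwd bwd
      where
      body : ∀ q s b → FO τ
      body q s b = andF (scanned j q s b (Y b)) (φ q s b (Y b))
      fwd : ⟦ someScanned j φ ⟧ ρ → P
      fwd p with to (sem-bigOr (λ q → bigOr (λ s → bigOr (λ b → existsF (ar b) width (body q s b)))) ρ) p
      ... | q , p₁ with to (sem-bigOr (λ s → bigOr (λ b → existsF (ar b) width (body q s b))) ρ) p₁
      ... | s , p₂ with to (sem-bigOr (λ b → existsF (ar b) width (body q s b)) ρ) p₂
      ... | b , p₃ with to (sem-existsF (ar b) width (body q s b) ρ) p₃
      ... | ys , sc , m with to (sem-scanned h q s b (Y b) (upds ρ width ys)) sc
      ... | hc , refl , refl = to (e b ys (trans hc (cong (cell b) (upds-new ρ width ys)))) m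
      bwd : P → ⟦ someScanned j φ ⟧ ρ
      bwd p with uncell (head c) lt
      ... | b , ys , hc = from (sem-bigOr (λ q → bigOr (λ s → bigOr (λ b → existsF (ar b) width (body q s b)))) ρ) (state c ,
              from (sem-bigOr (λ s → bigOr (λ b → existsF (ar b) width (body (state c) s b))) ρ) (tape c (head c) ,
              from (sem-bigOr (λ b → existsF (ar b) width (body (state c) (tape c (head c)) b)) ρ) (b ,
              from (sem-existsF (ar b) width (body (state c) (tape c (head c)) b) ρ) (ys ,
                from (sem-scanned h (state c) (tape c (head c)) b (Y b) (upds ρ width ys)) (trans (sym hc) (cong (cell b) (sym (upds-new ρ width ys))) , refl , refl) ,
                from (e b ys (sym hc)) p))))

    ar≤width : ∀ b → ar b ≤ width
    ar≤width b = ≤-total-at ar b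

    module _ {c : Config M} (h : Holds fz c) (lt : head c < Nc) {q s d} (eδ : δ (state c) (tape c (head c)) ≡ go q s d) where

      c′ : Config M
      c′ = record { state = q ; head = moveHead d (head c) ; tape = setAt (tape c) (head c) s }

      sem-nextSym : ∀ s′ b xs ρ → ⟦ nextSym s′ b xs ⟧ ρ ⇔ (tape c′ (cell b (val ρ xs)) ≡ s′)
      sem-nextSym s′ b xs ρ = mk⇔ fwd bwd
        where
        i = cell b (val ρ xs)
        inner : ∀ q₀ s₀ → FO τ
        inner q₀ s₀ = andF (scanned fz q₀ s₀ b xs) (onGo (λ _ s″ _ → testF s″ s′) (δ q₀ s₀))
        fwd : ⟦ nextSym s′ b xs ⟧ ρ → tape c′ i ≡ s′
        fwd (inj₁ p) with to (sem-bigOr (λ q₀ → bigOr (inner q₀)) ρ) p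
        ... | q₀ , p₁ with to (sem-bigOr (inner q₀) ρ) p₁
        ... | s₀ , sc , m with to (sem-scanned h q₀ s₀ b xs ρ) sc
        ... | hc , refl , refl rewrite eδ = trans (cong (if_then s else tape c i) (trans (cong (i ≡ᵇ_) hc) (≡ᵇ-refl i))) (to (sem-testF s s′ ρ) m)
        fwd (inj₂ (none , p)) = trans (cong (if_then s else tape c i) (≢⇒≡ᵇ-false away)) (to (holds-sym h b (val ρ xs) s′) p)
          where away : i ≢ head c
                away e = none (from (sem-bigOr (λ q₀ → fact fz (stF q₀) b xs) ρ) (state c , from (holds-st h b (val ρ xs) (state c)) (sym e , refl)))
        bwd : tape c′ i ≡ s′ → ⟦ nextSym s′ b xs ⟧ ρ
        bwd e with i ≟ head c
        ... | yes i≡ = inj₁ (from (sem-bigOr (λ q₀ → bigOr (inner q₀)) ρ) (state c , from (sem-bigOr (inner (state c)) ρ) (tape c (head c) ,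
                from (sem-scanned h (state c) (tape c (head c)) b xs ρ) (sym i≡ , refl , refl) ,
                subst (λ a → ⟦ onGo (λ _ s″ _ → testF s″ s′) a ⟧ ρ) (sym eδ) (from (sem-testF s s′ ρ)
                  (trans (sym (cong (if_then s else tape c i) (trans (cong (i ≡ᵇ_) (sym i≡)) (≡ᵇ-refl i)))) e)))))
        ... | no ne = inj₂ ((λ p → let x = to (sem-bigOr (λ q₀ → fact fz (stF q₀) b xs) ρ) p in ne (sym (proj₁ (to (holds-st h b (val ρ xs) (proj₁ x)) (proj₂ x))))) ,
                from (holds-sym h b (val ρ xs) s′) (trans (sym (cong (if_then s else tape c i) (≢⇒≡ᵇ-false ne))) e))

      sem-nextSt : ∀ q′ b ρ → ⟦ nextSt q′ b (X b) ⟧ ρ ⇔ (head c′ ≡ cell b (val ρ (X b)) × state c′ ≡ q′)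
      sem-nextSt q′ b ρ = sem-someScanned h lt (λ q s b₀ ys → onGo (λ q″ _ d → andF (testF q″ q′) (moveF d b₀ ys b (X b))) (δ q s)) ρ target
          (λ b₀ ys hc → subst (λ a → ⟦ onGo (λ q″ _ d → andF (testF q″ q′) (moveF d b₀ (Y b₀) b (X b))) a ⟧ (upds ρ width ys) ⇔ target) (sym eδ) (core b₀ ys hc))
        where
        target : Set
        target = head c′ ≡ cell b (val ρ (X b)) × state c′ ≡ q′
        core : ∀ b₀ ys → head c ≡ cell b₀ ys → (⟦ testF q q′ ⟧ (upds ρ width ys) × ⟦ moveF d b₀ (Y b₀) b (X b) ⟧ (upds ρ width ys)) ⇔ (moveHead d (head c) ≡ cell b (val ρ (X b)) × q ≡ q′)
        -- Assigning the variables from `width` on leaves those of `X b` alone, since `ar b` is at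
        -- most `width`.
        core b₀ ys hc = mk⇔
          (λ { (p , m) → trans (cong (moveHead d) (trans hc (cong (cell b₀) (sym (upds-new ρ width ys)))))
                  (trans (sym (to (sem-move d b₀ (Y b₀) b (X b) (upds ρ width ys)) m)) (cong (cell b) (map-below ρ width ys (ar b) 0 (ar≤width b)))) , to (sem-testF q q′ (upds ρ width ys)) p })
          (λ { (m , p) → from (sem-testF q q′ (upds ρ width ys)) p , from (sem-move d b₀ (Y b₀) b (X b) (upds ρ width ys))
                  (trans (cong (cell b) (map-below ρ width ys (ar b) 0 (ar≤width b))) (trans (sym m) (cong (moveHead d) (trans hc (cong (cell b₀) (sym (upds-new ρ width ys))))))) })

      sem-next : ∀ b t f ρ → ⟦ nextF f b ⟧ (upds ρ 0 t) ⇔ Truth c′ f (cell b t)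
      sem-next b t f ρ with splitAt G f
      ... | inj₁ s′ = subst (λ u → ⟦ nextSym s′ b (X b) ⟧ (upds ρ 0 t) ⇔ (tape c′ (cell b u) ≡ s′)) (upds-new ρ 0 t) (sem-nextSym s′ b (X b) (upds ρ 0 t))
      ... | inj₂ q′ = subst (λ u → ⟦ nextSt q′ b (X b) ⟧ (upds ρ 0 t) ⇔ (head c′ ≡ cell b u × state c′ ≡ q′)) (upds-new ρ 0 t) (sem-nextSt q′ b (upds ρ 0 t))

    step-go-inv : ∀ {c c₁} → step M c ≡ running c₁ → ∃ λ q → ∃ λ s → ∃ λ d → δ (state c) (tape c (head c)) ≡ go q s d ×
                  c₁ ≡ record { state = q ; head = moveHead d (head c) ; tape = setAt (tape c) (head c) s }
    step-go-inv {c} {c₁} e = byCase _ refl (trans (sym (Runs.step-after M c)) e)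
      where
      byCase : ∀ a → δ (state c) (tape c (head c)) ≡ a → Runs.after M c a ≡ running c₁ → ∃ λ q → ∃ λ s → ∃ λ d → δ (state c) (tape c (head c)) ≡ go q s d ×
               c₁ ≡ record { state = q ; head = moveHead d (head c) ; tape = setAt (tape c) (head c) s }
      byCase (go q s d) eδ refl = q , s , d , eδ , refl

    stepF-sound : ∀ {c} ρ → Holds fz c → head c < Nc → ⟦ stepF ⟧ ρ → ∃ λ c₁ → step M c ≡ running c₁ × Holds (fs fz) c₁
    stepF-sound {c} ρ h lt (alive , df) = byCase _ refl
      where
      going : ⟦ onGo (λ _ _ _ → ttF) (δ (state c) (tape c (head c))) ⟧ ρ
      going = to (sem-someScanned h lt (λ q s _ _ → onGo (λ _ _ _ → ttF) (δ q s)) ρ (⟦ onGo (λ _ _ _ → ttF) (δ (state c) (tape c (head c))) ⟧ ρ) (λ b ys _ → closed (δ (state c) (tape c (head c))) (upds ρ width ys))) alive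
        where closed : ∀ a ρ′ → ⟦ onGo (λ _ _ _ → ttF) a ⟧ ρ′ ⇔ ⟦ onGo (λ _ _ _ → ttF) a ⟧ ρ
              closed (halt _) ρ′ = mk⇔ id id
              closed (go _ _ _) ρ′ = mk⇔ id id
      byCase : ∀ a → δ (state c) (tape c (head c)) ≡ a → ∃ λ c₁ → step M c ≡ running c₁ × Holds (fs fz) c₁
      byCase (halt b) e = ⊥-elim (subst (λ a → ⟦ onGo (λ _ _ _ → ttF) a ⟧ ρ) e going)
      byCase (go q s d) e = _ , trans (Runs.step-after M c) (cong (Runs.after M c) e) ,
        to (defines-holds (fs fz) nextF ρ _ (λ b t f → sem-next h lt e b t f ρ)) df

    stepF-complete : ∀ {c c₁} ρ → Holds fz c → head c < Nc → step M c ≡ running c₁ → Holds (fs fz) c₁ → ⟦ stepF ⟧ ρ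
    stepF-complete {c} ρ h lt e h₁ with step-go-inv e
    ... | q , s , d , eδ , refl =
        from (sem-someScanned h lt (λ q s _ _ → onGo (λ _ _ _ → ttF) (δ q s)) ρ ⊤ (λ b ys _ → subst (λ a → ⟦ onGo (λ _ _ _ → ttF) a ⟧ (upds ρ width ys) ⇔ ⊤) (sym eδ) (mk⇔ id id))) _
      , from (defines-holds (fs fz) nextF ρ _ (λ b t f → sem-next h lt eδ b t f ρ)) h₁

    sem-accept : ∀ {c} ρ → Holds (fs fz) c → head c < Nc → ⟦ acceptF ⟧ ρ ⇔ (step M c ≡ done true)
    sem-accept {c} ρ h lt = sem-someScanned h lt (λ q s _ _ → onAccept ttF (δ q s)) ρ (step M c ≡ done true) (λ b ys _ → ⇔-trans (halting _ (upds ρ width ys)) (mk⇔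
        (trans (Runs.step-after M c)) (trans (sym (Runs.step-after M c)))))
      where
      halting : ∀ a ρ′ → ⟦ onAccept ttF a ⟧ ρ′ ⇔ (Runs.after M c a ≡ done true)
      halting (halt true) ρ′ = mk⇔ (λ _ → refl) (λ _ → _)
      halting (halt false) ρ′ = mk⇔ (λ ()) (λ ())
      halting (go _ _ _) ρ′ = mk⇔ (λ ()) (λ ())

-- The tape of the initial configuration.

replicate-map : ∀ {A B : Set} (x : B) (xs : List A) → map (λ _ → x) xs ≡ replicate (length xs) x
replicate-map x [] = refl
replicate-map x (_ ∷ xs) = cong (x ∷_) (replicate-map x xs)

nth-blank : ∀ {A B : Set} (f : A → B) (z : B) w {ys : List B} → (∀ y → y ∈ ys → y ≡ z) → ∀ j {s} →
            nth (map f w ++ ys) j ≡ just s → maybe f z (nth w j) ≡ s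
nth-blank f z [] h j e = sym (h _ (∈-nth _ j e))
nth-blank f z (x ∷ w) h zero refl = refl
nth-blank f z (x ∷ w) h (suc j) e = nth-blank f z w h j e

module Start (τ : Voc) (M : TM) (k C : ℕ) where

  -- The order of `enc`, with `C * n ^ k` work cells behind it.
  allKinds : List (Kind τ)
  allKinds = un ∷ sep ∷ map rl (allFin (length τ)) ++ replicate C wk

  open Simulation τ M k allKinds using (karity)

  module _ {n : ℕ} (rl′ : ∀ i → Vec (Fin n) (lookupL τ i) → Bool) where

    content : ∀ kd → Vec (Fin n) (karity kd) → Fin (3 + TM.extra M)
    content un v = bitSym true
    content sep v = bitSym false
    content (rl i) v = bitSym (rl′ i v)
    content wk v = fz

    table : Kind τ → List (Fin (3 + TM.extra M))
    table kd = map (content kd) (allVecs n (karity kd))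

    word : List Bool
    word = replicate n true ++ false ∷ concatMap (λ i → map (rl′ i) (allVecs n (lookupL τ i))) (allFin (length τ))

    blanks : List (Fin (3 + TM.extra M))
    blanks = concatMap table (replicate C wk)

    -- The blocks, listed in order, spell the encoding followed by blanks.
    tables-word : concatMap table allKinds ≡ map bitSym word ++ blanks
    tables-word = trans (cong (λ u → u ++ bitSym false ∷ concatMap table (map rl (allFin (length τ)) ++ replicate C wk)) ones)
      (trans (cong (λ u → map bitSym (replicate n true) ++ bitSym false ∷ u) rest)
      (trans (sym (LP.++-assoc (map bitSym (replicate n true)) _ blanks)) (cong (_++ blanks) (sym (LP.map-++ bitSym (replicate n true) _)))))
      where
      ones : table un ≡ map bitSym (replicate n true)
      ones = trans (replicate-map _ (allVecs n 1)) (trans (cong (λ m → replicate m (bitSym true)) (trans (length-allVecs n 1) (*-identityʳ n))) (sym (LP.map-replicate bitSym n true)))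
      rels-part : concatMap table (map rl (allFin (length τ))) ≡ map bitSym (concatMap (λ i → map (rl′ i) (allVecs n (lookupL τ i))) (allFin (length τ)))
      rels-part = trans (LP.concatMap-map table rl (allFin (length τ)))
        (trans (LP.concatMap-cong (λ i → LP.map-∘ (allVecs n (lookupL τ i))) (allFin (length τ)))
          (sym (LP.map-concatMap bitSym (λ i → map (rl′ i) (allVecs n (lookupL τ i))) (allFin (length τ)))))
      rest : concatMap table (map rl (allFin (length τ)) ++ replicate C wk) ≡
             map bitSym (concatMap (λ i → map (rl′ i) (allVecs n (lookupL τ i))) (allFin (length τ))) ++ blanks
      rest = trans (LP.concatMap-++ table (map rl (allFin (length τ))) (replicate C wk)) (cong (_++ blanks) rels-part)

    blanks-blank : ∀ c y → y ∈ concatMap table (replicate c wk) → y ≡ fz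
    blanks-blank (suc c) y m with ∈-++⁻ (table wk) m
    ... | inj₂ m′ = blanks-blank c y m′
    ... | inj₁ m′ with ∈-map⁻ (content wk) m′
    ...   | _ , _ , refl = refl

    tape-content : ∀ b (v : Vec (Fin n) (karity (lookupL allKinds b))) →
      maybe bitSym fz (nth word (offset (λ b → n ^ karity (lookupL allKinds b)) b + idx v)) ≡ content (lookupL allKinds b) v
    tape-content b v = nth-blank bitSym fz word (blanks-blank C) _
      (trans (cong (λ l → nth l at-v) (sym tables-word)) (trans (cong (λ l → nth (concatMap table l) at-v) (sym (LP.tabulate-lookup allKinds)))
        (trans (cong (λ o → nth (concatMap table (tabulate (lookupL allKinds))) (o + idx v)) (offset-cong (λ b → sym (len b)) b))
          (trans (nth-concatMap table (lookupL allKinds) b (idx v) (subst (idx v <_) (sym (len b)) (idx< v)))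
            (nth-map (content (lookupL allKinds b)) (allVecs n (karity (lookupL allKinds b))) (idx v) (nth-allVecs n (karity (lookupL allKinds b)) v))))))
      where
      at-v = offset (λ b → n ^ karity (lookupL allKinds b)) b + idx v
      len : ∀ b → length (table (lookupL allKinds b)) ≡ n ^ karity (lookupL allKinds b)
      len b = trans (LP.length-map (content (lookupL allKinds b)) (allVecs n (karity (lookupL allKinds b)))) (length-allVecs n (karity (lookupL allKinds b)))

-- Writing a configuration into a slot.

module SlotTargets (τ : Voc) (M : TM) (k : ℕ) (kinds : List (Kind τ)) where
  open Simulation τ M k kinds

  symOf? : (R : RelSym τ) → Dec (∃ λ j → ∃ λ f → ∃ λ b → R ≡ sy j f b)
  symOf? R = FP.any? (λ j → FP.any? (λ f → FP.any? (λ b → R ≟ˢ sy j f b)))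
    where
    _≟ˢ_ : DecidableEquality (RelSym τ)
    _≟ˢ_ = SumP.≡-dec FP._≟_ (ProdP.≡-dec _≟_ _≟_)
      where import Data.Sum.Properties as SumP
            import Data.Product.Properties as ProdP

  module _ {n : ℕ} (rk : Fin n → Fin n) where

    cellAt : ∀ b → Vec (Fin n) (ar b) → ℕ
    cellAt b t = offset (λ b → n ^ ar b) b + idx (Vec.map rk t)

    -- The same as `Meaning.Truth` and `Meaning.Holds`, which depend on neither the relations nor the order.
    TruthAt : Config M → Fin F → ℕ → Set
    TruthAt c f i with splitAt (3 + TM.extra M) f
    ... | inj₁ s = tape c i ≡ s
    ... | inj₂ q = head c ≡ i × state c ≡ q

    truth? : ∀ c f i → Dec (TruthAt c f i)
    truth? c f i with splitAt (3 + TM.extra M) f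
    ... | inj₁ s = tape c i FP.≟ s
    ... | inj₂ q = (head c ≟ i) ×-dec (state c FP.≟ q)
      where open import Relation.Nullary.Decidable using (_×-dec_)

    HoldsAt : Rels τ n → Fin 3 → Config M → Set
    HoldsAt r j c = ∀ b (t : Vec (Fin n) (ar b)) f → r (sy j f b) (toList t) ≡ true ⇔ TruthAt c f (cellAt b t)

    slotValue : Config M → ∀ f b → List (Fin n) → Bool
    slotValue c f b u = maybe (λ t → does (truth? c f (cellAt b t))) false (fromListN (ar b) u)

    opaque
      -- The relations to be arrived at when Eloise writes `c` into slot `j`: nothing outside the
      -- slot changes.
      setSlot : Rels τ n → Fin 3 → Config M → Rels τ n
      setSlot r j c R u with symOf? R
      ... | no _ = r R u
      ... | yes (j′ , f , b , _) with j′ FP.≟ j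
      ...   | yes _ = slotValue c f b u
      ...   | no _ = r R u

      setSlot-other : ∀ r j c R u → (∀ f b → R ≢ sy j f b) → setSlot r j c R u ≡ r R u
      setSlot-other r j c R u ne with symOf? R
      ... | no _ = refl
      ... | yes (j′ , f , b , e) with j′ FP.≟ j
      ...   | yes refl = contradiction e (ne f b)
      ...   | no _ = refl

      setSlot-same : ∀ r j c f b u → setSlot r j c (sy j f b) u ≡ slotValue c f b u
      setSlot-same r j c f b u with symOf? (sy j f b)
      ... | no ne = contradiction (j , f , b , refl) ne
      ... | yes (j′ , f′ , b′ , e) with sy-injective {j} {f} {b} {j′} {f′} {b′} e
      ...   | refl , refl , refl with j FP.≟ j
      ...     | yes _ = refl
      ...     | no ne = contradiction refl ne

    does-⇔ : ∀ {P : Set} (d : Dec P) → does d ≡ true ⇔ P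
    does-⇔ (yes p) = mk⇔ (λ _ → p) (λ _ → refl)
    does-⇔ (no np) = mk⇔ (λ ()) (λ p → contradiction p np)

    setSlot-holds : ∀ r j c → HoldsAt (setSlot r j c) j c
    setSlot-holds r j c b t f = subst (λ v → v ≡ true ⇔ TruthAt c f (cellAt b t))
      (sym (trans (setSlot-same r j c f b (toList t)) (cong (maybe _ false) (fromListN-toList t)))) (does-⇔ (truth? c f (cellAt b t)))

    holds-cong : ∀ {r r′ j c} → (∀ f b (t : Vec (Fin n) (ar b)) → r′ (sy j f b) (toList t) ≡ r (sy j f b) (toList t)) → HoldsAt r j c → HoldsAt r′ j c
    holds-cong {r} {r′} {j} {c} e h b t f = subst (λ v → v ≡ true ⇔ TruthAt c f (cellAt b t)) (sym (e f b t)) (h b t f)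

    setSlot-keeps : ∀ r {i j} c c′ → i ≢ j → HoldsAt r i c → HoldsAt (setSlot r j c′) i c
    setSlot-keeps r {i} {j} c c′ ne = holds-cong {r} {setSlot r j c′} {i} {c}
      (λ f b t → setSlot-other r j c′ (sy i f b) (toList t) (λ f′ b′ e → ne (proj₁ (sy-injective {i} {f} {b} {j} {f′} {b′} e))))

  editOf : ∀ {n} j f b → Vec (Fin n) (ar b) → Σ (RelSym τ) λ R → Vec (Fin n) (arity τ R)
  editOf j f b t = sy j f b , t

  opaque
    slotSyms : Fin 3 → List (RelSym τ)
    slotSyms j = concatMap (λ f → map (sy j f) (allFin nb)) (allFin F)

    ∈-slotSyms : ∀ j f b → sy j f b ∈ slotSyms j
    ∈-slotSyms j f b = ∈-concatMap⁺ (λ f → map (sy j f) (allFin nb)) (Any.map (λ { refl → ∈-map⁺ (sy j f) (∈-allFin b) }) (∈-allFin f))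

    slotSyms-∈ : ∀ j R → R ∈ slotSyms j → ∃ λ f → ∃ λ b → R ≡ sy j f b
    slotSyms-∈ j R m with Any.satisfied (∈-concatMap⁻ (λ f → map (sy j f) (allFin nb)) {xs = allFin F} m)
    ... | f , m′ with ∈-map⁻ (sy j f) m′
    ...   | b , _ , e = f , b , e

    -- Every tuple of the slot is edited, right or wrong, so that the number of edits depends on `n`
    -- alone and a clock can be set for it.
    slotEdits : ∀ n → Fin 3 → List (Σ (RelSym τ) λ R → Vec (Fin n) (arity τ R))
    slotEdits n j = concatMap (λ f → concatMap (λ b → map (editOf j f b) (allVecs n (ar b))) (allFin nb)) (allFin F)

    ∈-slotEdits : ∀ n j f b t → (sy j f b , t) ∈ slotEdits n j
    ∈-slotEdits n j f b t = ∈-concatMap⁺ (λ f → concatMap (λ b → map (editOf j f b) (allVecs n (ar b))) (allFin nb))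
      (Any.map (λ { refl → ∈-concatMap⁺ (λ b → map (editOf j f b) (allVecs n (ar b))) (Any.map (λ { refl → ∈-map⁺ (editOf j f b) (∈-allVecs t) }) (∈-allFin b)) }) (∈-allFin f))

    slotEdits-∈ : ∀ n j R t → (R , t) ∈ slotEdits n j → R ∈ slotSyms j
    slotEdits-∈ n j R t m with Any.satisfied (∈-concatMap⁻ (λ f → concatMap (λ b → map (editOf j f b) (allVecs n (ar b))) (allFin nb)) {xs = allFin F} m)
    ... | f , m₁ with Any.satisfied (∈-concatMap⁻ (λ b → map (editOf j f b) (allVecs n (ar b))) {xs = allFin nb} m₁)
    ...   | b , m₂ with ∈-map⁻ (editOf j f b) m₂
    ...     | _ , _ , refl = ∈-slotSyms j f b

    length-slotEdits : ∀ n j → length (slotEdits n j) ≡ F * total (λ b → n ^ ar b)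
    length-slotEdits n j = trans (length-concatMap (λ f → concatMap (λ b → map (editOf j f b) (allVecs n (ar b))) (allFin nb)) id)
      (trans (total-cong (λ f → trans (length-concatMap (λ b → map (editOf j f b) (allVecs n (ar b))) id)
        (total-cong (λ b → trans (LP.length-map (editOf j f b) (allVecs n (ar b))) (length-allVecs n (ar b)))))) (total-const F (total (λ b → n ^ ar b))))

  opaque
    unfolding setSlot

    setSlot-agrees : ∀ {n} (rk : Fin n → Fin n) r j c R (u : Vec (Fin n) (arity τ R)) → r R (toList u) ≡ setSlot rk r j c R (toList u) ⊎ (R , u) ∈ slotEdits n j
    setSlot-agrees {n} rk r j c R u with symOf? R
    ... | no _ = inj₁ refl
    ... | yes (j′ , f , b , refl) with j′ FP.≟ j
    ...   | yes refl = inj₂ (∈-slotEdits n j′ f b u)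
    ...   | no _ = inj₁ refl

-- Halving a run

module Savitch (τ : Voc) (M : TM) (k : ℕ) (kinds : List (Kind τ)) where
  open Simulation τ M k kinds
  open SlotTargets τ M k kinds

  slot₀ slot₁ slot₂ : Fin 3
  slot₀ = fz
  slot₁ = fs fz
  slot₂ = fs (fs fz)

  -- The end of the halving: a run of at most one step, where equality covers the empty run.
  finalF : FO τ
  finalF = orF (equalF slot₁ slot₀) stepF

  -- The logic has no assignment of relations. Eloise edits the slot as she likes, and Abelard
  -- either disputes the result or lets the next round begin, so a wrong copy loses.
  copyBack : Pol → Fin 3 → FO τ → Formula τ
  copyBack t j χ = edits t (slotSyms j) (and (formula χ) (loop 0))

  -- A comparison carries a description from its second slot to its first. In the first half slot 1
  -- is reached and tells what slot 2 describes; in the second half slot 2 is known and passes its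
  -- description on to slot 0.
  halves : Pol → Formula τ
  halves t = and (copyBack t slot₁ (equalF slot₂ slot₁)) (copyBack t slot₀ (equalF slot₀ slot₂))

  -- Slot 1 is reachable from slot 0: in at most one step, or through the
  -- configuration that Eloise writes to slot 2, Abelard choosing the half to go on with.
  round : Pol → Formula τ
  round t = lab 0 t (or (formula finalF) (edits t (slotSyms slot₂) (halves t)))

  module Rounds {φ₀ : Formula τ} {n₁ V : ℕ} (fits : Fits V φ₀) (t : Pol) (pR : List ℕ)
    (atR : subAt φ₀ pR ≡ just (round t))
    (rk : Fin (suc n₁) → Fin (suc n₁)) (rk-inj : ∀ {a b} → rk a ≡ rk b → a ≡ b) where

    open Evaluate {τ} {φ₀} {suc n₁} {V} fits
    open Heights φ₀ (suc n₁)
    open Editing {τ} {φ₀} {suc n₁} {V} fits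
    open Equivalence using (to; from)

    n Nc len : ℕ
    n = suc n₁
    Nc = total (λ b → n ^ ar b)
    len = length (slotEdits n slot₂)

    Order : Rels τ n → Set
    Order r = ∀ a b → r LT (a ∷ b ∷ []) ≡ true ⇔ (toℕ (rk a) < toℕ (rk b))

    Holds : Rels τ n → Fin 3 → Config M → Set
    Holds = HoldsAt rk

    module Mean (r : Rels τ n) (o : Order r) = Meaning {n₁} r rk rk-inj o

    retype : ∀ {r o j c} → Holds r j c ⇔ Mean.Holds r o j c
    retype {r} {o} {j} {c} = mk⇔ (λ h b t f → ⇔-trans (h b t f) (fwd f)) (λ h b t f → ⇔-trans (h b t f) (⇔-sym (fwd f)))
      where fwd : ∀ f {i} → TruthAt rk c f i ⇔ Mean.Truth r o c f i
            fwd f with splitAt (3 + TM.extra M) f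
            ... | inj₁ s = mk⇔ id id
            ... | inj₂ q = mk⇔ id id

    ρ-of : GState τ n → Var → Fin n
    ρ-of g v = maybe id fz (asg g v)

    assigns : ∀ {g} → Tot (asg g) → Assigns g (ρ-of g)
    assigns {g} tot v lt with asg g v | tot v lt
    ... | _ | a , refl = refl

    decideF : ∀ χ g → At (pos g) (formula χ) → eloiseVer g ≡ true → Tot (asg g) →
              Wins {φ₀ = φ₀} g ⇔ Semantics.⟦_⟧ {τ} (rels g) χ (ρ-of g)
    decideF χ g e v tot = subst (λ s → Wins {φ₀ = φ₀} g ⇔ Side s (Semantics.⟦_⟧ {τ} (rels g) χ (ρ-of g))) v (evaluate χ g (ρ-of g) e (assigns {g} tot) refl)

    pB p₁ q₁ p₂ q₂ p₃ q₃ : List ℕ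
    pB = pR ++ 0 ∷ []
    p₁ = pB ++ 1 ∷ []
    q₁ = exitPos (p₁ ++ 0 ∷ []) (length (slotSyms slot₂))
    p₂ = q₁ ++ 0 ∷ []
    q₂ = exitPos (p₂ ++ 0 ∷ []) (length (slotSyms slot₁))
    p₃ = q₁ ++ 1 ∷ []
    q₃ = exitPos (p₃ ++ 0 ∷ []) (length (slotSyms slot₀))

    atB : At pB (or (formula finalF) (edits t (slotSyms slot₂) (halves t)))
    atB = at-child pR 0 atR refl

    at₁ : At p₁ (edits t (slotSyms slot₂) (halves t))
    at₁ = at-child pB 1 atB refl

    at₁′ : At q₁ (halves t)
    at₁′ = at-exit (slotSyms slot₂) (p₁ ++ 0 ∷ []) (at-child p₁ 0 at₁ refl)

    at₂ : At p₂ (copyBack t slot₁ (equalF slot₂ slot₁))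
    at₂ = at-child q₁ 0 at₁′ refl

    at₃ : At p₃ (copyBack t slot₀ (equalF slot₀ slot₂))
    at₃ = at-child q₁ 1 at₁′ refl

    at₂′ : At q₂ (and (formula (equalF slot₂ slot₁)) (loop 0))
    at₂′ = at-exit (slotSyms slot₁) (p₂ ++ 0 ∷ []) (at-child p₂ 0 at₂ refl)

    at₃′ : At q₃ (and (formula (equalF slot₀ slot₂)) (loop 0))
    at₃′ = at-exit (slotSyms slot₀) (p₃ ++ 0 ∷ []) (at-child p₃ 0 at₃ refl)

    env-edits : ∀ Rs p {ψ} → At p (edits t Rs ψ) → env (exitPos (p ++ 0 ∷ []) (length Rs)) 0 ≡ env p 0
    env-edits Rs p e = trans (env-exit Rs (p ++ 0 ∷ []) 0 (at-child p 0 e refl)) (env-child p 0 0 e refl)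

    env₁ : env q₁ 0 ≡ just pR
    env₁ = trans (env-edits (slotSyms slot₂) p₁ at₁) (trans (env-child pB 1 0 atB refl) (env-child pR 0 0 atR refl))

    env₂ : env (q₂ ++ 1 ∷ []) 0 ≡ just pR
    env₂ = trans (env-child q₂ 1 0 at₂′ refl) (trans (env-edits (slotSyms slot₁) p₂ at₂) (trans (env-child q₁ 0 0 at₁′ refl) env₁))

    env₃ : env (q₃ ++ 1 ∷ []) 0 ≡ just pR
    env₃ = trans (env-child q₃ 1 0 at₃′ refl) (trans (env-edits (slotSyms slot₀) p₃ at₃) (trans (env-child q₁ 1 0 at₁′ refl) env₁))

    LT≢sy : ∀ j f b → LT ≢ sy j f b
    LT≢sy j f b e = nameOf-positive j f b (sym (,-injectiveˡ (inj₂-injective e)))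
      where open import Data.Sum.Properties using (inj₂-injective)

    sy∉ : ∀ {i j} → i ≢ j → ∀ f b S → S ∈ slotSyms j → sy i f b ≢ S
    sy∉ {i} {j} ne f b S m e with slotSyms-∈ j S m
    ... | f′ , b′ , e′ = ne (proj₁ (sy-injective (trans e e′)))

    LT∉ : ∀ {j} S → S ∈ slotSyms j → LT ≢ S
    LT∉ {j} S m e with slotSyms-∈ j S m
    ... | f′ , b′ , e′ = LT≢sy j f′ b′ (trans e e′)

    order-kept : ∀ {r r′} → (∀ u → r′ LT u ≡ r LT u) → Order r → Order r′
    order-kept e o a b = subst (λ v → v ≡ true ⇔ (toℕ (rk a) < toℕ (rk b))) (sym (e (a ∷ b ∷ []))) (o a b)

    -- A condition on the whole future of `c`, so that it passes to every configuration reached from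
    -- it.
    Good : Config M → Set
    Good c = ∀ t c′ → exec M t c ≡ running c′ → head c′ < Nc

    good-after : ∀ {c c′} u → Good c → exec M u c ≡ running c′ → Good c′
    good-after u h e t c″ e′ = h (u + t) c″ (trans (Runs.exec-+ M u e) e′)

    -- Slots may hold anything that Eloise cares to write, so no configuration is decoded from them.
    -- The claim speaks instead of all configurations that happen to match slot 0, and only what is
    -- reached from such a one is asserted to match slot 1.
    Claim : Rels τ n → Set
    Claim r = ∀ c → Good c → Holds r slot₀ c → ∃ λ c′ → (∃ λ u → exec M u c ≡ running c′) × Holds r slot₁ c′

    final-sound : ∀ {r} ρ → Order r → Semantics.⟦_⟧ {τ} r finalF ρ → Claim r
    final-sound {r} ρ o (inj₁ eq′) c gd h = c , (0 , refl) , from (retype {r} {o} {slot₁} {c}) (to (Mean.sem-equal r o slot₁ slot₀ ρ c (to (retype {r} {o} {slot₀} {c}) h)) eq′)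
    final-sound {r} ρ o (inj₂ st′) c gd h with Mean.stepF-sound r o ρ (to (retype {r} {o} {slot₀} {c}) h) (gd 0 c refl) st′
    ... | c′ , e , h′ = c′ , (1 , exec-running 0 e) , from (retype {r} {o} {slot₁} {c′}) h′

    shift : ∀ {k g q} → pos g ≡ q → W k g → W k (at g q)
    shift refl w = w

    unshift : ∀ {g q} → pos g ≡ q → Wins {φ₀ = φ₀} (at g q) → Wins {φ₀ = φ₀} g
    unshift refl w = w

    equal-holds : ∀ {r i j c} ρ → Order r → Semantics.⟦_⟧ {τ} r (equalF i j) ρ → Holds r j c → Holds r i c
    equal-holds {r} {i} {j} {c} ρ o eq′ h = from (retype {r} {o} {i} {c}) (to (Mean.sem-equal r o i j ρ c (to (retype {r} {o} {j} {c}) h)) eq′)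

    holds-equal : ∀ {r i j c} ρ → Order r → Holds r i c → Holds r j c → Semantics.⟦_⟧ {τ} r (equalF i j) ρ
    holds-equal {r} {i} {j} {c} ρ o hi hj = from (Mean.sem-equal r o i j ρ c (to (retype {r} {o} {j} {c}) hj)) (to (retype {r} {o} {i} {c}) hi)

    -- After a copy has been checked, play is back at the start of the round.
    copied-sound : ∀ m {k} j χ g {p q} → q ≡ exitPos (p ++ 0 ∷ []) (length (slotSyms j)) → At p (copyBack t j χ) → At q (and (formula χ) (loop 0)) → env (q ++ 1 ∷ []) 0 ≡ just pR →
      k ≤ m → eloiseVer g ≡ true → Tot (asg g) → W k (at g p) →
      ∃ λ l → ∃ λ g′ → l ≤ m × W l (at g′ pR) × eloiseVer g′ ≡ true × Tot (asg g′) ×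
        (∀ R → (∀ S → S ∈ slotSyms j → R ≢ S) → ∀ u → rels g′ R u ≡ rels g R u) × Semantics.⟦_⟧ {τ} (rels g′) χ (ρ-of g′)
    copied-sound m j χ g {p} {q} refl e e′ h le v tot w with edit-sound m (at g p) le e v tot w
    ... | left-at {l} g′ l≤ w′ ps vr tt′ kp with w-faced (trans (node-and {φ₀ = φ₀} {g = at g′ q} e′) (cong (λ s → choice (not s) (down (at g′ q) 0 ∷ down (at g′ q) 1 ∷ [])) vr)) (shift ps w′)
    ...   | l₁ , refl , both with w-det (loop-target (at-child q 1 e′ refl) h (at g′ (q ++ 1 ∷ [])) refl) (both _ (there (here refl)))
    ...     | l₂ , refl , w″ = l₂ , g′ , ≤-trans (n≤1+n _) (≤-trans (n≤1+n _) l≤) , w″ , vr , tt′ , kp ,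
                to (decideF χ (at g′ (q ++ 0 ∷ [])) (at-child q 0 e′ refl) vr tt′) (w-wins (both _ (here refl)))

    Kept : Fin 3 → Rels τ n → Rels τ n → Set
    Kept j r r′ = ∀ R → (∀ S → S ∈ slotSyms j → R ≢ S) → ∀ u → r′ R u ≡ r R u

    keep : ∀ {r r′ i j c} → i ≢ j → Kept j r r′ → Holds r i c → Holds r′ i c
    keep {r} {r′} {i} {j} {c} ne kept = holds-cong rk {r} {r′} {i} {c} (λ f b t → kept (sy i f b) (λ S m → sy∉ ne f b S m) (toList t))

    unkeep : ∀ {r r′ i j c} → i ≢ j → Kept j r r′ → Holds r′ i c → Holds r i c
    unkeep {r} {r′} {i} {j} {c} ne kept = holds-cong rk {r′} {r} {i} {c} (λ f b t → sym (kept (sy i f b) (λ S m → sy∉ ne f b S m) (toList t)))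

    -- The midpoint is the configuration that the first half reaches. The two comparisons carry its
    -- description from slot 1 through slot 2 to slot 0 of the second half, where the other claim
    -- takes over.
    compose-claims : ∀ {r r₁ r₂ r₃} ρ₂ ρ₃ → Order r₂ → Order r₃ → Kept slot₂ r r₁ → Kept slot₁ r₁ r₂ → Kept slot₀ r₁ r₃ →
      Semantics.⟦_⟧ {τ} r₂ (equalF slot₂ slot₁) ρ₂ → Semantics.⟦_⟧ {τ} r₃ (equalF slot₀ slot₂) ρ₃ → Claim r₂ → Claim r₃ → Claim r
    compose-claims {r} {r₁} {r₂} {r₃} ρ₂ ρ₃ o₂ o₃ kp ka kb ea eb s₂ s₃ c gd h
      with s₂ c gd (keep {r₁} {r₂} {c = c} (λ ()) ka (keep {r} {r₁} {c = c} (λ ()) kp h))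
    ... | c₁ , (u , eu) , h₁ with s₃ c₁ (good-after u gd eu) (equal-holds {r₃} {slot₀} {slot₂} {c₁} ρ₃ o₃ eb
              (keep {r₁} {r₃} {c = c₁} (λ ()) kb (unkeep {r₁} {r₂} {c = c₁} (λ ()) ka (equal-holds {r₂} {slot₂} {slot₁} {c₁} ρ₂ o₂ ea h₁))))
    ...   | c₂ , (w , ew) , h₂ = c₂ , (u + w , trans (Runs.exec-+ M u eu) ew) , unkeep {r} {r₁} {c = c₂} (λ ()) kp (unkeep {r₁} {r₃} {c = c₂} (λ ()) kb h₂)

    -- Induction on the bound `m` for the height of the derivation. Eloise wins whichever half
    -- Abelard picks, so both halves are followed and their claims composed.
    sound : ∀ m {k} g → k ≤ m → eloiseVer g ≡ true → Tot (asg g) → Order (rels g) → W k (at g pR) → Claim (rels g)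
    sound m g le v tot o w with visits g pR <ᵇ evalPol t n in lt
    ... | false with w-terminal (node-stuck {φ₀ = φ₀} {g = at g pR} atR lt) w
    ...   | ()
    sound m g le v tot o w | true with w-det (node-lab {φ₀ = φ₀} {g = at g pR} atR lt) w
    sound (suc m) g (s≤s le) v tot o w | true | k₁ , refl , w₁
      with w-chosen (trans (node-or {φ₀ = φ₀} {g = afterLab {φ₀ = φ₀} {g = at g pR}} atB) (cong (λ s → choice s (down (afterLab {φ₀ = φ₀} {g = at g pR}) 0 ∷ down (afterLab {φ₀ = φ₀} {g = at g pR}) 1 ∷ [])) v)) w₁
    ... | k₂ , _ , refl , here refl , w₂ = final-sound (ρ-of g) o (to (decideF finalF (down (afterLab {φ₀ = φ₀} {g = at g pR}) 0) (at-child pB 0 atB refl) v tot) (w-wins w₂))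
    ... | k₂ , _ , refl , there (here refl) , w₂ with edit-sound m (down (afterLab {φ₀ = φ₀} {g = at g pR}) 1) (≤-trans (n≤1+n k₂) le) at₁ v tot w₂
    ...   | left-at {l} g₁ l≤ w₃ ps vr tt′ kp with w-faced (trans (node-and {φ₀ = φ₀} {g = at g₁ q₁} at₁′) (cong (λ s → choice (not s) (down (at g₁ q₁) 0 ∷ down (at g₁ q₁) 1 ∷ [])) vr)) (shift ps w₃)
    ...     | l₁ , refl , both
      with copied-sound m slot₁ (equalF slot₂ slot₁) g₁ refl at₂ at₂′ env₂ (≤-trans (n≤1+n l₁) l≤) vr tt′ (both _ (here refl))
         | copied-sound m slot₀ (equalF slot₀ slot₂) g₁ refl at₃ at₃′ env₃ (≤-trans (n≤1+n l₁) l≤) vr tt′ (both _ (there (here refl)))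
    ...       | a , g₂ , a≤ , wa , va , ta , ka , ea | b , g₃ , b≤ , wb , vb , tb , kb , eb =
      compose-claims {rels g} {rels g₁} {rels g₂} {rels g₃} (ρ-of g₂) (ρ-of g₃) o₂ o₃ kp ka kb ea eb (sound m g₂ a≤ va ta o₂ wa) (sound m g₃ b≤ vb tb o₃ wb)
      where
      o₁ : Order (rels g₁)
      o₁ = order-kept {rels g} {rels g₁} (kp LT (λ S m → LT∉ {slot₂} S m)) o
      o₂ : Order (rels g₂)
      o₂ = order-kept {rels g₁} {rels g₂} (ka LT (λ S m → LT∉ {slot₁} S m)) o₁
      o₃ : Order (rels g₃)
      o₃ = order-kept {rels g₁} {rels g₃} (kb LT (λ S m → LT∉ {slot₀} S m)) o₁

    -- One visit of the round and one edit of a slot per halving.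
    record Budget (d : ℕ) (g : GState τ n) : Set where
      constructor budget
      field
        inR : visits g pR + d < evalPol t n
        in₁ : visits g p₁ + d * suc len < evalPol t n
        in₂ : visits g p₂ + d * suc len < evalPol t n
        in₃ : visits g p₃ + d * suc len < evalPol t n
    open Budget

    length-exitPos : ∀ q m → length q ≤ length (exitPos q m)
    length-exitPos q zero = ≤-refl
    length-exitPos q (suc m) = ≤-trans (≤-trans (≤-trans (m≤m+n (length q) 1) (≤-reflexive (sym (LP.length-++ q))))
      (≤-trans (m≤m+n (length (q ++ 1 ∷ [])) 1) (≤-reflexive (sym (LP.length-++ (q ++ 1 ∷ [])))))) (length-exitPos _ m)

    longer : ∀ (p : List ℕ) i → length p < length (p ++ i ∷ [])
    longer p i = ≤-reflexive (trans (+-comm 1 (length p)) (sym (LP.length-++ p {i ∷ []})))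

    -- Labels at different nodes have separate clocks. The nodes are told apart by the length of
    -- their paths, except `p₂` and `p₃`, which differ in the last step.
    R<1 : length pR < length p₁
    R<1 = <-trans (longer pR 0) (longer pB 1)

    1<2 : length p₁ < length p₂
    1<2 = ≤-trans (longer p₁ 0) (≤-trans (length-exitPos (p₁ ++ 0 ∷ []) (length (slotSyms slot₂))) (<⇒≤ (longer q₁ 0)))

    2≡3 : length p₂ ≡ length p₃
    2≡3 = trans (LP.length-++ q₁ {0 ∷ []}) (sym (LP.length-++ q₁ {1 ∷ []}))

    shorter : ∀ {p q : List ℕ} → length p < length q → p ≢ q
    shorter lt refl = <-irrefl refl lt

    p₂≢p₃ : p₂ ≢ p₃
    p₂≢p₃ e with LP.∷ʳ-injectiveʳ q₁ q₁ e
    ... | ()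

    1<3 : length p₁ < length p₃
    1<3 = ≤-trans 1<2 (≤-reflexive 2≡3)

    R<2 : length pR < length p₂
    R<2 = <-trans R<1 1<2

    R<3 : length pR < length p₃
    R<3 = <-trans R<1 1<3

    len≡ : ∀ j → length (slotEdits n j) ≡ len
    len≡ j = trans (length-slotEdits n j) (sym (length-slotEdits n slot₂))

    sy-apart : ∀ {i j} → i ≢ j → ∀ f b f′ b′ → sy i f b ≢ sy j f′ b′
    sy-apart ne f b f′ b′ e = ne (proj₁ (sy-injective e))

    module Rewrite {g g′ : GState τ n} {j E p q} {c : Config M} (w : Rewritten (setSlot rk (rels g) j c) E p q g g′) where

      new : Holds (rels g′) j c
      new = holds-cong rk {setSlot rk (rels g) j c} {rels g′} {j} {c} (λ f b t → rels≡ w (sy j f b) t) (setSlot-holds rk (rels g) j c)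

      old : ∀ {i c′} → i ≢ j → Holds (rels g) i c′ → Holds (rels g′) i c′
      old {i} {c′} ne = holds-cong rk {rels g} {rels g′} {i} {c′} (λ f b t → trans (rels≡ w (sy i f b) t)
        (setSlot-other rk (rels g) j c (sy i f b) (toList t) (λ f′ b′ → sy-apart ne f b f′ b′)))

      order′ : Order (rels g) → Order (rels g′)
      order′ o a b = subst (λ v → v ≡ true ⇔ (toℕ (rk a) < toℕ (rk b)))
        (sym (trans (rels≡ w LT (a ∷ b ∷ [])) (setSlot-other rk (rels g) j c LT (a ∷ b ∷ []) (λ f b → LT≢sy j f b)))) (o a b)

    write-slot : ∀ j c {ψ p} g → At p (edits t (slotSyms j) ψ) → eloiseVer g ≡ true → Tot (asg g) → visits g p + len < evalPol t n →
      (∀ g′ → Rewritten (setSlot rk (rels g) j c) len p (exitPos (p ++ 0 ∷ []) (length (slotSyms j))) g g′ →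
              Wins {φ₀ = φ₀} (at g′ (exitPos (p ++ 0 ∷ []) (length (slotSyms j))))) → Wins {φ₀ = φ₀} (at g p)
    write-slot j c {ψ} {p} g e v tot lt onward = rewrite-rels (setSlot rk (rels g) j c) {t} {slotSyms j} (slotEdits n j) (at g p) e v tot
      (λ R u m → slotEdits-∈ n j R u m) (subst (λ l → visits g p + l < evalPol t n) (sym (len≡ j)) lt)
      (λ R u → setSlot-agrees rk (rels g) j c R u)
      (λ g′ w → unshift (pos≡ w) (onward g′ (subst (λ l → Rewritten (setSlot rk (rels g) j c) l p _ g g′) (len≡ j) (record
         { pos≡ = pos≡ w ; ver≡ = ver≡ w ; total′ = total′ w ; rels≡ = rels≡ w ; here≡ = here≡ w ; there≡ = there≡ w }))))

    split-run : ∀ a {b c c′} → exec M (a + b) c ≡ running c′ → ∃ λ d → exec M a c ≡ running d × exec M b d ≡ running c′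
    split-run a {b} {c} {c′} e = byCase (exec M a c) refl
      where
      byCase : ∀ o → exec M a c ≡ o → ∃ λ d → o ≡ running d × exec M b d ≡ running c′
      byCase (running d) q = d , refl , trans (sym (Runs.exec-+ M a q)) e
      byCase (done x) q with trans (sym e) (Runs.done-+ M a b q)
      ... | ()

    final-complete : ∀ {r c c′} ρ T → T ≤ 1 → Order r → Good c → Holds r slot₀ c → exec M T c ≡ running c′ → Holds r slot₁ c′ → Semantics.⟦_⟧ {τ} r finalF ρ
    final-complete {r} {c} ρ zero le o gd h refl h′ = inj₁ (holds-equal {r} {slot₁} {slot₀} {c} ρ o h′ h)
    final-complete {r} {c} {c′} ρ (suc zero) le o gd h e h′ = inj₂ (Mean.stepF-complete r o ρ (to (retype {r} {o} {slot₀} {c}) h) (gd 0 c refl) one-step (to (retype {r} {o} {slot₁} {c′}) h′))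
      where
      one-step : step M c ≡ running c′
      one-step = byCase (step M c) refl
        where
        byCase : ∀ x → step M c ≡ x → x ≡ running c′
        byCase (done b) q with trans (sym e) (exec-done 0 q)
        ... | ()
        byCase (running d) q with trans (sym (exec-running 0 q)) e
        ... | refl = refl
    final-complete ρ (suc (suc T)) (s≤s ()) o gd h e h′

    -- The midpoint is the configuration after `T ⊓ 2 ^ d` steps, which leaves at most `2 ^ d` for
    -- either half. A halving visits the round once, and then edits slot 2 and one of the other two
    -- slots, with one visit per tuple and one to leave the loop.
    complete : ∀ d T {c c′} g → T ≤ 2 ^ d → Good c → exec M T c ≡ running c′ → Holds (rels g) slot₀ c → Holds (rels g) slot₁ c′ →
               eloiseVer g ≡ true → Tot (asg g) → Order (rels g) → Budget d g → Wins {φ₀ = φ₀} (at g pR)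
    complete d T {c} {c′} g le gd run h h′ v tot o B = forced (node-lab {φ₀ = φ₀} {g = at g pR} atR (<ᵇ-true (≤-trans (s≤s (m≤m+n _ d)) (inR B)))) (body d le B)
      where
      g₀ = afterLab {φ₀ = φ₀} {g = at g pR}
      or-node : node φ₀ n g₀ ≡ choice true (down g₀ 0 ∷ down g₀ 1 ∷ [])
      or-node = trans (node-or {φ₀ = φ₀} {g = g₀} atB) (cong (λ s → choice s (down g₀ 0 ∷ down g₀ 1 ∷ [])) v)
      visR : visits g₀ pR ≡ suc (visits g pR)
      visR rewrite pathEq-refl pR = refl
      vis-other : ∀ q → q ≢ pR → visits g₀ q ≡ visits g q
      vis-other q ne with listEq _≡ᵇ_ q pR in e
      ... | true = contradiction (pathEq-sound q pR e) ne
      ... | false = refl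
      body : ∀ d → T ≤ 2 ^ d → Budget d g → Wins {φ₀ = φ₀} g₀
      body zero le B = eChoose or-node (here refl) (from (decideF finalF (down g₀ 0) (at-child pB 0 atB refl) v tot)
        (final-complete {rels g} {c} {c′} (ρ-of g) T le o gd h run h′))
      body (suc d) le B = eChoose or-node (there (here refl)) (write-slot slot₂ m (down g₀ 1) at₁ v tot
          (≤-trans (s≤s (≤-trans (≤-reflexive (cong (_+ len) (vis-other p₁ (λ e → shorter R<1 (sym e))))) (+-monoʳ-≤ (visits g p₁) (≤-trans (n≤1+n len) (m≤m+n (suc len) (d * suc len)))))) (in₁ B))
          choose-half)
        where
        T₁ = T ⊓ 2 ^ d
        T₂ = T ∸ 2 ^ d
        T≡ : T₁ + T₂ ≡ T
        T≡ = m⊓n+m∸n≡m′ T (2 ^ d)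
          where m⊓n+m∸n≡m′ : ∀ a b → (a ⊓ b) + (a ∸ b) ≡ a
                m⊓n+m∸n≡m′ zero zero = refl
                m⊓n+m∸n≡m′ zero (suc b) = refl
                m⊓n+m∸n≡m′ (suc a) zero = refl
                m⊓n+m∸n≡m′ (suc a) (suc b) = cong suc (m⊓n+m∸n≡m′ a b)
        le₂ : T₂ ≤ 2 ^ d
        le₂ = ≤-trans (∸-monoˡ-≤ (2 ^ d) le) (≤-reflexive (trans (cong (_∸ 2 ^ d) (cong (2 ^ d +_) (+-identityʳ (2 ^ d)))) (m+n∸m≡n (2 ^ d) (2 ^ d))))
        mid = split-run T₁ {T₂} {c} {c′} (trans (cong (λ k → exec M k c) T≡) run)
        m = proj₁ mid
        choose-half : ∀ g₁ → Rewritten (setSlot rk (rels g) slot₂ m) len p₁ q₁ (down g₀ 1) g₁ → Wins {φ₀ = φ₀} (at g₁ q₁)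
        choose-half g₁ w = aChoose (trans (node-and {φ₀ = φ₀} {g = at g₁ q₁} at₁′) (cong (λ s → choice (not s) (down (at g₁ q₁) 0 ∷ down (at g₁ q₁) 1 ∷ [])) (ver≡ w)))
            (λ { _ (here refl) → write-slot slot₁ m g₁ at₂ (ver≡ w) (total′ w) (room p₂ vis₂ (in₂ B)) first
               ; _ (there (here refl)) → write-slot slot₀ m g₁ at₃ (ver≡ w) (total′ w) (room p₃ vis₃ (in₃ B)) second })
          where
          module R₁ = Rewrite {down g₀ 1} {g₁} {slot₂} w
          vis₂ : visits g₁ p₂ ≡ visits g p₂
          vis₂ = trans (there≡ w p₂ (λ e → shorter 1<2 (sym e))) (vis-other p₂ (λ e → shorter R<2 (sym e)))
          vis₃ : visits g₁ p₃ ≡ visits g p₃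
          vis₃ = trans (there≡ w p₃ (λ e → shorter 1<3 (sym e))) (vis-other p₃ (λ e → shorter R<3 (sym e)))
          vis₁ : visits g₁ p₁ ≡ visits g p₁ + suc len
          vis₁ = trans (here≡ w) (cong (_+ suc len) (vis-other p₁ (λ e → shorter R<1 (sym e))))
          visR₁ : visits g₁ pR ≡ suc (visits g pR)
          visR₁ = trans (there≡ w pR (shorter R<1)) visR
          room : ∀ p → visits g₁ p ≡ visits g p → visits g p + suc d * suc len < evalPol t n → visits g₁ p + len < evalPol t n
          room p e lt = ≤-trans (s≤s (≤-trans (≤-reflexive (cong (_+ len) e)) (+-monoʳ-≤ (visits g p) (≤-trans (n≤1+n len) (m≤m+n (suc len) (d * suc len)))))) lt
          spent : ∀ a → a + suc len + d * suc len ≡ a + suc d * suc len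
          spent a = +-assoc a (suc len) (d * suc len)
          less : ∀ a → a + d * suc len ≤ a + suc d * suc len
          less a = +-monoʳ-≤ a (m≤n+m (d * suc len) (suc len))
          looped : ∀ g₂ {q} → At (q ++ 1 ∷ []) (loop 0) → env (q ++ 1 ∷ []) 0 ≡ just pR → Wins {φ₀ = φ₀} (at g₂ pR) → Wins {φ₀ = φ₀} (down (at g₂ q) 1)
          looped g₂ {q} e h w = forced (loop-target e h (at g₂ (q ++ 1 ∷ [])) refl) w
          first : ∀ g₂ → Rewritten (setSlot rk (rels g₁) slot₁ m) len p₂ q₂ g₁ g₂ → Wins {φ₀ = φ₀} (at g₂ q₂)
          first g₂ w₂ = aChoose (trans (node-and {φ₀ = φ₀} {g = at g₂ q₂} at₂′) (cong (λ s → choice (not s) (down (at g₂ q₂) 0 ∷ down (at g₂ q₂) 1 ∷ [])) (ver≡ w₂)))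
              (λ { _ (here refl) → from (decideF (equalF slot₂ slot₁) (at g₂ (q₂ ++ 0 ∷ [])) (at-child q₂ 0 at₂′ refl) (ver≡ w₂) (total′ w₂))
                      (holds-equal {rels g₂} {slot₂} {slot₁} {m} (ρ-of g₂) o₂ (R₂.old {slot₂} {m} (λ ()) R₁.new) R₂.new)
                 ; _ (there (here refl)) → looped g₂ (at-child q₂ 1 at₂′ refl) env₂
                      (complete d T₁ g₂ (m⊓n≤n T (2 ^ d)) gd (proj₁ (proj₂ mid)) (R₂.old {slot₀} {c} (λ ()) (R₁.old {slot₀} {c} (λ ()) h)) R₂.new (ver≡ w₂) (total′ w₂) o₂
                        (budget (≤-trans (s≤s (≤-reflexive (trans (cong (_+ d) (trans (there≡ w₂ pR (shorter R<2)) visR₁)) (sym (+-suc (visits g pR) d))))) (inR B))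
                                (≤-trans (s≤s (≤-reflexive (trans (cong (_+ d * suc len) (trans (there≡ w₂ p₁ (shorter 1<2)) vis₁)) (spent (visits g p₁))))) (in₁ B))
                                (≤-trans (s≤s (≤-reflexive (trans (cong (_+ d * suc len) (trans (here≡ w₂) (cong (_+ suc len) vis₂))) (spent (visits g p₂))))) (in₂ B))
                                (≤-trans (s≤s (≤-trans (≤-reflexive (cong (_+ d * suc len) (trans (there≡ w₂ p₃ (λ e → p₂≢p₃ (sym e))) vis₃))) (less (visits g p₃)))) (in₃ B)))) })
            where
            module R₂ = Rewrite {g₁} {g₂} {slot₁} w₂
            o₂ = R₂.order′ (R₁.order′ o)
          second : ∀ g₂ → Rewritten (setSlot rk (rels g₁) slot₀ m) len p₃ q₃ g₁ g₂ → Wins {φ₀ = φ₀} (at g₂ q₃)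
          second g₂ w₂ = aChoose (trans (node-and {φ₀ = φ₀} {g = at g₂ q₃} at₃′) (cong (λ s → choice (not s) (down (at g₂ q₃) 0 ∷ down (at g₂ q₃) 1 ∷ [])) (ver≡ w₂)))
              (λ { _ (here refl) → from (decideF (equalF slot₀ slot₂) (at g₂ (q₃ ++ 0 ∷ [])) (at-child q₃ 0 at₃′ refl) (ver≡ w₂) (total′ w₂))
                      (holds-equal {rels g₂} {slot₀} {slot₂} {m} (ρ-of g₂) o₂ R₂.new (R₂.old {slot₂} {m} (λ ()) R₁.new))
                 ; _ (there (here refl)) → looped g₂ (at-child q₃ 1 at₃′ refl) env₃
                      (complete d T₂ g₂ le₂ (good-after T₁ gd (proj₁ (proj₂ mid))) (proj₂ (proj₂ mid)) R₂.new (R₂.old {slot₁} {c′} (λ ()) (R₁.old {slot₁} {c′} (λ ()) h′)) (ver≡ w₂) (total′ w₂) o₂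
                        (budget (≤-trans (s≤s (≤-reflexive (trans (cong (_+ d) (trans (there≡ w₂ pR (shorter R<3)) visR₁)) (sym (+-suc (visits g pR) d))))) (inR B))
                                (≤-trans (s≤s (≤-reflexive (trans (cong (_+ d * suc len) (trans (there≡ w₂ p₁ (shorter 1<3)) vis₁)) (spent (visits g p₁))))) (in₁ B))
                                (≤-trans (s≤s (≤-trans (≤-reflexive (cong (_+ d * suc len) (trans (there≡ w₂ p₂ p₂≢p₃) vis₂))) (less (visits g p₂)))) (in₂ B))
                                (≤-trans (s≤s (≤-reflexive (trans (cong (_+ d * suc len) (trans (here≡ w₂) (cong (_+ suc len) vis₃))) (spent (visits g p₃))))) (in₃ B)))) })
            where
            module R₂ = Rewrite {g₁} {g₂} {slot₀} w₂
            o₂ = R₂.order′ (R₁.order′ o)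

-- Closing the formula

filterB-∈ : ∀ {A : Set} (p : A → Bool) xs {x} → x ∈ filterB p xs → x ∈ xs × p x ≡ true
filterB-∈ p (y ∷ ys) m with p y in e
filterB-∈ p (y ∷ ys) (here refl) | true = here refl , e
filterB-∈ p (y ∷ ys) (there m) | true = there (proj₁ (filterB-∈ p ys m)) , proj₂ (filterB-∈ p ys m)
filterB-∈ p (y ∷ ys) m | false = there (proj₁ (filterB-∈ p ys m)) , proj₂ (filterB-∈ p ys m)

free-fits : ∀ {τ V} (φ : Formula τ) → Fits V φ → ∀ {v} → v ∈ freeVars φ → v < V
free-fits (atom R xs) (_ , h) m = All.lookup h m
free-fits (eq x y) (p , q) (here refl) = p
free-fits (eq x y) (p , q) (there (here refl)) = q
free-fits (neg φ) h m = free-fits φ h m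
free-fits (and φ ψ) (p , q) m with ∈-++⁻ (freeVars φ) m
... | inj₁ m′ = free-fits φ p m′
... | inj₂ m′ = free-fits ψ q m′
free-fits (or φ ψ) (p , q) m with ∈-++⁻ (freeVars φ) m
... | inj₁ m′ = free-fits φ p m′
... | inj₂ m′ = free-fits ψ q m′
free-fits (ex x φ) (p , q) m = free-fits φ q (proj₁ (filterB-∈ _ (freeVars φ) m))
free-fits (all x φ) (p , q) m = free-fits φ q (proj₁ (filterB-∈ _ (freeVars φ) m))
free-fits (ins R xs φ) (p , q) m = free-fits φ q (proj₁ (filterB-∈ _ (freeVars φ) m))
free-fits (del R xs φ) (p , q) m = free-fits φ q (proj₁ (filterB-∈ _ (freeVars φ) m))
free-fits (lab C t φ) h m = free-fits φ h m

-- Quantifying all variables at the outset serves twice: the formula becomes a sentence, and every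
-- variable is assigned before the first atom is reached.
exs : ∀ {τ} → ℕ → Var → Formula τ → Formula τ
exs zero x ψ = ψ
exs (suc k) x ψ = ex x (exs k (suc x) ψ)

exs-free : ∀ {τ} k x (ψ : Formula τ) → (∀ {v} → v ∈ freeVars ψ → v < x + k) → ∀ {v} → v ∈ freeVars (exs k x ψ) → v < x
exs-free zero x ψ h m = subst (_ <_) (+-identityʳ x) (h m)
exs-free (suc k) x ψ h {v} m with filterB-∈ _ (freeVars (exs k (suc x) ψ)) m
... | m′ , ne = ≤∧≢⇒< (≤-pred (exs-free k (suc x) ψ (λ {u} m → subst (u <_) (+-suc x k) (h m)) m′)) (λ { refl → contradiction (trans (sym ne) (cong not (≡ᵇ-refl v))) (λ ()) })

exs-sentence : ∀ {τ V} (ψ : Formula τ) → Fits V ψ → Sentence (exs V 0 ψ)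
exs-sentence {V = V} ψ f = empty (freeVars (exs V 0 ψ)) (λ m → exs-free V 0 ψ (free-fits ψ f) m)
  where empty : ∀ xs → (∀ {v} → v ∈ xs → v < 0) → xs ≡ []
        empty [] h = refl
        empty (x ∷ xs) h with h (here refl)
        ... | ()

exs-fits : ∀ {τ V} k x (ψ : Formula τ) → x + k ≤ V → Fits V ψ → Fits V (exs k x ψ)
exs-fits zero x ψ le f = f
exs-fits (suc k) x ψ le f = ≤-trans (≤-trans (s≤s (m≤m+n x k)) (≤-reflexive (sym (+-suc x k)))) le , exs-fits k (suc x) ψ (≤-trans (≤-reflexive (sym (+-suc x k))) le) f

-- The position behind a block of `k` quantifiers.
prefixPos : List ℕ → ℕ → List ℕ
prefixPos q zero = q
prefixPos q (suc k) = prefixPos (q ++ 0 ∷ []) k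

module Prefix {τ : Voc} {φ₀ : Formula τ} {n₁ V : ℕ} (fits : Fits V φ₀) where
  open Evaluate {τ} {φ₀} {suc n₁} {V} fits
  open Heights φ₀ (suc n₁)
  open Editing {τ} {φ₀} {suc n₁} {V} fits

  TotBelow : ℕ → (Var → Maybe (Fin (suc n₁))) → Set
  TotBelow x f = ∀ v → v < x → ∃ λ a → f v ≡ just a

  below-assign : ∀ {x f} a → TotBelow x f → TotBelow (suc x) (assign f x a)
  below-assign {x} a h v lt with v ≡ᵇ x in e
  ... | true = a , refl
  ... | false = h v (≤∧≢⇒< (≤-pred lt) (≡ᵇ-false⇒≢ e))

  at-prefix : ∀ k x q {ψ} → At q (exs k x ψ) → At (prefixPos q k) ψ
  at-prefix zero x q e = e
  at-prefix (suc k) x q e = at-prefix k (suc x) (q ++ 0 ∷ []) (at-child q 0 e refl)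

  prefix-sound : ∀ k x {h} g {ψ} → At (pos g) (exs k x ψ) → eloiseVer g ≡ true → TotBelow x (asg g) → W h g →
    ∃ λ l → ∃ λ g′ → W l (at g′ (prefixPos (pos g) k)) × eloiseVer g′ ≡ true × TotBelow (x + k) (asg g′) × rels g′ ≡ rels g
  prefix-sound zero x g e v tot w = _ , g , w , v , (λ u lt → tot u (≤-trans lt (≤-reflexive (+-identityʳ x)))) , refl
  prefix-sound (suc k) x g e v tot w with w-chosen (trans (node-ex {φ₀ = φ₀} {g = g} e) (cong (λ s → choice s (map (afterVar {φ₀ = φ₀} {g = g} x) (allFin (suc n₁)))) v)) w
  ... | l , _ , refl , m , w′ with ∈-map⁻ (afterVar {φ₀ = φ₀} {g = g} x) m
  ...   | a , _ , refl with prefix-sound k (suc x) (afterVar {φ₀ = φ₀} {g = g} x a) (at-child (pos g) 0 e refl) v (below-assign {x} {asg g} a tot) w′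
  ...     | l′ , g′ , w″ , v′ , tot′ , r′ = l′ , g′ , w″ , v′ , (λ u lt → tot′ u (≤-trans lt (≤-reflexive (+-suc x k)))) , r′

  prefix-complete : ∀ k x g {ψ} → At (pos g) (exs k x ψ) → eloiseVer g ≡ true → TotBelow x (asg g) →
    (∀ g′ → eloiseVer g′ ≡ true → TotBelow (x + k) (asg g′) → rels g′ ≡ rels g → visits g′ ≡ visits g → Wins {φ₀ = φ₀} (at g′ (prefixPos (pos g) k))) → Wins {φ₀ = φ₀} g
  prefix-complete zero x g e v tot h = h g v (λ u lt → tot u (≤-trans lt (≤-reflexive (+-identityʳ x)))) refl refl
  prefix-complete (suc k) x g e v tot h = eChoose (trans (node-ex {φ₀ = φ₀} {g = g} e) (cong (λ s → choice s (map (afterVar {φ₀ = φ₀} {g = g} x) (allFin (suc n₁)))) v))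
    (∈-map⁺ (afterVar {φ₀ = φ₀} {g = g} x) (∈-allFin fz))
    (prefix-complete k (suc x) (afterVar {φ₀ = φ₀} {g = g} x fz) (at-child (pos g) 0 e refl) v (below-assign {x} {asg g} fz tot)
      (λ g′ v′ tot′ r′ vs′ → h g′ v′ (λ u lt → tot′ u (≤-trans lt (≤-reflexive (+-suc x k)))) r′ vs′))

-- Encodings, work space and the initial formula.

-- Relations read from the same bits agree pointwise, so the identity is an isomorphism; this is the
-- form in which closure of the class can use it.
enc-injective : ∀ {τ} (A B : Struct τ) → enc A ≡ enc B → Iso A B
enc-injective {τ} record { size = m ; nonempty = _ ; rel = ra } record { size = m′ ; nonempty = _ ; rel = rb } e
  with replicate-split m m′ (inj₂ (_ , refl)) e
... | refl , e′ = record { bij = mk↔ₛ′ id id (λ _ → refl) (λ _ → refl) ; preserves = λ i v → trans (same i v) (cong (rb i) (sym (VP.map-id v))) }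
  where
  at : ∀ (r : ∀ i → Vec (Fin m) (lookupL τ i) → Bool) i v →
       nth (concatMap (λ i → map (r i) (allVecs m (lookupL τ i))) (allFin (length τ))) (offset (λ i → m ^ lookupL τ i) i + idx v) ≡ just (r i v)
  at r i v = trans (cong (λ o → nth (concatMap (λ i → map (r i) (allVecs m (lookupL τ i))) (allFin (length τ))) (o + idx v)) (offset-cong (λ i → sym (len i)) i))
      (trans (nth-concatMap (λ i → map (r i) (allVecs m (lookupL τ i))) id i (idx v) (subst (idx v <_) (sym (len i)) (idx< v)))
        (nth-map (r i) (allVecs m (lookupL τ i)) (idx v) (nth-allVecs m (lookupL τ i) v)))
    where len : ∀ i → length (map (r i) (allVecs m (lookupL τ i))) ≡ m ^ lookupL τ i
          len i = trans (LP.length-map (r i) (allVecs m (lookupL τ i))) (length-allVecs m (lookupL τ i))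
  same : ∀ i v → ra i v ≡ rb i v
  same i v = just-injective (trans (sym (at ra i v)) (trans (cong (λ l → nth l (offset (λ i → m ^ lookupL τ i) i + idx v)) (sym (LP.∷-injectiveʳ e′))) (at rb i v)))

pevalAt : ∀ t {f} → IsPoly f → IsPoly (λ n → evalPol t (f n))
pevalAt [] p = pcon 0
pevalAt (c ∷ cs) p = pcon c p+ (p p* pevalAt cs p)

-- Yields the number `C` and the tuple length `k` of the work blocks. The domain is nonempty, so
-- powers grow with the exponent and the two exponents may be added.
monomial : ∀ e → ∃ λ C → ∃ λ k → ∀ n → 0 < n → ⟪ e ⟫ n ≤ C * n ^ k
monomial var = 1 , 1 , λ n _ → ≤-reflexive (sym (trans (+-identityʳ _) (*-identityʳ n)))
monomial (con c) = c , 0 , λ n _ → ≤-reflexive (sym (*-identityʳ c))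
monomial (e ⊕ f) with monomial e | monomial f
... | C , k , p | D , l , q = C + D , k + l , bound
  where
  bound : ∀ n → 0 < n → ⟪ e ⟫ n + ⟪ f ⟫ n ≤ (C + D) * n ^ (k + l)
  bound (suc n) pos = ≤-trans (+-mono-≤ (≤-trans (p (suc n) pos) (*-monoʳ-≤ C (^-monoʳ-≤ (suc n) (m≤m+n k l))))
                                        (≤-trans (q (suc n) pos) (*-monoʳ-≤ D (^-monoʳ-≤ (suc n) (m≤n+m l k)))))
    (≤-reflexive (sym (*-distribʳ-+ (suc n ^ (k + l)) C D)))
monomial (e ⊗ f) with monomial e | monomial f
... | C , k , p | D , l , q = C * D , k + l , λ n pos → ≤-trans (*-mono-≤ (p n pos) (q n pos))
    (≤-reflexive (trans (lemma C (n ^ k) D (n ^ l)) (cong (C * D *_) (sym (^-distribˡ-+-* n k l)))))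
  where lemma : ∀ a b c d → a * b * (c * d) ≡ a * c * (b * d)
        lemma = solve-∀

lt-⇔ : ∀ m n → (m <ᵇ n) ≡ true ⇔ (m < n)
lt-⇔ m n = mk⇔ (λ e → <ᵇ⇒< m n (subst T (sym e) _)) <ᵇ-true

module StartMeaning (τ : Voc) (M : TM) (k C : ℕ) where
  open Start τ M k C
  open Simulation τ M k allKinds

  module _ {n₁ : ℕ} (r : Rels τ (suc n₁)) (rk : Fin (suc n₁) → Fin (suc n₁))
    (rk-inj : ∀ {a b} → rk a ≡ rk b → a ≡ b)
    (order : ∀ a b → r LT (a ∷ b ∷ []) ≡ true ⇔ (toℕ (rk a) < toℕ (rk b)))
    (rl′ : ∀ i → Vec (Fin (suc n₁)) (lookupL τ i) → Bool)
    (input : ∀ i (v : Vec (Fin (suc n₁)) (lookupL τ i)) → r (inj₁ i) (toList v) ≡ rl′ i (Vec.map rk v)) where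
    open Meaning {n₁} r rk rk-inj order
    open Semantics {τ} {suc n₁} r
    open Connectives {τ} {suc n₁} r
    open Equivalence using (to; from)

    sem-content : ∀ kd (xs : Vec Var (karity kd)) s ρ → ⟦ contentF kd xs s ⟧ ρ ⇔ (content rl′ kd (Vec.map rk (val ρ xs)) ≡ s)
    sem-content un xs s ρ = sem-testF _ s ρ
    sem-content sep xs s ρ = sem-testF _ s ρ
    sem-content wk xs s ρ = sem-testF fz s ρ
    sem-content (rl i) xs s ρ = mk⇔ fwd bwd
      where
      b = rl′ i (Vec.map rk (val ρ xs))
      fwd : ⟦ contentF (rl i) xs s ⟧ ρ → bitSym b ≡ s
      fwd (inj₁ (a , e)) = trans (cong bitSym (trans (sym (input i (val ρ xs))) a)) (to (sem-testF (bitSym true) s ρ) e)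
      fwd (inj₂ (na , e)) = trans (cong bitSym (notTrue b (λ q → na (trans (input i (val ρ xs)) q)))) (to (sem-testF (bitSym false) s ρ) e)
        where notTrue : ∀ b → b ≢ true → b ≡ false
              notTrue true ne = contradiction refl ne
              notTrue false ne = refl
      bwd : bitSym b ≡ s → ⟦ contentF (rl i) xs s ⟧ ρ
      bwd e = byCase b refl
        where
        byCase : ∀ c → b ≡ c → ⟦ contentF (rl i) xs s ⟧ ρ
        byCase true q = inj₁ (trans (input i (val ρ xs)) q , from (sem-testF (bitSym true) s ρ) (trans (cong bitSym (sym q)) e))
        byCase false q = inj₂ ((λ a → contradiction (trans (sym a) (trans (input i (val ρ xs)) q)) (λ ())) , from (sem-testF (bitSym false) s ρ) (trans (cong bitSym (sym q)) e))

    c₀ : Config M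
    c₀ = initConfig M (word rl′)

    sem-start : ∀ b t f ρ → ⟦ startF f b ⟧ (upds ρ 0 t) ⇔ Truth c₀ f (cell b t)
    sem-start b t f ρ with splitAt (3 + TM.extra M) f
    ... | inj₁ s = ⇔-trans (sem-content (kind b) (X b) s (upds ρ 0 t))
          (subst (λ u → (content rl′ (kind b) (Vec.map rk u) ≡ s) ⇔ (tape c₀ (cell b t) ≡ s)) (sym (upds-new ρ 0 t))
            (mk⇔ (trans (tape-content rl′ b (Vec.map rk t))) (trans (sym (tape-content rl′ b (Vec.map rk t))))))
    ... | inj₂ q = mk⇔
          (λ { (p , o) → sym (trans (cong (cell b) (sym (upds-new ρ 0 t))) (to (sem-first b (X b) (upds ρ 0 t)) o)) , to (sem-testF (TM.start M) q (upds ρ 0 t)) p })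
          (λ { (o , p) → from (sem-testF (TM.start M) q (upds ρ 0 t)) p , from (sem-first b (X b) (upds ρ 0 t)) (trans (cong (cell b) (upds-new ρ 0 t)) (sym o)) })

    -- The cells follow the ranks, so the word on the tape is the encoding of the structure
    -- relabelled along `rk`, not that of the structure itself.
    sem-init : ∀ ρ → ⟦ initF ⟧ ρ ⇔ Holds fz c₀
    sem-init ρ = defines-holds fz startF ρ c₀ (λ b t f → sem-start b t f ρ)

-- Guessing the order and the end configurations

join-agreements : ∀ {A B : Set} {E E′ : List A} {x} {a b c : B} → a ≡ b ⊎ x ∈ E → b ≡ c ⊎ x ∈ E′ → a ≡ c ⊎ x ∈ E ++ E′
join-agreements (inj₁ p) (inj₁ q) = inj₁ (trans p q)
join-agreements (inj₂ m) _ = inj₂ (∈-++⁺ˡ m)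
join-agreements {E = E} (inj₁ _) (inj₂ m) = inj₂ (∈-++⁺ʳ E m)

module Clock (τ : Voc) (M : TM) (k : ℕ) (kinds : List (Kind τ)) where
  open Simulation τ M k kinds using (F; ar)
  open Runs M using (Q; G)

  -- All labels share one polynomial, hence a sum that dominates each need: `depthAt` visits to the
  -- round, one visit per tuple of a slot and one more for each halving, and at the start the edits
  -- of the order and of two slots. `depthAt` is the exponent from `configs≤` with `Cells n` as
  -- space; the leading `suc` makes the bounds strict.
  Cells depthAt clockAt : ℕ → ℕ
  Cells n = total (λ b → n ^ ar b)
  depthAt n = Q + (Cells n + G * Cells n)
  clockAt n = suc (depthAt n + depthAt n * suc (F * Cells n) + (n ^ 2 + (F * Cells n + F * Cells n)))

module Capture (τ : Voc) (M : TM) (k : ℕ) (kinds : List (Kind τ)) (t : Pol)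
  (start : ∀ {n : ℕ} → (∀ i → Vec (Fin n) (lookupL τ i) → Bool) → Config M)
  (sem-init : ∀ {n₁ : ℕ} (r : Rels τ (suc n₁)) (rk : Fin (suc n₁) → Fin (suc n₁)) (rk-inj : ∀ {a b} → rk a ≡ rk b → a ≡ b)
    (order : ∀ a b → r (Simulation.LT τ M k kinds) (a ∷ b ∷ []) ≡ true ⇔ (toℕ (rk a) < toℕ (rk b)))
    (inp : ∀ i → Vec (Fin (suc n₁)) (lookupL τ i) → Bool)
    (input : ∀ i (v : Vec (Fin (suc n₁)) (lookupL τ i)) → r (inj₁ i) (toList v) ≡ inp i (Vec.map rk v)) (ρ : Var → Fin (suc n₁)) →
    Semantics.⟦_⟧ {τ} r (Simulation.initF τ M k kinds) ρ ⇔ Simulation.Meaning.Holds τ M k kinds r rk rk-inj order fz (start inp)) where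
  open Savitch τ M k kinds
  open Simulation τ M k kinds
  open SlotTargets τ M k kinds
  open Clock τ M k kinds
  open Equivalence using (to; from)

  -- Eloise writes down a linear order, the initial configuration and an accepting one.
  guessed : List (RelSym τ)
  guessed = LT ∷ slotSyms slot₀ ++ slotSyms slot₁

  checkF : FO τ
  checkF = andF linearF (andF initF acceptF)

  main : Formula τ
  main = edits t guessed (and (formula checkF) (round t))

  -- With the order of the indices the ranks are the identity, and the word on the tape is the
  -- encoding of the structure as given.
  setLT : ∀ {n} → Rels τ n → Rels τ n
  setLT r (inj₂ (0 , 2)) (a ∷ b ∷ []) = toℕ a <ᵇ toℕ b
  setLT r R u = r R u

  orderEdit : ∀ {n} → Vec (Fin n) 2 → Σ (RelSym τ) λ R → Vec (Fin n) (arity τ R)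
  orderEdit u = LT , u

  guesses : ∀ n → List (Σ (RelSym τ) λ R → Vec (Fin n) (arity τ R))
  guesses n = map orderEdit (allVecs n 2) ++ (slotEdits n slot₀ ++ slotEdits n slot₁)

  setLT-agrees : ∀ {n} (r : Rels τ n) R (u : Vec (Fin n) (arity τ R)) → r R (toList u) ≡ setLT r R (toList u) ⊎ (R , u) ∈ map orderEdit (allVecs n 2)
  setLT-agrees r (inj₁ i) u = inj₁ refl
  setLT-agrees r (inj₂ (suc a , k)) u = inj₁ refl
  setLT-agrees r (inj₂ (0 , 0)) u = inj₁ refl
  setLT-agrees r (inj₂ (0 , 1)) u = inj₁ refl
  setLT-agrees r (inj₂ (0 , 2)) u = inj₂ (∈-map⁺ orderEdit (∈-allVecs u))
  setLT-agrees r (inj₂ (0 , suc (suc (suc k)))) u = inj₁ (other u)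
    where other : ∀ u → r (inj₂ (0 , suc (suc (suc k)))) (toList u) ≡ setLT r (inj₂ (0 , suc (suc (suc k)))) (toList u)
          other (_ ∷ _ ∷ _ ∷ _) = refl

  guesses-∈ : ∀ n R u → (R , u) ∈ guesses n → R ∈ guessed
  guesses-∈ n R u m with ∈-++⁻ (map orderEdit (allVecs n 2)) m
  ... | inj₁ m₁ with ∈-map⁻ orderEdit m₁
  ...   | _ , _ , refl = here refl
  guesses-∈ n R u m | inj₂ m₂ with ∈-++⁻ (slotEdits n slot₀) m₂
  ... | inj₁ m₃ = there (∈-++⁺ˡ (slotEdits-∈ n slot₀ R u m₃))
  ... | inj₂ m₃ = there (∈-++⁺ʳ (slotSyms slot₀) (slotEdits-∈ n slot₁ R u m₃))

  length-guesses : ∀ n → length (guesses n) ≡ n ^ 2 + (F * Cells n + F * Cells n)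
  length-guesses n = trans (lengths (map orderEdit (allVecs n 2)) (slotEdits n slot₀) (slotEdits n slot₁))
    (cong₂ _+_ (trans (LP.length-map orderEdit (allVecs n 2)) (length-allVecs n 2)) (cong₂ _+_ (length-slotEdits n slot₀) (length-slotEdits n slot₁)))
    where lengths : ∀ {A : Set} (xs ys zs : List A) → length (xs ++ (ys ++ zs)) ≡ length xs + (length ys + length zs)
          lengths xs ys zs = trans (LP.length-++ xs) (cong (length xs +_) (LP.length-++ ys))

  input∉guessed : ∀ {i} S → S ∈ guessed → inj₁ i ≢ S
  input∉guessed S (there m) refl with ∈-++⁻ (slotSyms slot₀) m
  ... | inj₁ m₀ with slotSyms-∈ slot₀ S m₀
  ...   | _ , _ , ()
  input∉guessed S (there m) refl | inj₂ m₁ with slotSyms-∈ slot₁ S m₁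
  ...   | _ , _ , ()

  module Game {V : ℕ} (fits-main : Fits V main) (n₁ : ℕ) where

    φ₀ : Formula τ
    φ₀ = exs V 0 main

    n : ℕ
    n = suc n₁

    fits : Fits V φ₀
    fits = exs-fits V 0 main ≤-refl fits-main

    open Evaluate {τ} {φ₀} {n} {V} fits
    open Heights φ₀ n
    open Editing {τ} {φ₀} {n} {V} fits
    open Prefix {τ} {φ₀} {n₁} {V} fits

    pE q₀ pC pR : List ℕ
    pE = prefixPos [] V
    q₀ = exitPos (pE ++ 0 ∷ []) (length guessed)
    pC = q₀ ++ 0 ∷ []
    pR = q₀ ++ 1 ∷ []

    atE : At pE main
    atE = at-prefix V 0 [] refl

    at₀ : At q₀ (and (formula checkF) (round t))
    at₀ = at-exit guessed (pE ++ 0 ∷ []) (at-child pE 0 atE refl)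

    atC : At pC (formula checkF)
    atC = at-child q₀ 0 at₀ refl

    atR : At pR (round t)
    atR = at-child q₀ 1 at₀ refl

    initial : Rels τ n → GState τ n
    initial r = record { rels = r ; asg = λ _ → nothing ; pos = [] ; visits = λ _ → 0 ; eloiseVer = true }

    Input : Set
    Input = ∀ i → Vec (Fin n) (lookupL τ i) → Bool

    Bounded : Input → Set
    Bounded inp = ∀ u c → exec M u (start inp) ≡ running c → head c < Cells n

    ρ-of : GState τ n → Var → Fin n
    ρ-of g v = maybe id fz (asg g v)

    decideCheck : ∀ g → pos g ≡ pC → eloiseVer g ≡ true → Tot (asg g) → Wins {φ₀ = φ₀} g ⇔ Semantics.⟦_⟧ {τ} (rels g) checkF (ρ-of g)
    -- The identity is a dummy ranking: evaluating a first-order formula in the game does not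
    -- involve the order.
    decideCheck g refl v tot = Rounds.decideF {φ₀} {n₁} {V} fits t pR atR id id checkF g atC v tot

    conjuncts : ∀ g → eloiseVer g ≡ true → node φ₀ n (at g q₀) ≡ choice false (at g pC ∷ at g pR ∷ [])
    conjuncts g v = trans (node-and {φ₀ = φ₀} {g = at g q₀} at₀) (cong (λ s → choice (not s) (at g pC ∷ at g pR ∷ [])) v)

    -- The order found in `LT` decides which relabelling has been accepted; `σ` inverts its ranking.
    -- That relabelling is not known in advance, which is why boundedness is assumed for every
    -- input.
    accepted-from : ∀ {l} g → eloiseVer g ≡ true → Tot (asg g) → Semantics.⟦_⟧ {τ} (rels g) linearF (ρ-of g) → Semantics.⟦_⟧ {τ} (rels g) initF (ρ-of g) →
      Semantics.⟦_⟧ {τ} (rels g) acceptF (ρ-of g) → W l (at g pR) → ∀ (inp : Input) → (∀ i v → rels g (inj₁ i) (toList v) ≡ inp i v) → (∀ rl′ → Bounded rl′) →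
      ∃ λ (σ : Fin n ↔ Fin n) → ∃ λ u → exec M u (start (λ i v → inp i (Vec.map (Inverse.to σ) v))) ≡ done true
    accepted-from {l} g v tot lin ini acc w inp input bounded = σ , finish (sound l g ≤-refl v tot rk-< w c₀ (bounded rl′) holds₀)
      where
      r : Rels τ n
      r = rels g
      precedes : Fin n → Fin n → Bool
      precedes a b = r LT (a ∷ b ∷ [])
      false-of : ∀ {b} → b ≢ true → b ≡ false
      false-of {true} ne = contradiction refl ne
      false-of {false} ne = refl
      resolve : ∀ {A B : Set} → ¬ A ⊎ B → A → B
      resolve (inj₁ na) a = contradiction a na
      resolve (inj₂ b) _ = b
      open Ranking precedes (λ a → false-of (proj₁ lin a)) (λ a b c p q → resolve (proj₁ (proj₂ lin) a b c) (p , q)) (proj₂ (proj₂ lin))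
      rk⁻¹ : Fin n → Fin n
      rk⁻¹ i = proj₁ (injective⇒surjective rk rk-injective i)
      rk-rk⁻¹ : ∀ i → rk (rk⁻¹ i) ≡ i
      rk-rk⁻¹ i = proj₂ (injective⇒surjective rk rk-injective i)
      rk⁻¹-rk : ∀ a → rk⁻¹ (rk a) ≡ a
      rk⁻¹-rk a = rk-injective (rk-rk⁻¹ (rk a))
      σ : Fin n ↔ Fin n
      σ = mk↔ₛ′ rk⁻¹ rk rk⁻¹-rk rk-rk⁻¹
      rl′ : Input
      rl′ i v = inp i (Vec.map rk⁻¹ v)
      c₀ : Config M
      c₀ = start rl′
      undo : ∀ {m} (v : Vec (Fin n) m) → Vec.map rk⁻¹ (Vec.map rk v) ≡ v
      undo v = trans (sym (VP.map-∘ rk⁻¹ rk v)) (trans (VP.map-cong rk⁻¹-rk v) (VP.map-id v))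
      open Rounds {φ₀} {n₁} {V} fits t pR atR rk rk-injective using (sound; retype; Holds; module Mean)
      holds₀ : Holds r slot₀ c₀
      holds₀ = from (retype {r} {rk-<} {slot₀} {c₀})
        (to (sem-init r rk rk-injective rk-< rl′ (λ i v → trans (input i v) (cong (inp i) (sym (undo v)))) (ρ-of g)) ini)
      finish : (∃ λ c′ → (∃ λ u → exec M u c₀ ≡ running c′) × Holds r slot₁ c′) → ∃ λ u → exec M u c₀ ≡ done true
      finish (c′ , (u , run) , h) = u + 1 , Runs.halts-after M u 0 run
        (to (Mean.sem-accept r rk-< (ρ-of g) (to (retype {r} {rk-<} {slot₁} {c′}) h) (bounded rl′ u c′ run)) acc)

    accepted-at : ∀ {k} g → eloiseVer g ≡ true → Tot (asg g) → W k (at g q₀) → ∀ (inp : Input) → (∀ i v → rels g (inj₁ i) (toList v) ≡ inp i v) → (∀ rl′ → Bounded rl′) →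
      ∃ λ (σ : Fin n ↔ Fin n) → ∃ λ u → exec M u (start (λ i v → inp i (Vec.map (Inverse.to σ) v))) ≡ done true
    accepted-at g v tot w inp input bounded with w-faced (conjuncts g v) w
    ... | l , _ , both = accepted-from g v tot (proj₁ sem) (proj₁ (proj₂ sem)) (proj₂ (proj₂ sem)) (both (at g pR) (there (here refl))) inp input bounded
      where sem = to (decideCheck (at g pC) refl v tot) (w-wins (both (at g pC) (here refl)))

    accepted : ∀ r (inp : Input) → (∀ i v → r (inj₁ i) (toList v) ≡ inp i v) → (∀ rl′ → Bounded rl′) → Wins {φ₀ = φ₀} (initial r) →
      ∃ λ (σ : Fin n ↔ Fin n) → ∃ λ u → exec M u (start (λ i v → inp i (Vec.map (Inverse.to σ) v))) ≡ done true
    accepted r inp input bounded w with height w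
    ... | h , w₀ with prefix-sound V 0 (initial r) refl refl (λ _ ()) w₀
    ...   | l , g₁ , w₁ , v₁ , tot₁ , refl with edit-sound l {Rs = guessed} (at g₁ pE) ≤-refl atE v₁ tot₁ w₁
    ...     | left-at g₂ _ w₂ refl v₂ tot₂ kept = accepted-at g₂ v₂ tot₂ w₂ inp
                (λ i v → trans (kept (inj₁ i) (λ S m → input∉guessed S m) (toList v)) (input i v)) bounded

    id-injective : ∀ {a b : Fin n} → id a ≡ id b → a ≡ b
    id-injective e = e

    open Rounds {φ₀} {n₁} {V} fits t pR atR id id-injective using (Order; Holds; module Mean; retype; LT≢sy; sy-apart; len; p₁; p₂; p₃; longer; length-exitPos; shorter; R<1; R<2; R<3; unshift; Budget; budget; complete)

    module _ (clock : evalPol t n ≡ clockAt n) (inp : Input) (bounded : Bounded inp) {T : ℕ} {c′ : Config M}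
      (T≤ : T ≤ 2 ^ depthAt n) (run : exec M T (start inp) ≡ running c′) (acc : step M c′ ≡ done true) where

      target : Rels τ n → Rels τ n
      target r = setSlot id (setSlot id (setLT r) slot₀ (start inp)) slot₁ c′

      -- The three rewritings touch separate relations, so the tuples that change are among the
      -- three lists of edits put together.
      agrees : ∀ r R (u : Vec (Fin n) (arity τ R)) → r R (toList u) ≡ target r R (toList u) ⊎ (R , u) ∈ guesses n
      agrees r R u = join-agreements (setLT-agrees r R u) (join-agreements {E = slotEdits n slot₀}
        (setSlot-agrees id (setLT r) slot₀ (start inp) R u) (setSlot-agrees id (setSlot id (setLT r) slot₀ (start inp)) slot₁ c′ R u))

      target-order : ∀ r → Order (target r)
      target-order r a b = subst (λ v → v ≡ true ⇔ (toℕ a < toℕ b))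
        (sym (trans (setSlot-other id (setSlot id (setLT r) slot₀ (start inp)) slot₁ c′ LT (a ∷ b ∷ []) (λ f b → LT≢sy slot₁ f b))
                    (setSlot-other id (setLT r) slot₀ (start inp) LT (a ∷ b ∷ []) (λ f b → LT≢sy slot₀ f b)))) (lt-⇔ (toℕ a) (toℕ b))

      target-input : ∀ r i u → target r (inj₁ i) u ≡ r (inj₁ i) u
      target-input r i u = trans (setSlot-other id (setSlot id (setLT r) slot₀ (start inp)) slot₁ c′ (inj₁ i) u (λ _ _ ()))
                                 (setSlot-other id (setLT r) slot₀ (start inp) (inj₁ i) u (λ _ _ ()))

      target-first : ∀ r → HoldsAt id (target r) slot₀ (start inp)
      target-first r = setSlot-keeps id (setSlot id (setLT r) slot₀ (start inp)) {slot₀} {slot₁} (start inp) c′ (λ ()) (setSlot-holds id (setLT r) slot₀ (start inp))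

      linear : ∀ {r} ρ → Order r → Semantics.⟦_⟧ {τ} r linearF ρ
      linear {r} ρ o = (λ a e → <-irrefl refl (to (o a a) e)) , (λ a b c → transitive (r LT (a ∷ b ∷ []) Data.Bool.≟ true) (r LT (b ∷ c ∷ []) Data.Bool.≟ true)) , compare
        where
        import Data.Bool
        transitive : ∀ {a b c} → Dec (r LT (a ∷ b ∷ []) ≡ true) → Dec (r LT (b ∷ c ∷ []) ≡ true) →
          (¬ (r LT (a ∷ b ∷ []) ≡ true × r LT (b ∷ c ∷ []) ≡ true)) ⊎ r LT (a ∷ c ∷ []) ≡ true
        transitive {a} {b} {c} (yes p) (yes q) = inj₂ (from (o a c) (<-trans (to (o a b) p) (to (o b c) q)))
        transitive (no np) _ = inj₁ (λ z → np (proj₁ z))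
        transitive (yes _) (no nq) = inj₁ (λ z → nq (proj₂ z))
        compare : ∀ a b → a ≡ b ⊎ r LT (a ∷ b ∷ []) ≡ true ⊎ r LT (b ∷ a ∷ []) ≡ true
        compare a b with FP.<-cmp a b
        ... | tri< l _ _ = inj₂ (inj₁ (from (o a b) l))
        ... | tri≈ _ e _ = inj₁ e
        ... | tri> _ _ l = inj₂ (inj₂ (from (o b a) l))

      wins-checked : ∀ g → eloiseVer g ≡ true → Tot (asg g) → Order (rels g) → (∀ i v → rels g (inj₁ i) (toList v) ≡ inp i v) →
        Holds (rels g) slot₀ (start inp) → Holds (rels g) slot₁ c′ → Budget (depthAt n) g → Wins {φ₀ = φ₀} (at g q₀)
      wins-checked g v tot o input h h′ B = aChoose (conjuncts g v)
        (λ { _ (here refl) → from (decideCheck (at g pC) refl v tot)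
               ( linear {rels g} (ρ-of g) o
               , from (sem-init (rels g) id id-injective o inp (λ i v → trans (input i v) (cong (inp i) (sym (VP.map-id v)))) (ρ-of g))
                      (to (retype {rels g} {o} {slot₀} {start inp}) h)
               , from (Mean.sem-accept (rels g) o (ρ-of g) (to (retype {rels g} {o} {slot₁} {c′}) h′) (bounded T c′ run)) acc )
           ; _ (there (here refl)) → complete (depthAt n) T g T≤ bounded run h h′ v tot o B })

      roomy : ∀ {m} → m ≤ depthAt n + depthAt n * suc (F * Cells n) + (n ^ 2 + (F * Cells n + F * Cells n)) → m < evalPol t n
      roomy le = ≤-trans (s≤s le) (≤-reflexive (sym clock))

      -- The clocks of the round and of its three editing loops are still full when the round is
      -- first reached, as the guessing loop runs on a clock of its own.
      fresh : ∀ g → visits g pR ≡ 0 → visits g p₁ ≡ 0 → visits g p₂ ≡ 0 → visits g p₃ ≡ 0 → Budget (depthAt n) g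
      fresh g e₀ e₁ e₂ e₃ = budget
          (roomy (≤-trans (≤-reflexive (cong (_+ depthAt n) e₀)) (≤-trans (m≤m+n (depthAt n) _) (m≤m+n (depthAt n + depthAt n * suc (F * Cells n)) _))))
          (spend e₁) (spend e₂) (spend e₃)
        where
        spend : ∀ {a} → a ≡ 0 → a + depthAt n * suc len < evalPol t n
        spend e = roomy (≤-trans (≤-reflexive (cong₂ (λ a l → a + depthAt n * suc l) e (length-slotEdits n slot₂)))
          (≤-trans (m≤n+m (depthAt n * suc (F * Cells n)) (depthAt n)) (m≤m+n (depthAt n + depthAt n * suc (F * Cells n)) _)))

      E<R : length pE < length pR
      E<R = ≤-trans (longer pE 0) (≤-trans (length-exitPos (pE ++ 0 ∷ []) (length guessed)) (<⇒≤ (longer q₀ 1)))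

      wins-initial : ∀ r → (∀ i v → r (inj₁ i) (toList v) ≡ inp i v) → Wins {φ₀ = φ₀} (initial r)
      wins-initial r input = prefix-complete V 0 (initial r) refl refl (λ _ ()) onward
        where
        onward : ∀ g₁ → eloiseVer g₁ ≡ true → TotBelow V (asg g₁) → rels g₁ ≡ r → visits g₁ ≡ (λ _ → 0) → Wins {φ₀ = φ₀} (at g₁ pE)
        onward g₁ v₁ tot₁ refl vis₁ = rewrite-rels (target r) {t} {guessed} (guesses n) (at g₁ pE) atE v₁ tot₁ (guesses-∈ n)
          (roomy (≤-trans (≤-reflexive (cong₂ (λ f l → f pE + l) vis₁ (length-guesses n))) (m≤n+m _ (depthAt n + depthAt n * suc (F * Cells n)))))
          (agrees r) written
          where
          written : ∀ g₂ → Rewritten (target r) (length (guesses n)) pE q₀ (at g₁ pE) g₂ → Wins {φ₀ = φ₀} g₂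
          written g₂ w = unshift (pos≡ w) (wins-checked g₂ (ver≡ w) (total′ w)
              (order-kept′ (target-order r))
              (λ i v → trans (rels≡ w (inj₁ i) v) (trans (target-input r i (toList v)) (input i v)))
              (holds-cong id {target r} {rels g₂} {slot₀} {start inp} (λ f b u → rels≡ w (sy slot₀ f b) u) (target-first r))
              (holds-cong id {target r} {rels g₂} {slot₁} {c′} (λ f b u → rels≡ w (sy slot₁ f b) u)
                 (setSlot-holds id (setSlot id (setLT r) slot₀ (start inp)) slot₁ c′))
              (fresh g₂ (unvisited pR E<R) (unvisited p₁ (<-trans E<R R<1)) (unvisited p₂ (<-trans E<R R<2)) (unvisited p₃ (<-trans E<R R<3))))
            where
            order-kept′ : Order (target r) → Order (rels g₂)
            order-kept′ o a b = subst (λ v → v ≡ true ⇔ (toℕ a < toℕ b)) (sym (rels≡ w LT (a ∷ b ∷ []))) (o a b)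
            unvisited : ∀ p → length pE < length p → visits g₂ p ≡ 0
            unvisited p lt = trans (there≡ w p (λ e → shorter lt (sym e))) (cong (λ f → f p) vis₁)

-- The sentence of a decidable class.

wordLength : Voc → ℕ → ℕ
wordLength τ n = n + suc (total (λ i → n ^ lookupL τ i))

replicate-total : ∀ {A : Set} (f : A → ℕ) xs c x → c * f x ≤ total (λ b → f (lookupL (xs ++ replicate c x) b))
replicate-total f [] zero x = z≤n
replicate-total f [] (suc c) x = +-monoʳ-≤ (f x) (replicate-total f [] c x)
replicate-total f (y ∷ ys) c x = ≤-trans (replicate-total f ys c x) (m≤n+m _ (f y))

module Decided (τ : Voc) (K : Struct τ → Set) (iso : IsoClosed K) (M : TM) (p : Pol)
  (spec : ∀ (w : List Bool) → (∀ t c → exec M t (initConfig M w) ≡ running c → head c ≤ evalPol p (length w))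
    × Σ ℕ λ t → Σ Bool λ b → (exec M t (initConfig M w) ≡ done b) × (b ≡ true ⇔ Σ (Struct τ) λ A → K A × enc A ≡ w))
  (k C : ℕ) (room : ∀ n → 0 < n → evalPol p (wordLength τ n) < C * n ^ k) where
  open Start τ M k C
  open Runs M using (Q; G; done-unique; last-running; halting-time; configs≤)
  open Simulation τ M k allKinds using (karity; F; ar)
  open Clock τ M k allKinds
  open Equivalence using (to; from)

  start : ∀ {n : ℕ} → (∀ i → Vec (Fin n) (lookupL τ i) → Bool) → Config M
  start inp = initConfig M (word inp)

  cells-isPoly : IsPoly Cells
  cells-isPoly = ptotal (λ b n → n ^ ar b) (λ b → ppow (ar b))

  depth-isPoly : IsPoly depthAt
  depth-isPoly = pcon Q p+ (cells-isPoly p+ (pcon G p* cells-isPoly))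

  clock-isPoly : IsPoly clockAt
  clock-isPoly = pcon 1 p+ (depth-isPoly p+ depth-isPoly p* (pcon 1 p+ pcon F p* cells-isPoly) p+ (ppow 2 p+ (pcon F p* cells-isPoly p+ pcon F p* cells-isPoly)))

  t : Pol
  t = toPol (proj₁ clock-isPoly)

  clock : ∀ n → evalPol t n ≡ clockAt n
  clock n = trans (evalPol-toPol (proj₁ clock-isPoly) n) (sym (proj₂ clock-isPoly n))

  length-word : ∀ {n} (inp : ∀ i → Vec (Fin n) (lookupL τ i) → Bool) → length (word inp) ≡ wordLength τ n
  length-word {n} inp = trans (LP.length-++ (replicate n true)) (cong₂ (λ a b → a + suc b) (LP.length-replicate n)
    (trans (length-concatMap (λ i → map (inp i) (allVecs n (lookupL τ i))) id)
      (total-cong (λ i → trans (LP.length-map (inp i) (allVecs n (lookupL τ i))) (length-allVecs n (lookupL τ i))))))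

  -- The work blocks alone already have more cells than the machine uses; the length of the word
  -- depends only on `n`, so this holds for every input of that size.
  bounded : ∀ {n₁} (inp : ∀ i → Vec (Fin (suc n₁)) (lookupL τ i) → Bool) u c → exec M u (start inp) ≡ running c → head c < Cells (suc n₁)
  bounded {n₁} inp u c run = ≤-trans (s≤s (proj₁ (spec (word inp)) u c run))
    (≤-trans (≤-reflexive (cong (λ l → suc (evalPol p l)) (length-word inp)))
      (≤-trans (room (suc n₁) (s≤s z≤n)) (replicate-total (λ kd → suc n₁ ^ karity kd) (un ∷ sep ∷ map rl (allFin (length τ))) C wk)))

  -- An accepted word is the encoding of some member of the class, which `enc-injective` makes
  -- isomorphic to `A`. The verdict is unique because the machine is deterministic.
  accepts-⇔ : ∀ A → (∃ λ u → exec M u (initConfig M (enc A)) ≡ done true) ⇔ K A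
  accepts-⇔ A = byRun (proj₂ (spec (enc A)))
    where
    byRun : (Σ ℕ λ t → Σ Bool λ b → (exec M t (initConfig M (enc A)) ≡ done b) × (b ≡ true ⇔ Σ (Struct τ) λ B → K B × enc B ≡ enc A)) →
            (∃ λ u → exec M u (initConfig M (enc A)) ≡ done true) ⇔ K A
    byRun (u , b , run , iff) = mk⇔ fwd (λ ka → u , trans run (cong done (from iff (A , ka , refl))))
      where
      fwd : (∃ λ u → exec M u (initConfig M (enc A)) ≡ done true) → K A
      fwd (v , run′) with to iff (done-unique u v run run′)
      ... | B , kb , e = iso B A (enc-injective B A e) kb

  open Capture τ M k allKinds t start (StartMeaning.sem-init τ M k C) using (main; module Game)

  module _ {V : ℕ} (fits-main : Fits V main) where

    -- Left to right, a relabelling of `A` is accepted, and closure under isomorphism leads back to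
    -- `A`. Right to left, the accepting run has fewer steps than there are configurations, so
    -- `depthAt` halvings exhaust it.
    correct : ∀ (A : Struct τ) → (A ⊨ exs V 0 main) ⇔ K A
    correct A@(record { size = suc n₁ ; nonempty = pos ; rel = inp }) = mk⇔ fwd bwd
      where
      input : ∀ i v → initRels A (inj₁ i) (toList v) ≡ inp i v
      input i v = cong (maybe (inp i) false) (fromListN-toList v)
      relabelled : (σ : Fin (suc n₁) ↔ Fin (suc n₁)) → Struct τ
      relabelled σ = record { size = suc n₁ ; nonempty = pos ; rel = λ i v → inp i (Vec.map (Inverse.to σ) v) }
      fwd : A ⊨ exs V 0 main → K A
      fwd w with Game.accepted fits-main n₁ (initRels A) inp input bounded w
      ... | σ , u , run = iso (relabelled σ) A (record { bij = σ ; preserves = λ _ _ → refl }) (to (accepts-⇔ (relabelled σ)) (u , run))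
      bwd : K A → A ⊨ exs V 0 main
      bwd ka with from (accepts-⇔ A) ka
      ... | u , run with last-running u run
      ...   | T , c′ , run′ , acc = Game.wins-initial fits-main n₁ (clock (suc n₁)) inp (bounded inp)
                (<⇒≤ (≤-trans (halting-time (start inp) (Cells (suc n₁)) (bounded inp) T run′ acc) (configs≤ (start inp) (Cells (suc n₁)) (bounded inp)))) run′ acc (initRels A) input

  definition : Σ (Formula τ) λ φ → Sentence φ × (∀ (A : Struct τ) → (A ⊨ φ) ⇔ K A)
  definition = withBound (fits-exists main)
    where
    withBound : (∃ λ V → Fits V main) → Σ (Formula τ) λ φ → Sentence φ × (∀ (A : Struct τ) → (A ⊨ φ) ⇔ K A)
    withBound (V , fits-main) = exs V 0 main , exs-sentence main fits-main , correct fits-main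

definable : ∀ (τ : Voc) (K : Struct τ → Set) → IsoClosed K → PSpaceDecidable τ K →
  Σ (Formula τ) λ φ → Sentence φ × (∀ (A : Struct τ) → (A ⊨ φ) ⇔ K A)
definable τ K iso (M , p , spec) = definition
  where
  space : IsPoly (λ n → suc (evalPol p (wordLength τ n)))
  space = pcon 1 p+ pevalAt p (pvar p+ (pcon 1 p+ ptotal (λ i n → n ^ lookupL τ i) (λ i → ppow (lookupL τ i))))
  enough : ∃ λ C → ∃ λ k → ∀ n → 0 < n → ⟪ proj₁ space ⟫ n ≤ C * n ^ k
  enough = monomial (proj₁ space)
  room : ∀ n → 0 < n → evalPol p (wordLength τ n) < proj₁ enough * n ^ proj₁ (proj₂ enough)
  room n pos = ≤-trans (≤-reflexive (proj₂ space n)) (proj₂ (proj₂ enough) n pos)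
  -- The monomial bound supplies both parameters of the work space: its exponent is the length of
  -- the tuples, its coefficient the number of blocks.
  open Decided τ K iso M p spec (proj₁ (proj₂ enough)) (proj₁ enough) room

theorem4 : (τ : Voc) →
    (((φ : Formula τ) → Sentence φ → PSpaceDecidable τ (λ M → M ⊨ φ))
    × ((K : Struct τ → Set) → IsoClosed K → PSpaceDecidable τ K →
        Σ (Formula τ) λ φ → Sentence φ × (∀ (M : Struct τ) → (M ⊨ φ) ⇔ K M)))
theorem4 τ = (λ φ _ → pspace-decidable τ φ) , definable τ
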